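{- Let $a,b,c,d$ be distinct vertices of a $4$-connected graph $G$. Then exactly one of the following holds: (i) $G$ contains a $K_4$-minor rooted at $a,b,c,d$; (ii) $G$ is planar and $a,b,c,d$ lie on a common face.
   Context: Graphs are finite, simple and undirected. A $K_4$-minor rooted at $a,b,c,d$ is a set of four pairwise vertex-disjoint connected subgraphs of $G$, respectively containing $a,b,c,d$, every two of which are joined by an edge of $G$. A 3-connected planar graph has a unique planar embedding up to the choice of the outer face, so faces are well defined. -}

module Defs where

open import Data.Nat using (ℕ; zero; suc; _+_; _*_; _≤_)
open import Data.Fin using (Fin)
open import Data.Bool using (Bool; true; false; if_then_else_)
open import Data.Product using (Σ; ∃; _×_; _,_; proj₁; proj₂)
open import Data.Sum using (_⊎_)
open import Data.Empty using (⊥)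
open import Relation.Nullary using (¬_)
open import Relation.Binary.PropositionalEquality using (_≡_)
open import Data.Fin.Subset using (Subset; _∈_; _∉_; ∣_∣)

record Graph (n : ℕ) : Set where
  field
    adj    : Fin n → Fin n → Bool
    sym    : ∀ u v → adj u v ≡ true → adj v u ≡ true
    irrefl : ∀ v → ¬ (adj v v ≡ true)

open Graph public

module _ {n : ℕ} (G : Graph n) where

  Adj : Fin n → Fin n → Set
  Adj u v = adj G u v ≡ true

  data WalkIn (P : Fin n → Set) : Fin n → Fin n → Set where
    [_]  : ∀ {x} → P x → WalkIn P x x
    _∷⟨_⟩_ : ∀ {x y z} → P x → Adj x y → WalkIn P y z → WalkIn P x z

  ConnectedIn : (Fin n → Set) → Set
  ConnectedIn P = ∀ x y → P x → P y → WalkIn P x y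

  KConnected : ℕ → Set
  KConnected k = (suc k ≤ n) ×
    (∀ (S : Subset n) → suc ∣ S ∣ ≤ k → ConnectedIn (λ v → v ∉ S))

  Disjoint : (Fin n → Set) → (Fin n → Set) → Set
  Disjoint X Y = ∀ v → X v → Y v → ⊥

  Joined : (Fin n → Set) → (Fin n → Set) → Set
  Joined X Y = Σ (Fin n) λ u → Σ (Fin n) λ v → X u × Y v × Adj u v

  Branch : Fin n → (Fin n → Set) → Set
  Branch r X = X r × ConnectedIn X

  RootedK4Minor : Fin n → Fin n → Fin n → Fin n → Set₁
  RootedK4Minor a b c d =
    Σ (Fin n → Set) λ A → Σ (Fin n → Set) λ B →
    Σ (Fin n → Set) λ C → Σ (Fin n → Set) λ D →
      Branch a A × Branch b B × Branch c C × Branch d D ×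
      Disjoint A B × Disjoint A C × Disjoint A D ×
      Disjoint B C × Disjoint B D × Disjoint C D ×
      Joined A B × Joined A C × Joined A D ×
      Joined B C × Joined B D × Joined C D

  iter : {A : Set} → (A → A) → ℕ → A → A
  iter f zero x = x
  iter f (suc k) x = f (iter f k x)

  -- a rotation system: for each vertex v, σ v restricted to the
  -- neighbourhood of v is a cyclic permutation of it
  record Rotation : Set where
    field
      σ      : Fin n → Fin n → Fin n
      closed : ∀ v u → Adj v u → Adj v (σ v u)
      cyclic : ∀ v u w → Adj v u → Adj v w → ∃ λ k → iter (σ v) k u ≡ w

  Dart : Set
  Dart = Fin n × Fin n

  IsDart : Dart → Set
  IsDart (u , v) = Adj u v

  -- face-tracing permutation on darts
  φ : Rotation → Dart → Dart
  φ ρ (u , v) = v , Rotation.σ ρ v u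

  SameFace : Rotation → Dart → Dart → Set
  SameFace ρ d e = ∃ λ k → iter (φ ρ) k d ≡ e

  sumFin : ∀ {m} → (Fin m → ℕ) → ℕ
  sumFin {zero} f = 0
  sumFin {suc m} f = f Fin.zero + sumFin (λ i → f (Fin.suc i))

  dartCount : ℕ
  dartCount = sumFin λ u → sumFin λ v → if adj G u v then 1 else 0

  HasFaces : Rotation → ℕ → Set
  HasFaces ρ F =
    Σ ((d : Dart) → IsDart d → Fin F) λ lab →
      (∀ d e (pd : IsDart d) (pe : IsDart e) →
         (lab d pd ≡ lab e pe → SameFace ρ d e) ×
         (SameFace ρ d e → lab d pd ≡ lab e pe)) ×
      (∀ (i : Fin F) → Σ Dart λ d → Σ (IsDart d) λ pd → lab d pd ≡ i)

  -- ρ is a planar (genus 0) embedding of the connected graph G: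
  -- Euler's formula V - E + F = 2, i.e. 2V + 2F = (#darts) + 4.
  PlanarEmbedding : Rotation → Set
  PlanarEmbedding ρ = Σ ℕ λ F → HasFaces ρ F × (2 * (n + F) ≡ dartCount + 4)

  OnFace : Rotation → Dart → Fin n → Set
  OnFace ρ d₀ x = ∃ λ k → proj₁ (iter (φ ρ) k d₀) ≡ x

  PlanarWithCommonFace : Fin n → Fin n → Fin n → Fin n → Set
  PlanarWithCommonFace a b c d =
    Σ Rotation λ ρ → PlanarEmbedding ρ ×
      Σ Dart λ d₀ → IsDart d₀ ×
        OnFace ρ d₀ a × OnFace ρ d₀ b × OnFace ρ d₀ c × OnFace ρ d₀ d

{-# OPTIONS --safe #-}
module Submission where

-- By 4-connectedness there is a cycle through a, b, c, d; say in this order.  If disjoint connected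
-- sets X ∋ a, c and Y ∋ b, d exist, then choosing such a partition of the vertices with the fewest
-- edges of the cycle between X and Y, one can cut X and Y each in two to obtain the rooted K₄-minor.
-- Otherwise the two-paths theorem applies: by induction (separations of order three are replaced by
-- triangles, then a neighbour of a is contracted into a) the path b, c, d can be swept across the
-- graph to the path b, a, d by inserting and deleting single vertices, so that each edge joins
-- consecutive vertices at some moment.  Drawing the edges in this order yields a rotation system for
-- which every circulation is the coboundary of a function on the faces.  That exactness is
-- equivalent to Euler's formula, by counting in linear systems over ℤ.  For the two alternatives to
-- exclude each other, the face through a, b, c, d and exactness play the rôle of the Jordan curve
-- theorem: two disjoint paths cannot join crossing pairs of vertices of a face.

open import Defs hiding (sym)
open import Data.Nat as ℕ using (ℕ; zero; suc; _+_; _*_; _≤_; _<_; z≤n; s≤s)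
import Data.Nat.Properties as ℕₚ
open import Data.Fin using (Fin; zero; suc; toℕ)
open import Data.Fin.Properties using (_≟_; any?)
open import Data.Bool using (Bool; true; false; if_then_else_)
open import Data.Product using (Σ; ∃; _×_; _,_; proj₁; proj₂)
open import Data.Sum using (_⊎_; inj₁; inj₂)
open import Data.Empty using (⊥; ⊥-elim)
open import Data.Unit using (⊤; tt)
open import Data.List using (List; []; _∷_; _++_; length; filter; allFin)
import Data.List.Properties as Listₚ
open import Data.List.Membership.Propositional using (_∈_; _∉_)
open import Data.List.Membership.Propositional.Properties using (∈-++⁺ˡ; ∈-++⁺ʳ; ∈-++⁻; ∈-∃++; ∈-filter⁺; ∈-filter⁻; ∈-allFin; ∈-map⁺)
open import Data.List.Relation.Unary.Any using (here; there)
open import Data.List.Relation.Unary.All as All using (All; []; _∷_)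
import Data.List.Relation.Unary.All.Properties as Allₚ
open import Data.List.Relation.Unary.AllPairs using (AllPairs; []; _∷_)
open import Data.List.Relation.Unary.Unique.Propositional using (Unique)
open import Relation.Nullary using (¬_; Dec; yes; no)
open import Relation.Nullary.Decidable using (_×-dec_; _⊎-dec_; ¬?; map′)
open import Relation.Binary.PropositionalEquality using (_≡_; _≢_; refl; sym; trans; cong; cong₂; subst; subst₂)
open import Function using (_∘_; id; case_of_)
open import Data.Integer as ℤ using (ℤ; 0ℤ; 1ℤ)
import Data.Integer.Properties as ℤₚ
open import Data.Integer.Tactic.RingSolver using (solve-∀)
open import Algebra.Properties.Semiring.Sum ℤₚ.+-*-semiring using (sum; sum-cong-≗; ∑-distrib-+; ∑-comm; sum-permute; *-distribˡ-sum)
open import Data.Fin.Permutation using (Permutation; permutation)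
import Data.Fin as Fin
import Data.Fin.Properties as Finₚ
open import Relation.Binary.Definitions using (tri<; tri≈; tri>)
import Data.List.Relation.Unary.Any as Any
import Data.Nat.DivMod as DivMod
import Data.Product.Properties as Productₚ
import Data.List.Relation.Unary.Unique.Propositional.Properties as Uniqueₚ
open import Data.Vec using ([]; _∷_)
import Data.Fin.Subset as Subset
import Data.Fin.Subset.Properties as Subsetₚ

-- Walks and reachability

-- The induction needs a statement that survives contracting a neighbour `v` of `a`. A triple
-- through the new `a` may come from a separator of order four through `a` and `v`, so separations
-- by `a` and two further vertices reappear. They are hidden behind triangles, and in the result
-- they return as regions hanging between `a` and two consecutive vertices of the path. When `v` is
-- split off again, unlinkedness leaves such regions only at the two ends of the stretch of the path
-- that `v` sees, and each of these corners is a smaller society with four terminals. Genus is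
-- awkward to follow while edges are added, since faces are orbits that split and merge. Potentials
-- are easier: along the moving path one records, for each slot between consecutive vertices, the
-- value of the face above it. A vertex whose edges are all drawn has divergence zero, so the slots
-- on its two sides agree and it can leave the path; nothing global has to be known. Faces enter
-- only at the end, when exactness is compared with the numbers of unknowns and equations.

infixr 5 _▷⟨_⟩_

data Walk {n : ℕ} (E : Fin n → Fin n → Set) (P : Fin n → Set) : Fin n → Fin n → Set where
  ⟦_⟧ : ∀ {x} → P x → Walk E P x x
  _▷⟨_⟩_ : ∀ {x y z} → P x → E x y → Walk E P y z → Walk E P x z

module _ {n : ℕ} {E : Fin n → Fin n → Set} where

  walk-start : ∀ {P x y} → Walk E P x y → P x
  walk-start ⟦ p ⟧ = p
  walk-start (p ▷⟨ _ ⟩ _) = p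

  walk-end : ∀ {P x y} → Walk E P x y → P y
  walk-end ⟦ p ⟧ = p
  walk-end (_ ▷⟨ _ ⟩ w) = walk-end w

  walk-mono : ∀ {P Q x y} → (∀ {v} → P v → Q v) → Walk E P x y → Walk E Q x y
  walk-mono f ⟦ p ⟧ = ⟦ f p ⟧
  walk-mono f (p ▷⟨ e ⟩ w) = f p ▷⟨ e ⟩ walk-mono f w

  infixr 5 _⊕_
  _⊕_ : ∀ {P x y z} → Walk E P x y → Walk E P y z → Walk E P x z
  ⟦ _ ⟧ ⊕ w = w
  (p ▷⟨ e ⟩ v) ⊕ w = p ▷⟨ e ⟩ (v ⊕ w)

  edge : ∀ {P x y} → P x → P y → E x y → Walk E P x y
  edge p q e = p ▷⟨ e ⟩ ⟦ q ⟧

  module _ (E-sym : ∀ {x y} → E x y → E y x) where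
    walk-rev : ∀ {P x y} → Walk E P x y → Walk E P y x
    walk-rev w = go w ⟦ walk-start w ⟧
      where
      go : ∀ {P x y z} → Walk E P x y → Walk E P x z → Walk E P y z
      go ⟦ _ ⟧ acc = acc
      go (p ▷⟨ e ⟩ w) acc = go w (walk-start w ▷⟨ E-sym e ⟩ acc)

  walk-closed : ∀ {P x y} (Q : Fin n → Set) → (∀ {u v} → Q u → E u v → P v → Q v) →
    Walk E P x y → Q x → Walk E Q x y
  walk-closed Q cl ⟦ p ⟧ q = ⟦ q ⟧
  walk-closed Q cl (p ▷⟨ e ⟩ w) q = q ▷⟨ e ⟩ walk-closed Q cl w (cl q e (walk-start w))

  -- The prefix is returned as a walk inside both `P` and `Q`, because most uses need to know where
  -- the last vertex before the exit lies.
  walk-exit : ∀ {P x y} (Q : Fin n → Set) → (∀ v → Dec (Q v)) → Walk E P x y → Q x → ¬ Q y →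
    ∃ λ u → ∃ λ v → Walk E (λ w → P w × Q w) x u × E u v × P v × ¬ Q v
  walk-exit Q Q? ⟦ p ⟧ q ¬q = ⊥-elim (¬q q)
  walk-exit Q Q? (_▷⟨_⟩_ {y = y} p e w) q ¬q with Q? y
  ... | no ¬qy = _ , y , ⟦ p , q ⟧ , e , walk-start w , ¬qy
  ... | yes qy with walk-exit Q Q? w qy ¬q
  ... | u , v , w′ , e′ , pv , ¬qv = u , v , ((p , q) ▷⟨ e ⟩ w′) , e′ , pv , ¬qv

  walk-step : ∀ {P x y} → x ≢ y → Walk E P x y → ∃ λ z → E x z × P z
  walk-step x≢y ⟦ _ ⟧ = ⊥-elim (x≢y refl)
  walk-step x≢y (_ ▷⟨ e ⟩ w) = _ , e , walk-start w

  walk-last : ∀ {P x y} → x ≢ y → Walk E P x y → ∃ λ z → E z y × P z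
  walk-last x≢y ⟦ _ ⟧ = ⊥-elim (x≢y refl)
  walk-last {y = y} x≢y (_▷⟨_⟩_ {x} {z} p e w) with z ≟ y
  ... | yes refl = x , e , p
  ... | no z≢y = walk-last z≢y w

walk-map : ∀ {n} {E E′ : Fin n → Fin n → Set} {P x y} → (∀ {u v} → P u → P v → E u v → E′ u v) →
  Walk E P x y → Walk E′ P x y
walk-map f ⟦ p ⟧ = ⟦ p ⟧
walk-map f (p ▷⟨ e ⟩ w) = p ▷⟨ f p (walk-start w) e ⟩ walk-map f w

-- Transfers walks from a modified graph to the original one: an artificial edge is replaced by a
-- detour.
walk-bind : ∀ {n} {E E′ : Fin n → Fin n → Set} {P Q x y} → (∀ {u} → P u → Q u) →
  (∀ {u v} → P u → P v → E u v → Walk E′ Q u v) → Walk E P x y → Walk E′ Q x y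
walk-bind g f ⟦ p ⟧ = ⟦ g p ⟧
walk-bind g f (p ▷⟨ e ⟩ w) = f p (walk-start w) e ⊕ walk-bind g f w

module _ {n : ℕ} where

  count : {P : Fin n → Set} → (∀ x → Dec (P x)) → ℕ
  count P? = length (filter P? (allFin n))

  private
    filter-≤ : {P Q : Fin n → Set} (P? : ∀ x → Dec (P x)) (Q? : ∀ x → Dec (Q x)) →
      (∀ {x} → P x → Q x) → ∀ xs → length (filter P? xs) ≤ length (filter Q? xs)
    filter-≤ P? Q? f [] = z≤n
    filter-≤ P? Q? f (x ∷ xs) with P? x | Q? x
    ... | yes p | yes q = s≤s (filter-≤ P? Q? f xs)
    ... | yes p | no ¬q = ⊥-elim (¬q (f p))
    ... | no ¬p | yes q = ℕₚ.m≤n⇒m≤1+n (filter-≤ P? Q? f xs)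
    ... | no ¬p | no ¬q = filter-≤ P? Q? f xs

    filter-< : {P Q : Fin n → Set} (P? : ∀ x → Dec (P x)) (Q? : ∀ x → Dec (Q x)) →
      (∀ {x} → P x → Q x) → ∀ {v} → Q v → ¬ P v → ∀ xs → v ∈ xs →
      length (filter P? xs) < length (filter Q? xs)
    filter-< P? Q? f {v} q ¬p (.v ∷ xs) (here refl) with P? v | Q? v
    ... | yes p | _ = ⊥-elim (¬p p)
    ... | no _ | no ¬q = ⊥-elim (¬q q)
    ... | no _ | yes _ = s≤s (filter-≤ P? Q? f xs)
    filter-< P? Q? f q ¬p (x ∷ xs) (there i) with P? x | Q? x
    ... | yes p | yes _ = s≤s (filter-< P? Q? f q ¬p xs i)
    ... | yes p | no ¬q = ⊥-elim (¬q (f p))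
    ... | no _ | yes _ = ℕₚ.m≤n⇒m≤1+n (filter-< P? Q? f q ¬p xs i)
    ... | no _ | no _ = filter-< P? Q? f q ¬p xs i

  count-< : {P Q : Fin n → Set} (P? : ∀ x → Dec (P x)) (Q? : ∀ x → Dec (Q x)) →
    (∀ {x} → P x → Q x) → ∀ {v} → Q v → ¬ P v → count P? < count Q?
  count-< P? Q? f {v} q ¬p = filter-< P? Q? f q ¬p (allFin n) (∈-allFin v)

module _ {n : ℕ} (E : Fin n → Fin n → Set) (E? : ∀ x y → Dec (E x y))
         (P : Fin n → Set) (P? : ∀ x → Dec (P x)) where

  -- Membership is a decidable predicate kept apart from the walks that witness it: deciding the
  -- existence of a `Walk` is no finite search by itself, and most arguments only use the closure
  -- `step`.
  record Comp (x : Fin n) : Set₁ where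
    field
      C : Fin n → Set
      C? : ∀ y → Dec (C y)
      root : C x
      sound : ∀ {y} → C y → Walk E (λ z → P z × C z) x y
      step : ∀ {y z} → C y → E y z → P z → C z

    C⊆P : ∀ {y} → C y → P y
    C⊆P c = proj₁ (walk-end (sound c))

    complete : ∀ {y} → Walk E P x y → C y
    complete w = walk-end (walk-closed C step w root)

  abstract
    component : ∀ x → P x → Comp x
    component x px = grow (count P?) (λ y → y ≡ x) (λ y → y ≟ x)
        (λ { refl → px }) refl (λ { refl → ⟦ px , refl ⟧ }) (bound (λ y → y ≟ x))
      where
      rest? : {S : Fin n → Set} → (∀ y → Dec (S y)) → ∀ y → Dec (P y × ¬ S y)
      rest? S? y = P? y ×-dec ¬? (S? y)

      bound : {S : Fin n → Set} (S? : ∀ y → Dec (S y)) → count (rest? S?) ≤ count P?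
      bound S? = go (allFin n)
        where
        go : ∀ xs → length (filter (rest? S?) xs) ≤ length (filter P? xs)
        go [] = z≤n
        go (y ∷ xs) with P? y | S? y
        ... | yes _ | yes _ = ℕₚ.m≤n⇒m≤1+n (go xs)
        ... | yes _ | no _ = s≤s (go xs)
        ... | no _ | yes _ = go xs
        ... | no _ | no _ = go xs

      -- The fuel `k` bounds the number of vertices of `P` still outside `S`; every round adds one
      -- of them.
      grow : ∀ k (S : Fin n → Set) (S? : ∀ y → Dec (S y)) → (∀ {y} → S y → P y) → S x →
        (∀ {y} → S y → Walk E (λ z → P z × S z) x y) → count (rest? S?) ≤ k → Comp x
      grow k S S? S⊆P sx snd le
        with any? (λ z → (P? z ×-dec ¬? (S? z)) ×-dec any? (λ y → S? y ×-dec E? y z))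
      ... | no none = record { C = S ; C? = S? ; root = sx ; sound = snd ; step = st }
        where
        st : ∀ {y z} → S y → E y z → P z → S z
        st {y} {z} sy e pz with S? z
        ... | yes sz = sz
        ... | no ¬sz = ⊥-elim (none (z , (pz , ¬sz) , y , sy , e))
      ... | yes (z , (pz , ¬sz) , y , sy , e) with k
      ... | zero = ⊥-elim (ℕₚ.n≮0 (ℕₚ.<-≤-trans
                     (count-< (λ _ → no id) (rest? S?) (λ ()) {z} (pz , ¬sz) id) le))
      ... | suc k′ = grow k′ (λ u → S u ⊎ u ≡ z) (λ u → S? u ⊎-dec (u ≟ z))
                       (λ { (inj₁ s) → S⊆P s ; (inj₂ refl) → pz }) (inj₁ sx)
                       (λ { (inj₁ s) → walk-mono (λ (p , q) → p , inj₁ q) (snd s)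
                          ; (inj₂ refl) → walk-mono (λ (p , q) → p , inj₁ q) (snd sy)
                              ⊕ ((S⊆P sy , inj₁ sy) ▷⟨ e ⟩ ⟦ pz , inj₂ refl ⟧) })
                       (ℕₚ.≤-pred (ℕₚ.≤-trans (count-< (rest? (λ u → S? u ⊎-dec (u ≟ z))) (rest? S?)
                          (λ (p , q) → p , q ∘ inj₁) {z} (pz , ¬sz) (λ (_ , q) → q (inj₂ refl))) le))

  reach? : ∀ x y → Dec (Walk E P x y)
  reach? x y with P? x
  ... | no ¬p = no (¬p ∘ walk-start)
  ... | yes p = map′ (λ c → walk-mono proj₁ (Comp.sound cx c)) (Comp.complete cx) (Comp.C? cx y)
    where cx = component x p

-- Lists of vertices

module _ {A : Set} where

  data Consec (x y : A) : List A → Set where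
    here : ∀ {l} → Consec x y (x ∷ y ∷ l)
    there : ∀ {z l} → Consec x y l → Consec x y (z ∷ l)

  data First (x : A) : List A → Set where
    first : ∀ {l} → First x (x ∷ l)

  data Last (x : A) : List A → Set where
    last : Last x (x ∷ [])
    there : ∀ {y l} → Last x l → Last x (y ∷ l)

  consec-++ʳ : ∀ {x y} p {l} → Consec x y l → Consec x y (p ++ l)
  consec-++ʳ [] c = c
  consec-++ʳ (_ ∷ p) c = there (consec-++ʳ p c)

  consec-++ˡ : ∀ {x y l} s → Consec x y l → Consec x y (l ++ s)
  consec-++ˡ s here = here
  consec-++ˡ s (there c) = there (consec-++ˡ s c)

  consec-∈ˡ : ∀ {x y l} → Consec x y l → x ∈ l
  consec-∈ˡ here = here refl
  consec-∈ˡ (there c) = there (consec-∈ˡ c)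

  consec-∈ʳ : ∀ {x y l} → Consec x y l → y ∈ l
  consec-∈ʳ here = there (here refl)
  consec-∈ʳ (there c) = there (consec-∈ʳ c)

  -- A consecutive pair of p ++ x ∷ s lies on one side of x.
  consec-split : ∀ {u v} p {x s} → Consec u v (p ++ x ∷ s) →
    Consec u v (p ++ x ∷ []) ⊎ Consec u v (x ∷ s)
  consec-split [] c = inj₂ c
  consec-split (w ∷ []) here = inj₁ here
  consec-split (w ∷ []) (there c) = inj₂ c
  consec-split (w ∷ w′ ∷ p) here = inj₁ here
  consec-split (w ∷ w′ ∷ p) (there c) with consec-split (w′ ∷ p) c
  ... | inj₁ d = inj₁ (there d)
  ... | inj₂ d = inj₂ d

  consec-join₁ : ∀ {u v} p {x s} → Consec u v (p ++ x ∷ []) → Consec u v (p ++ x ∷ s)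
  consec-join₁ (w ∷ []) here = here
  consec-join₁ (w ∷ w′ ∷ p) here = here
  consec-join₁ [] (there ())
  consec-join₁ (w ∷ p) (there c) = there (consec-join₁ p c)

  last-∈ : ∀ {x l} → Last x l → x ∈ l
  last-∈ last = here refl
  last-∈ (there l) = there (last-∈ l)

  first-∈ : ∀ {x l} → First x l → x ∈ l
  first-∈ first = here refl

  last-++ : ∀ {x l} p → Last x l → Last x (p ++ l)
  last-++ [] l = l
  last-++ (_ ∷ p) l = there (last-++ p l)

  last-++⁻ : ∀ {x} p {y s} → Last x (p ++ y ∷ s) → Last x (y ∷ s)
  last-++⁻ [] l = l
  last-++⁻ (_ ∷ []) (there l) = l
  last-++⁻ (_ ∷ w ∷ p) (there l) = last-++⁻ (w ∷ p) l

  first-swap : ∀ {x} p {y s s′} → First x (p ++ y ∷ s) → First x (p ++ y ∷ s′)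
  first-swap [] first = first
  first-swap (_ ∷ p) first = first

  unique-++⁻ : ∀ (p : List A) {s} → Unique (p ++ s) → Unique p × Unique s × (∀ {x} → x ∈ p → x ∈ s → ⊥)
  unique-++⁻ [] u = [] , u , λ ()
  unique-++⁻ (x ∷ p) (nx ∷ u) with unique-++⁻ p u
  ... | up , us , dj = (Allₚ.++⁻ˡ p nx ∷ up) , us ,
    λ { (here refl) i → All.lookup (Allₚ.++⁻ʳ p nx) i refl ; (there j) i → dj j i }

  unique-++⁺ : ∀ {p s : List A} → Unique p → Unique s → (∀ {x} → x ∈ p → x ∈ s → ⊥) → Unique (p ++ s)
  unique-++⁺ [] us dj = us
  unique-++⁺ (nx ∷ up) us dj =
    Allₚ.++⁺ nx (All.tabulate λ i e → dj (here (sym e)) i) ∷ unique-++⁺ up us (λ i j → dj (there i) j)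

  ∉⇒All≢ : ∀ {x} {l : List A} → x ∉ l → All (λ y → x ≢ y) l
  ∉⇒All≢ ni = All.tabulate λ i e → ni (subst (_∈ _) (sym e) i)

  All≢⇒∉ : ∀ {x} {l : List A} → All (λ y → x ≢ y) l → x ∉ l
  All≢⇒∉ al i = All.lookup al i refl

module _ {A : Set} {P : A → Set} (P? : ∀ x → Dec (P x)) where

  split-first : ∀ l → (∃ λ x → x ∈ l × P x) →
    ∃ λ p → ∃ λ x → ∃ λ s → l ≡ p ++ x ∷ s × P x × (∀ {y} → y ∈ p → ¬ P y)
  split-first [] (_ , () , _)
  split-first (y ∷ l) (x , i , px) with P? y
  ... | yes py = [] , y , l , refl , py , λ ()
  split-first (y ∷ l) (x , here refl , px) | no ¬py = ⊥-elim (¬py px)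
  split-first (y ∷ l) (x , there i , px) | no ¬py with split-first l (x , i , px)
  ... | p , z , s , refl , pz , np = y ∷ p , z , s , refl , pz , λ { (here refl) → ¬py ; (there j) → np j }

  split-last : ∀ l → (∃ λ x → x ∈ l × P x) →
    ∃ λ p → ∃ λ x → ∃ λ s → l ≡ p ++ x ∷ s × P x × (∀ {y} → y ∈ s → ¬ P y)
  split-last [] (_ , () , _)
  split-last (y ∷ l) (x , i , px) with Any? l
    where
    Any? : ∀ l → Dec (∃ λ x → x ∈ l × P x)
    Any? [] = no λ ()
    Any? (z ∷ l) with P? z | Any? l
    ... | yes pz | _ = yes (z , here refl , pz)
    ... | no _ | yes (w , j , pw) = yes (w , there j , pw)
    ... | no ¬pz | no ¬a = no λ { (w , here refl , pw) → ¬pz pw ; (w , there j , pw) → ¬a (w , j , pw) }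
  ... | yes h with split-last l h
  ... | p , z , s , refl , pz , np = y ∷ p , z , s , refl , pz , np
  split-last (y ∷ l) (x , here refl , px) | no ¬a = [] , y , l , refl , px , λ j pj → ¬a (_ , j , pj)
  split-last (y ∷ l) (x , there i , px) | no ¬a = ⊥-elim (¬a (x , i , px))

infix 4 _∈?_
_∈?_ : ∀ {n} (x : Fin n) (l : List (Fin n)) → Dec (x ∈ l)
x ∈? [] = no λ ()
x ∈? (y ∷ l) with x ≟ y | x ∈? l
... | yes refl | _ = yes (here refl)
... | no _ | yes i = yes (there i)
... | no ne | no ni = no λ { (here e) → ne e ; (there i) → ni i }

-- Sweeping a path across a disc

module _ {A : Set} where

  consec-last-∈ : ∀ {u w x : A} p → Consec u w (p ++ x ∷ []) → u ∈ p
  consec-last-∈ [] (there ())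
  consec-last-∈ (y ∷ []) here = here refl
  consec-last-∈ (y ∷ []) (there (there ()))
  consec-last-∈ (y ∷ y′ ∷ p) here = here refl
  consec-last-∈ (y ∷ y′ ∷ p) (there c) = there (consec-last-∈ (y′ ∷ p) c)

  consec-first-∈ : ∀ {u w x : A} {s} → Consec u w (x ∷ s) → w ∈ s
  consec-first-∈ here = here refl
  consec-first-∈ (there c) = consec-∈ʳ c

  consec-uniqueˡ : ∀ {u u′ w : A} {l} → Unique l → Consec u w l → Consec u′ w l → u ≡ u′
  consec-uniqueˡ _ here here = refl
  consec-uniqueˡ (_ ∷ nw ∷ _) here (there c) = ⊥-elim (All≢⇒∉ nw (consec-first-∈ c))
  consec-uniqueˡ (_ ∷ nw ∷ _) (there c) here = ⊥-elim (All≢⇒∉ nw (consec-first-∈ c))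
  consec-uniqueˡ (_ ∷ u) (there c) (there d) = consec-uniqueˡ u c d

  consec-uniqueʳ : ∀ {u w w′ : A} {l} → Unique l → Consec u w l → Consec u w′ l → w ≡ w′
  consec-uniqueʳ _ here here = refl
  consec-uniqueʳ (nu ∷ _) here (there c) = ⊥-elim (All≢⇒∉ nu (consec-∈ˡ c))
  consec-uniqueʳ (nu ∷ _) (there c) here = ⊥-elim (All≢⇒∉ nu (consec-∈ˡ c))
  consec-uniqueʳ (_ ∷ u) (there c) (there d) = consec-uniqueʳ u c d

  consec-asym : ∀ {u w : A} {l} → Unique l → Consec u w l → Consec w u l → ⊥
  consec-asym ((u≢u ∷ _) ∷ _) here here = u≢u refl
  consec-asym (nu ∷ _) here (there c) = All≢⇒∉ nu (consec-∈ʳ c)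
  consec-asym (nu ∷ _) (there c) here = All≢⇒∉ nu (consec-∈ʳ c)
  consec-asym (_ ∷ u) (there c) (there d) = consec-asym u c d

  -- One step slides the path across a triangle. The two ends of the path never move, and
  -- consecutive entries need not be adjacent in any graph.
  data Step : List A → List A → Set where
    ins : ∀ {x z s} v → Step (x ∷ z ∷ s) (x ∷ v ∷ z ∷ s)
    del : ∀ {x y z s} → Step (x ∷ y ∷ z ∷ s) (x ∷ z ∷ s)
    skip : ∀ {w l m} → Step l m → Step (w ∷ l) (w ∷ m)

  infixr 5 _▸_
  data Sweep : List A → List A → Set where
    done : ∀ {l} → Sweep l l
    _▸_ : ∀ {l m k} → Step l m → Sweep m k → Sweep l k

  insertedˢ : ∀ {l m} → Step l m → List A
  insertedˢ (ins v) = v ∷ []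
  insertedˢ del = []
  insertedˢ (skip s) = insertedˢ s

  inserted : ∀ {l m} → Sweep l m → List A
  inserted done = []
  inserted (s ▸ S) = insertedˢ s ++ inserted S

  Beside : A → A → List A → Set
  Beside x y l = Consec x y l ⊎ Consec y x l

  beside-sym : ∀ {x y l} → Beside x y l → Beside y x l
  beside-sym (inj₁ c) = inj₂ c
  beside-sym (inj₂ c) = inj₁ c

  -- Every intermediate path counts: an edge can be drawn at any moment at which its ends are
  -- neighbours on the path.
  Covers : ∀ {l m} → Sweep l m → A → A → Set
  Covers {l} done x y = Beside x y l
  Covers {l} (_ ▸ S) x y = Beside x y l ⊎ Covers S x y

  covers-sym : ∀ {l m x y} (S : Sweep l m) → Covers S x y → Covers S y x
  covers-sym done c = beside-sym c
  covers-sym (s ▸ S) (inj₁ c) = inj₁ (beside-sym c)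
  covers-sym (s ▸ S) (inj₂ c) = inj₂ (covers-sym S c)

  covers-start : ∀ {l m x y} (S : Sweep l m) → Beside x y l → Covers S x y
  covers-start done c = c
  covers-start (_ ▸ _) c = inj₁ c

  covers-end : ∀ {l m x y} (S : Sweep l m) → Beside x y m → Covers S x y
  covers-end done c = c
  covers-end (_ ▸ S) c = inj₂ (covers-end S c)

  _++ˢ_ : ∀ {l m k} → Sweep l m → Sweep m k → Sweep l k
  done ++ˢ T = T
  (s ▸ S) ++ˢ T = s ▸ (S ++ˢ T)

  inserted-++ : ∀ {l m k} (S : Sweep l m) (T : Sweep m k) → inserted (S ++ˢ T) ≡ inserted S ++ inserted T
  inserted-++ done T = refl
  inserted-++ (s ▸ S) T rewrite inserted-++ S T =
    sym (Listₚ.++-assoc (insertedˢ s) (inserted S) (inserted T))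

  covers-++ˡ : ∀ {l m k x y} (S : Sweep l m) (T : Sweep m k) → Covers S x y → Covers (S ++ˢ T) x y
  covers-++ˡ done T c = covers-start T c
  covers-++ˡ (s ▸ S) T (inj₁ c) = inj₁ c
  covers-++ˡ (s ▸ S) T (inj₂ c) = inj₂ (covers-++ˡ S T c)

  covers-++ʳ : ∀ {l m k x y} (S : Sweep l m) (T : Sweep m k) → Covers T x y → Covers (S ++ˢ T) x y
  covers-++ʳ done T c = c
  covers-++ʳ (s ▸ S) T c = inj₂ (covers-++ʳ S T c)

  private
    suffixˢ : ∀ {l m} s → Step l m → Step (l ++ s) (m ++ s)
    suffixˢ s (ins v) = ins v
    suffixˢ s del = del
    suffixˢ s (skip t) = skip (suffixˢ s t)

    insertedˢ-suffix : ∀ {l m} s (t : Step l m) → insertedˢ (suffixˢ s t) ≡ insertedˢ t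
    insertedˢ-suffix s (ins v) = refl
    insertedˢ-suffix s del = refl
    insertedˢ-suffix s (skip t) = insertedˢ-suffix s t

    beside-context : ∀ {x y} p s {l} → Beside x y l → Beside x y (p ++ l ++ s)
    beside-context p s (inj₁ c) = inj₁ (consec-++ʳ p (consec-++ˡ s c))
    beside-context p s (inj₂ c) = inj₂ (consec-++ʳ p (consec-++ˡ s c))

    contextˢ : ∀ p s {l m} → Step l m → Step (p ++ l ++ s) (p ++ m ++ s)
    contextˢ [] s t = suffixˢ s t
    contextˢ (w ∷ p) s t = skip (contextˢ p s t)

    insertedˢ-context : ∀ p s {l m} (t : Step l m) → insertedˢ (contextˢ p s t) ≡ insertedˢ t
    insertedˢ-context [] s t = insertedˢ-suffix s t
    insertedˢ-context (w ∷ p) s t = insertedˢ-context p s t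

    context : ∀ p s {l m} → Sweep l m → Sweep (p ++ l ++ s) (p ++ m ++ s)
    context p s done = done
    context p s (t ▸ S) = contextˢ p s t ▸ context p s S

    inserted-context : ∀ p s {l m} (S : Sweep l m) → inserted (context p s S) ≡ inserted S
    inserted-context p s done = refl
    inserted-context p s (t ▸ S) = cong₂ _++_ (insertedˢ-context p s t) (inserted-context p s S)

    covers-context : ∀ p s {l m x y} (S : Sweep l m) → Covers S x y → Covers (context p s S) x y
    covers-context p s done c = beside-context p s c
    covers-context p s (t ▸ S) (inj₁ c) = inj₁ (beside-context p s c)
    covers-context p s (t ▸ S) (inj₂ c) = inj₂ (covers-context p s S c)

  -- `Q` confines the inserted vertices, so that sweeps over disjoint regions compose without
  -- inserting a vertex twice; `R` collects the pairs promised to become neighbours.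
  record Swp (l m : List A) (Q : A → Set) (R : A → A → Set) : Set where
    field
      sweep : Sweep l m
      ins-unique : Unique (inserted sweep)
      ins-sub : ∀ {v} → v ∈ inserted sweep → Q v
      covered : ∀ {x y} → R x y → Covers sweep x y

  open Swp public

  -- The new promise may inspect the sweep itself, since some pairs are covered only by its first or
  -- its last path.
  swp-weaken : ∀ {l m Q Q′ R R′} → (∀ {v} → Q v → Q′ v) → Swp l m Q R →
    ((S : Sweep l m) → (∀ {x y} → R x y → Covers S x y) → ∀ {x y} → R′ x y → Covers S x y) → Swp l m Q′ R′
  swp-weaken f S g = record { sweep = sweep S ; ins-unique = ins-unique S ; ins-sub = f ∘ ins-sub S
                            ; covered = g (sweep S) (covered S) }

  swp-cast : ∀ {l m l′ m′ Q R} → l ≡ l′ → m ≡ m′ → Swp l m Q R → Swp l′ m′ Q R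
  swp-cast refl refl S = S

  swp-context : ∀ p s {l m Q R} → Swp l m Q R → Swp (p ++ l ++ s) (p ++ m ++ s) Q R
  swp-context p s S = record
    { sweep = context p s (sweep S)
    ; ins-unique = subst Unique (sym (inserted-context p s (sweep S))) (ins-unique S)
    ; ins-sub = λ i → ins-sub S (subst (_ ∈_) (inserted-context p s (sweep S)) i)
    ; covered = λ r → covers-context p s (sweep S) (covered S r) }

  swp-trans : ∀ {l m k Q Q′ R R′} → Swp l m Q R → Swp m k Q′ R′ → (∀ {v} → Q v → Q′ v → ⊥) →
    Swp l k (λ v → Q v ⊎ Q′ v) (λ x y → R x y ⊎ R′ x y)
  swp-trans S T dj = record
    { sweep = sweep S ++ˢ sweep T
    ; ins-unique = subst Unique (sym (inserted-++ (sweep S) (sweep T)))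
        (unique-++⁺ (ins-unique S) (ins-unique T) (λ i j → dj (ins-sub S i) (ins-sub T j)))
    ; ins-sub = λ i → case ∈-++⁻ (inserted (sweep S)) (subst (_ ∈_) (inserted-++ (sweep S) (sweep T)) i) of
        λ { (inj₁ j) → inj₁ (ins-sub S j) ; (inj₂ j) → inj₂ (ins-sub T j) }
    ; covered = λ { (inj₁ r) → covers-++ˡ (sweep S) (sweep T) (covered S r)
                  ; (inj₂ r) → covers-++ʳ (sweep S) (sweep T) (covered T r) } }

  swp-done : ∀ l → Swp l l (λ _ → ⊥) (λ x y → Beside x y l)
  swp-done l = record { sweep = done ; ins-unique = [] ; ins-sub = λ () ; covered = id }

  swp-ins : ∀ x v z → Swp (x ∷ z ∷ []) (x ∷ v ∷ z ∷ []) (λ y → y ≡ v) (λ u w → Beside u w (x ∷ v ∷ z ∷ []))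
  swp-ins x v z = record { sweep = ins v ▸ done ; ins-unique = [] ∷ [] ; ins-sub = λ { (here refl) → refl }
                         ; covered = inj₂ }

  swp-del : ∀ x y z → Swp (x ∷ y ∷ z ∷ []) (x ∷ z ∷ []) (λ _ → ⊥)
    (λ u w → Beside u w (x ∷ y ∷ z ∷ []) ⊎ Beside u w (x ∷ z ∷ []))
  swp-del x y z = record { sweep = del ▸ done ; ins-unique = [] ; ins-sub = λ ()
                         ; covered = id }

  -- A fan at `v`: deleting the entries behind `v` one at a time brings each of them next to `v`.
  swp-sweep-away : ∀ v ms m → Swp (v ∷ ms ++ m ∷ []) (v ∷ m ∷ []) (λ _ → ⊥) (λ u w → u ≡ v × w ∈ (ms ++ m ∷ []))
  swp-sweep-away v [] m = swp-weaken id (swp-done _) (λ S f → λ { (refl , here refl) → f (inj₁ here) })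
  swp-sweep-away v (y ∷ []) m = swp-weaken id (swp-del v y m)
    (λ S f → λ { (refl , here refl) → f (inj₁ (inj₁ here)) ; (refl , there (here refl)) → f (inj₂ (inj₁ here)) })
  swp-sweep-away v (y ∷ y′ ∷ ms) m = swp-weaken (λ { (inj₁ ()) ; (inj₂ ()) })
    (swp-trans (swp-context [] (ms ++ m ∷ []) (swp-del v y y′)) (swp-sweep-away v (y′ ∷ ms) m) (λ ()))
    (λ S f → λ { (refl , here refl) → f (inj₁ (inj₁ (inj₁ here))) ; (refl , there i) → f (inj₂ (refl , i)) })

  first-last : ∀ {p r : A} {l} → p ≢ r → First p l → Last r l → ∃ λ m → l ≡ p ∷ m ++ r ∷ []
  first-last ne first last = ⊥-elim (ne refl)
  first-last {p} {r} ne (first {l}) (there lt) with go lt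
    where
    go : ∀ {l} → Last r l → ∃ λ m → l ≡ m ++ r ∷ []
    go last = [] , refl
    go (there {y} lt) with go lt
    ... | m , refl = y ∷ m , refl
  ... | m , refl = m , refl

-- Societies with four terminals

record Society (n : ℕ) : Set₁ where
  field
    V : Fin n → Set
    V? : ∀ x → Dec (V x)
    E : Fin n → Fin n → Set
    E? : ∀ x y → Dec (E x y)
    E-sym : ∀ {x y} → E x y → E y x
    E-irr : ∀ {x} → ¬ E x x
    E⇒V : ∀ {x y} → E x y → V x
    a b c d : Fin n
    Va : V a
    Vb : V b
    Vc : V c
    Vd : V d
    a≢b : a ≢ b
    a≢c : a ≢ c
    a≢d : a ≢ d
    b≢c : b ≢ c
    b≢d : b ≢ d
    c≢d : c ≢ d

  Terminal : Fin n → Set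
  Terminal x = x ≡ a ⊎ x ≡ b ⊎ x ≡ c ⊎ x ≡ d

  terminal? : ∀ x → Dec (Terminal x)
  terminal? x = (x ≟ a) ⊎-dec (x ≟ b) ⊎-dec (x ≟ c) ⊎-dec (x ≟ d)

  Off : Fin n → Fin n → Fin n → Fin n → Set
  Off p q r x = V x × x ≢ p × x ≢ q × x ≢ r

  off? : ∀ p q r x → Dec (Off p q r x)
  off? p q r x = V? x ×-dec ¬? (x ≟ p) ×-dec ¬? (x ≟ q) ×-dec ¬? (x ≟ r)

  Escapes : Fin n → Fin n → Fin n → Fin n → Set
  Escapes p q r x = ∃ λ t → Terminal t × Walk E (Off p q r) x t

  escapes? : ∀ p q r x → Dec (Escapes p q r x)
  escapes? p q r x = any? λ t → terminal? t ×-dec reach? E E? (Off p q r) (off? p q r) x t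

  Good : Fin n → Fin n → Fin n → Set
  Good p q r = ∀ x → Off p q r x → Escapes p q r x

  Full : Set
  Full = ∀ p q r → Good p q r

  -- What is left of `Full` after a contraction into `a`: a triple through `a` may stem from four
  -- vertices, so only pairs through `a` are still known not to separate. The repeated `s` encodes
  -- such a pair.
  Semi : Set
  Semi = (∀ p q r → p ≢ a → q ≢ a → r ≢ a → Good p q r) × (∀ s → Good a s s)

  Unlinked : Set₁
  Unlinked = ∀ (X Y : Fin n → Set) → (∀ {x} → X x → Y x → ⊥) → Walk E X a c → Walk E Y b d → ⊥

  good-weaken : ∀ {p q r p′ q′ r′} → (∀ {x} → Off p q r x → Off p′ q′ r′ x) →
    (∀ {x} → Off p′ q′ r′ x → Off p q r x) → Good p q r → Good p′ q′ r′
  good-weaken f g h x o with h x (g o)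
  ... | t , T , w = t , T , walk-mono f w

-- In the paths returned below every vertex other than a lies on the path L, in one of the
-- regions hanging between a and two consecutive vertices of L, or in the core K behind L.
record Sweepable {n : ℕ} (S : Society n) : Set₁ where
  open Society S
  field
    L : List (Fin n)
    L-first : First b L
    L-last : Last d L
    L-unique : Unique L
    L-sub : ∀ {x} → x ∈ L → V x × x ≢ a
    Gap : Fin n → Set
    Gap? : ∀ x → Dec (Gap x)
    gap-V : ∀ {r} → Gap r → V r × r ≢ a × r ∉ L
    gap-T : ∀ {r} → Gap r → ¬ Terminal r
    left right : Fin n → Fin n
    gap-ends : ∀ {r} → Gap r → Consec (left r) (right r) L
    gap-nbr : ∀ {r y} → Gap r → E r y →
      y ≡ a ⊎ y ≡ left r ⊎ y ≡ right r ⊎ (Gap y × left y ≡ left r × right y ≡ right r)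
    a-nbr : ∀ {y} → E a y → y ∈ L ⊎ Gap y
    induced : ∀ {x y} → x ∈ L → y ∈ L → E x y → Beside x y L

  K : Fin n → Set
  K x = V x × x ≢ a × x ∉ L × ¬ Gap x

  Core : Fin n → Set
  Core x = x ∈ L ⊎ K x

  CoreEdge : Fin n → Fin n → Set
  CoreEdge x y = E x y × Core x × Core y

  field
    -- If `c` is on `L`, then `L` is just `b ∷ c ∷ d ∷ []`, and its consecutive vertices need not be
    -- joined at all.
    joined : c ∉ L → ∀ {x y} → Consec x y L → Walk E (λ w → w ≡ x ⊎ w ≡ y ⊎ (Gap w × left w ≡ x)) x y
    K-to-c : ∀ {y} → K y → Walk E K y c
    L-to-c : ∀ {l} → l ∈ L → l ≢ b → l ≢ d → Walk E (λ w → w ≡ l ⊎ K w) l c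
    sweep₁ : Swp (b ∷ c ∷ d ∷ []) L (λ v → Core v × v ≢ b × v ≢ c × v ≢ d) CoreEdge
    -- The same region, swept so that `c` stays as the last vertex and `d` is newly inserted. A
    -- corner filled in the course of a larger sweep needs this form when the vertex in the role of
    -- `d` is not yet on the path.
    sweep₂ : (c ∉ L × Swp (b ∷ c ∷ []) (L ++ c ∷ []) (λ v → Core v × v ≢ b × v ≢ c) CoreEdge)
             ⊎ L ≡ b ∷ c ∷ d ∷ []

module _ {n : ℕ} (S : Society n) where
  open Society S

  abstract
    -- A region hanging between `a` and two consecutive vertices of `L` is cut off from the
    -- terminals by these three.
    full-gapless : Full → (O : Sweepable S) → ∀ {r} → ¬ Sweepable.Gap O r
    full-gapless full O {r} g with full a (left r) (right r) r
        (proj₁ (gap-V g) , proj₁ (proj₂ (gap-V g)) ,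
         (λ e → proj₂ (proj₂ (gap-V g)) (subst (_∈ L) (sym e) (consec-∈ˡ (gap-ends g)))) ,
         (λ e → proj₂ (proj₂ (gap-V g)) (subst (_∈ L) (sym e) (consec-∈ʳ (gap-ends g)))))
      where open Sweepable O
    ... | t , T , w = gap-T (proj₁ (walk-end (walk-closed (λ y → Gap y × left y ≡ left r × right y ≡ right r)
                        cl w (g , refl , refl)))) T
      where
      open Sweepable O
      cl : ∀ {u v} → Gap u × left u ≡ left r × right u ≡ right r → E u v → Off a (left r) (right r) v →
           Gap v × left v ≡ left r × right v ≡ right r
      cl (gu , l , r′) e (_ , ≢a , ≢l , ≢r) with gap-nbr gu e
      ... | inj₁ p = ⊥-elim (≢a p)
      ... | inj₂ (inj₁ p) = ⊥-elim (≢l (trans p l))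
      ... | inj₂ (inj₂ (inj₁ p)) = ⊥-elim (≢r (trans p r′))
      ... | inj₂ (inj₂ (inj₂ (gv , l′ , r″))) = gv , trans l′ l , trans r″ r′

  -- The base case: all vertices are terminals

  module Base (unlinked : Unlinked) (allT : ∀ {x} → V x → Terminal x) where

    E⇒V′ : ∀ {x y} → E x y → V y
    E⇒V′ = E⇒V ∘ E-sym

    flat : ¬ E b d → Sweepable S
    flat ¬bd = record
      { L = b ∷ c ∷ d ∷ [] ; L-first = first ; L-last = there (there last)
      ; L-unique = (b≢c ∷ b≢d ∷ []) ∷ (c≢d ∷ []) ∷ [] ∷ []
      ; L-sub = λ { (here refl) → Vb , a≢b ∘ sym ; (there (here refl)) → Vc , a≢c ∘ sym
                  ; (there (there (here refl))) → Vd , a≢d ∘ sym }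
      ; Gap = λ _ → ⊥ ; Gap? = λ _ → no id ; gap-V = λ () ; gap-T = λ () ; left = id ; right = id
      ; gap-ends = λ () ; gap-nbr = λ ()
      ; a-nbr = λ e → inj₁ (in-L (E⇒V′ e) (λ { refl → E-irr e }))
      ; induced = ind
      ; joined = λ ni → ⊥-elim (ni (there (here refl)))
      ; K-to-c = λ k → ⊥-elim (noK k)
      ; L-to-c = λ { (here refl) ne _ → ⊥-elim (ne refl) ; (there (here refl)) _ _ → ⟦ inj₁ refl ⟧
                   ; (there (there (here refl))) _ ne → ⊥-elim (ne refl) }
      ; sweep₁ = swp-weaken (λ ()) (swp-done _) (λ S f → λ { (e , x , y) → f (ind (core x) (core y) e) })
      ; sweep₂ = inj₂ refl }
      where
      in-L : ∀ {x} → V x → x ≢ a → x ∈ (b ∷ c ∷ d ∷ [])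
      in-L v ne with allT v
      ... | inj₁ e = ⊥-elim (ne e)
      ... | inj₂ (inj₁ e) = here e
      ... | inj₂ (inj₂ (inj₁ e)) = there (here e)
      ... | inj₂ (inj₂ (inj₂ e)) = there (there (here e))
      noK : ∀ {x} → V x × x ≢ a × x ∉ (b ∷ c ∷ d ∷ []) × ¬ ⊥ → ⊥
      noK (v , ne , ni , _) = ni (in-L v ne)
      core : ∀ {x} → x ∈ (b ∷ c ∷ d ∷ []) ⊎ (V x × x ≢ a × x ∉ (b ∷ c ∷ d ∷ []) × ¬ ⊥) → x ∈ (b ∷ c ∷ d ∷ [])
      core (inj₁ i) = i
      core (inj₂ k) = ⊥-elim (noK k)
      ind : ∀ {x y} → x ∈ (b ∷ c ∷ d ∷ []) → y ∈ (b ∷ c ∷ d ∷ []) → E x y → Beside x y (b ∷ c ∷ d ∷ [])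
      ind (here refl) (here refl) e = ⊥-elim (E-irr e)
      ind (here refl) (there (here refl)) e = inj₁ here
      ind (here refl) (there (there (here refl))) e = ⊥-elim (¬bd e)
      ind (there (here refl)) (here refl) e = inj₂ here
      ind (there (here refl)) (there (here refl)) e = ⊥-elim (E-irr e)
      ind (there (here refl)) (there (there (here refl))) e = inj₁ (there here)
      ind (there (there (here refl))) (here refl) e = ⊥-elim (¬bd (E-sym e))
      ind (there (there (here refl))) (there (here refl)) e = inj₂ (there here)
      ind (there (there (here refl))) (there (there (here refl))) e = ⊥-elim (E-irr e)

    bridged : E b d → Sweepable S
    bridged bd = record
      { L = b ∷ d ∷ [] ; L-first = first ; L-last = there last
      ; L-unique = (b≢d ∷ []) ∷ [] ∷ []
      ; L-sub = λ { (here refl) → Vb , a≢b ∘ sym ; (there (here refl)) → Vd , a≢d ∘ sym }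
      ; Gap = λ _ → ⊥ ; Gap? = λ _ → no id ; gap-V = λ () ; gap-T = λ () ; left = id ; right = id
      ; gap-ends = λ () ; gap-nbr = λ ()
      ; a-nbr = an
      ; induced = ind
      ; joined = λ { _ here → edge (inj₁ refl) (inj₂ (inj₁ refl)) bd ; _ (there (there ())) }
      ; K-to-c = λ k → subst (λ z → Walk E _ z c) (sym (K≡c k)) ⟦ subst (λ z → V z × z ≢ a × z ∉ (b ∷ d ∷ []) × ¬ ⊥) (K≡c k) k ⟧
      ; L-to-c = λ { (here refl) ne _ → ⊥-elim (ne refl) ; (there (here refl)) _ ne → ⊥-elim (ne refl) }
      ; sweep₁ = swp-weaken (λ ()) (swp-del b c d) (λ S f → λ { (e , x , y) → f (cov₁ e (core x) (core y)) })
      ; sweep₂ = inj₁ ((λ { (here e) → b≢c (sym e) ; (there (here e)) → c≢d e }) ,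
          swp-weaken (λ { refl → inj₁ (there (here refl)) , b≢d ∘ sym , c≢d ∘ sym }) (swp-ins b d c)
            (λ S f → λ { (e , x , y) → case cov₂ e (core x) (core y) of λ
               { (inj₁ p) → covers-start S p ; (inj₂ p) → f p } })) }
      where
      an : ∀ {y} → E a y → y ∈ (b ∷ d ∷ []) ⊎ ⊥
      an {y} e with allT (E⇒V′ e)
      ... | inj₁ refl = ⊥-elim (E-irr e)
      ... | inj₂ (inj₁ p) = inj₁ (here p)
      ... | inj₂ (inj₂ (inj₂ p)) = inj₁ (there (here p))
      -- An edge from `a` to `c` would cross the edge from `b` to `d`.
      ... | inj₂ (inj₂ (inj₁ refl)) = ⊥-elim (unlinked (λ x → x ≡ a ⊎ x ≡ c) (λ x → x ≡ b ⊎ x ≡ d)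
              (λ { (inj₁ refl) (inj₁ q) → a≢b q ; (inj₁ refl) (inj₂ q) → a≢d q
                 ; (inj₂ refl) (inj₁ q) → b≢c (sym q) ; (inj₂ refl) (inj₂ q) → c≢d q })
              (edge (inj₁ refl) (inj₂ refl) e) (edge (inj₁ refl) (inj₂ refl) bd))
      K≡c : ∀ {x} → V x × x ≢ a × x ∉ (b ∷ d ∷ []) × ¬ ⊥ → x ≡ c
      K≡c (v , ne , ni , _) with allT v
      ... | inj₁ e = ⊥-elim (ne e)
      ... | inj₂ (inj₁ e) = ⊥-elim (ni (here e))
      ... | inj₂ (inj₂ (inj₁ e)) = e
      ... | inj₂ (inj₂ (inj₂ e)) = ⊥-elim (ni (there (here e)))
      ind : ∀ {x y} → x ∈ (b ∷ d ∷ []) → y ∈ (b ∷ d ∷ []) → E x y → Beside x y (b ∷ d ∷ [])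
      ind (here refl) (here refl) e = ⊥-elim (E-irr e)
      ind (here refl) (there (here refl)) e = inj₁ here
      ind (there (here refl)) (here refl) e = inj₂ here
      ind (there (here refl)) (there (here refl)) e = ⊥-elim (E-irr e)
      core : ∀ {x} → x ∈ (b ∷ d ∷ []) ⊎ (V x × x ≢ a × x ∉ (b ∷ d ∷ []) × ¬ ⊥) → x ∈ (b ∷ c ∷ d ∷ [])
      core (inj₁ (here e)) = here e
      core (inj₁ (there (here e))) = there (there (here e))
      core (inj₂ k) = there (here (K≡c k))
      cov₁ : ∀ {x y} → E x y → x ∈ (b ∷ c ∷ d ∷ []) → y ∈ (b ∷ c ∷ d ∷ []) →
        Beside x y (b ∷ c ∷ d ∷ []) ⊎ Beside x y (b ∷ d ∷ [])
      cov₁ e (here refl) (here refl) = ⊥-elim (E-irr e)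
      cov₁ e (here refl) (there (here refl)) = inj₁ (inj₁ here)
      cov₁ e (here refl) (there (there (here refl))) = inj₂ (inj₁ here)
      cov₁ e (there (here refl)) (here refl) = inj₁ (inj₂ here)
      cov₁ e (there (here refl)) (there (here refl)) = ⊥-elim (E-irr e)
      cov₁ e (there (here refl)) (there (there (here refl))) = inj₁ (inj₁ (there here))
      cov₁ e (there (there (here refl))) (here refl) = inj₂ (inj₂ here)
      cov₁ e (there (there (here refl))) (there (here refl)) = inj₁ (inj₂ (there here))
      cov₁ e (there (there (here refl))) (there (there (here refl))) = ⊥-elim (E-irr e)
      cov₂ : ∀ {x y} → E x y → x ∈ (b ∷ c ∷ d ∷ []) → y ∈ (b ∷ c ∷ d ∷ []) →
        Beside x y (b ∷ c ∷ []) ⊎ Beside x y (b ∷ d ∷ c ∷ [])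
      cov₂ e (here refl) (here refl) = ⊥-elim (E-irr e)
      cov₂ e (here refl) (there (here refl)) = inj₁ (inj₁ here)
      cov₂ e (here refl) (there (there (here refl))) = inj₂ (inj₁ here)
      cov₂ e (there (here refl)) (here refl) = inj₁ (inj₂ here)
      cov₂ e (there (here refl)) (there (here refl)) = ⊥-elim (E-irr e)
      cov₂ e (there (here refl)) (there (there (here refl))) = inj₂ (inj₂ (there here))
      cov₂ e (there (there (here refl))) (here refl) = inj₂ (inj₂ here)
      cov₂ e (there (there (here refl))) (there (here refl)) = inj₂ (inj₁ (there here))
      cov₂ e (there (there (here refl))) (there (there (here refl))) = ⊥-elim (E-irr e)

    base : Sweepable S
    base with E? b d
    ... | yes bd = bridged bd
    ... | no ¬bd = flat ¬bd

  -- A set of vertices separated from the terminals by a, q, r is replaced by a triangle on a, q, r.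
  module Thick (unlinked : Unlinked) (semi : Semi) (q r x₀ : Fin n)
               (x₀-off : Off a q r x₀) (x₀-stuck : ¬ Escapes a q r x₀) where

    -- A degenerate separator reduces to `a` and one further vertex, which the second half of `Semi`
    -- forbids. The same reason gives `Vr`, `q≢a`, `r≢a` and `q≢r`.
    Vq : V q
    Vq with V? q
    ... | yes v = v
    ... | no ¬v with proj₂ semi r x₀ (let (v , ≢a , ≢q , ≢r) = x₀-off in v , ≢a , ≢r , ≢r)
    ... | t , T , w = ⊥-elim (x₀-stuck (t , T , walk-mono (λ { (v , ≢a , ≢r , _) → v , ≢a , (λ { refl → ¬v v }) , ≢r }) w))

    Vr : V r
    Vr with V? r
    ... | yes v = v
    ... | no ¬v with proj₂ semi q x₀ (let (v , ≢a , ≢q , ≢r) = x₀-off in v , ≢a , ≢q , ≢q)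
    ... | t , T , w = ⊥-elim (x₀-stuck (t , T , walk-mono (λ { (v , ≢a , ≢q , _) → v , ≢a , ≢q , (λ { refl → ¬v v }) }) w))

    q≢a : q ≢ a
    q≢a refl = x₀-stuck (good-weaken (λ (v , p , s , t) → v , p , p , t) (λ (v , p , s , t) → v , p , t , t)
                 (proj₂ semi r) x₀ x₀-off)

    r≢a : r ≢ a
    r≢a refl = x₀-stuck (good-weaken (λ (v , p , s , t) → v , p , s , p) (λ (v , p , s , t) → v , p , s , s)
                 (proj₂ semi q) x₀ x₀-off)

    q≢r : q ≢ r
    q≢r refl = x₀-stuck (proj₂ semi q x₀ x₀-off)

    -- All stuck vertices are removed at once, not only the component of `x₀`; a neighbour of a
    -- stuck vertex is then stuck or a corner.
    R : Fin n → Set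
    R x = Off a q r x × ¬ Escapes a q r x

    R? : ∀ x → Dec (R x)
    R? x = off? a q r x ×-dec ¬? (escapes? a q r x)

    In₃ : Fin n → Set
    In₃ x = x ≡ a ⊎ x ≡ q ⊎ x ≡ r

    in₃? : ∀ x → Dec (In₃ x)
    in₃? x = (x ≟ a) ⊎-dec (x ≟ q) ⊎-dec (x ≟ r)

    in₃-V : ∀ {x} → In₃ x → V x
    in₃-V (inj₁ refl) = Va
    in₃-V (inj₂ (inj₁ refl)) = Vq
    in₃-V (inj₂ (inj₂ refl)) = Vr

    in₃-¬R : ∀ {x} → In₃ x → ¬ R x
    in₃-¬R (inj₁ e) ((_ , ne , _) , _) = ne e
    in₃-¬R (inj₂ (inj₁ e)) ((_ , _ , ne , _) , _) = ne e
    in₃-¬R (inj₂ (inj₂ e)) ((_ , _ , _ , ne) , _) = ne e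

    R-nbr : ∀ {x y} → R x → E x y → ¬ R y → In₃ y
    R-nbr {x} {y} (o , s) e ¬Ry with in₃? y
    ... | yes i = i
    ... | no ¬i = ⊥-elim (¬Ry ((oy , (λ (t , T , w) → s (t , T , (o ▷⟨ e ⟩ w))))))
      where oy = E⇒V (E-sym e) , ¬i ∘ inj₁ , ¬i ∘ inj₂ ∘ inj₁ , ¬i ∘ inj₂ ∘ inj₂

    R-¬T : ∀ {x} → R x → ¬ Terminal x
    R-¬T (o , s) T = s (_ , T , ⟦ o ⟧)

    x₀-R : R x₀
    x₀-R = x₀-off , x₀-stuck

    -- Every corner of the triangle is reached from within the region: avoid the other two.
    to-corner : ∀ {u} → In₃ u → Walk E (λ y → R y ⊎ y ≡ u) x₀ u
    to-corner {u} iu = go iu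
      where
      finish : ∀ {p s t} → Escapes p s t x₀ → (∀ {v} → In₃ v → Off p s t v → v ≡ u) → Walk E (λ y → R y ⊎ y ≡ u) x₀ u
      finish (t , T , w) f with walk-exit R R? w x₀-R (λ Rt → R-¬T Rt T)
      ... | z , v , w′ , e , o , ¬Rv with f (R-nbr (proj₂ (walk-end w′)) e ¬Rv) o
      ... | refl = walk-mono (inj₁ ∘ proj₂) w′ ⊕ edge (inj₁ (proj₂ (walk-end w′))) (inj₂ refl) e
      go : In₃ u → Walk E (λ y → R y ⊎ y ≡ u) x₀ u
      go (inj₁ refl) = finish (proj₁ semi q r r q≢a r≢a r≢a x₀ (let (v , _ , x , y) = x₀-off in v , x , y , y))
        λ { (inj₁ p) _ → p ; (inj₂ (inj₁ p)) (_ , ne , _) → ⊥-elim (ne p) ; (inj₂ (inj₂ p)) (_ , _ , ne , _) → ⊥-elim (ne p) }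
      go (inj₂ (inj₁ refl)) = finish (proj₂ semi r x₀ (let (v , z , x , y) = x₀-off in v , z , y , y))
        λ { (inj₂ (inj₁ p)) _ → p ; (inj₁ p) (_ , ne , _) → ⊥-elim (ne p) ; (inj₂ (inj₂ p)) (_ , _ , ne , _) → ⊥-elim (ne p) }
      go (inj₂ (inj₂ refl)) = finish (proj₂ semi q x₀ (let (v , z , x , y) = x₀-off in v , z , x , x))
        λ { (inj₂ (inj₂ p)) _ → p ; (inj₁ p) (_ , ne , _) → ⊥-elim (ne p) ; (inj₂ (inj₁ p)) (_ , _ , ne , _) → ⊥-elim (ne p) }

    through : ∀ {u v} → In₃ u → In₃ v → Walk E (λ y → R y ⊎ y ≡ u ⊎ y ≡ v) u v
    through iu iv = walk-rev E-sym (walk-mono (λ { (inj₁ p) → inj₁ p ; (inj₂ p) → inj₂ (inj₁ p) }) (to-corner iu))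
                    ⊕ walk-mono (λ { (inj₁ p) → inj₁ p ; (inj₂ p) → inj₂ (inj₂ p) }) (to-corner iv)

    Tri : Fin n → Fin n → Set
    Tri x y = In₃ x × In₃ y × x ≢ y

    T¬R : ∀ {x} → Terminal x → ¬ R x
    T¬R T Rx = R-¬T Rx T

    S^ : Society n
    S^ = record
      { V = λ x → V x × ¬ R x ; V? = λ x → V? x ×-dec ¬? (R? x)
      ; E = λ x y → (E x y × ¬ R x × ¬ R y) ⊎ Tri x y
      ; E? = λ x y → (E? x y ×-dec ¬? (R? x) ×-dec ¬? (R? y)) ⊎-dec (in₃? x ×-dec in₃? y ×-dec ¬? (x ≟ y))
      ; E-sym = λ { (inj₁ (e , p , s)) → inj₁ (E-sym e , s , p) ; (inj₂ (i , j , ne)) → inj₂ (j , i , ne ∘ sym) }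
      ; E-irr = λ { (inj₁ (e , _)) → E-irr e ; (inj₂ (_ , _ , ne)) → ne refl }
      ; E⇒V = λ { (inj₁ (e , p , _)) → E⇒V e , p ; (inj₂ (i , _)) → in₃-V i , in₃-¬R i }
      ; a = a ; b = b ; c = c ; d = d
      ; Va = Va , T¬R (inj₁ refl) ; Vb = Vb , T¬R (inj₂ (inj₁ refl))
      ; Vc = Vc , T¬R (inj₂ (inj₂ (inj₁ refl))) ; Vd = Vd , T¬R (inj₂ (inj₂ (inj₂ refl)))
      ; a≢b = a≢b ; a≢c = a≢c ; a≢d = a≢d ; b≢c = b≢c ; b≢d = b≢d ; c≢d = c≢d }

    module ^ = Society S^

    -- A walk that enters the removed set leaves it through a corner again, and two different
    -- corners are joined by an edge of the triangle. The mutual lemma carries the corner of entry.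
    project : ∀ {p s u x t} → Terminal t → Walk E (Off p s u) x t → ¬ R x → ^.Escapes p s u x
    project-in : ∀ {p s u x y t} → Terminal t → Walk E (Off p s u) y t → R y → In₃ x → ^.Off p s u x → ^.Escapes p s u x
    project T ⟦ v , o ⟧ ¬Rx = _ , T , ⟦ (v , ¬Rx) , o ⟧
    project T (_▷⟨_⟩_ {y = y} (v , o) e w) ¬Rx with R? y
    ... | yes Ry = project-in T w Ry (R-nbr Ry (E-sym e) ¬Rx) ((v , ¬Rx) , o)
    ... | no ¬Ry with project T w ¬Ry
    ... | t , T′ , w′ = t , T′ , (((v , ¬Rx) , o) ▷⟨ inj₁ (e , ¬Rx , ¬Ry) ⟩ w′)
    project-in T ⟦ _ ⟧ Ry _ _ = ⊥-elim (R-¬T Ry T)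
    project-in {x = x} T (_▷⟨_⟩_ {y = z} _ e w) Ry ix o with R? z
    ... | yes Rz = project-in T w Rz ix o
    ... | no ¬Rz with x ≟ z
    ... | yes refl = project T w ¬Rz
    ... | no x≢z with project T w ¬Rz
    ... | t , T′ , w′ = t , T′ , (o ▷⟨ inj₂ (ix , R-nbr Ry e ¬Rz , x≢z) ⟩ w′)

    good^ : ∀ {p s u} → Good p s u → ^.Good p s u
    good^ g x ((v , ¬Rx) , o) with g x (v , o)
    ... | t , T , w = project T w ¬Rx

    semi^ : ^.Semi
    semi^ = (λ p s u p≢ s≢ u≢ → good^ (proj₁ semi p s u p≢ s≢ u≢)) , (λ s → good^ (proj₂ semi s))

    -- The removed set is given to the side that owns two of the three corners; two disjoint sides
    -- cannot both do so.
    unlinked^ : ^.Unlinked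
    unlinked^ X Y dj wX wY = unlinked (lift X) (lift Y) dj′ (liftW X wX (Va , T¬R (inj₁ refl)))
                               (liftW Y wY (Vb , T¬R (inj₂ (inj₁ refl))))
      where
      Two : (Fin n → Set) → Set
      Two X = (X a × X q) ⊎ (X a × X r) ⊎ (X q × X r)
      lift : (Fin n → Set) → Fin n → Set
      lift X x = (X x × ^.V x) ⊎ (R x × Two X)
      two : ∀ X {u v} → In₃ u → In₃ v → u ≢ v → X u → X v → Two X
      two X (inj₁ refl) (inj₁ refl) ne _ _ = ⊥-elim (ne refl)
      two X (inj₁ refl) (inj₂ (inj₁ refl)) _ p s = inj₁ (p , s)
      two X (inj₁ refl) (inj₂ (inj₂ refl)) _ p s = inj₂ (inj₁ (p , s))
      two X (inj₂ (inj₁ refl)) (inj₁ refl) _ p s = inj₁ (s , p)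
      two X (inj₂ (inj₁ refl)) (inj₂ (inj₁ refl)) ne _ _ = ⊥-elim (ne refl)
      two X (inj₂ (inj₁ refl)) (inj₂ (inj₂ refl)) _ p s = inj₂ (inj₂ (p , s))
      two X (inj₂ (inj₂ refl)) (inj₁ refl) _ p s = inj₂ (inj₁ (s , p))
      two X (inj₂ (inj₂ refl)) (inj₂ (inj₁ refl)) _ p s = inj₂ (inj₂ (s , p))
      two X (inj₂ (inj₂ refl)) (inj₂ (inj₂ refl)) ne _ _ = ⊥-elim (ne refl)
      pigeon : Two X → Two Y → ⊥
      pigeon (inj₁ (p , _)) (inj₁ (s , _)) = dj p s
      pigeon (inj₁ (p , _)) (inj₂ (inj₁ (s , _))) = dj p s
      pigeon (inj₁ (_ , p)) (inj₂ (inj₂ (s , _))) = dj p s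
      pigeon (inj₂ (inj₁ (p , _))) (inj₁ (s , _)) = dj p s
      pigeon (inj₂ (inj₁ (p , _))) (inj₂ (inj₁ (s , _))) = dj p s
      pigeon (inj₂ (inj₁ (_ , p))) (inj₂ (inj₂ (_ , s))) = dj p s
      pigeon (inj₂ (inj₂ (p , _))) (inj₁ (_ , s)) = dj p s
      pigeon (inj₂ (inj₂ (_ , p))) (inj₂ (inj₁ (_ , s))) = dj p s
      pigeon (inj₂ (inj₂ (p , _))) (inj₂ (inj₂ (s , _))) = dj p s
      dj′ : ∀ {x} → lift X x → lift Y x → ⊥
      dj′ (inj₁ (p , _)) (inj₁ (s , _)) = dj p s
      dj′ (inj₁ (_ , (_ , ¬R))) (inj₂ (Rx , _)) = ¬R Rx
      dj′ (inj₂ (Rx , _)) (inj₁ (_ , (_ , ¬R))) = ¬R Rx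
      dj′ (inj₂ (_ , p)) (inj₂ (_ , s)) = pigeon p s
      liftW : ∀ X {u v} → Walk ^.E X u v → ^.V u → Walk E (lift X) u v
      liftW X w vu = walk-bind inj₁
          (λ { (p , v) (p′ , v′) (inj₁ (e , _)) → edge (inj₁ (p , v)) (inj₁ (p′ , v′)) e
             ; (p , v) (p′ , v′) (inj₂ (i , j , ne)) → walk-mono
                 (λ { (inj₁ Ry) → inj₂ (Ry , two X i j ne p p′) ; (inj₂ (inj₁ refl)) → inj₁ (p , v)
                    ; (inj₂ (inj₂ refl)) → inj₁ (p′ , v′) }) (through i j) })
          (walk-closed (λ x → X x × ^.V x) (λ _ e p → p , ^.E⇒V (^.E-sym e)) w (walk-start w , vu))

    size-< : count ^.V? < count V?
    size-< = count-< ^.V? V? proj₁ {x₀} (proj₁ x₀-off) (λ (_ , ¬R) → ¬R x₀-R)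

    module _ (O : Sweepable S^) where
      open Sweepable O

      Slot : Fin n → Fin n → Fin n → Set
      Slot g h y = y ≡ g ⊎ y ≡ h ⊎ (Gap y × left y ≡ g × right y ≡ h)

      -- In `S^` the corners `q` and `r` are adjacent to `a` and to each other, which forces them
      -- between the same two consecutive vertices of `L`. The removed set will hang there.
      slot : ∃ λ g → ∃ λ h → Consec g h L × Slot g h q × Slot g h r
      slot with a-nbr {q} (inj₂ (inj₁ refl , inj₂ (inj₁ refl) , q≢a ∘ sym))
              | a-nbr {r} (inj₂ (inj₁ refl , inj₂ (inj₂ refl) , r≢a ∘ sym))
      ... | inj₂ gq | _ = left q , right q , gap-ends gq , inj₂ (inj₂ (gq , refl , refl)) ,
              (case gap-nbr gq (inj₂ (inj₂ (inj₁ refl) , inj₂ (inj₂ refl) , q≢r)) of λ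
                { (inj₁ p) → ⊥-elim (r≢a p) ; (inj₂ s) → s })
      ... | inj₁ _ | inj₂ gr = left r , right r , gap-ends gr ,
              (case gap-nbr gr (inj₂ (inj₂ (inj₂ refl) , inj₂ (inj₁ refl) , q≢r ∘ sym)) of λ
                { (inj₁ p) → ⊥-elim (q≢a p) ; (inj₂ s) → s }) , inj₂ (inj₂ (gr , refl , refl))
      ... | inj₁ iq | inj₁ ir with induced iq ir (inj₂ (inj₂ (inj₁ refl) , inj₂ (inj₂ refl) , q≢r))
      ... | inj₁ c = q , r , c , inj₁ refl , inj₂ (inj₁ refl)
      ... | inj₂ c = r , q , c , inj₂ (inj₁ refl) , inj₁ refl

      g h : Fin n
      g = proj₁ slot
      h = proj₁ (proj₂ slot)

      gh : Consec g h L
      gh = proj₁ (proj₂ (proj₂ slot))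

      in₃-slot : ∀ {y} → In₃ y → y ≡ a ⊎ Slot g h y
      in₃-slot (inj₁ e) = inj₁ e
      in₃-slot (inj₂ (inj₁ refl)) = inj₂ (proj₁ (proj₂ (proj₂ (proj₂ slot))))
      in₃-slot (inj₂ (inj₂ refl)) = inj₂ (proj₂ (proj₂ (proj₂ (proj₂ slot))))

      Gap′ : Fin n → Set
      Gap′ y = Gap y ⊎ R y

      left′ right′ : Fin n → Fin n
      left′ y with R? y
      ... | yes _ = g
      ... | no _ = left y
      right′ y with R? y
      ... | yes _ = h
      ... | no _ = right y

      left-R : ∀ {y} → R y → left′ y ≡ g
      left-R {y} Ry with R? y
      ... | yes _ = refl
      ... | no ¬R = ⊥-elim (¬R Ry)

      right-R : ∀ {y} → R y → right′ y ≡ h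
      right-R {y} Ry with R? y
      ... | yes _ = refl
      ... | no ¬R = ⊥-elim (¬R Ry)

      left-¬R : ∀ {y} → ¬ R y → left′ y ≡ left y
      left-¬R {y} ¬Ry with R? y
      ... | yes Ry = ⊥-elim (¬Ry Ry)
      ... | no _ = refl

      right-¬R : ∀ {y} → ¬ R y → right′ y ≡ right y
      right-¬R {y} ¬Ry with R? y
      ... | yes Ry = ⊥-elim (¬Ry Ry)
      ... | no _ = refl

      gap-¬R : ∀ {y} → Gap y → ¬ R y
      gap-¬R gy = proj₂ (proj₁ (gap-V gy))

      L-¬R : ∀ {y} → y ∈ L → ¬ R y
      L-¬R i = proj₂ (proj₁ (L-sub i))

      gap-nbr′ : ∀ {x y} → Gap′ x → E x y →
        y ≡ a ⊎ y ≡ left′ x ⊎ y ≡ right′ x ⊎ (Gap′ y × left′ y ≡ left′ x × right′ y ≡ right′ x)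
      gap-nbr′ {x} {y} (inj₂ Rx) e rewrite left-R Rx | right-R Rx with R? y
      ... | yes Ry = inj₂ (inj₂ (inj₂ (inj₂ Ry , refl , refl)))
      ... | no ¬Ry with in₃-slot (R-nbr Rx e ¬Ry)
      ... | inj₁ p = inj₁ p
      ... | inj₂ (inj₁ p) = inj₂ (inj₁ p)
      ... | inj₂ (inj₂ (inj₁ p)) = inj₂ (inj₂ (inj₁ p))
      ... | inj₂ (inj₂ (inj₂ (gy , p , s))) = inj₂ (inj₂ (inj₂ (inj₁ gy , p , s)))
      gap-nbr′ {x} {y} (inj₁ gx) e rewrite left-¬R (gap-¬R gx) | right-¬R (gap-¬R gx) with R? y
      ... | yes Ry with in₃-slot (R-nbr Ry (E-sym e) (gap-¬R gx))
      ... | inj₁ p = ⊥-elim (proj₁ (proj₂ (gap-V gx)) p)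
      ... | inj₂ (inj₁ refl) = ⊥-elim (proj₂ (proj₂ (gap-V gx)) (consec-∈ˡ gh))
      ... | inj₂ (inj₂ (inj₁ refl)) = ⊥-elim (proj₂ (proj₂ (gap-V gx)) (consec-∈ʳ gh))
      ... | inj₂ (inj₂ (inj₂ (_ , p , s))) = inj₂ (inj₂ (inj₂ (inj₂ Ry , sym p , sym s)))
      gap-nbr′ {x} {y} (inj₁ gx) e | no ¬Ry with gap-nbr gx (inj₁ (e , gap-¬R gx , ¬Ry))
      ... | inj₁ p = inj₁ p
      ... | inj₂ (inj₁ p) = inj₂ (inj₁ p)
      ... | inj₂ (inj₂ (inj₁ p)) = inj₂ (inj₂ (inj₁ p))
      ... | inj₂ (inj₂ (inj₂ (gy , p , s))) = inj₂ (inj₂ (inj₂ (inj₁ gy , p , s)))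

      -- Consequently walks through the core use no edge of the triangle and carry over unchanged.
      K-in₃ : ∀ {y} → K y → ¬ In₃ y
      K-in₃ (_ , ne , ni , ¬g) i with in₃-slot i
      ... | inj₁ p = ne p
      ... | inj₂ (inj₁ refl) = ni (consec-∈ˡ gh)
      ... | inj₂ (inj₂ (inj₁ refl)) = ni (consec-∈ʳ gh)
      ... | inj₂ (inj₂ (inj₂ (gy , _))) = ¬g gy

      K⇒ : ∀ {y} → K y → V y × y ≢ a × y ∉ L × ¬ Gap′ y
      K⇒ ((v , ¬R) , ne , ni , ¬g) = v , ne , ni , λ { (inj₁ gy) → ¬g gy ; (inj₂ Ry) → ¬R Ry }

      K⇐ : ∀ {y} → V y × y ≢ a × y ∉ L × ¬ Gap′ y → K y
      K⇐ (v , ne , ni , ¬g) = (v , ¬g ∘ inj₂) , ne , ni , ¬g ∘ inj₁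

      core⇒ : ∀ {y} → Core y → y ∈ L ⊎ (V y × y ≢ a × y ∉ L × ¬ Gap′ y)
      core⇒ (inj₁ i) = inj₁ i
      core⇒ (inj₂ k) = inj₂ (K⇒ k)

      core-¬R : ∀ {y} → y ∈ L ⊎ (V y × y ≢ a × y ∉ L × ¬ Gap′ y) → Core y × ¬ R y
      core-¬R (inj₁ i) = inj₁ i , L-¬R i
      core-¬R (inj₂ k) = inj₂ (K⇐ k) , proj₂ (proj₂ (proj₂ k)) ∘ inj₂

      cover⇐ : ∀ {x y} → E x y × (x ∈ L ⊎ (V x × x ≢ a × x ∉ L × ¬ Gap′ x)) × (y ∈ L ⊎ (V y × y ≢ a × y ∉ L × ¬ Gap′ y)) → CoreEdge x y
      cover⇐ (e , x , y) = inj₁ (e , proj₂ (core-¬R x) , proj₂ (core-¬R y)) , proj₁ (core-¬R x) , proj₁ (core-¬R y)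

      -- A triangle edge in the old connection becomes a detour through the removed set. The point
      -- is that such an edge forces `g` to be `x`, so the detour stays in the region between `x`
      -- and `y`.
      joined′ : c ∉ L → ∀ {x y} → Consec x y L → Walk E (λ w → w ≡ x ⊎ w ≡ y ⊎ (Gap′ w × left′ w ≡ x)) x y
      joined′ ni {x} {y} cxy = walk-bind emb f (joined ni cxy)
        where
        emb : ∀ {w} → w ≡ x ⊎ w ≡ y ⊎ (Gap w × left w ≡ x) → w ≡ x ⊎ w ≡ y ⊎ (Gap′ w × left′ w ≡ x)
        emb (inj₁ p) = inj₁ p
        emb (inj₂ (inj₁ p)) = inj₂ (inj₁ p)
        emb (inj₂ (inj₂ (gw , p))) = inj₂ (inj₂ (inj₁ gw , trans (left-¬R (gap-¬R gw)) p))
        ends : ∀ {u v} → u ≡ x ⊎ u ≡ y → v ≡ x ⊎ v ≡ y → u ≢ v → Consec u v L ⊎ Consec v u L → Consec g h L →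
          u ≡ g ⊎ u ≡ h → v ≡ g ⊎ v ≡ h → g ≡ x
        ends (inj₁ refl) _ _ _ _ (inj₁ p) _ = sym p
        ends _ (inj₁ refl) _ _ _ _ (inj₁ p) = sym p
        ends (inj₁ refl) (inj₁ refl) ne _ _ _ _ = ⊥-elim (ne refl)
        ends (inj₂ refl) (inj₂ refl) ne _ _ _ _ = ⊥-elim (ne refl)
        ends (inj₁ refl) (inj₂ refl) ne _ _ (inj₂ p) (inj₂ p′) = ⊥-elim (ne (trans p (sym p′)))
        ends (inj₂ refl) (inj₁ refl) ne _ _ (inj₂ p) (inj₂ p′) = ⊥-elim (ne (trans p (sym p′)))
        ends (inj₁ refl) (inj₂ refl) ne _ cg (inj₂ refl) (inj₁ refl) = ⊥-elim (consec-asym L-unique cg cxy)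
        ends (inj₂ refl) (inj₁ refl) ne _ cg (inj₁ refl) (inj₂ refl) = ⊥-elim (consec-asym L-unique cg cxy)
        at : ∀ {u} → u ≡ x ⊎ u ≡ y ⊎ (Gap u × left u ≡ x) → In₃ u → (u ≡ x ⊎ u ≡ y) × (u ≡ g ⊎ u ≡ h) ⊎ g ≡ x
        at p i with in₃-slot i
        at (inj₁ refl) i | inj₁ refl = ⊥-elim (proj₂ (L-sub (consec-∈ˡ cxy)) refl)
        at (inj₂ (inj₁ refl)) i | inj₁ refl = ⊥-elim (proj₂ (L-sub (consec-∈ʳ cxy)) refl)
        at (inj₂ (inj₂ (gu , _))) i | inj₁ refl = ⊥-elim (proj₁ (proj₂ (gap-V gu)) refl)
        at (inj₁ p) i | inj₂ (inj₁ s) = inj₁ (inj₁ p , inj₁ s)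
        at (inj₂ (inj₁ p)) i | inj₂ (inj₁ s) = inj₁ (inj₂ p , inj₁ s)
        at (inj₂ (inj₂ (gu , _))) i | inj₂ (inj₁ refl) = ⊥-elim (proj₂ (proj₂ (gap-V gu)) (consec-∈ˡ gh))
        at (inj₁ p) i | inj₂ (inj₂ (inj₁ s)) = inj₁ (inj₁ p , inj₂ s)
        at (inj₂ (inj₁ p)) i | inj₂ (inj₂ (inj₁ s)) = inj₁ (inj₂ p , inj₂ s)
        at (inj₂ (inj₂ (gu , _))) i | inj₂ (inj₂ (inj₁ refl)) = ⊥-elim (proj₂ (proj₂ (gap-V gu)) (consec-∈ʳ gh))
        at (inj₁ refl) i | inj₂ (inj₂ (inj₂ (gu , _))) = ⊥-elim (proj₂ (proj₂ (gap-V gu)) (consec-∈ˡ cxy))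
        at (inj₂ (inj₁ refl)) i | inj₂ (inj₂ (inj₂ (gu , _))) = ⊥-elim (proj₂ (proj₂ (gap-V gu)) (consec-∈ʳ cxy))
        at (inj₂ (inj₂ (gu , p))) i | inj₂ (inj₂ (inj₂ (_ , s , _))) = inj₂ (trans (sym s) p)
        f : ∀ {u v} → u ≡ x ⊎ u ≡ y ⊎ (Gap u × left u ≡ x) → v ≡ x ⊎ v ≡ y ⊎ (Gap v × left v ≡ x) → ^.E u v →
            Walk E (λ w → w ≡ x ⊎ w ≡ y ⊎ (Gap′ w × left′ w ≡ x)) u v
        f pu pv (inj₁ (e , _)) = edge (emb pu) (emb pv) e
        f {u} {v} pu pv (inj₂ (i , j , ne)) = walk-mono
            (λ { (inj₁ Rw) → inj₂ (inj₂ (inj₂ Rw , trans (left-R Rw) g≡x)) ; (inj₂ (inj₁ refl)) → emb pu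
               ; (inj₂ (inj₂ refl)) → emb pv }) (through i j)
          where
          g≡x : g ≡ x
          g≡x with at pu i | at pv j
          ... | inj₂ p | _ = p
          ... | _ | inj₂ p = p
          ... | inj₁ (p , s) | inj₁ (p′ , s′) = ends p p′ ne (inj₁′ p p′) gh s s′
            where
            inj₁′ : u ≡ x ⊎ u ≡ y → v ≡ x ⊎ v ≡ y → Consec u v L ⊎ Consec v u L
            inj₁′ (inj₁ refl) (inj₁ refl) = ⊥-elim (ne refl)
            inj₁′ (inj₁ refl) (inj₂ refl) = inj₁ cxy
            inj₁′ (inj₂ refl) (inj₁ refl) = inj₂ cxy
            inj₁′ (inj₂ refl) (inj₂ refl) = ⊥-elim (ne refl)

      restore : Sweepable S
      restore = record
        { L = L ; L-first = L-first ; L-last = L-last ; L-unique = L-unique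
        ; L-sub = λ i → proj₁ (proj₁ (L-sub i)) , proj₂ (L-sub i)
        ; Gap = Gap′ ; Gap? = λ x → Gap? x ⊎-dec R? x
        ; gap-V = λ { (inj₁ gr) → let (v , ne , ni) = gap-V gr in proj₁ v , ne , ni
                    ; (inj₂ Rr) → proj₁ (proj₁ Rr) , proj₁ (proj₂ (proj₁ Rr)) , (λ i → L-¬R i Rr) }
        ; gap-T = λ { (inj₁ gr) → gap-T gr ; (inj₂ Rr) → R-¬T Rr }
        ; left = left′ ; right = right′
        ; gap-ends = λ { (inj₁ gr) → subst₂ (λ p s → Consec p s L) (sym (left-¬R (gap-¬R gr))) (sym (right-¬R (gap-¬R gr))) (gap-ends gr)
                       ; (inj₂ Rr) → subst₂ (λ p s → Consec p s L) (sym (left-R Rr)) (sym (right-R Rr)) gh }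
        ; gap-nbr = gap-nbr′
        ; a-nbr = an
        ; induced = λ i j e → induced i j (inj₁ (e , L-¬R i , L-¬R j))
        ; joined = joined′
        ; K-to-c = λ k → walk-mono K⇒ (walk-map kk (K-to-c (K⇐ k)))
        ; L-to-c = λ i nb nd → walk-mono (λ { (inj₁ p) → inj₁ p ; (inj₂ k) → inj₂ (K⇒ k) }) (walk-map lk (L-to-c i nb nd))
        ; sweep₁ = swp-weaken (λ (k , p) → core⇒ k , p) sweep₁ (λ S f → f ∘ cover⇐)
        ; sweep₂ = case sweep₂ of λ { (inj₁ (ni , W)) → inj₁ (ni , swp-weaken (λ (k , p) → core⇒ k , p) W (λ S f → f ∘ cover⇐))
                                    ; (inj₂ p) → inj₂ p } }
        where
        an : ∀ {y} → E a y → y ∈ L ⊎ Gap′ y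
        an {y} e with R? y
        ... | yes Ry = inj₂ (inj₂ Ry)
        ... | no ¬Ry with a-nbr (inj₁ (e , T¬R (inj₁ refl) , ¬Ry))
        ... | inj₁ i = inj₁ i
        ... | inj₂ gy = inj₂ (inj₁ gy)
        kk : ∀ {u v} → K u → K v → ^.E u v → E u v
        kk _ _ (inj₁ (e , _)) = e
        kk ku _ (inj₂ (i , _)) = ⊥-elim (K-in₃ ku i)
        lk : ∀ {l u v} → u ≡ l ⊎ K u → v ≡ l ⊎ K v → ^.E u v → E u v
        lk _ _ (inj₁ (e , _)) = e
        lk (inj₂ k) _ (inj₂ (i , _)) = ⊥-elim (K-in₃ k i)
        lk _ (inj₂ k) (inj₂ (_ , i , _)) = ⊥-elim (K-in₃ k i)
        lk (inj₁ refl) (inj₁ refl) (inj₂ (_ , _ , ne)) = ⊥-elim (ne refl)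

-- The induction hypothesis as a value: corners can be filled before the recursion that supplies it
-- is defined.
Solver : ℕ → ℕ → Set₁
Solver n k = ∀ (S : Society n) → count (Society.V? S) < k → Society.Semi S → Society.Unlinked S → Sweepable S

-- Filling a region bounded by `a` and three further vertices

module _ {n : ℕ} (S : Society n) where
  open Society S

  module Corner (p q r : Fin n)
    (a≢p : a ≢ p) (a≢q : a ≢ q) (a≢r : a ≢ r) (p≢q : p ≢ q) (p≢r : p ≢ r) (q≢r : q ≢ r)
    (R : Fin n → Set) (R? : ∀ x → Dec (R x))
    (R-V : ∀ {x} → R x → V x) (R-T : ∀ {x} → R x → ¬ Terminal x)
    (R-off : ∀ {x} → R x → x ≢ a × x ≢ p × x ≢ q × x ≢ r)
    (R-nbr : ∀ {x y} → R x → E x y → y ≡ a ⊎ y ≡ p ⊎ y ≡ q ⊎ y ≡ r ⊎ R y)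
    where

    -- `fill₁` serves a corner whose boundary vertex `r` is on the path already and whose `q` is
    -- swept over; `fill₂` one where `r` enters during the sweep and `q` has to stay.
    record Filled : Set where
      field
        Pm : List (Fin n)
      P : List (Fin n)
      P = p ∷ Pm ++ r ∷ []
      field
        P-unique : Unique P
        Pm-R : ∀ {y} → y ∈ Pm → R y
        P-joined : ∀ {x y} → Consec x y P → E x y
        P-a : ∀ {y} → R y → E a y → y ∈ Pm
        P-induced : ∀ {x y} → x ∈ P → y ∈ P → E x y → Beside x y P
        R-to-q : ∀ {y} → R y → y ∉ Pm → Walk E (λ w → (R w × w ∉ Pm) ⊎ w ≡ q) y q
        P-to-q : ∀ {y} → y ∈ Pm → Walk E (λ w → w ≡ y ⊎ (R w × w ∉ Pm) ⊎ w ≡ q) y q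
        fill₁ : Swp (p ∷ q ∷ r ∷ []) P R (λ x y → E x y × R x × y ≢ a)
        fill₂ : Swp (p ∷ q ∷ []) (p ∷ Pm ++ r ∷ q ∷ []) (λ y → R y ⊎ y ≡ r) (λ x y → E x y × R x × y ≢ a)

    trivial : E p r → (∀ {x} → ¬ R x) → Filled
    trivial pr noR = record
      { Pm = [] ; P-unique = (p≢r ∷ []) ∷ [] ∷ [] ; Pm-R = λ ()
      ; P-joined = λ { here → pr ; (there (there ())) }
      ; P-a = λ R → ⊥-elim (noR R)
      ; P-induced = λ { (here refl) (here refl) e → ⊥-elim (E-irr e) ; (here refl) (there (here refl)) e → inj₁ here
                      ; (there (here refl)) (here refl) e → inj₂ here ; (there (here refl)) (there (here refl)) e → ⊥-elim (E-irr e) }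
      ; R-to-q = λ R → ⊥-elim (noR R) ; P-to-q = λ ()
      ; fill₁ = swp-weaken (λ ()) (swp-del p q r) (λ S f (_ , R , _) → ⊥-elim (noR R))
      ; fill₂ = swp-weaken inj₂ (swp-ins p r q) (λ S f (_ , R , _) → ⊥-elim (noR R)) }

    module _ (full : Full) (x₀ : Fin n) (Rx₀ : R x₀) (¬pr : ¬ E p r)
      (Vp : V p) (Vq : V q) (Vr : V r)
      (unlinked : ∀ (X Y : Fin n → Set) → (∀ {y} → X y → Y y → ⊥) →
        (∀ {y} → X y → y ≡ a ⊎ y ≡ q ⊎ R y) → (∀ {y} → Y y → y ≡ p ⊎ y ≡ r ⊎ R y) →
        Walk E X a q → Walk E Y p r → ⊥)
      (s : Fin n) (Vs : V s) (s∉ : ¬ R s × s ≢ a × s ≢ p × s ≢ q × s ≢ r)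
      (solve : Solver n (count V?)) where

      private
        Four : Fin n → Set
        Four x = x ≡ a ⊎ x ≡ p ⊎ x ≡ q ⊎ x ≡ r

        four? : ∀ x → Dec (Four x)
        four? x = (x ≟ a) ⊎-dec (x ≟ p) ⊎-dec (x ≟ q) ⊎-dec (x ≟ r)

        four-V : ∀ {x} → Four x → V x
        four-V (inj₁ refl) = Va
        four-V (inj₂ (inj₁ refl)) = Vp
        four-V (inj₂ (inj₂ (inj₁ refl))) = Vq
        four-V (inj₂ (inj₂ (inj₂ refl))) = Vr

        R-nbr′ : ∀ {x y} → R x → E x y → Four y ⊎ R y
        R-nbr′ R e with R-nbr R e
        ... | inj₁ h = inj₁ (inj₁ h)
        ... | inj₂ (inj₁ h) = inj₁ (inj₂ (inj₁ h))
        ... | inj₂ (inj₂ (inj₁ h)) = inj₁ (inj₂ (inj₂ (inj₁ h)))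
        ... | inj₂ (inj₂ (inj₂ (inj₁ h))) = inj₁ (inj₂ (inj₂ (inj₂ h)))
        ... | inj₂ (inj₂ (inj₂ (inj₂ h))) = inj₂ h

        Sᶜ : Society n
        Sᶜ = record
          { V = λ x → R x ⊎ Four x ; V? = λ x → R? x ⊎-dec four? x
          -- Only edges that meet `R` are kept; those among the four boundary vertices are left to
          -- the surrounding sweep.
          ; E = λ x y → E x y × (R x ⊎ R y) ; E? = λ x y → E? x y ×-dec (R? x ⊎-dec R? y)
          ; E-sym = λ { (e , inj₁ h) → E-sym e , inj₂ h ; (e , inj₂ h) → E-sym e , inj₁ h }
          ; E-irr = λ (e , _) → E-irr e
          ; E⇒V = λ { (e , inj₁ h) → inj₁ h ; (e , inj₂ h) → case R-nbr′ h (E-sym e) of λ { (inj₁ f) → inj₂ f ; (inj₂ R) → inj₁ R } }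
          ; a = a ; b = p ; c = q ; d = r
          ; Va = inj₂ (inj₁ refl) ; Vb = inj₂ (inj₂ (inj₁ refl)) ; Vc = inj₂ (inj₂ (inj₂ (inj₁ refl))) ; Vd = inj₂ (inj₂ (inj₂ (inj₂ refl)))
          ; a≢b = a≢p ; a≢c = a≢q ; a≢d = a≢r ; b≢c = p≢q ; b≢d = p≢r ; c≢d = q≢r }

        module ᶜ = Society Sᶜ

        -- All four boundary vertices are terminals here, so it suffices to follow an escape in `S`
        -- until it leaves `R`.
        fullᶜ : ᶜ.Full
        fullᶜ u v w x (inj₂ f , o) = x , f , ⟦ inj₂ f , o ⟧
        fullᶜ u v w x (inj₁ Rx , o) with full u v w x (R-V Rx , o)
        ... | t , T , W with walk-exit R R? W Rx (λ Rt → R-T Rt T)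
        ... | y , z , W′ , e , (_ , oz) , ¬Rz with R-nbr′ (proj₂ (walk-end W′)) e
        ... | inj₂ Rz = ⊥-elim (¬Rz Rz)
        ... | inj₁ fz = z , fz , walk-mono (λ ((_ , o) , h) → inj₁ h , o) (walk-map (λ h _ e → e , inj₁ (proj₂ h)) W′)
            ⊕ edge (inj₁ Ry , proj₂ (proj₁ (walk-end W′))) (inj₂ fz , oz) (e , inj₁ Ry)
          where Ry = proj₂ (walk-end W′)

        unlinkedᶜ : ᶜ.Unlinked
        unlinkedᶜ X Y dj wX wY = unlinked
          (λ y → X y × (y ≡ a ⊎ y ≡ q ⊎ R y)) (λ y → Y y × (y ≡ p ⊎ y ≡ r ⊎ R y))
          (λ (h , _) (k , _) → dj h k) proj₂ proj₂
          (go (λ { (xv , inj₁ R) → inj₂ (inj₂ R) ; (xv , inj₂ (inj₁ e)) → inj₁ e ; (xv , inj₂ (inj₂ (inj₁ refl))) → ⊥-elim (dj xv (walk-start wY))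
                 ; (xv , inj₂ (inj₂ (inj₂ (inj₁ e)))) → inj₂ (inj₁ e) ; (xv , inj₂ (inj₂ (inj₂ (inj₂ refl)))) → ⊥-elim (dj xv (walk-end wY)) })
              wX ᶜ.Va)
          (go (λ { (yv , inj₁ R) → inj₂ (inj₂ R) ; (yv , inj₂ (inj₁ refl)) → ⊥-elim (dj (walk-start wX) yv) ; (yv , inj₂ (inj₂ (inj₁ e))) → inj₁ e
                 ; (yv , inj₂ (inj₂ (inj₂ (inj₁ refl)))) → ⊥-elim (dj (walk-end wX) yv) ; (yv , inj₂ (inj₂ (inj₂ (inj₂ e)))) → inj₂ (inj₁ e) })
              wY ᶜ.Vb)
          where
          go : ∀ {Z Q : Fin n → Set} {u v} → (∀ {y} → Z y × ᶜ.V y → Q y) → Walk ᶜ.E Z u v → ᶜ.V u → Walk E (λ y → Z y × Q y) u v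
          go {Z} f w vu = walk-map (λ _ _ → proj₁) (walk-mono (λ (z , v) → z , f (z , v))
            (walk-closed (λ y → Z y × ᶜ.V y) (λ _ e z → z , ᶜ.E⇒V (ᶜ.E-sym e)) w (walk-start w , vu)))

        abstract
          smaller : count ᶜ.V? < count V?
          smaller = count-< ᶜ.V? V? (λ { (inj₁ R) → R-V R ; (inj₂ f) → four-V f }) {s} Vs
            (λ { (inj₁ R) → proj₁ s∉ R ; (inj₂ (inj₁ e)) → proj₁ (proj₂ s∉) e ; (inj₂ (inj₂ (inj₁ e))) → proj₁ (proj₂ (proj₂ s∉)) e
               ; (inj₂ (inj₂ (inj₂ (inj₁ e)))) → proj₁ (proj₂ (proj₂ (proj₂ s∉))) e ; (inj₂ (inj₂ (inj₂ (inj₂ e)))) → proj₂ (proj₂ (proj₂ (proj₂ s∉))) e })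

        abstract
          O : Sweepable Sᶜ
          O = solve Sᶜ smaller ((λ u v w _ _ _ → fullᶜ u v w) , (λ s → fullᶜ _ s s)) unlinkedᶜ

        open Sweepable O

        gapless : ∀ {x} → ¬ Gap x
        gapless = full-gapless Sᶜ fullᶜ O

        -- In the flat case `x₀` would belong to the core, and its walk to `q` inside the core would
        -- end on the path.
        not-flat : ¬ (L ≡ p ∷ q ∷ r ∷ [])
        not-flat eq = proj₁ (proj₂ (proj₂ (walk-end (K-to-c (inj₁ Rx₀ , proj₁ (R-off Rx₀) , x₀∉ ∘ subst (x₀ ∈_) eq , gapless)))))
          (subst (q ∈_) (sym eq) (there (here refl)))
          where
          x₀∉ : x₀ ∉ p ∷ q ∷ r ∷ []
          x₀∉ (here e) = proj₁ (proj₂ (R-off Rx₀)) e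
          x₀∉ (there (here e)) = proj₁ (proj₂ (proj₂ (R-off Rx₀))) e
          x₀∉ (there (there (here e))) = proj₂ (proj₂ (proj₂ (R-off Rx₀))) e

        q∉L : q ∉ L
        q∉L with sweep₂
        ... | inj₁ (ni , _) = ni
        ... | inj₂ e = ⊥-elim (not-flat e)

        abstract
          shape : ∃ λ m → L ≡ p ∷ m ++ r ∷ []
          shape = first-last p≢r L-first L-last

        m : List (Fin n)
        m = proj₁ shape

        Leq : L ≡ p ∷ m ++ r ∷ []
        Leq = proj₂ shape

        Lu : Unique (p ∷ m ++ r ∷ [])
        Lu = subst Unique Leq L-unique

        m-R : ∀ {y} → y ∈ m → R y
        m-R {y} i with L-sub (subst (y ∈_) (sym Leq) (there (∈-++⁺ˡ i)))
        ... | inj₁ R , _ = R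
        ... | inj₂ (inj₁ e) , ne = ⊥-elim (ne e)
        ... | inj₂ (inj₂ (inj₁ refl)) , _ = ⊥-elim (All≢⇒∉ (case Lu of λ { (h ∷ _) → h }) (∈-++⁺ˡ i))
        ... | inj₂ (inj₂ (inj₂ (inj₁ refl))) , _ = ⊥-elim (q∉L (subst (q ∈_) (sym Leq) (there (∈-++⁺ˡ i))))
        ... | inj₂ (inj₂ (inj₂ (inj₂ refl))) , _ = ⊥-elim (proj₂ (proj₂ (unique-++⁻ m (case Lu of λ { (_ ∷ h) → h }))) i (here refl))

        R-m : ∀ {y} → R y → y ∈ L → y ∈ m
        R-m {y} R i with subst (y ∈_) Leq i
        ... | here e = ⊥-elim (proj₁ (proj₂ (R-off R)) e)
        ... | there j with ∈-++⁻ m j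
        ... | inj₁ k = k
        ... | inj₂ (here e) = ⊥-elim (proj₂ (proj₂ (proj₂ (R-off R))) e)

        K⇒ : ∀ {y} → K y → (R y × y ∉ m) ⊎ y ≡ q
        K⇒ (inj₁ R , _ , ni , _) = inj₁ (R , λ i → ni (subst (_ ∈_) (sym Leq) (there (∈-++⁺ˡ i))))
        K⇒ (inj₂ (inj₁ e) , ne , _) = ⊥-elim (ne e)
        K⇒ (inj₂ (inj₂ (inj₁ refl)) , _ , ni , _) = ⊥-elim (ni (first-∈ L-first))
        K⇒ (inj₂ (inj₂ (inj₂ (inj₁ e))) , _) = inj₂ e
        K⇒ (inj₂ (inj₂ (inj₂ (inj₂ refl))) , _ , ni , _) = ⊥-elim (ni (last-∈ L-last))

        R-K : ∀ {y} → R y → y ∉ m → K y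
        R-K R ni = inj₁ R , proj₁ (R-off R) , (λ i → ni (R-m R i)) , gapless

        core : ∀ {y} → ᶜ.V y → y ≢ a → Core y
        core {y} v ne with y ∈? L
        ... | yes i = inj₁ i
        ... | no ni = inj₂ (v , ne , ni , gapless)

        pr-R : ∀ {y} → y ∈ (p ∷ m ++ r ∷ []) → y ≡ p ⊎ y ≡ r ⊎ R y
        pr-R (here e) = inj₁ e
        pr-R (there i) with ∈-++⁻ m i
        ... | inj₁ j = inj₂ (inj₂ (m-R j))
        ... | inj₂ (here e) = inj₂ (inj₁ e)

        ins-R : ∀ {y} → Core y → y ≢ p → y ≢ q → R y ⊎ y ≡ r
        ins-R {y} (inj₁ i) np nq with pr-R (subst (y ∈_) Leq i)
        ... | inj₁ e = ⊥-elim (np e)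
        ... | inj₂ (inj₁ e) = inj₂ e
        ... | inj₂ (inj₂ R) = inj₁ R
        ins-R (inj₂ k) np nq with K⇒ k
        ... | inj₁ (R , _) = inj₁ R
        ... | inj₂ e = ⊥-elim (nq e)

        toE : ∀ {Q : Fin n → Set} {u v} → Walk ᶜ.E Q u v → Walk E Q u v
        toE = walk-map (λ _ _ → proj₁)

        -- Edges at a are drawn only later, so the fillings cover the remaining edges at R.
        edge-core : ∀ {x y} → E x y × R x × y ≢ a → CoreEdge x y
        edge-core (e , Rx , ya) = (e , inj₁ Rx) , core (inj₁ Rx) (proj₁ (R-off Rx)) ,
          core (case R-nbr′ Rx e of λ { (inj₁ f) → inj₂ f ; (inj₂ h) → inj₁ h }) ya

        e-ind : ∀ {x y} → x ∈ (p ∷ m ++ r ∷ []) → y ∈ (p ∷ m ++ r ∷ []) → E x y → R x ⊎ R y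
        e-ind i j e with pr-R i | pr-R j
        ... | inj₂ (inj₂ R) | _ = inj₁ R
        ... | _ | inj₂ (inj₂ R) = inj₂ R
        ... | inj₁ refl | inj₁ refl = ⊥-elim (E-irr e)
        ... | inj₁ refl | inj₂ (inj₁ refl) = ⊥-elim (¬pr e)
        ... | inj₂ (inj₁ refl) | inj₁ refl = ⊥-elim (¬pr (E-sym e))
        ... | inj₂ (inj₁ refl) | inj₂ (inj₁ refl) = ⊥-elim (E-irr e)

        joinedE : ∀ {x y} → Consec x y (p ∷ m ++ r ∷ []) → E x y
        joinedE {x} {y} cxy = go (joined q∉L cxy′)
          where
          cxy′ : Consec x y L
          cxy′ = subst (Consec x y) (sym Leq) cxy
          x≢y : x ≢ y
          x≢y refl = consec-asym L-unique cxy′ cxy′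
          go : Walk ᶜ.E (λ w → w ≡ x ⊎ w ≡ y ⊎ (Gap w × left w ≡ x)) x y → E x y
          go w with walk-last x≢y w
          ... | z , (e , _) , inj₁ refl = e
          ... | z , (e , _) , inj₂ (inj₁ refl) = ⊥-elim (E-irr e)
          ... | z , (e , _) , inj₂ (inj₂ (g , _)) = ⊥-elim (gapless g)

      filled : Filled
      filled = record
        { Pm = m ; P-unique = Lu ; Pm-R = m-R ; P-joined = joinedE
        ; P-a = λ Ry e → case a-nbr (e , inj₂ Ry) of λ { (inj₁ i) → R-m Ry i ; (inj₂ g) → ⊥-elim (gapless g) }
        ; P-induced = λ {x} {y} i j e → subst (Beside x y) Leq
            (induced (subst (x ∈_) (sym Leq) i) (subst (y ∈_) (sym Leq) j) (e , e-ind i j e))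
        ; R-to-q = λ Ry ni → walk-mono K⇒ (toE (K-to-c (R-K Ry ni)))
        ; P-to-q = λ {y} i → walk-mono (λ { (inj₁ e) → inj₁ e ; (inj₂ k) → inj₂ (K⇒ k) })
            (toE (L-to-c (subst (y ∈_) (sym Leq) (there (∈-++⁺ˡ i)))
              (proj₁ (proj₂ (R-off (m-R i)))) (proj₂ (proj₂ (proj₂ (R-off (m-R i)))))))
        ; fill₁ = swp-cast refl Leq (swp-weaken
            (λ (k , np , nq , nr) → case ins-R k np nq of λ { (inj₁ R) → R ; (inj₂ e) → ⊥-elim (nr e) })
            sweep₁ (λ S f → f ∘ edge-core))
        ; fill₂ = case sweep₂ of λ
            { (inj₁ (_ , W)) → swp-cast refl (trans (cong (_++ q ∷ []) Leq) (cong (p ∷_) (Listₚ.++-assoc m (r ∷ []) (q ∷ []))))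
                (swp-weaken (λ (k , np , nq) → ins-R k np nq) W (λ S f → f ∘ edge-core))
            ; (inj₂ e) → ⊥-elim (not-flat e) } }

module _ {A : Set} where

  snoc-view : ∀ (m : A) ms → ∃ λ ini → ∃ λ k → m ∷ ms ≡ ini ++ k ∷ []
  snoc-view m [] = [] , m , refl
  snoc-view m (m′ ∷ ms) with snoc-view m′ ms
  ... | ini , k , eq = m ∷ ini , k , cong (m ∷_) eq

  first-place : ∀ p {x s} {b : A} → First b (p ++ x ∷ s) → b ∈ p ⊎ b ≡ x
  first-place [] first = inj₂ refl
  first-place (_ ∷ p) first = inj₁ (here refl)

  three-split : ∀ pre {x m ms z post} {b c d : A} → pre ++ x ∷ m ∷ ms ++ z ∷ post ≡ b ∷ c ∷ d ∷ [] →
    pre ≡ [] × x ≡ b × m ≡ c × ms ≡ [] × z ≡ d × post ≡ []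
  three-split [] {ms = []} refl = refl , refl , refl , refl , refl , refl
  three-split [] {ms = _ ∷ []} ()
  three-split [] {ms = _ ∷ _ ∷ _} ()
  three-split (_ ∷ []) {ms = []} ()
  three-split (_ ∷ []) {ms = _ ∷ _} ()
  three-split (_ ∷ _ ∷ []) ()
  three-split (_ ∷ _ ∷ _ ∷ []) ()
  three-split (_ ∷ _ ∷ _ ∷ _ ∷ _) ()

module _ {n : ℕ} {E : Fin n → Fin n → Set} {P : Fin n → Set} where

  walk-along : ∀ pre x {s b} → First b (pre ++ x ∷ s) → (∀ {u w} → Consec u w (pre ++ x ∷ []) → Walk E P u w) →
    P x → Walk E P b x
  walk-along [] x first f px = ⟦ px ⟧
  walk-along (u ∷ []) x first f px = f here
  walk-along (u ∷ w ∷ pre) x first f px = f here ⊕ walk-along (w ∷ pre) x {s = []} first (f ∘ there) px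

  alongʳ : ∀ z post {d} → Last d (z ∷ post) → (∀ {u w} → Consec u w (z ∷ post) → Walk E P u w) →
    P z → Walk E P z d
  alongʳ z [] last f pz = ⟦ pz ⟧
  alongʳ z (w ∷ post) (there l) f pz = f here ⊕ alongʳ w post l (f ∘ there) (walk-end (f here))

-- Contracting a neighbour of `a` into `a`

module _ {n : ℕ} (S : Society n) where
  open Society S

  module Contract (full : Full) (unlinked : Unlinked)
    (v : Fin n) (av : E a v) (v¬T : ¬ Terminal v) where

    Vv : V v
    Vv = E⇒V (E-sym av)

    v≢a : v ≢ a
    v≢a e = v¬T (inj₁ e)

    T≢v : ∀ {t} → Terminal t → t ≢ v
    T≢v T refl = v¬T T

    S^ : Society n
    S^ = record
      { V = λ x → V x × x ≢ v ; V? = λ x → V? x ×-dec ¬? (x ≟ v)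
      ; E = λ x y → x ≢ v × y ≢ v × x ≢ y × (E x y ⊎ (x ≡ a × E v y) ⊎ (y ≡ a × E v x))
      ; E? = λ x y → ¬? (x ≟ v) ×-dec ¬? (y ≟ v) ×-dec ¬? (x ≟ y) ×-dec
          (E? x y ⊎-dec ((x ≟ a) ×-dec E? v y) ⊎-dec ((y ≟ a) ×-dec E? v x))
      ; E-sym = λ { (p , q , ne , inj₁ e) → q , p , ne ∘ sym , inj₁ (E-sym e)
                  ; (p , q , ne , inj₂ (inj₁ e)) → q , p , ne ∘ sym , inj₂ (inj₂ e)
                  ; (p , q , ne , inj₂ (inj₂ e)) → q , p , ne ∘ sym , inj₂ (inj₁ e) }
      ; E-irr = λ (_ , _ , ne , _) → ne refl
      ; E⇒V = λ { (p , _ , _ , inj₁ e) → E⇒V e , p ; (p , _ , _ , inj₂ (inj₁ (refl , _))) → Va , p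
                ; (p , _ , _ , inj₂ (inj₂ (_ , e))) → E⇒V (E-sym e) , p }
      ; a = a ; b = b ; c = c ; d = d
      ; Va = Va , T≢v (inj₁ refl) ; Vb = Vb , T≢v (inj₂ (inj₁ refl))
      ; Vc = Vc , T≢v (inj₂ (inj₂ (inj₁ refl))) ; Vd = Vd , T≢v (inj₂ (inj₂ (inj₂ refl)))
      ; a≢b = a≢b ; a≢c = a≢c ; a≢d = a≢d ; b≢c = b≢c ; b≢d = b≢d ; c≢d = c≢d }

    module ^ = Society S^

    E≢ : ∀ {x y} → E x y → x ≢ y
    E≢ e refl = E-irr e

    up : ∀ {x y} → E x y → x ≢ v → y ≢ v → ^.E x y
    up e p q = p , q , E≢ e , inj₁ e

    down : ∀ {x y} → ^.E x y → x ≢ a → y ≢ a → E x y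
    down (_ , _ , _ , inj₁ e) _ _ = e
    down (_ , _ , _ , inj₂ (inj₁ (p , _))) ne _ = ⊥-elim (ne p)
    down (_ , _ , _ , inj₂ (inj₂ (p , _))) _ ne = ⊥-elim (ne p)

    -- If the triple avoids `a`, a walk may stop on reaching `v`, because `v` has become the
    -- terminal `a`. For a pair `a`, `s` the walk has to avoid `v` too, which uses up the triple
    -- `a`, `v`, `s`.
    semi^ : ^.Semi
    semi^ = (λ p q r p≢ q≢ r≢ x ((Vx , x≢v) , o) → let (t , T , w) = full p q r x (Vx , o) in
              project (p≢ ∘ sym , q≢ ∘ sym , r≢ ∘ sym) T w x≢v)
          , (λ s x ((Vx , x≢v) , x≢a , x≢s , _) → let (t , T , w) = full a v s x (Vx , x≢a , x≢v , x≢s) in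
              t , T , walk-mono (λ (Vy , ya , yv , ys) → (Vy , yv) , ya , ys , ys)
                        (walk-map (λ (_ , _ , p , _) (_ , _ , q , _) e → up e p q) w))
      where
      project : ∀ {p q r x t} → a ≢ p × a ≢ q × a ≢ r → Terminal t → Walk E (Off p q r) x t → x ≢ v → ^.Escapes p q r x
      project _ T ⟦ Vx , o ⟧ xv = _ , T , ⟦ (Vx , xv) , o ⟧
      project {x = x} na T (_▷⟨_⟩_ {y = y} (Vx , o) e w) xv with y ≟ v
      ... | no yv = let (t , T′ , w′) = project na T w yv in t , T′ , (((Vx , xv) , o) ▷⟨ up e xv yv ⟩ w′)
      ... | yes refl with x ≟ a
      ... | yes refl = a , inj₁ refl , ⟦ (Vx , xv) , o ⟧
      ... | no xa = a , inj₁ refl , edge ((Vx , xv) , o) (^.Va , na)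
                      (xv , T≢v (inj₁ refl) , xa , inj₂ (inj₂ (refl , E-sym e)))

    -- The side of `a` takes `v` back; the other side cannot use the new edges, since all of them
    -- end in `a`.
    unlinked^ : ^.Unlinked
    unlinked^ X Y dj wX wY = unlinked (λ y → (X y × y ≢ v) ⊎ y ≡ v) (λ y → Y y × y ≢ v)
        (λ { (inj₁ (p , _)) (q , _) → dj p q ; (inj₂ p) (_ , q) → q p })
        (walk-bind inj₁ (λ { p q (_ , _ , _ , inj₁ e) → edge (inj₁ p) (inj₁ q) e
                           ; p q (_ , _ , _ , inj₂ (inj₁ (refl , e))) → inj₁ p ▷⟨ av ⟩ edge (inj₂ refl) (inj₁ q) e
                           ; p q (_ , _ , _ , inj₂ (inj₂ (refl , e))) → inj₁ p ▷⟨ E-sym e ⟩ edge (inj₂ refl) (inj₁ q) (E-sym av) })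
          (off-v wX (T≢v (inj₁ refl))))
        (walk-map (λ { _ _ (_ , _ , _ , inj₁ e) → e
                     ; (p , _) _ (_ , _ , _ , inj₂ (inj₁ (refl , e))) → ⊥-elim (dj (walk-start wX) p)
                     ; _ (p , _) (_ , _ , _ , inj₂ (inj₂ (refl , e))) → ⊥-elim (dj (walk-start wX) p) })
          (off-v wY (T≢v (inj₂ (inj₁ refl)))))
      where
      off-v : ∀ {Z : Fin n → Set} {u w} → Walk ^.E Z u w → u ≢ v → Walk ^.E (λ y → Z y × y ≢ v) u w
      off-v {Z} w uv = walk-closed (λ y → Z y × y ≢ v) (λ _ (_ , q , _) z → z , q) w (walk-start w , uv)

    smaller^ : count ^.V? < count V?
    smaller^ = count-< ^.V? V? proj₁ {v} Vv (λ (_ , ne) → ne refl)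

    module Range-of (O : Sweepable S^) where
      open Sweepable O

      toE : ∀ {Q u w} → (∀ {y} → Q y → y ≢ a) → Walk ^.E Q u w → Walk E Q u w
      toE f = walk-map (λ p q e → down e (f p) (f q))

      L-a : ∀ {y} → y ∈ L → y ≢ a
      L-a i = proj₂ (L-sub i)

      L-v : ∀ {y} → y ∈ L → y ≢ v
      L-v i = proj₂ (proj₁ (L-sub i))

      gap-v : ∀ {r} → Gap r → r ≢ v
      gap-v g = proj₂ (proj₁ (gap-V g))

      gap-a : ∀ {r} → Gap r → r ≢ a
      gap-a g = proj₁ (proj₂ (gap-V g))

      gap-L : ∀ {r} → Gap r → r ∉ L
      gap-L g = proj₂ (proj₂ (gap-V g))

      v-nbr : ∀ {y} → E v y → y ≢ a → y ∈ L ⊎ Gap y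
      v-nbr e ya = a-nbr (v≢a ∘ sym , E≢ e ∘ sym , ya ∘ sym , inj₂ (inj₁ (refl , e)))

      a-nbr′ : ∀ {y} → E a y → y ≢ v → y ∈ L ⊎ Gap y
      a-nbr′ e yv = a-nbr (up e (v≢a ∘ sym) yv)

      Beyond : Fin n → Fin n → Set
      Beyond r y = Gap y × left y ≡ left r × right y ≡ right r

      gap-nbr′ : ∀ {r y} → Gap r → E r y → y ≡ v ⊎ y ≡ a ⊎ y ≡ left r ⊎ y ≡ right r ⊎ Beyond r y
      gap-nbr′ {r} {y} g e with y ≟ v
      ... | yes p = inj₁ p
      ... | no yv = inj₂ (gap-nbr g (up e (gap-v g) yv))

      -- A gap region touches all four of its corners: avoid the other three.
      gap-to : ∀ {r t} → Gap r → t ≡ v ⊎ t ≡ a ⊎ t ≡ left r ⊎ t ≡ right r → Walk E (λ y → Beyond r y ⊎ y ≡ t) r t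
      gap-to {r} {t} g = go
        where
        l≢ : r ≢ left r
        l≢ e = gap-L g (subst (_∈ L) (sym e) (consec-∈ˡ (gap-ends g)))
        r≢ : r ≢ right r
        r≢ e = gap-L g (subst (_∈ L) (sym e) (consec-∈ʳ (gap-ends g)))
        corner : ∀ {x y} → Beyond r x → E x y → ¬ Beyond r y → y ≡ v ⊎ y ≡ a ⊎ y ≡ left r ⊎ y ≡ right r
        corner (gx , lx , rx) e ¬B = case gap-nbr′ gx e of λ
          { (inj₁ p) → inj₁ p ; (inj₂ (inj₁ p)) → inj₂ (inj₁ p)
          ; (inj₂ (inj₂ (inj₁ p))) → inj₂ (inj₂ (inj₁ (trans p lx)))
          ; (inj₂ (inj₂ (inj₂ (inj₁ p)))) → inj₂ (inj₂ (inj₂ (trans p rx)))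
          ; (inj₂ (inj₂ (inj₂ (inj₂ (gy , ly , ry))))) → ⊥-elim (¬B (gy , trans ly lx , trans ry rx)) }
        finish : ∀ {p q s} → Escapes p q s r → (∀ {y} → y ≡ v ⊎ y ≡ a ⊎ y ≡ left r ⊎ y ≡ right r → Off p q s y → y ≡ t) →
          Walk E (λ y → Beyond r y ⊎ y ≡ t) r t
        finish {p} {q} {s} (u , T , w) f = conclude (walk-exit (Beyond r)
            (λ y → Gap? y ×-dec (left y ≟ left r) ×-dec (right y ≟ right r)) w (g , refl , refl) (λ (gu , _) → gap-T gu T))
          where
          conclude : (∃ λ x → ∃ λ y → Walk E (λ y → Off p q s y × Beyond r y) r x × E x y × Off p q s y × ¬ Beyond r y) →
            Walk E (λ y → Beyond r y ⊎ y ≡ t) r t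
          conclude (x , y , w′ , e , o , ¬B) = subst (Walk E _ r) eq
              (walk-mono (inj₁ ∘ proj₂) w′ ⊕ edge (inj₁ (proj₂ (walk-end w′))) (inj₂ eq) e)
            where eq = f (corner (proj₂ (walk-end w′)) e ¬B) o
        Vr = proj₁ (proj₁ (gap-V g))
        go : t ≡ v ⊎ t ≡ a ⊎ t ≡ left r ⊎ t ≡ right r → Walk E (λ y → Beyond r y ⊎ y ≡ t) r t
        go (inj₁ refl) = finish (full a (left r) (right r) r (Vr , gap-a g , l≢ , r≢)) λ
          { (inj₁ p) _ → p ; (inj₂ (inj₁ p)) (_ , q , _) → ⊥-elim (q p)
          ; (inj₂ (inj₂ (inj₁ p))) (_ , _ , q , _) → ⊥-elim (q p) ; (inj₂ (inj₂ (inj₂ p))) (_ , _ , _ , q) → ⊥-elim (q p) }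
        go (inj₂ (inj₁ refl)) = finish (full v (left r) (right r) r (Vr , gap-v g , l≢ , r≢)) λ
          { (inj₂ (inj₁ p)) _ → p ; (inj₁ p) (_ , q , _) → ⊥-elim (q p)
          ; (inj₂ (inj₂ (inj₁ p))) (_ , _ , q , _) → ⊥-elim (q p) ; (inj₂ (inj₂ (inj₂ p))) (_ , _ , _ , q) → ⊥-elim (q p) }
        go (inj₂ (inj₂ (inj₁ refl))) = finish (full v a (right r) r (Vr , gap-v g , gap-a g , r≢)) λ
          { (inj₂ (inj₂ (inj₁ p))) _ → p ; (inj₁ p) (_ , q , _) → ⊥-elim (q p)
          ; (inj₂ (inj₁ p)) (_ , _ , q , _) → ⊥-elim (q p) ; (inj₂ (inj₂ (inj₂ p))) (_ , _ , _ , q) → ⊥-elim (q p) }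
        go (inj₂ (inj₂ (inj₂ refl))) = finish (full v a (left r) r (Vr , gap-v g , gap-a g , l≢)) λ
          { (inj₂ (inj₂ (inj₂ p))) _ → p ; (inj₁ p) (_ , q , _) → ⊥-elim (q p)
          ; (inj₂ (inj₁ p)) (_ , _ , q , _) → ⊥-elim (q p) ; (inj₂ (inj₂ (inj₁ p))) (_ , _ , _ , q) → ⊥-elim (q p) }

      -- Contacts of `v` with the path, where a hanging region counts as contact at its left end for
      -- the start of the range and at its right end for the end of it.
      Touch₁ Touch₂ : Fin n → Set
      Touch₁ l = E v l ⊎ ∃ λ r → Gap r × left r ≡ l
      Touch₂ l = E v l ⊎ ∃ λ r → Gap r × right r ≡ l

      touch₁? : ∀ l → Dec (Touch₁ l)
      touch₁? l = E? v l ⊎-dec any? λ r → Gap? r ×-dec (left r ≟ l)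

      touch₂? : ∀ l → Dec (Touch₂ l)
      touch₂? l = E? v l ⊎-dec any? λ r → Gap? r ×-dec (right r ≟ l)

      -- Otherwise `v` and all hanging regions would be cut off from the terminals by `a`, `x`, `z`.
      -- This provides the range with an interior vertex.
      too-short : ∀ x z → x ∈ L → z ∈ L → (∀ {y} → E v y → y ∈ L → y ≡ x ⊎ y ≡ z) →
        (∀ {r} → Gap r → left r ≡ x × right r ≡ z) → ⊥
      too-short x z xL zL f g with full a x z v (Vv , v≢a , L-v xL ∘ sym , L-v zL ∘ sym)
      ... | t , T , w with walk-end (walk-closed (λ y → y ≡ v ⊎ Gap y) cl w (inj₁ refl))
        where
        cl : ∀ {u w} → u ≡ v ⊎ Gap u → E u w → Off a x z w → w ≡ v ⊎ Gap w
        cl (inj₁ refl) e (_ , wa , wx , wz) with v-nbr e wa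
        ... | inj₂ gw = inj₂ gw
        ... | inj₁ i with f e i
        ... | inj₁ p = ⊥-elim (wx p)
        ... | inj₂ p = ⊥-elim (wz p)
        cl (inj₂ gu) e (_ , wa , wx , wz) with gap-nbr′ gu e
        ... | inj₁ p = inj₁ p
        ... | inj₂ (inj₁ p) = ⊥-elim (wa p)
        ... | inj₂ (inj₂ (inj₁ p)) = ⊥-elim (wx (trans p (proj₁ (g gu))))
        ... | inj₂ (inj₂ (inj₂ (inj₁ p))) = ⊥-elim (wz (trans p (proj₂ (g gu))))
        ... | inj₂ (inj₂ (inj₂ (inj₂ (gw , _)))) = inj₂ gw
      ... | inj₁ p = v¬T (subst Terminal p T)
      ... | inj₂ p = gap-T p T

      record Range : Set where
        field
          pre ms post : List (Fin n)
          x m₁ z : Fin n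
          L-eq : L ≡ pre ++ x ∷ m₁ ∷ ms ++ z ∷ post
          x-touch : Touch₁ x
          z-touch : Touch₂ z
          pre-touch : ∀ {y} → y ∈ pre → ¬ Touch₁ y
          post-touch : ∀ {y} → y ∈ post → ¬ Touch₂ y

      touched : ∃ λ y → y ∈ L × Touch₁ y
      touched with full a a a v (Vv , v≢a , v≢a , v≢a)
      ... | t , T , w with walk-step (T≢v T ∘ sym) w
      ... | y , e , (_ , ya , _) with v-nbr e ya
      ... | inj₁ i = y , i , inj₁ e
      ... | inj₂ g = left y , consec-∈ˡ (gap-ends g) , inj₂ (y , g , refl)

      range : Range
      range with split-first touch₁? L touched
      ... | pre , x , rest , eq , tx , npre with split-last touch₂? (x ∷ rest) (second tx)
        where
        second : Touch₁ x → ∃ λ y → y ∈ x ∷ rest × Touch₂ y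
        second (inj₁ e) = x , here refl , inj₁ e
        second (inj₂ (r , g , refl)) with consec-split pre (subst (Consec x (right r)) eq (gap-ends g))
        ... | inj₂ c = right r , there (consec-first-∈ c) , inj₂ (r , g , refl)
        ... | inj₁ c = ⊥-elim (npre (consec-last-∈ pre c) tx)
      ... | [] , z , post , refl , tz , npost = ⊥-elim (too-short x x xL xL near (λ g → ⊥-elim (none g)))
        where
        xL : x ∈ L
        xL = subst (x ∈_) (sym eq) (∈-++⁺ʳ pre (here refl))
        near : ∀ {y} → E v y → y ∈ L → y ≡ x ⊎ y ≡ x
        near {y} e i with ∈-++⁻ pre (subst (y ∈_) eq i)
        ... | inj₁ j = ⊥-elim (npre j (inj₁ e))
        ... | inj₂ (here p) = inj₁ p
        ... | inj₂ (there j) = ⊥-elim (npost j (inj₁ e))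
        none : ∀ {r} → ¬ Gap r
        none {r} g with consec-split pre (subst (Consec (left r) (right r)) eq (gap-ends g))
        ... | inj₁ c = npre (consec-last-∈ pre c) (inj₂ (r , g , refl))
        ... | inj₂ c = npost (consec-first-∈ c) (inj₂ (r , g , refl))
      ... | _ ∷ [] , z , post , refl , tz , npost = ⊥-elim (too-short x z xL zL near only)
        where
        xL : x ∈ L
        xL = subst (x ∈_) (sym eq) (∈-++⁺ʳ pre (here refl))
        zL : z ∈ L
        zL = subst (z ∈_) (sym eq) (∈-++⁺ʳ pre (there (here refl)))
        near : ∀ {y} → E v y → y ∈ L → y ≡ x ⊎ y ≡ z
        near {y} e i with ∈-++⁻ pre (subst (y ∈_) eq i)
        ... | inj₁ j = ⊥-elim (npre j (inj₁ e))
        ... | inj₂ (here p) = inj₁ p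
        ... | inj₂ (there (here p)) = inj₂ p
        ... | inj₂ (there (there j)) = ⊥-elim (npost j (inj₁ e))
        only′ : ∀ {r u w} → Gap r → u ≡ left r → w ≡ right r → Consec u w (x ∷ z ∷ post) → u ≡ x × w ≡ z
        only′ g _ _ here = refl , refl
        only′ {r} g _ refl (there c) = ⊥-elim (npost (consec-first-∈ c) (inj₂ (r , g , refl)))
        only : ∀ {r} → Gap r → left r ≡ x × right r ≡ z
        only {r} g with consec-split pre (subst (Consec (left r) (right r)) eq (gap-ends g))
        ... | inj₁ c = ⊥-elim (npre (consec-last-∈ pre c) (inj₂ (r , g , refl)))
        ... | inj₂ c = only′ g refl refl c
      ... | _ ∷ m ∷ ms , z , post , refl , tz , npost = record
        { pre = pre ; ms = ms ; post = post ; x = x ; m₁ = m ; z = z ; L-eq = eq ; x-touch = tx ; z-touch = tz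
        ; pre-touch = npre ; post-touch = npost }

-- The range of the contracted vertex on the path

module _ {n : ℕ} (S : Society n) where
  open Society S

  module Assemble (full : Full) (unlinked : Unlinked)
    (v : Fin n) (av : E a v) (v¬T : ¬ Terminal v)
    (O : Sweepable (Contract.S^ S full unlinked v av v¬T))
    (range : Contract.Range-of.Range S full unlinked v av v¬T O) where

    open Contract S full unlinked v av v¬T
    open Range-of O hiding (range)
    open Sweepable O
    open Range range

    mid : List (Fin n)
    mid = m₁ ∷ ms

    ini : List (Fin n)
    ini = proj₁ (snoc-view m₁ ms)

    mk : Fin n
    mk = proj₁ (proj₂ (snoc-view m₁ ms))

    mid-eq : mid ≡ ini ++ mk ∷ []
    mid-eq = proj₂ (proj₂ (snoc-view m₁ ms))

    mk-mid : mk ∈ mid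
    mk-mid = subst (mk ∈_) (sym mid-eq) (∈-++⁺ʳ ini (here refl))

    data Place (y : Fin n) : Set where
      in-pre : y ∈ pre → Place y
      at-x : y ≡ x → Place y
      in-mid : y ∈ mid → Place y
      at-z : y ≡ z → Place y
      in-post : y ∈ post → Place y

    place : ∀ {y} → y ∈ L → Place y
    place {y} i with ∈-++⁻ pre (subst (y ∈_) L-eq i)
    ... | inj₁ j = in-pre j
    ... | inj₂ (here e) = at-x e
    ... | inj₂ (there j) with ∈-++⁻ mid j
    ... | inj₁ k = in-mid k
    ... | inj₂ (here e) = at-z e
    ... | inj₂ (there k) = in-post k

    unplace : ∀ {y} → Place y → y ∈ L
    unplace {y} p = subst (y ∈_) (sym L-eq) (go p)
      where
      go : Place y → y ∈ pre ++ x ∷ mid ++ z ∷ post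
      go (in-pre i) = ∈-++⁺ˡ i
      go (at-x e) = ∈-++⁺ʳ pre (here e)
      go (in-mid i) = ∈-++⁺ʳ pre (there (∈-++⁺ˡ i))
      go (at-z e) = ∈-++⁺ʳ pre (there (∈-++⁺ʳ mid (here e)))
      go (in-post i) = ∈-++⁺ʳ pre (there (∈-++⁺ʳ mid (there i)))

    L-unique′ : Unique (pre ++ x ∷ mid ++ z ∷ post)
    L-unique′ = subst Unique L-eq L-unique

    pre-unique : Unique pre
    pre-unique = proj₁ (unique-++⁻ pre L-unique′)

    rest-unique : Unique (x ∷ mid ++ z ∷ post)
    rest-unique = proj₁ (proj₂ (unique-++⁻ pre L-unique′))

    pre-rest : ∀ {y} → y ∈ pre → y ∈ x ∷ mid ++ z ∷ post → ⊥
    pre-rest = proj₂ (proj₂ (unique-++⁻ pre L-unique′))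

    x-rest : ∀ {y} → y ∈ mid ++ z ∷ post → x ≢ y
    x-rest i refl = case rest-unique of λ { (h ∷ _) → All≢⇒∉ h i }

    tail-unique : Unique (mid ++ z ∷ post)
    tail-unique = case rest-unique of λ { (_ ∷ h) → h }

    zpost-unique : Unique (z ∷ post)
    zpost-unique = proj₁ (proj₂ (unique-++⁻ mid tail-unique))

    mid-zpost : ∀ {y} → y ∈ mid → y ∈ z ∷ post → ⊥
    mid-zpost = proj₂ (proj₂ (unique-++⁻ mid tail-unique))

    x-mid : x ∉ mid
    x-mid i = x-rest (∈-++⁺ˡ i) refl

    x≢z : x ≢ z
    x≢z = x-rest (∈-++⁺ʳ mid (here refl))

    z-mid : z ∉ mid
    z-mid i = mid-zpost i (here refl)

    pre-mid : ∀ {y} → y ∈ pre → y ∉ mid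
    pre-mid i j = pre-rest i (there (∈-++⁺ˡ j))

    post-mid : ∀ {y} → y ∈ post → y ∉ mid
    post-mid i j = mid-zpost j (there i)

    pre-x : x ∉ pre
    pre-x i = pre-rest i (here refl)

    pre-z : z ∉ pre
    pre-z i = pre-rest i (there (∈-++⁺ʳ mid (here refl)))

    pre-post : ∀ {y} → y ∈ pre → y ∉ post
    pre-post i j = pre-rest i (there (∈-++⁺ʳ mid (there j)))

    x-post : x ∉ post
    x-post i = x-rest (∈-++⁺ʳ mid (there i)) refl

    xL : x ∈ L
    xL = unplace (at-x refl)

    zL : z ∈ L
    zL = unplace (at-z refl)

    midL : ∀ {y} → y ∈ mid → y ∈ L
    midL i = unplace (in-mid i)

    nbr-range : ∀ {y} → E v y → y ∈ L → y ≡ x ⊎ y ∈ mid ⊎ y ≡ z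
    nbr-range e i with place i
    ... | in-pre j = ⊥-elim (pre-touch j (inj₁ e))
    ... | at-x p = inj₁ p
    ... | in-mid j = inj₂ (inj₁ j)
    ... | at-z p = inj₂ (inj₂ p)
    ... | in-post j = ⊥-elim (post-touch j (inj₁ e))

    consec-mid : ∀ {u w} → Consec u w (x ∷ mid ++ z ∷ []) →
      (u ≡ x × w ≡ m₁) ⊎ (u ∈ mid × w ∈ mid) ⊎ (u ≡ mk × w ≡ z)
    consec-mid here = inj₁ (refl , refl)
    consec-mid {u} {w} (there c) with consec-split ini
        (subst (Consec u w) (trans (cong (_++ z ∷ []) mid-eq) (Listₚ.++-assoc ini (mk ∷ []) (z ∷ []))) c)
    ... | inj₁ c′ = let c″ = subst (Consec u w) (sym mid-eq) c′ in inj₂ (inj₁ (consec-∈ˡ c″ , consec-∈ʳ c″))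
    ... | inj₂ here = inj₂ (inj₂ (refl , refl))
    ... | inj₂ (there (there ()))

    gap-range : ∀ {r} → Gap r → (left r ≡ x × right r ≡ m₁) ⊎ (left r ∈ mid × right r ∈ mid) ⊎ (left r ≡ mk × right r ≡ z)
    gap-range {r} g with consec-split pre (subst (Consec (left r) (right r)) L-eq (gap-ends g))
    ... | inj₁ c = ⊥-elim (pre-touch (consec-last-∈ pre c) (inj₂ (r , g , refl)))
    ... | inj₂ c with consec-split (x ∷ mid) c
    ... | inj₁ c′ = consec-mid c′
    ... | inj₂ c′ = ⊥-elim (post-touch (consec-first-∈ c′) (inj₂ (r , g , refl)))

    flat? : (pre ≡ [] × post ≡ []) ⊎ c ∉ L
    flat? with sweep₂
    ... | inj₁ (ni , _) = inj₂ ni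
    ... | inj₂ e with three-split pre (trans (sym L-eq) e)
    ... | p , _ , _ , _ , _ , q = inj₁ (p , q)

    -- Outside the range of v no gap region hangs, so consecutive vertices of L are adjacent there.
    join-pre : ∀ {u w} → Consec u w (pre ++ x ∷ []) → E u w
    join-pre {u} {w} cuw with flat?
    ... | inj₁ (p , _) = case subst (λ l → Consec u w (l ++ x ∷ [])) p cuw of λ { (there ()) }
    ... | inj₂ ni = go (joined ni cL)
      where
      cL : Consec u w L
      cL = subst (Consec u w) (sym L-eq) (consec-join₁ pre cuw)
      go : Walk ^.E (λ y → y ≡ u ⊎ y ≡ w ⊎ (Gap y × left y ≡ u)) u w → E u w
      go W with walk-last (λ { refl → consec-asym L-unique cL cL }) W
      ... | y , e , inj₁ refl = down e (L-a (consec-∈ˡ cL)) (L-a (consec-∈ʳ cL))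
      ... | y , (_ , _ , ne , _) , inj₂ (inj₁ p) = ⊥-elim (ne p)
      ... | y , e , inj₂ (inj₂ (g , p)) = ⊥-elim (pre-touch (consec-last-∈ pre cuw) (inj₂ (y , g , p)))

    join-post : ∀ {u w} → Consec u w (z ∷ post) → E u w
    join-post {u} {w} cuw with flat?
    ... | inj₁ (_ , p) = case subst (λ l → Consec u w (z ∷ l)) p cuw of λ { (there ()) }
    ... | inj₂ ni = go (joined ni cL)
      where
      cL : Consec u w L
      cL = subst (Consec u w) (sym L-eq) (consec-++ʳ pre (there (consec-++ʳ mid cuw)))
      go : Walk ^.E (λ y → y ≡ u ⊎ y ≡ w ⊎ (Gap y × left y ≡ u)) u w → E u w
      go W with walk-last (λ { refl → consec-asym L-unique cL cL }) W
      ... | y , e , inj₁ refl = down e (L-a (consec-∈ˡ cL)) (L-a (consec-∈ʳ cL))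
      ... | y , (_ , _ , ne , _) , inj₂ (inj₁ p) = ⊥-elim (ne p)
      ... | y , e , inj₂ (inj₂ (g , refl)) = ⊥-elim (post-touch (consec-first-∈ cuw)
              (inj₂ (y , g , consec-uniqueʳ L-unique (gap-ends g) cL)))

    mid-to-c : ∀ {s} → s ∈ mid → Walk E (λ w → w ≡ s ⊎ K w) s c
    mid-to-c {s} i = toE (λ { (inj₁ refl) → L-a (midL i) ; (inj₂ k) → proj₁ (proj₂ k) })
      (L-to-c (midL i) (λ { refl → b∉ i }) (λ { refl → d∉ i }))
      where
      b∉ : b ∉ mid
      b∉ j = case first-place pre (subst (First b) L-eq L-first) of λ
          { (inj₁ i) → pre-mid i j ; (inj₂ refl) → x-mid j }
      d∉ : d ∉ mid
      d∉ j = mid-zpost j (last-∈ (last-++⁻ mid (case last-++⁻ pre (subst (Last d) L-eq L-last) of λ { (there l) → l })))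

    -- A path from a to c through the middle together with a path from b to d through v.
    link : ∀ {s} → s ∈ mid → (W₀ W₁ W₂ : Fin n → Set) →
      (∀ {y} → W₀ y → y ≡ a ⊎ y ≡ s ⊎ Gap y) → (∀ {y} → W₁ y → y ≡ x ⊎ y ≡ v ⊎ Gap y) →
      (∀ {y} → W₂ y → y ≡ v ⊎ y ≡ z ⊎ Gap y) → (∀ {y} → W₀ y → W₁ y → ⊥) → (∀ {y} → W₀ y → W₂ y → ⊥) →
      Walk E W₀ a s → Walk E W₁ x v → Walk E W₂ v z → ⊥
    link {s} sm W₀ W₁ W₂ f₀ f₁ f₂ d₁ d₂ w₀ w₁ w₂ = unlinked X Y dj
        (walk-mono inj₁ w₀ ⊕ walk-mono (λ { (inj₁ refl) → inj₁ (walk-end w₀) ; (inj₂ k) → inj₂ k }) (mid-to-c sm))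
        (walk-along pre x (subst (First b) L-eq L-first)
            (λ cu → edge (cls (consec-∈ˡ cu)) (cls (consec-∈ʳ cu)) (join-pre cu)) (Y₁ (walk-start w₁))
         ⊕ walk-mono Y₁ w₁ ⊕ walk-mono Y₂ w₂
         ⊕ alongʳ z post post-last
             (λ cu → edge (clz (consec-∈ˡ cu)) (clz (consec-∈ʳ cu)) (join-post cu)) (Y₂ (walk-end w₂)))
      where
      after-x : Last d (mid ++ z ∷ post)
      after-x = strip (last-++⁻ pre (subst (Last d) L-eq L-last))
        where
        strip : Last d (x ∷ mid ++ z ∷ post) → Last d (mid ++ z ∷ post)
        strip (there l) = l
      post-last : Last d (z ∷ post)
      post-last = last-++⁻ mid after-x
      X Y : Fin n → Set
      X y = W₀ y ⊎ K y
      Y y = y ∈ pre ⊎ y ∈ post ⊎ W₁ y ⊎ W₂ y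
      Y₁ : ∀ {y} → W₁ y → Y y
      Y₁ h = inj₂ (inj₂ (inj₁ h))
      Y₂ : ∀ {y} → W₂ y → Y y
      Y₂ h = inj₂ (inj₂ (inj₂ h))
      cls : ∀ {y} → y ∈ pre ++ x ∷ [] → Y y
      cls i with ∈-++⁻ pre i
      ... | inj₁ j = inj₁ j
      ... | inj₂ (here refl) = Y₁ (walk-start w₁)
      clz : ∀ {y} → y ∈ z ∷ post → Y y
      clz (here refl) = Y₂ (walk-end w₂)
      clz (there i) = inj₂ (inj₁ i)
      outer : ∀ {y} → y ∈ pre ⊎ y ∈ post → W₀ y → ⊥
      outer i h with f₀ h
      outer (inj₁ i) h | inj₁ refl = L-a (unplace (in-pre i)) refl
      outer (inj₂ i) h | inj₁ refl = L-a (unplace (in-post i)) refl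
      outer (inj₁ i) h | inj₂ (inj₁ refl) = pre-mid i sm
      outer (inj₂ i) h | inj₂ (inj₁ refl) = post-mid i sm
      outer (inj₁ i) h | inj₂ (inj₂ g) = gap-L g (unplace (in-pre i))
      outer (inj₂ i) h | inj₂ (inj₂ g) = gap-L g (unplace (in-post i))
      K-off : ∀ {y} → K y → y ≡ x ⊎ y ≡ v ⊎ y ≡ z ⊎ Gap y → ⊥
      K-off (_ , _ , ni , _) (inj₁ refl) = ni xL
      K-off ((_ , ne) , _) (inj₂ (inj₁ p)) = ne p
      K-off (_ , _ , ni , _) (inj₂ (inj₂ (inj₁ refl))) = ni zL
      K-off (_ , _ , _ , ng) (inj₂ (inj₂ (inj₂ g))) = ng g
      dj : ∀ {y} → X y → Y y → ⊥
      dj (inj₁ h) (inj₁ i) = outer (inj₁ i) h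
      dj (inj₁ h) (inj₂ (inj₁ i)) = outer (inj₂ i) h
      dj (inj₁ h) (inj₂ (inj₂ (inj₁ i))) = d₁ h i
      dj (inj₁ h) (inj₂ (inj₂ (inj₂ i))) = d₂ h i
      dj (inj₂ k) (inj₁ i) = proj₁ (proj₂ (proj₂ k)) (unplace (in-pre i))
      dj (inj₂ k) (inj₂ (inj₁ i)) = proj₁ (proj₂ (proj₂ k)) (unplace (in-post i))
      dj (inj₂ k) (inj₂ (inj₂ (inj₁ i))) = K-off k (case f₁ i of λ { (inj₁ p) → inj₁ p ; (inj₂ (inj₁ p)) → inj₂ (inj₁ p) ; (inj₂ (inj₂ p)) → inj₂ (inj₂ (inj₂ p)) })
      dj (inj₂ k) (inj₂ (inj₂ (inj₂ i))) = K-off k (inj₂ (f₂ i))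

    R₁ R₂ : Fin n → Set
    R₁ y = Gap y × left y ≡ x
    R₂ y = Gap y × right y ≡ z

    R₁? : ∀ y → Dec (R₁ y)
    R₁? y = Gap? y ×-dec (left y ≟ x)

    R₂? : ∀ y → Dec (R₂ y)
    R₂? y = Gap? y ×-dec (right y ≟ z)

    x-to-v : Touch₁ x → Walk E (λ y → y ≡ x ⊎ y ≡ v ⊎ R₁ y) x v
    x-to-v (inj₁ e) = edge (inj₁ refl) (inj₂ (inj₁ refl)) (E-sym e)
    x-to-v (inj₂ (r , g , p)) =
      walk-rev E-sym (walk-mono (λ { (inj₁ (gy , q , _)) → inj₂ (inj₂ (gy , trans q p)) ; (inj₂ q) → inj₁ q })
                        (gap-to g (inj₂ (inj₂ (inj₁ (sym p))))))
      ⊕ walk-mono (λ { (inj₁ (gy , q , _)) → inj₂ (inj₂ (gy , trans q p)) ; (inj₂ q) → inj₂ (inj₁ q) }) (gap-to g (inj₁ refl))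

    v-to-z : Touch₂ z → Walk E (λ y → y ≡ v ⊎ y ≡ z ⊎ R₂ y) v z
    v-to-z (inj₁ e) = edge (inj₁ refl) (inj₂ (inj₁ refl)) e
    v-to-z (inj₂ (r , g , p)) =
      walk-rev E-sym (walk-mono (λ { (inj₁ (gy , _ , q)) → inj₂ (inj₂ (gy , trans q p)) ; (inj₂ q) → inj₁ q }) (gap-to g (inj₁ refl)))
      ⊕ walk-mono (λ { (inj₁ (gy , _ , q)) → inj₂ (inj₂ (gy , trans q p)) ; (inj₂ q) → inj₂ (inj₁ q) })
          (gap-to g (inj₂ (inj₂ (inj₂ (sym p)))))

    W₁⊆ : ∀ {y} → y ≡ x ⊎ y ≡ v ⊎ R₁ y → y ≡ x ⊎ y ≡ v ⊎ Gap y
    W₁⊆ (inj₁ p) = inj₁ p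
    W₁⊆ (inj₂ (inj₁ p)) = inj₂ (inj₁ p)
    W₁⊆ (inj₂ (inj₂ (g , _))) = inj₂ (inj₂ g)

    W₂⊆ : ∀ {y} → y ≡ v ⊎ y ≡ z ⊎ R₂ y → y ≡ v ⊎ y ≡ z ⊎ Gap y
    W₂⊆ (inj₁ p) = inj₁ p
    W₂⊆ (inj₂ (inj₁ p)) = inj₂ (inj₁ p)
    W₂⊆ (inj₂ (inj₂ (g , _))) = inj₂ (inj₂ g)

    ¬gap-v : ¬ Gap v
    ¬gap-v g = gap-v g refl

    off-ends : ∀ {s y} {Q : Set} → s ∈ mid → y ≡ a ⊎ y ≡ s ⊎ (Gap y × Q) → y ≡ x ⊎ y ≡ v ⊎ y ≡ z → ⊥
    off-ends sm (inj₁ refl) (inj₁ q) = L-a xL (sym q)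
    off-ends sm (inj₁ refl) (inj₂ (inj₁ q)) = v≢a (sym q)
    off-ends sm (inj₁ refl) (inj₂ (inj₂ q)) = L-a zL (sym q)
    off-ends sm (inj₂ (inj₁ refl)) (inj₁ refl) = x-mid sm
    off-ends sm (inj₂ (inj₁ refl)) (inj₂ (inj₁ q)) = L-v (midL sm) q
    off-ends sm (inj₂ (inj₁ refl)) (inj₂ (inj₂ refl)) = z-mid sm
    off-ends sm (inj₂ (inj₂ (g , _))) (inj₁ refl) = gap-L g xL
    off-ends sm (inj₂ (inj₂ (g , _))) (inj₂ (inj₁ refl)) = ¬gap-v g
    off-ends sm (inj₂ (inj₂ (g , _))) (inj₂ (inj₂ refl)) = gap-L g zL

    off-gap : ∀ {s y} {Q : Set} → s ∈ mid → y ≡ a ⊎ y ≡ s ⊎ (Gap y × Q) → Gap y → Q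
    off-gap sm (inj₁ p) g = ⊥-elim (gap-a g p)
    off-gap sm (inj₂ (inj₁ refl)) g = ⊥-elim (gap-L g (midL sm))
    off-gap sm (inj₂ (inj₂ (_ , q))) g = q

    -- The edge from `a` and the bridge that `v` makes over the range would cross.
    a-mid : ∀ {s} → E a s → s ∉ mid
    a-mid {s} e sm = link sm (λ y → y ≡ a ⊎ y ≡ s) _ _ (λ { (inj₁ p) → inj₁ p ; (inj₂ p) → inj₂ (inj₁ p) }) W₁⊆ W₂⊆
      (λ { h (inj₁ p) → off-ends sm (up₀ h) (inj₁ p) ; h (inj₂ (inj₁ p)) → off-ends sm (up₀ h) (inj₂ (inj₁ p))
         ; h (inj₂ (inj₂ (g , _))) → off-gap sm (up₀ h) g })
      (λ { h (inj₁ p) → off-ends sm (up₀ h) (inj₂ (inj₁ p)) ; h (inj₂ (inj₁ p)) → off-ends sm (up₀ h) (inj₂ (inj₂ p))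
         ; h (inj₂ (inj₂ (g , _))) → off-gap sm (up₀ h) g })
      (edge (inj₁ refl) (inj₂ refl) e) (x-to-v x-touch) (v-to-z z-touch)
      where
      up₀ : ∀ {y} → y ≡ a ⊎ y ≡ s → y ≡ a ⊎ y ≡ s ⊎ (Gap y × ⊥)
      up₀ (inj₁ p) = inj₁ p
      up₀ (inj₂ p) = inj₂ (inj₁ p)

    -- A gap region joining a to the middle must be used by v to reach the end of its range.
    gap-link : ∀ {r s} → Gap r → s ∈ mid → s ≡ left r ⊎ s ≡ right r →
      (W₁ W₂ : Fin n → Set) → (∀ {y} → W₁ y → y ≡ x ⊎ y ≡ v ⊎ (Gap y × (left y ≡ left r → ⊥))) →
      (∀ {y} → W₂ y → y ≡ v ⊎ y ≡ z ⊎ (Gap y × (right y ≡ right r → ⊥))) → Walk E W₁ x v → Walk E W₂ v z → ⊥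
    gap-link {r} {s} g sm sr W₁ W₂ f₁ f₂ w₁ w₂ = link sm (λ y → y ≡ a ⊎ y ≡ s ⊎ Beyond r y) W₁ W₂
      (λ { (inj₁ p) → inj₁ p ; (inj₂ (inj₁ p)) → inj₂ (inj₁ p) ; (inj₂ (inj₂ (gy , _))) → inj₂ (inj₂ gy) })
      (λ h → case f₁ h of λ { (inj₁ p) → inj₁ p ; (inj₂ (inj₁ p)) → inj₂ (inj₁ p) ; (inj₂ (inj₂ (gy , _))) → inj₂ (inj₂ gy) })
      (λ h → case f₂ h of λ { (inj₁ p) → inj₁ p ; (inj₂ (inj₁ p)) → inj₂ (inj₁ p) ; (inj₂ (inj₂ (gy , _))) → inj₂ (inj₂ gy) })
      (λ h i → case f₁ i of λ { (inj₁ p) → off-ends sm h (inj₁ p) ; (inj₂ (inj₁ p)) → off-ends sm h (inj₂ (inj₁ p))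
         ; (inj₂ (inj₂ (gy , ne))) → ne (proj₁ (off-gap sm h gy)) })
      (λ h i → case f₂ i of λ { (inj₁ p) → off-ends sm h (inj₂ (inj₁ p)) ; (inj₂ (inj₁ p)) → off-ends sm h (inj₂ (inj₂ p))
         ; (inj₂ (inj₂ (gy , ne))) → ne (proj₂ (off-gap sm h gy)) })
      (walk-rev E-sym (walk-mono (λ { (inj₁ h) → inj₂ (inj₂ h) ; (inj₂ p) → inj₁ p }) (gap-to g (inj₂ (inj₁ refl))))
        ⊕ walk-mono (λ { (inj₁ h) → inj₂ (inj₂ h) ; (inj₂ p) → inj₂ (inj₁ p) })
            (gap-to g (case sr of λ { (inj₁ p) → inj₂ (inj₂ (inj₁ p)) ; (inj₂ p) → inj₂ (inj₂ (inj₂ p)) })))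
      w₁ w₂

    -- A region with an end strictly inside the range leads from `a` to the middle, so it must block
    -- `v` on one side. Only the two outermost slots can do this, and only if `v` has no edge of its
    -- own to that end of the range.
    gap-place : ∀ {r} → Gap r → (left r ≡ x × right r ≡ m₁ × ¬ E v x) ⊎ (left r ≡ mk × right r ≡ z × ¬ E v z)
    gap-place {r} g with gap-range g
    ... | inj₁ (p , q) = inj₁ (p , q , λ e → gap-link g (here refl) (inj₂ (sym q)) (λ y → y ≡ x ⊎ y ≡ v) _
            (λ { (inj₁ h) → inj₁ h ; (inj₂ h) → inj₂ (inj₁ h) })
            (λ { (inj₁ h) → inj₁ h ; (inj₂ (inj₁ h)) → inj₂ (inj₁ h)
               ; (inj₂ (inj₂ (gy , h))) → inj₂ (inj₂ (gy , λ k → z-mid (here (trans (sym h) (trans k q))))) })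
            (edge (inj₁ refl) (inj₂ refl) (E-sym e)) (v-to-z z-touch))
    ... | inj₂ (inj₁ (p , q)) = ⊥-elim (gap-link g p (inj₁ refl) _ _
            (λ { (inj₁ h) → inj₁ h ; (inj₂ (inj₁ h)) → inj₂ (inj₁ h)
               ; (inj₂ (inj₂ (gy , h))) → inj₂ (inj₂ (gy , λ k → x-mid (subst (_∈ mid) (trans (sym k) h) p))) })
            (λ { (inj₁ h) → inj₁ h ; (inj₂ (inj₁ h)) → inj₂ (inj₁ h)
               ; (inj₂ (inj₂ (gy , h))) → inj₂ (inj₂ (gy , λ k → z-mid (subst (_∈ mid) (trans (sym k) h) q))) })
            (x-to-v x-touch) (v-to-z z-touch))
    ... | inj₂ (inj₂ (p , q)) = inj₂ (p , q , λ e → gap-link g mk-mid (inj₁ (sym p)) _ (λ y → y ≡ v ⊎ y ≡ z)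
            (λ { (inj₁ h) → inj₁ h ; (inj₂ (inj₁ h)) → inj₂ (inj₁ h)
               ; (inj₂ (inj₂ (gy , h))) → inj₂ (inj₂ (gy , λ k → x-mid (subst (_∈ mid) (trans (sym p) (trans (sym k) h)) mk-mid))) })
            (λ { (inj₁ h) → inj₁ h ; (inj₂ h) → inj₂ (inj₁ h) })
            (x-to-v x-touch) (edge (inj₁ refl) (inj₂ refl) e))

    gap-split : ∀ {r} → Gap r → R₁ r ⊎ R₂ r
    gap-split g with gap-place g
    ... | inj₁ (p , _) = inj₁ (g , p)
    ... | inj₂ (_ , p , _) = inj₂ (g , p)

    R₁-right : ∀ {r} → R₁ r → right r ≡ m₁ × ¬ E v x
    R₁-right (g , l) with gap-place g
    ... | inj₁ (_ , p) = p
    ... | inj₂ (p , _) = ⊥-elim (x-mid (subst (_∈ mid) (trans (sym p) l) mk-mid))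

    R₂-left : ∀ {r} → R₂ r → left r ≡ mk × ¬ E v z
    R₂-left (g , l) with gap-place g
    ... | inj₂ (p , _ , q) = p , q
    ... | inj₁ (_ , p , _) = ⊥-elim (z-mid (here (trans (sym l) p)))

    R₁-R₂ : ∀ {r} → R₁ r → R₂ r → ⊥
    R₁-R₂ (g , p) h = x-mid (subst (_∈ mid) (trans (sym (proj₁ (R₂-left h))) p) mk-mid)

-- The corners at the two ends of the range

module _ {n : ℕ} (S : Society n) where
  open Society S

  module Corners (full : Full) (unlinked : Unlinked)
    (v : Fin n) (av : E a v) (v¬T : ¬ Terminal v)
    (O : Sweepable (Contract.S^ S full unlinked v av v¬T))
    (range : Contract.Range-of.Range S full unlinked v av v¬T O) where

    open Contract S full unlinked v av v¬T
    open Range-of O hiding (range)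
    open Sweepable O
    open Range range
    open Assemble S full unlinked v av v¬T O range

    m₁L : m₁ ∈ L
    m₁L = midL (here refl)

    mkL : mk ∈ L
    mkL = midL mk-mid

    R₁-nbr : ∀ {r y} → R₁ r → E r y → y ≡ a ⊎ y ≡ x ⊎ y ≡ m₁ ⊎ y ≡ v ⊎ R₁ y
    R₁-nbr (g , l) e with gap-nbr′ g e
    ... | inj₁ p = inj₂ (inj₂ (inj₂ (inj₁ p)))
    ... | inj₂ (inj₁ p) = inj₁ p
    ... | inj₂ (inj₂ (inj₁ p)) = inj₂ (inj₁ (trans p l))
    ... | inj₂ (inj₂ (inj₂ (inj₁ p))) = inj₂ (inj₂ (inj₁ (trans p (proj₁ (R₁-right (g , l))))))
    ... | inj₂ (inj₂ (inj₂ (inj₂ (gy , p , _)))) = inj₂ (inj₂ (inj₂ (inj₂ (gy , trans p l))))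

    R₂-nbr : ∀ {r y} → R₂ r → E r y → y ≡ a ⊎ y ≡ v ⊎ y ≡ mk ⊎ y ≡ z ⊎ R₂ y
    R₂-nbr (g , l) e with gap-nbr′ g e
    ... | inj₁ p = inj₂ (inj₁ p)
    ... | inj₂ (inj₁ p) = inj₁ p
    ... | inj₂ (inj₂ (inj₁ p)) = inj₂ (inj₂ (inj₁ (trans p (proj₁ (R₂-left (g , l))))))
    ... | inj₂ (inj₂ (inj₂ (inj₁ p))) = inj₂ (inj₂ (inj₂ (inj₁ (trans p l))))
    ... | inj₂ (inj₂ (inj₂ (inj₂ (gy , _ , p)))) = inj₂ (inj₂ (inj₂ (inj₂ (gy , trans p l))))

    gap-off : ∀ {r p q} → Gap r → p ∈ L → q ∈ L → r ≢ a × r ≢ p × r ≢ q × r ≢ v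
    gap-off g i j = gap-a g , (λ { refl → gap-L g i }) , (λ { refl → gap-L g j }) , gap-v g

    R₂-off : ∀ {r} → R₂ r → r ≢ a × r ≢ v × r ≢ mk × r ≢ z
    R₂-off (g , _) = let (p , q , s , t) = gap-off g mkL zL in p , t , q , s

    module C₁ = Corner S x m₁ v (L-a xL ∘ sym) (L-a m₁L ∘ sym) (v≢a ∘ sym)
      (λ e → x-mid (here e)) (L-v xL) (L-v m₁L) R₁ R₁?
      (λ (g , _) → proj₁ (proj₁ (gap-V g))) (λ (g , _) → gap-T g) (λ (g , _) → gap-off g xL m₁L) R₁-nbr

    module C₂ = Corner S v mk z (v≢a ∘ sym) (L-a mkL ∘ sym) (L-a zL ∘ sym)
      (L-v mkL ∘ sym) (L-v zL ∘ sym) (λ e → z-mid (subst (_∈ mid) e mk-mid)) R₂ R₂?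
      (λ (g , _) → proj₁ (proj₁ (gap-V g))) (λ (g , _) → gap-T g)
      R₂-off R₂-nbr

    VL : ∀ {y} → y ∈ L → V y
    VL i = proj₁ (proj₁ (L-sub i))

    -- If `v` is adjacent to `x`, no region hangs here. Otherwise the contact at `x` is due to a
    -- region, and crossing paths in it would extend to a linkage of the whole society by `link`.
    fill-left : Solver n (count V?) → C₁.Filled
    fill-left solve with E? x v
    ... | yes e = C₁.trivial e (λ R → proj₂ (R₁-right R) (E-sym e))
    ... | no ne = fromTouch x-touch
      where
      fromTouch : Touch₁ x → C₁.Filled
      fromTouch (inj₁ e) = ⊥-elim (ne (E-sym e))
      fromTouch (inj₂ (r , R)) = C₁.filled full r R ne (VL xL) (VL m₁L) Vv
        (λ X Y dj fX fY wX wY → link (here refl) X Y _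
          (λ h → case fX h of λ { (inj₁ p) → inj₁ p ; (inj₂ (inj₁ p)) → inj₂ (inj₁ p) ; (inj₂ (inj₂ (g , _))) → inj₂ (inj₂ g) })
          (λ h → case fY h of λ { (inj₁ p) → inj₁ p ; (inj₂ (inj₁ p)) → inj₂ (inj₁ p) ; (inj₂ (inj₂ (g , _))) → inj₂ (inj₂ g) })
          W₂⊆ dj
          (λ h i → case i of λ
            { (inj₁ p) → off-ends (here refl) (fX h) (inj₂ (inj₁ p)) ; (inj₂ (inj₁ p)) → off-ends (here refl) (fX h) (inj₂ (inj₂ p))
            ; (inj₂ (inj₂ (g , q))) → R₁-R₂ (g , off-gap (here refl) (fX h) g) (g , q) })
          wX wY (v-to-z z-touch))
        -- The far end `z` of the range is outside this corner, which makes the corner strictly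
        -- smaller than the society.
        z (VL zL) ((λ (g , _) → gap-L g zL) , L-a zL , (λ p → x≢z (sym p)) , (λ p → z-mid (here p)) , L-v zL) solve

    fill-right : Solver n (count V?) → C₂.Filled
    fill-right solve with E? v z
    ... | yes e = C₂.trivial e (λ R → proj₂ (R₂-left R) e)
    ... | no ne = fromTouch z-touch
      where
      fromTouch : Touch₂ z → C₂.Filled
      fromTouch (inj₁ e) = ⊥-elim (ne e)
      fromTouch (inj₂ (r , R)) = C₂.filled full r R ne Vv (VL mkL) (VL zL)
        (λ X Y dj fX fY wX wY → link mk-mid X _ Y
          (λ h → case fX h of λ { (inj₁ p) → inj₁ p ; (inj₂ (inj₁ p)) → inj₂ (inj₁ p) ; (inj₂ (inj₂ (g , _))) → inj₂ (inj₂ g) })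
          W₁⊆
          (λ h → case fY h of λ { (inj₁ p) → inj₁ p ; (inj₂ (inj₁ p)) → inj₂ (inj₁ p) ; (inj₂ (inj₂ (g , _))) → inj₂ (inj₂ g) })
          (λ h i → case i of λ
            { (inj₁ p) → off-ends mk-mid (fX h) (inj₁ p) ; (inj₂ (inj₁ p)) → off-ends mk-mid (fX h) (inj₂ (inj₁ p))
            ; (inj₂ (inj₂ (g , q))) → R₁-R₂ (g , q) (g , off-gap mk-mid (fX h) g) })
          dj wX (x-to-v x-touch) wY)
        x (VL xL) ((λ (g , _) → gap-L g xL) , L-a xL , L-v xL , (λ p → x-mid (subst (_∈ mid) (sym p) mk-mid)) , x≢z) solve

module _ {A : Set} where

  consec-before-last : ∀ (x : A) m v → ∃ λ u → Consec u v (x ∷ m ++ v ∷ [])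
  consec-before-last x [] v = x , here
  consec-before-last x (y ∷ m) v with consec-before-last y m v
  ... | u , c = u , there c

  consec-after-first : ∀ (v : A) m z → ∃ λ w → Consec v w (v ∷ m ++ z ∷ [])
  consec-after-first v [] z = z , here
  consec-after-first v (y ∷ m) z = y , here

-- The path after the contraction is undone

module _ {n : ℕ} (S : Society n) where
  open Society S

  module Refit (full : Full) (unlinked : Unlinked)
    (v : Fin n) (av : E a v) (v¬T : ¬ Terminal v)
    (O : Sweepable (Contract.S^ S full unlinked v av v¬T))
    (range : Contract.Range-of.Range S full unlinked v av v¬T O)
    (F₁ : Corners.C₁.Filled S full unlinked v av v¬T O range)
    (F₂ : Corners.C₂.Filled S full unlinked v av v¬T O range) where

    open Contract S full unlinked v av v¬T
    open Range-of O hiding (range)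
    open Sweepable O
    open Range range
    open Assemble S full unlinked v av v¬T O range
    open Corners S full unlinked v av v¬T O range
    module F₁ = C₁.Filled F₁
    module F₂ = C₂.Filled F₂

    -- The interior of the range gives way to the two filled corners with `v` between them. It falls
    -- into the core, together with what the fillings leave behind.
    P₁ P₂ L⁺ : List (Fin n)
    P₁ = F₁.Pm
    P₂ = F₂.Pm
    L⁺ = pre ++ x ∷ P₁ ++ v ∷ P₂ ++ z ∷ post

    data Place⁺ (y : Fin n) : Set where
      in-pre : y ∈ pre → Place⁺ y
      at-x : y ≡ x → Place⁺ y
      in-P₁ : y ∈ P₁ → Place⁺ y
      at-v : y ≡ v → Place⁺ y
      in-P₂ : y ∈ P₂ → Place⁺ y
      at-z : y ≡ z → Place⁺ y
      in-post : y ∈ post → Place⁺ y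

    place⁺ : ∀ {y} → y ∈ L⁺ → Place⁺ y
    place⁺ i with ∈-++⁻ pre i
    ... | inj₁ j = in-pre j
    ... | inj₂ (here e) = at-x e
    ... | inj₂ (there j) with ∈-++⁻ P₁ j
    ... | inj₁ k = in-P₁ k
    ... | inj₂ (here e) = at-v e
    ... | inj₂ (there k) with ∈-++⁻ P₂ k
    ... | inj₁ h = in-P₂ h
    ... | inj₂ (here e) = at-z e
    ... | inj₂ (there h) = in-post h

    unplace⁺ : ∀ {y} → Place⁺ y → y ∈ L⁺
    unplace⁺ (in-pre i) = ∈-++⁺ˡ i
    unplace⁺ (at-x e) = ∈-++⁺ʳ pre (here e)
    unplace⁺ (in-P₁ i) = ∈-++⁺ʳ pre (there (∈-++⁺ˡ i))
    unplace⁺ (at-v e) = ∈-++⁺ʳ pre (there (∈-++⁺ʳ P₁ (here e)))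
    unplace⁺ (in-P₂ i) = ∈-++⁺ʳ pre (there (∈-++⁺ʳ P₁ (there (∈-++⁺ˡ i))))
    unplace⁺ (at-z e) = ∈-++⁺ʳ pre (there (∈-++⁺ʳ P₁ (there (∈-++⁺ʳ P₂ (here e)))))
    unplace⁺ (in-post i) = ∈-++⁺ʳ pre (there (∈-++⁺ʳ P₁ (there (∈-++⁺ʳ P₂ (there i)))))

    data Kind (y : Fin n) : Set where
      old : y ∈ L → y ∉ mid → Kind y
      new₁ : y ∈ P₁ → Kind y
      new-v : y ≡ v → Kind y
      new₂ : y ∈ P₂ → Kind y

    kind : ∀ {y} → y ∈ L⁺ → Kind y
    kind i with place⁺ i
    ... | in-pre j = old (unplace (in-pre j)) (pre-mid j)
    ... | at-x refl = old xL x-mid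
    ... | in-P₁ j = new₁ j
    ... | at-v e = new-v e
    ... | in-P₂ j = new₂ j
    ... | at-z refl = old zL z-mid
    ... | in-post j = old (unplace (in-post j)) (post-mid j)

    old∈ : ∀ {y} → y ∈ L → y ∉ mid → y ∈ L⁺
    old∈ i nm with place i
    ... | in-pre j = unplace⁺ (in-pre j)
    ... | at-x e = unplace⁺ (at-x e)
    ... | in-mid j = ⊥-elim (nm j)
    ... | at-z e = unplace⁺ (at-z e)
    ... | in-post j = unplace⁺ (in-post j)

    P₁-gap : ∀ {y} → y ∈ P₁ → Gap y
    P₁-gap i = proj₁ (F₁.Pm-R i)

    P₂-gap : ∀ {y} → y ∈ P₂ → Gap y
    P₂-gap i = proj₁ (F₂.Pm-R i)

    mid∉ : ∀ {y} → y ∈ mid → y ∉ L⁺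
    mid∉ m i with kind i
    ... | old _ nm = nm m
    ... | new₁ j = gap-L (P₁-gap j) (midL m)
    ... | new-v refl = L-v (midL m) refl
    ... | new₂ j = gap-L (P₂-gap j) (midL m)

    gap-new : ∀ {y} → Gap y → y ∈ L⁺ → y ∈ P₁ ⊎ y ∈ P₂
    gap-new g i with kind i
    ... | old j _ = ⊥-elim (gap-L g j)
    ... | new₁ j = inj₁ j
    ... | new-v refl = ⊥-elim (¬gap-v g)
    ... | new₂ j = inj₂ j

    R₁-new : ∀ {y} → R₁ y → y ∈ L⁺ → y ∈ P₁
    R₁-new R i with gap-new (proj₁ R) i
    ... | inj₁ j = j
    ... | inj₂ j = ⊥-elim (R₁-R₂ R (F₂.Pm-R j))

    R₂-new : ∀ {y} → R₂ y → y ∈ L⁺ → y ∈ P₂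
    R₂-new R i with gap-new (proj₁ R) i
    ... | inj₂ j = j
    ... | inj₁ j = ⊥-elim (R₁-R₂ (F₁.Pm-R j) R)

    -- The trivial last conjunct is `¬ Gap` for the new structure, which has no hanging regions.
    K⁺ : Fin n → Set
    K⁺ y = V y × y ≢ a × y ∉ L⁺ × ¬ ⊥

    K⇒K⁺ : ∀ {y} → K y → K⁺ y
    K⇒K⁺ ((Vy , yv) , ya , ni , ng) = Vy , ya , no-L⁺ , id
      where
      no-L⁺ : _ ∉ L⁺
      no-L⁺ i with kind i
      ... | old j _ = ni j
      ... | new₁ j = ng (P₁-gap j)
      ... | new-v e = yv e
      ... | new₂ j = ng (P₂-gap j)

    mid⇒K⁺ : ∀ {y} → y ∈ mid → K⁺ y
    mid⇒K⁺ m = VL (midL m) , L-a (midL m) , mid∉ m , id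

    gap-V′ : ∀ {r} → Gap r → V r
    gap-V′ g = proj₁ (proj₁ (gap-V g))

    R₁⇒K⁺ : ∀ {y} → R₁ y → y ∉ P₁ → K⁺ y
    R₁⇒K⁺ R ni = gap-V′ (proj₁ R) , gap-a (proj₁ R) , ni ∘ R₁-new R , id

    R₂⇒K⁺ : ∀ {y} → R₂ y → y ∉ P₂ → K⁺ y
    R₂⇒K⁺ R ni = gap-V′ (proj₁ R) , gap-a (proj₁ R) , ni ∘ R₂-new R , id

    L⁺-sub : ∀ {y} → y ∈ L⁺ → V y × y ≢ a
    L⁺-sub i with kind i
    ... | old j _ = VL j , L-a j
    ... | new₁ j = gap-V′ (P₁-gap j) , gap-a (P₁-gap j)
    ... | new-v refl = Vv , v≢a
    ... | new₂ j = gap-V′ (P₂-gap j) , gap-a (P₂-gap j)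

    L⁺-unique : Unique L⁺
    L⁺-unique = unique-++⁺ pre-unique
        (unique-++⁺ (proj₁ (unique-++⁻ (x ∷ P₁) F₁.P-unique))
          (unique-++⁺ (proj₁ (unique-++⁻ (v ∷ P₂) F₂.P-unique)) zpost-unique dj₃) dj₂) dj₁
      where
      zL′ : ∀ {y} → y ∈ z ∷ post → y ∈ L
      zL′ (here e) = unplace (at-z e)
      zL′ (there i) = unplace (in-post i)
      dj₃ : ∀ {y} → y ∈ v ∷ P₂ → y ∈ z ∷ post → ⊥
      dj₃ (here refl) j = L-v (zL′ j) refl
      dj₃ (there i) j = gap-L (P₂-gap i) (zL′ j)
      dj₂ : ∀ {y} → y ∈ x ∷ P₁ → y ∈ (v ∷ P₂) ++ z ∷ post → ⊥
      dj₂ i j with ∈-++⁻ (v ∷ P₂) j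
      dj₂ (here refl) j | inj₁ (here e) = L-v xL e
      dj₂ (here refl) j | inj₁ (there k) = gap-L (P₂-gap k) xL
      dj₂ (here refl) j | inj₂ (here e) = x≢z e
      dj₂ (here refl) j | inj₂ (there k) = x-post k
      dj₂ (there i) j | inj₁ (here refl) = ¬gap-v (P₁-gap i)
      dj₂ (there i) j | inj₁ (there k) = R₁-R₂ (F₁.Pm-R i) (F₂.Pm-R k)
      dj₂ (there i) j | inj₂ k = gap-L (P₁-gap i) (zL′ k)
      dj₁ : ∀ {y} → y ∈ pre → y ∈ x ∷ P₁ ++ v ∷ P₂ ++ z ∷ post → ⊥
      dj₁ i (here refl) = pre-x i
      dj₁ i (there j) with ∈-++⁻ P₁ j
      ... | inj₁ k = gap-L (P₁-gap k) (unplace (in-pre i))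
      ... | inj₂ (here refl) = L-v (unplace (in-pre i)) refl
      ... | inj₂ (there k) with ∈-++⁻ P₂ k
      ... | inj₁ h = gap-L (P₂-gap h) (unplace (in-pre i))
      ... | inj₂ (here refl) = pre-z i
      ... | inj₂ (there h) = pre-post i h

    emb-pre : ∀ {u w} → Consec u w (pre ++ x ∷ []) → Consec u w L⁺
    emb-pre c = consec-join₁ pre c

    emb₁ : ∀ {u w} → Consec u w F₁.P → Consec u w L⁺
    emb₁ c = consec-++ʳ pre (consec-join₁ (x ∷ P₁) c)

    emb₂ : ∀ {u w} → Consec u w F₂.P → Consec u w L⁺
    emb₂ c = consec-++ʳ pre (there (consec-++ʳ P₁ (consec-join₁ (v ∷ P₂) c)))

    emb-post : ∀ {u w} → Consec u w (z ∷ post) → Consec u w L⁺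
    emb-post c = consec-++ʳ pre (there (consec-++ʳ P₁ (there (consec-++ʳ P₂ c))))

    b₁ : ∀ {u w} → Beside u w F₁.P → Beside u w L⁺
    b₁ (inj₁ c) = inj₁ (emb₁ c)
    b₁ (inj₂ c) = inj₂ (emb₁ c)

    b₂ : ∀ {u w} → Beside u w F₂.P → Beside u w L⁺
    b₂ (inj₁ c) = inj₁ (emb₂ c)
    b₂ (inj₂ c) = inj₂ (emb₂ c)

    L⁺-joined : ∀ {u w} → Consec u w L⁺ → E u w
    L⁺-joined c with consec-split pre c
    ... | inj₁ c′ = join-pre c′
    ... | inj₂ c′ with consec-split (x ∷ P₁) c′
    ... | inj₁ c″ = F₁.P-joined c″
    ... | inj₂ c″ with consec-split (v ∷ P₂) c″
    ... | inj₁ c‴ = F₂.P-joined c‴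
    ... | inj₂ c‴ = join-post c‴

    a-nbr⁺ : ∀ {y} → E a y → y ∈ L⁺ ⊎ ⊥
    a-nbr⁺ {y} e with y ≟ v
    ... | yes p = inj₁ (unplace⁺ (at-v p))
    ... | no yv with a-nbr′ e yv
    ... | inj₁ i = inj₁ (old∈ i (a-mid e))
    ... | inj₂ g with gap-split g
    ... | inj₁ R = inj₁ (unplace⁺ (in-P₁ (F₁.P-a R (e))))
    ... | inj₂ R = inj₁ (unplace⁺ (in-P₂ (F₂.P-a R (e))))

    x∈P₁ : x ∈ F₁.P
    x∈P₁ = here refl

    v∈P₁ : v ∈ F₁.P
    v∈P₁ = there (∈-++⁺ʳ P₁ (here refl))

    v∈P₂ : v ∈ F₂.P
    v∈P₂ = here refl

    z∈P₂ : z ∈ F₂.P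
    z∈P₂ = there (∈-++⁺ʳ P₂ (here refl))

    ind-v : ∀ {w} → w ∈ L⁺ → E v w → Beside v w L⁺
    ind-v i e with kind i
    ... | new₁ j = b₁ (F₁.P-induced v∈P₁ (there (∈-++⁺ˡ j)) e)
    ... | new-v refl = ⊥-elim (E-irr e)
    ... | new₂ j = b₂ (F₂.P-induced v∈P₂ (there (∈-++⁺ˡ j)) e)
    ... | old j nm with nbr-range e j
    ... | inj₁ refl = b₁ (F₁.P-induced v∈P₁ x∈P₁ e)
    ... | inj₂ (inj₁ k) = ⊥-elim (nm k)
    ... | inj₂ (inj₂ refl) = b₂ (F₂.P-induced v∈P₂ z∈P₂ e)

    ind₁ : ∀ {u w} → u ∈ P₁ → w ∈ L⁺ → E u w → Beside u w L⁺
    ind₁ i j e with R₁-nbr (F₁.Pm-R i) e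
    ... | inj₁ p = ⊥-elim (proj₂ (L⁺-sub j) p)
    ... | inj₂ (inj₁ refl) = b₁ (F₁.P-induced (there (∈-++⁺ˡ i)) x∈P₁ e)
    ... | inj₂ (inj₂ (inj₁ refl)) = ⊥-elim (mid∉ (here refl) j)
    ... | inj₂ (inj₂ (inj₂ (inj₁ refl))) = b₁ (F₁.P-induced (there (∈-++⁺ˡ i)) v∈P₁ e)
    ... | inj₂ (inj₂ (inj₂ (inj₂ R))) = b₁ (F₁.P-induced (there (∈-++⁺ˡ i)) (there (∈-++⁺ˡ (R₁-new R j))) e)

    ind₂ : ∀ {u w} → u ∈ P₂ → w ∈ L⁺ → E u w → Beside u w L⁺
    ind₂ i j e with R₂-nbr (F₂.Pm-R i) e
    ... | inj₁ p = ⊥-elim (proj₂ (L⁺-sub j) p)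
    ... | inj₂ (inj₁ refl) = b₂ (F₂.P-induced (there (∈-++⁺ˡ i)) v∈P₂ e)
    ... | inj₂ (inj₂ (inj₁ refl)) = ⊥-elim (mid∉ mk-mid j)
    ... | inj₂ (inj₂ (inj₂ (inj₁ refl))) = b₂ (F₂.P-induced (there (∈-++⁺ˡ i)) z∈P₂ e)
    ... | inj₂ (inj₂ (inj₂ (inj₂ R))) = b₂ (F₂.P-induced (there (∈-++⁺ˡ i)) (there (∈-++⁺ˡ (R₂-new R j))) e)

    emb-old : ∀ {u w} → Consec u w L → u ∉ mid → w ∉ mid → Consec u w L⁺
    emb-old {u} {w} c nu nw with consec-split pre (subst (Consec u w) L-eq c)
    ... | inj₁ c′ = emb-pre c′
    ... | inj₂ c′ with consec-split (x ∷ mid) c′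
    ... | inj₂ c″ = emb-post c″
    ... | inj₁ c″ with consec-mid c″
    ... | inj₁ (_ , p) = ⊥-elim (nw (here p))
    ... | inj₂ (inj₁ (p , _)) = ⊥-elim (nu p)
    ... | inj₂ (inj₂ (p , _)) = ⊥-elim (nu (subst (_∈ mid) (sym p) mk-mid))

    induced⁺ : ∀ {u w} → u ∈ L⁺ → w ∈ L⁺ → E u w → Beside u w L⁺
    induced⁺ i j e with kind i | kind j
    ... | new-v refl | _ = ind-v j e
    ... | new₁ k | _ = ind₁ k j e
    ... | new₂ k | _ = ind₂ k j e
    ... | old _ _ | new-v refl = beside-sym (ind-v i (E-sym e))
    ... | old _ _ | new₁ k = beside-sym (ind₁ k i (E-sym e))
    ... | old _ _ | new₂ k = beside-sym (ind₂ k i (E-sym e))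
    ... | old k nk | old l nl with induced k l (up e (L-v k) (L-v l))
    ... | inj₁ c = inj₁ (emb-old c nk nl)
    ... | inj₂ c = inj₂ (emb-old c nl nk)

    mid-to-c⁺ : ∀ {s} → s ∈ mid → Walk E K⁺ s c
    mid-to-c⁺ m = walk-mono (λ { (inj₁ refl) → mid⇒K⁺ m ; (inj₂ k) → K⇒K⁺ k }) (mid-to-c m)

    R₁-to-c : ∀ {y} → R₁ y → y ∉ P₁ → Walk E K⁺ y c
    R₁-to-c R ni = walk-mono (λ { (inj₁ (R′ , nj)) → R₁⇒K⁺ R′ nj ; (inj₂ refl) → mid⇒K⁺ (here refl) }) (F₁.R-to-q R ni)
      ⊕ mid-to-c⁺ (here refl)

    R₂-to-c : ∀ {y} → R₂ y → y ∉ P₂ → Walk E K⁺ y c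
    R₂-to-c R ni = walk-mono (λ { (inj₁ (R′ , nj)) → R₂⇒K⁺ R′ nj ; (inj₂ refl) → mid⇒K⁺ mk-mid }) (F₂.R-to-q R ni)
      ⊕ mid-to-c⁺ mk-mid

    K⁺-to-c : ∀ {y} → K⁺ y → Walk E K⁺ y c
    K⁺-to-c {y} (Vy , ya , ni , _) with y ≟ v
    ... | yes e = ⊥-elim (ni (unplace⁺ (at-v e)))
    ... | no yv with Gap? y
    ... | yes g = case gap-split g of λ
            { (inj₁ R) → R₁-to-c R (λ i → ni (unplace⁺ (in-P₁ i)))
            ; (inj₂ R) → R₂-to-c R (λ i → ni (unplace⁺ (in-P₂ i))) }
    ... | no ng with y ∈? L
    ... | no nL = walk-mono K⇒K⁺ (toE (λ k → proj₁ (proj₂ k)) (K-to-c ((Vy , yv) , ya , nL , ng)))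
    ... | yes i with y ∈? mid
    ... | yes m = mid-to-c⁺ m
    ... | no nm = ⊥-elim (ni (old∈ i nm))

    v-only₁ : ∀ {u y} → Consec u v F₁.P → y ∈ F₁.P → E v y → y ≡ u
    v-only₁ cu i e with F₁.P-induced v∈P₁ i e
    ... | inj₂ c = consec-uniqueˡ F₁.P-unique c cu
    ... | inj₁ c = ⊥-elim (proj₂ (proj₂ (unique-++⁻ (x ∷ P₁) F₁.P-unique)) (consec-last-∈ (x ∷ P₁) c) (here refl))

    v-only₂ : ∀ {u y} → Consec v u F₂.P → y ∈ F₂.P → E v y → y ≡ u
    v-only₂ cu i e with F₂.P-induced v∈P₂ i e
    ... | inj₁ c = consec-uniqueʳ F₂.P-unique c cu
    ... | inj₂ c = ⊥-elim (case F₂.P-unique of λ { (h ∷ _) → All≢⇒∉ h (consec-first-∈ c) })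

    -- By `Full`, `v` has a neighbour besides `a` and its two neighbours on the new path. Since the
    -- path is induced, this neighbour lies behind it.
    v-to-c : Walk E (λ w → w ≡ v ⊎ K⁺ w) v c
    v-to-c with consec-before-last x P₁ v | consec-after-first v P₂ z
    ... | u , cu | w , cw with full a u w v (Vv , v≢a , (λ { refl → consec-asym F₁.P-unique cu cu }) , (λ { refl → consec-asym F₂.P-unique cw cw }))
    ... | t , T , W with walk-step (T≢v T ∘ sym) W
    ... | y , e , (_ , ya , yu , yw) = inj₁ refl ▷⟨ e ⟩ walk-mono inj₂ onward
      where
      onward : Walk E K⁺ y c
      onward with v-nbr e ya
      ... | inj₁ i = case nbr-range e i of λ
              { (inj₁ refl) → ⊥-elim (yu (v-only₁ cu x∈P₁ e)) ; (inj₂ (inj₁ m)) → mid-to-c⁺ m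
              ; (inj₂ (inj₂ refl)) → ⊥-elim (yw (v-only₂ cw z∈P₂ e)) }
      ... | inj₂ g with gap-split g
      ... | inj₁ R = R₁-to-c R (λ i → yu (v-only₁ cu (there (∈-++⁺ˡ i)) e))
      ... | inj₂ R = R₂-to-c R (λ i → yw (v-only₂ cw (there (∈-++⁺ˡ i)) e))

    L⁺-to-c : ∀ {l} → l ∈ L⁺ → l ≢ b → l ≢ d → Walk E (λ w → w ≡ l ⊎ K⁺ w) l c
    L⁺-to-c i nb nd with kind i
    ... | old j _ = walk-mono (λ { (inj₁ e) → inj₁ e ; (inj₂ k) → inj₂ (K⇒K⁺ k) })
            (toE (λ { (inj₁ refl) → L-a j ; (inj₂ k) → proj₁ (proj₂ k) }) (L-to-c j nb nd))
    ... | new-v refl = v-to-c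
    ... | new₁ j = walk-mono (λ { (inj₁ e) → inj₁ e ; (inj₂ (inj₁ (R , nj))) → inj₂ (R₁⇒K⁺ R nj) ; (inj₂ (inj₂ refl)) → inj₂ (mid⇒K⁺ (here refl)) })
            (F₁.P-to-q j) ⊕ walk-mono inj₂ (mid-to-c⁺ (here refl))
    ... | new₂ j = walk-mono (λ { (inj₁ e) → inj₁ e ; (inj₂ (inj₁ (R , nj))) → inj₂ (R₂⇒K⁺ R nj) ; (inj₂ (inj₂ refl)) → inj₂ (mid⇒K⁺ mk-mid) })
            (F₂.P-to-q j) ⊕ walk-mono inj₂ (mid-to-c⁺ mk-mid)

    New : Fin n → Set
    New y = R₁ y ⊎ y ≡ v ⊎ R₂ y

    -- The left corner is filled with `v` inserted in front of `m₁`; then `v` sweeps over the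
    -- interior of the range up to `mk`; then the right corner is filled, with `v` and `z` in place.
    -- The tail `s` is arbitrary because both sweeps are to be prolonged.
    local : ∀ s → Swp (pre ++ x ∷ mid ++ z ∷ s) (pre ++ x ∷ P₁ ++ v ∷ P₂ ++ z ∷ s) New
      (λ u w → E u w × New u × w ∈ L⁺ ⊎ E u w × New u × w ∈ mid ⊎ E u w × New u × Gap w)
    local s = swp-weaken (λ { (inj₁ (inj₁ (inj₁ R))) → inj₁ R ; (inj₁ (inj₁ (inj₂ e))) → inj₂ (inj₁ e) ; (inj₁ (inj₂ ())) ; (inj₂ R) → inj₂ (inj₂ R) })
        (swp-trans (swp-trans (swp-context pre (ms ++ z ∷ s) F₁.fill₂) (swp-cast (sym eq₁) refl (swp-context (pre ++ x ∷ P₁) (z ∷ s) (swp-sweep-away v ini mk))) (λ _ ()))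
          (swp-cast refl eq₂ (swp-context (pre ++ x ∷ P₁) s F₂.fill₁))
          (λ { (inj₁ (inj₁ R)) R′ → R₁-R₂ R R′ ; (inj₁ (inj₂ refl)) R′ → ¬gap-v (proj₁ R′) ; (inj₂ ()) }))
        (λ T f → λ { (inj₁ h) → cov₁ T f h ; (inj₂ (inj₁ h)) → cov₂ T f h ; (inj₂ (inj₂ h)) → cov₃ T f h })
      where
      eq₁ : pre ++ (x ∷ P₁ ++ v ∷ m₁ ∷ []) ++ ms ++ z ∷ s ≡ (pre ++ x ∷ P₁) ++ (v ∷ ini ++ mk ∷ []) ++ z ∷ s
      eq₁ = trans (cong (pre ++_) (trans (Listₚ.++-assoc (x ∷ P₁) (v ∷ m₁ ∷ []) (ms ++ z ∷ s))
                      (cong (λ l → (x ∷ P₁) ++ v ∷ l ++ z ∷ s) mid-eq)))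
                  (sym (Listₚ.++-assoc pre (x ∷ P₁) _))
      eq₂ : (pre ++ x ∷ P₁) ++ (v ∷ P₂ ++ z ∷ []) ++ s ≡ pre ++ x ∷ P₁ ++ v ∷ P₂ ++ z ∷ s
      eq₂ = trans (Listₚ.++-assoc pre (x ∷ P₁) _) (cong (λ l → pre ++ (x ∷ P₁) ++ l) (Listₚ.++-assoc (v ∷ P₂) (z ∷ []) s))
      Goal : Sweep (pre ++ x ∷ mid ++ z ∷ s) (pre ++ x ∷ P₁ ++ v ∷ P₂ ++ z ∷ s) → Set
      Goal T = ∀ {u w} → ((E u w × R₁ u × w ≢ a) ⊎ (u ≡ v × w ∈ ini ++ mk ∷ [])) ⊎ (E u w × R₂ u × w ≢ a) → Covers T u w
      fin₁ : ∀ {u w} → Beside u w F₁.P → Beside u w (pre ++ x ∷ P₁ ++ v ∷ P₂ ++ z ∷ s)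
      fin₁ (inj₁ c) = inj₁ (consec-++ʳ pre (consec-join₁ (x ∷ P₁) c))
      fin₁ (inj₂ c) = inj₂ (consec-++ʳ pre (consec-join₁ (x ∷ P₁) c))
      fin₂ : ∀ {u w} → Beside u w F₂.P → Beside u w (pre ++ x ∷ P₁ ++ v ∷ P₂ ++ z ∷ s)
      fin₂ (inj₁ c) = inj₁ (consec-++ʳ pre (there (consec-++ʳ P₁ (consec-join₁ (v ∷ P₂) c))))
      fin₂ (inj₂ c) = inj₂ (consec-++ʳ pre (there (consec-++ʳ P₁ (consec-join₁ (v ∷ P₂) c))))
      cov-R : ∀ T → Goal T → ∀ {u w} → E u w → R₁ u ⊎ R₂ u → w ≢ a → Covers T u w
      cov-R T f e (inj₁ R) wa = f (inj₁ (inj₁ (e , R , wa)))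
      cov-R T f e (inj₂ R) wa = f (inj₂ (e , R , wa))
      cov₂ : ∀ T → Goal T → ∀ {u w} → E u w × New u × w ∈ mid → Covers T u w
      cov₂ T f (e , inj₁ R , m) = cov-R T f e (inj₁ R) (L-a (midL m))
      cov₂ T f {w = w} (e , inj₂ (inj₁ refl) , m) = f (inj₁ (inj₂ (refl , subst (w ∈_) mid-eq m)))
      cov₂ T f (e , inj₂ (inj₂ R) , m) = cov-R T f e (inj₂ R) (L-a (midL m))
      cov₃ : ∀ T → Goal T → ∀ {u w} → E u w × New u × Gap w → Covers T u w
      cov₃ T f (e , inj₁ R , g) = cov-R T f e (inj₁ R) (gap-a g)
      cov₃ T f (e , inj₂ (inj₁ refl) , g) = covers-sym T (cov-R T f (E-sym e) (gap-split g) v≢a)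
      cov₃ T f (e , inj₂ (inj₂ R) , g) = cov-R T f e (inj₂ R) (gap-a g)
      cov₁ : ∀ T → Goal T → ∀ {u w} → E u w × New u × w ∈ L⁺ → Covers T u w
      cov₁ T f (e , inj₁ R , i) = cov-R T f e (inj₁ R) (proj₂ (L⁺-sub i))
      cov₁ T f (e , inj₂ (inj₂ R) , i) = cov-R T f e (inj₂ R) (proj₂ (L⁺-sub i))
      cov₁ T f (e , inj₂ (inj₁ refl) , i) with kind i
      ... | new₁ j = covers-end T (fin₁ (F₁.P-induced v∈P₁ (there (∈-++⁺ˡ j)) e))
      ... | new-v refl = ⊥-elim (E-irr e)
      ... | new₂ j = covers-end T (fin₂ (F₂.P-induced v∈P₂ (there (∈-++⁺ˡ j)) e))
      ... | old j nm = case nbr-range e j of λ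
              { (inj₁ refl) → covers-end T (fin₁ (F₁.P-induced v∈P₁ x∈P₁ e)) ; (inj₂ (inj₁ m)) → ⊥-elim (nm m)
              ; (inj₂ (inj₂ refl)) → covers-end T (fin₂ (F₂.P-induced v∈P₂ z∈P₂ e)) }

-- Prolonging the two sweeps

module _ {n : ℕ} (S : Society n) where
  open Society S

  module Resweep (full : Full) (unlinked : Unlinked)
    (v : Fin n) (av : E a v) (v¬T : ¬ Terminal v)
    (O : Sweepable (Contract.S^ S full unlinked v av v¬T))
    (range : Contract.Range-of.Range S full unlinked v av v¬T O)
    (F₁ : Corners.C₁.Filled S full unlinked v av v¬T O range)
    (F₂ : Corners.C₂.Filled S full unlinked v av v¬T O range) where

    open Contract S full unlinked v av v¬T
    open Range-of O hiding (range)
    open Sweepable O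
    open Range range
    open Assemble S full unlinked v av v¬T O range
    open Corners S full unlinked v av v¬T O range
    open Refit S full unlinked v av v¬T O range F₁ F₂ hiding (module F₁; module F₂)
    module F₁ = C₁.Filled F₁
    module F₂ = C₂.Filled F₂

    Core⁺ : Fin n → Set
    Core⁺ y = y ∈ L⁺ ⊎ K⁺ y

    core⁺ : ∀ {y} → V y → y ≢ a → Core⁺ y
    core⁺ {y} Vy ya with y ∈? L⁺
    ... | yes i = inj₁ i
    ... | no ni = inj₂ (Vy , ya , ni , id)

    core⇒ : ∀ {y} → Core y → Core⁺ y
    core⇒ (inj₁ i) = core⁺ (VL i) (L-a i)
    core⇒ (inj₂ k) = inj₂ (K⇒K⁺ k)

    core-V : ∀ {y} → Core⁺ y → V y × y ≢ a
    core-V (inj₁ i) = L⁺-sub i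
    core-V (inj₂ (Vy , ya , _)) = Vy , ya

    new-core : ∀ {y} → New y → Core⁺ y
    new-core (inj₁ (g , _)) = core⁺ (gap-V′ g) (gap-a g)
    new-core (inj₂ (inj₁ refl)) = core⁺ Vv v≢a
    new-core (inj₂ (inj₂ (g , _))) = core⁺ (gap-V′ g) (gap-a g)

    new-¬T : ∀ {y} → New y → ¬ Terminal y
    new-¬T (inj₁ (g , _)) = gap-T g
    new-¬T (inj₂ (inj₁ refl)) = v¬T
    new-¬T (inj₂ (inj₂ (g , _))) = gap-T g

    age : ∀ {y} → Core⁺ y → New y ⊎ (Core y × y ≢ v)
    age {y} cy with y ≟ v
    ... | yes e = inj₁ (inj₂ (inj₁ e))
    ... | no yv with Gap? y
    ... | yes g = inj₁ (case gap-split g of λ { (inj₁ R) → inj₁ R ; (inj₂ R) → inj₂ (inj₂ R) })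
    ... | no ng with y ∈? L
    ... | yes i = inj₂ (inj₁ i , yv)
    ... | no ni = inj₂ (inj₂ ((proj₁ (core-V cy) , yv) , proj₂ (core-V cy) , ni , ng) , yv)

    Local : Fin n → Fin n → Set
    Local u w = E u w × New u × w ∈ L⁺ ⊎ E u w × New u × w ∈ mid ⊎ E u w × New u × Gap w

    new-edge : ∀ {u w} → E u w → New u → Core⁺ w → Local u w
    new-edge {u} {w} e N cw with w ∈? L⁺
    ... | yes i = inj₁ (e , N , i)
    ... | no ni with Gap? w
    ... | yes g = inj₂ (inj₂ (e , N , g))
    ... | no ng = inj₂ (inj₁ (e , N , go N))
      where
      in-mid′ : w ∈ L → w ∈ mid
      in-mid′ i with w ∈? mid
      ... | yes m = m
      ... | no nm = ⊥-elim (ni (old∈ i nm))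
      go : New u → w ∈ mid
      go (inj₁ R) with R₁-nbr R e
      ... | inj₁ p = ⊥-elim (proj₂ (core-V cw) p)
      ... | inj₂ (inj₁ refl) = in-mid′ xL
      ... | inj₂ (inj₂ (inj₁ refl)) = here refl
      ... | inj₂ (inj₂ (inj₂ (inj₁ refl))) = ⊥-elim (ni (unplace⁺ (at-v refl)))
      ... | inj₂ (inj₂ (inj₂ (inj₂ (g , _)))) = ⊥-elim (ng g)
      go (inj₂ (inj₂ R)) with R₂-nbr R e
      ... | inj₁ p = ⊥-elim (proj₂ (core-V cw) p)
      ... | inj₂ (inj₁ refl) = ⊥-elim (ni (unplace⁺ (at-v refl)))
      ... | inj₂ (inj₂ (inj₁ refl)) = mk-mid
      ... | inj₂ (inj₂ (inj₂ (inj₁ refl))) = in-mid′ zL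
      ... | inj₂ (inj₂ (inj₂ (inj₂ (g , _)))) = ⊥-elim (ng g)
      go (inj₂ (inj₁ refl)) with v-nbr e (proj₂ (core-V cw))
      ... | inj₁ i = in-mid′ i
      ... | inj₂ g = ⊥-elim (ng g)

    CoreEdge⁺ : Fin n → Fin n → Set
    CoreEdge⁺ u w = E u w × Core⁺ u × Core⁺ w

    split-edge : ∀ {u w} → CoreEdge⁺ u w → CoreEdge u w ⊎ Local u w ⊎ Local w u
    split-edge (e , cu , cw) with age cu | age cw
    ... | inj₁ N | _ = inj₂ (inj₁ (new-edge e N cw))
    ... | _ | inj₁ N = inj₂ (inj₂ (new-edge (E-sym e) N cu))
    ... | inj₂ (cu′ , uv) | inj₂ (cw′ , wv) = inj₁ (up e uv wv , cu′ , cw′)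

    core-new : ∀ {y} → Core y → New y → ⊥
    core-new (inj₁ i) (inj₁ (g , _)) = gap-L g i
    core-new (inj₁ i) (inj₂ (inj₁ refl)) = L-v i refl
    core-new (inj₁ i) (inj₂ (inj₂ (g , _))) = gap-L g i
    core-new (inj₂ (_ , _ , _ , ng)) (inj₁ (g , _)) = ng g
    core-new (inj₂ ((_ , yv) , _)) (inj₂ (inj₁ p)) = yv p
    core-new (inj₂ (_ , _ , _ , ng)) (inj₂ (inj₂ (g , _))) = ng g

    -- Used for both sweeps: `s` is empty for the first and `c` alone for the second, and `Q`
    -- excludes the vertices present at the start.
    extend : ∀ {l} (Q : Fin n → Set) s → Swp l (L ++ s) (λ y → Core y × Q y) CoreEdge → (∀ {y} → ¬ Terminal y → Q y) →
      Swp l (L⁺ ++ s) (λ y → Core⁺ y × Q y) CoreEdge⁺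
    extend Q s W f = swp-weaken (λ { (inj₁ (k , q)) → core⇒ k , q ; (inj₂ N) → new-core N , f (new-¬T N) })
        (swp-trans W (swp-cast (trans (sym eq) (cong (_++ s) (sym L-eq))) (sym eq⁺) (local (post ++ s))) (λ (k , _) → core-new k))
        (λ T g r → case split-edge r of λ
           { (inj₁ h) → g (inj₁ h) ; (inj₂ (inj₁ h)) → g (inj₂ h) ; (inj₂ (inj₂ h)) → covers-sym T (g (inj₂ h)) })
      where
      eq : (pre ++ x ∷ mid ++ z ∷ post) ++ s ≡ pre ++ x ∷ mid ++ z ∷ post ++ s
      eq = trans (Listₚ.++-assoc pre _ s) (cong (λ l → pre ++ x ∷ l) (Listₚ.++-assoc mid (z ∷ post) s))
      eq⁺ : L⁺ ++ s ≡ pre ++ x ∷ P₁ ++ v ∷ P₂ ++ z ∷ post ++ s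
      eq⁺ = trans (Listₚ.++-assoc pre _ s) (cong (λ l → pre ++ x ∷ l)
              (trans (Listₚ.++-assoc P₁ _ s) (cong (λ l → P₁ ++ v ∷ l) (Listₚ.++-assoc P₂ (z ∷ post) s))))

    c∉L⁺ : c ∉ L⁺
    c∉L⁺ i with kind i
    ... | new₁ j = gap-T (P₁-gap j) (inj₂ (inj₂ (inj₁ refl)))
    ... | new-v p = T≢v (inj₂ (inj₂ (inj₁ refl))) p
    ... | new₂ j = gap-T (P₂-gap j) (inj₂ (inj₂ (inj₁ refl)))
    ... | old j nm with sweep₂
    ... | inj₁ (ni , _) = ni j
    ... | inj₂ e with three-split pre (trans (sym L-eq) e)
    ... | _ , _ , p , _ = nm (here (sym p))

    -- When c lies on L the second sweep inserts d after the left corner has been filled.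
    flat-sweep : L ≡ b ∷ c ∷ d ∷ [] → Swp (b ∷ c ∷ []) (L⁺ ++ c ∷ []) (λ y → Core⁺ y × y ≢ b × y ≢ c) CoreEdge⁺
    flat-sweep e with three-split pre (trans (sym L-eq) e)
    ... | p , xb , mc , m0 , zd , q = swp-weaken
        (λ { (inj₁ (inj₁ R)) → new (inj₁ R) ; (inj₁ (inj₂ refl)) → new (inj₂ (inj₁ refl)) ; (inj₂ (inj₁ R)) → new (inj₂ (inj₂ R))
           ; (inj₂ (inj₂ refl)) → core⁺ (VL zL) (L-a zL) , (λ r → b≢d (trans (sym r) zd)) , (λ r → c≢d (trans (sym r) zd)) })
        (swp-trans (swp-cast (cong₂ (λ s t → s ∷ t ∷ []) xb mc) refl fill₂′)
          (swp-cast eq₁ eq₂ (swp-context (x ∷ P₁) [] F₂.fill₂))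
          (λ { (inj₁ R) (inj₁ R′) → R₁-R₂ R R′ ; (inj₁ (g , _)) (inj₂ refl) → gap-L g zL
             ; (inj₂ refl) (inj₁ (g , _)) → ¬gap-v g ; (inj₂ refl) (inj₂ r) → L-v zL (sym r) }))
        (λ T g r → case split-edge r of λ
           { (inj₁ (h , cu , cw)) → old-edge T h cu cw ; (inj₂ (inj₁ h)) → loc T g h ; (inj₂ (inj₂ h)) → covers-sym T (loc T g h) })
      where
      mk≡m₁ : mk ≡ m₁
      mk≡m₁ = go (subst (λ l → mk ∈ m₁ ∷ l) m0 mk-mid)
        where
        go : mk ∈ m₁ ∷ [] → mk ≡ m₁
        go (here r) = r
      eq₁ : (x ∷ P₁) ++ (v ∷ mk ∷ []) ++ [] ≡ x ∷ P₁ ++ v ∷ m₁ ∷ []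
      eq₁ = cong (λ t → (x ∷ P₁) ++ v ∷ t ∷ []) mk≡m₁
      eq₂ : (x ∷ P₁) ++ (v ∷ P₂ ++ z ∷ mk ∷ []) ++ [] ≡ L⁺ ++ c ∷ []
      eq₂ = trans (cong ((x ∷ P₁) ++_) (Listₚ.++-identityʳ _)) (trans (cong (λ t → (x ∷ P₁) ++ v ∷ P₂ ++ z ∷ t ∷ []) (trans mk≡m₁ mc))
              (trans (cong (λ t → (x ∷ P₁) ++ v ∷ t) (sym (Listₚ.++-assoc P₂ (z ∷ []) (c ∷ []))))
                (trans (sym (Listₚ.++-assoc (x ∷ P₁) (v ∷ P₂ ++ z ∷ []) (c ∷ [])))
                  (cong₂ (λ s t → (s ++ x ∷ P₁ ++ v ∷ P₂ ++ z ∷ t) ++ c ∷ []) (sym p) (sym q)))))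
      new : ∀ {y} → New y → Core⁺ y × y ≢ b × y ≢ c
      new N = new-core N , (λ r → new-¬T N (inj₂ (inj₁ r))) , (λ r → new-¬T N (inj₂ (inj₂ (inj₁ r))))
      Rel : Fin n → Fin n → Set
      Rel u w = ((E u w × R₁ u × w ≢ a) ⊎ (u ≡ v × w ≡ m₁)) ⊎ (E u w × R₂ u × w ≢ a)
      fill₂′ : Swp (x ∷ m₁ ∷ []) (x ∷ P₁ ++ v ∷ m₁ ∷ []) (λ y → R₁ y ⊎ y ≡ v) (λ u w → (E u w × R₁ u × w ≢ a) ⊎ (u ≡ v × w ≡ m₁))
      fill₂′ = swp-weaken id F₁.fill₂ (λ T f → λ { (inj₁ h) → f h ; (inj₂ (refl , refl)) → covers-end T (inj₁ (consec-++ʳ (x ∷ P₁) here)) })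
      mid-c : ∀ {y} → y ∈ mid → y ≡ c
      mid-c {y} i = go (subst (λ l → y ∈ m₁ ∷ l) m0 i)
        where
        go : y ∈ m₁ ∷ [] → y ≡ c
        go (here r) = trans r mc
      L-cases : ∀ {y} → Core y → y ≡ b ⊎ y ≡ c ⊎ y ≡ d
      L-cases (inj₁ i) = go (subst (_ ∈_) e i)
        where
        go : ∀ {y} → y ∈ b ∷ c ∷ d ∷ [] → y ≡ b ⊎ y ≡ c ⊎ y ≡ d
        go (here r) = inj₁ r
        go (there (here r)) = inj₂ (inj₁ r)
        go (there (there (here r))) = inj₂ (inj₂ r)
      L-cases (inj₂ k) = ⊥-elim (proj₁ (proj₂ (proj₂ (walk-end (K-to-c k)))) (subst (c ∈_) (sym e) (there (here refl))))
      dc : Consec d c (L⁺ ++ c ∷ [])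
      dc = subst₂ (λ s l → Consec s c l) zd (cong (_++ c ∷ []) (cong (λ t → pre ++ x ∷ P₁ ++ v ∷ P₂ ++ z ∷ t) (sym q)))
             (subst (Consec z c) (trans (cong (pre ++_) (trans (cong (λ t → x ∷ P₁ ++ v ∷ t) (sym (Listₚ.++-assoc P₂ (z ∷ []) (c ∷ []))))
                (sym (Listₚ.++-assoc (x ∷ P₁) (v ∷ P₂ ++ z ∷ []) (c ∷ []))))) (sym (Listₚ.++-assoc pre _ (c ∷ []))))
               (consec-++ʳ pre (there (consec-++ʳ P₁ (there (consec-++ʳ P₂ here))))))
      old-edge : ∀ (T : Sweep (b ∷ c ∷ []) (L⁺ ++ c ∷ [])) {u w} → ^.E u w → Core u → Core w → Covers T u w
      old-edge T {u} {w} h cu cw with L-cases cu | L-cases cw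
      ... | inj₁ refl | inj₁ refl = ⊥-elim (^.E-irr h)
      ... | inj₁ refl | inj₂ (inj₁ refl) = covers-start T (inj₁ here)
      ... | inj₂ (inj₁ refl) | inj₁ refl = covers-start T (inj₂ here)
      ... | inj₂ (inj₁ refl) | inj₂ (inj₁ refl) = ⊥-elim (^.E-irr h)
      ... | inj₂ (inj₁ refl) | inj₂ (inj₂ refl) = covers-end T (inj₂ dc)
      ... | inj₂ (inj₂ refl) | inj₂ (inj₁ refl) = covers-end T (inj₁ dc)
      ... | inj₂ (inj₂ refl) | inj₂ (inj₂ refl) = ⊥-elim (^.E-irr h)
      -- The path is induced and `c` stands between `b` and `d` on it, so these two are not
      -- adjacent.
      ... | inj₁ refl | inj₂ (inj₂ refl) = ⊥-elim (no-bd (induced (first-∈ L-first) (last-∈ L-last) h))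
        where
        no-bd : Beside b d L → ⊥
        no-bd s = case subst (Beside b d) e s of λ
          { (inj₁ here) → c≢d refl ; (inj₁ (there here)) → b≢c refl ; (inj₁ (there (there (there ()))))
          ; (inj₂ here) → b≢d refl ; (inj₂ (there here)) → b≢d refl ; (inj₂ (there (there (there ())))) }
      ... | inj₂ (inj₂ refl) | inj₁ refl = ⊥-elim (no-bd (induced (first-∈ L-first) (last-∈ L-last) (^.E-sym h)))
        where
        no-bd : Beside b d L → ⊥
        no-bd s = case subst (Beside b d) e s of λ
          { (inj₁ here) → c≢d refl ; (inj₁ (there here)) → b≢c refl ; (inj₁ (there (there (there ()))))
          ; (inj₂ here) → b≢d refl ; (inj₂ (there here)) → b≢d refl ; (inj₂ (there (there (there ())))) }
      vc : ∀ (T : Sweep (b ∷ c ∷ []) (L⁺ ++ c ∷ [])) → (∀ {u w} → Rel u w → Covers T u w) → ∀ {u w} → E u w → R₁ u ⊎ R₂ u → w ≢ a → Covers T u w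
      vc T g h (inj₁ R) wa = g (inj₁ (inj₁ (h , R , wa)))
      vc T g h (inj₂ R) wa = g (inj₂ (h , R , wa))
      loc : ∀ (T : Sweep (b ∷ c ∷ []) (L⁺ ++ c ∷ [])) → (∀ {u w} → Rel u w → Covers T u w) → ∀ {u w} → Local u w → Covers T u w
      fin₁ : ∀ (T : Sweep (b ∷ c ∷ []) (L⁺ ++ c ∷ [])) {u w} → Beside u w L⁺ → Covers T u w
      fin₁ T (inj₁ h) = covers-end T (inj₁ (consec-++ˡ (c ∷ []) h))
      fin₁ T (inj₂ h) = covers-end T (inj₂ (consec-++ˡ (c ∷ []) h))
      locW : ∀ {u w} → Local u w → w ≢ a
      locW (inj₁ (_ , _ , i)) = proj₂ (L⁺-sub i)
      locW (inj₂ (inj₁ (_ , _ , i))) = L-a (midL i)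
      locW (inj₂ (inj₂ (_ , _ , h))) = gap-a h
      locE : ∀ {u w} → Local u w → E u w × New u
      locE (inj₁ (h , N , _)) = h , N
      locE (inj₂ (inj₁ (h , N , _))) = h , N
      locE (inj₂ (inj₂ (h , N , _))) = h , N
      loc T g h with locE h
      ... | ed , inj₁ R = vc T g ed (inj₁ R) (locW h)
      ... | ed , inj₂ (inj₂ R) = vc T g ed (inj₂ R) (locW h)
      loc T g (inj₁ (_ , _ , i)) | ed , inj₂ (inj₁ refl) = fin₁ T (ind-v i ed)
      loc T g (inj₂ (inj₁ (_ , _ , i))) | ed , inj₂ (inj₁ refl) = g (inj₁ (inj₂ (refl , trans (mid-c i) (sym mc))))
      loc T g (inj₂ (inj₂ (_ , _ , h))) | ed , inj₂ (inj₁ refl) = covers-sym T (vc T g (E-sym ed) (gap-split h) v≢a)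

    resweep : Sweepable S
    resweep = record
      { L = L⁺ ; L-first = first-swap pre (subst (First b) L-eq L-first)
      ; L-last = last-++ pre (there (last-++ P₁ (there (last-++ P₂ (last-++⁻ mid (case last-++⁻ pre (subst (Last d) L-eq L-last) of λ { (there l) → l }))))))
      ; L-unique = L⁺-unique ; L-sub = L⁺-sub
      ; Gap = λ _ → ⊥ ; Gap? = λ _ → no id ; gap-V = λ () ; gap-T = λ () ; left = id ; right = id
      ; gap-ends = λ () ; gap-nbr = λ () ; a-nbr = a-nbr⁺ ; induced = induced⁺
      ; joined = λ _ cu → edge (inj₁ refl) (inj₂ (inj₁ refl)) (L⁺-joined cu)
      ; K-to-c = K⁺-to-c ; L-to-c = L⁺-to-c
      ; sweep₁ = swp-cast refl (Listₚ.++-identityʳ L⁺) (extend (λ y → y ≢ b × y ≢ c × y ≢ d) [] (swp-cast refl (sym (Listₚ.++-identityʳ L)) sweep₁)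
          (λ nT → (λ e → nT (inj₂ (inj₁ e))) , (λ e → nT (inj₂ (inj₂ (inj₁ e)))) , (λ e → nT (inj₂ (inj₂ (inj₂ e))))))
      ; sweep₂ = inj₁ (c∉L⁺ , (case sweep₂ of λ
          { (inj₁ (_ , W)) → extend (λ y → y ≢ b × y ≢ c) (c ∷ []) W (λ nT → (λ e → nT (inj₂ (inj₁ e))) , (λ e → nT (inj₂ (inj₂ (inj₁ e)))))
          ; (inj₂ e) → flat-sweep e })) }

-- The two-paths induction

abstract
  solve : ∀ {n} k → Solver n k
  solve zero S ()
  solve {n} (suc k) S (s≤s le) semi unlinked with any? (λ q → any? λ r → any? λ x → off? a q r x ×-dec ¬? (escapes? a q r x))
    where open Society S
  -- Separators through `a` are removed first; once there are none, `Semi` amounts to `Full` and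
  -- contraction is possible.
  ... | yes (q , r , x , o , s) = T.restore (solve k T.S^ (ℕₚ.<-≤-trans T.size-< le) T.semi^ T.unlinked^)
    where module T = Thick S unlinked semi q r x o s
  ... | no none = fully (any? λ x → V? x ×-dec ¬? (terminal? x))
    where
    open Society S
    free : ∀ q r → Good a q r
    free q r x o with escapes? a q r x
    ... | yes e = e
    ... | no ¬e = ⊥-elim (none (q , r , x , o , ¬e))
    full : Full
    full p q r with p ≟ a | q ≟ a | r ≟ a
    ... | yes refl | _ | _ = free q r
    ... | no _ | yes refl | _ = good-weaken (λ (v , p , q , r) → v , q , p , r) (λ (v , p , q , r) → v , q , p , r) (free p r)
    ... | no _ | no _ | yes refl = good-weaken (λ (v , p , q , r) → v , r , q , p) (λ (v , p , q , r) → v , r , q , p) (free q p)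
    ... | no p≢ | no q≢ | no r≢ = proj₁ semi p q r p≢ q≢ r≢
    finish : ∀ v → E a v → ¬ Terminal v → Sweepable S
    finish v av v¬T = Resweep.resweep S full unlinked v av v¬T O range (C.fill-left rec) (C.fill-right rec)
      where
      module D = Contract S full unlinked v av v¬T
      O : Sweepable D.S^
      O = solve k D.S^ (ℕₚ.<-≤-trans D.smaller^ le) D.semi^ D.unlinked^
      range : D.Range-of.Range O
      range = D.Range-of.range O
      module C = Corners S full unlinked v av v¬T O range
      rec : Solver n (count V?)
      rec S′ lt = solve k S′ (ℕₚ.<-≤-trans lt le)
    fully : Dec (∃ λ x → V x × ¬ Terminal x) → Sweepable S
    fully (no noT) = Base.base S unlinked λ {x} v → case terminal? x of λ { (yes t) → t ; (no ¬t) → ⊥-elim (noT (x , v , ¬t)) }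
    -- A walk that avoids `b`, `c`, `d` can only escape to `a`; its last vertex before `a` is the
    -- one to contract.
    fully (yes (x , Vx , x¬T)) with full b c d x (Vx , x¬T ∘ inj₂ ∘ inj₁ , x¬T ∘ inj₂ ∘ inj₂ ∘ inj₁ , x¬T ∘ inj₂ ∘ inj₂ ∘ inj₂)
    ... | t , inj₂ (inj₁ p) , w = ⊥-elim (proj₁ (proj₂ (walk-end w)) p)
    ... | t , inj₂ (inj₂ (inj₁ p)) , w = ⊥-elim (proj₁ (proj₂ (proj₂ (walk-end w))) p)
    ... | t , inj₂ (inj₂ (inj₂ p)) , w = ⊥-elim (proj₂ (proj₂ (proj₂ (walk-end w))) p)
    ... | t , inj₁ refl , w with walk-last (x¬T ∘ inj₁) w
    ... | v , e , (_ , vb , vc , vd) = finish v (E-sym e) λ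
          { (inj₁ refl) → E-irr e ; (inj₂ (inj₁ p)) → vb p ; (inj₂ (inj₂ (inj₁ p))) → vc p ; (inj₂ (inj₂ (inj₂ p))) → vd p }

-- Integer sums over vertices and darts

-- Partial sums run over all of `Fin n` with the unwanted terms set to 0, so that the exchange and
-- permutation laws of `sum` apply to them.
pick : {P : Set} → Dec P → ℤ → ℤ
pick (yes _) x = x
pick (no _) _ = 0ℤ

pick-yes : {P : Set} (d : Dec P) {x : ℤ} → P → pick d x ≡ x
pick-yes (yes _) _ = refl
pick-yes (no ¬p) p = ⊥-elim (¬p p)

pick-no : {P : Set} (d : Dec P) {x : ℤ} → ¬ P → pick d x ≡ 0ℤ
pick-no (yes p) ¬p = ⊥-elim (¬p p)
pick-no (no _) _ = refl

pick-cong : {P Q : Set} (d : Dec P) (e : Dec Q) {x y : ℤ} → (P → Q) → (Q → P) → (P → x ≡ y) → pick d x ≡ pick e y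
pick-cong (yes p) e f g h = trans (h p) (sym (pick-yes e (f p)))
pick-cong (no ¬p) e f g h = sym (pick-no e (¬p ∘ g))

pick-0 : {P : Set} (d : Dec P) → pick d 0ℤ ≡ 0ℤ
pick-0 (yes _) = refl
pick-0 (no _) = refl

pick-+ : {P : Set} (d : Dec P) (x y : ℤ) → pick d (x ℤ.+ y) ≡ pick d x ℤ.+ pick d y
pick-+ (yes _) x y = refl
pick-+ (no _) x y = refl

pick-* : {P : Set} (d : Dec P) (c x : ℤ) → pick d (c ℤ.* x) ≡ c ℤ.* pick d x
pick-* (yes _) c x = refl
pick-* (no _) c x = sym (ℤₚ.*-zeroʳ c)

sum-0 : ∀ {n} {f : Fin n → ℤ} → (∀ i → f i ≡ 0ℤ) → sum f ≡ 0ℤ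
sum-0 {zero} h = refl
sum-0 {suc n} h = cong₂ ℤ._+_ (h zero) (sum-0 (h ∘ suc))

sum-* : ∀ {n} c (f : Fin n → ℤ) → sum (λ i → c ℤ.* f i) ≡ c ℤ.* sum f
sum-* c f = sym (*-distribˡ-sum c f)

sum-single : ∀ {n} (x : Fin n) (f : Fin n → ℤ) → sum (λ i → pick (i ≟ x) (f i)) ≡ f x
sum-single {suc n} zero f = trans (cong (λ t → f zero ℤ.+ t) (sum-0 {n} {λ _ → 0ℤ} λ i → refl)) (ℤₚ.+-identityʳ (f zero))
sum-single (suc x) f = trans (ℤₚ.+-identityˡ _) (trans (sum-cong-≗ λ i → pick-cong (suc i ≟ suc x) (i ≟ x) (λ { refl → refl }) (cong suc) (λ _ → refl))
  (sum-single x (f ∘ suc)))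

sumᴸ : ∀ {n} → (Fin n → ℤ) → List (Fin n) → ℤ
sumᴸ f [] = 0ℤ
sumᴸ f (x ∷ l) = f x ℤ.+ sumᴸ f l

sum-list : ∀ {n} (f : Fin n → ℤ) l → Unique l → sum (λ i → pick (i ∈? l) (f i)) ≡ sumᴸ f l
sum-list {n} f [] _ = sum-0 {n} {λ _ → 0ℤ} λ i → refl
sum-list {n} f (x ∷ l) (nx ∷ u) = trans (sum-cong-≗ split) (trans (∑-distrib-+ (λ i → pick (i ≟ x) (f i)) (λ i → pick (i ∈? l) (f i)))
  (cong₂ ℤ._+_ (sum-single x f) (sum-list f l u)))
  where
  split : ∀ i → pick (i ∈? (x ∷ l)) (f i) ≡ pick (i ≟ x) (f i) ℤ.+ pick (i ∈? l) (f i)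
  split i = go (i ≟ x)
    where
    go : (e : Dec (i ≡ x)) → pick (i ∈? (x ∷ l)) (f i) ≡ pick e (f i) ℤ.+ pick (i ∈? l) (f i)
    go (yes refl) = trans (pick-yes (i ∈? (i ∷ l)) (here refl))
        (sym (trans (cong (λ t → f i ℤ.+ t) (pick-no (i ∈? l) (All≢⇒∉ nx))) (ℤₚ.+-identityʳ (f i))))
    go (no ne) = trans (pick-cong (i ∈? (x ∷ l)) (i ∈? l) (λ { (here e) → ⊥-elim (ne e) ; (there j) → j }) there (λ _ → refl))
        (sym (ℤₚ.+-identityˡ _))

module _ {n : ℕ} (G : Graph n) where

  adj? : ∀ u v → Dec (Adj G u v)
  adj? u v = adj G u v ≟ᵇ true
    where
    _≟ᵇ_ : (x y : Bool) → Dec (x ≡ y)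
    true ≟ᵇ true = yes refl
    true ≟ᵇ false = no λ ()
    false ≟ᵇ true = no λ ()
    false ≟ᵇ false = yes refl

  adj-sym : ∀ {u v} → Adj G u v → Adj G v u
  adj-sym = Graph.sym G _ _

  Σᴺ : Fin n → (Fin n → ℤ) → ℤ
  Σᴺ u f = sum λ v → pick (adj? u v) (f v)

  Σᴰ : (Fin n → Fin n → ℤ) → ℤ
  Σᴰ f = sum λ u → Σᴺ u (f u)

  Σᴺ-cong : ∀ u {f g} → (∀ v → Adj G u v → f v ≡ g v) → Σᴺ u f ≡ Σᴺ u g
  Σᴺ-cong u h = sum-cong-≗ λ v → pick-cong (adj? u v) (adj? u v) id id (h v)

  Σᴺ-+ : ∀ u f g → Σᴺ u (λ v → f v ℤ.+ g v) ≡ Σᴺ u f ℤ.+ Σᴺ u g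
  Σᴺ-+ u f g = trans (sum-cong-≗ λ v → pick-+ (adj? u v) (f v) (g v)) (∑-distrib-+ (λ v → pick (adj? u v) (f v)) (λ v → pick (adj? u v) (g v)))

  Σᴺ-* : ∀ u c f → Σᴺ u (λ v → c ℤ.* f v) ≡ c ℤ.* Σᴺ u f
  Σᴺ-* u c f = trans (sum-cong-≗ λ v → pick-* (adj? u v) c (f v)) (sum-* c (λ v → pick (adj? u v) (f v)))

  Σᴺ-neg : ∀ u f → Σᴺ u (λ v → ℤ.- f v) ≡ ℤ.- Σᴺ u f
  Σᴺ-neg u f = trans (Σᴺ-cong u λ v _ → sym (ℤₚ.-1*i≡-i (f v))) (trans (Σᴺ-* u (ℤ.- 1ℤ) f) (ℤₚ.-1*i≡-i _))

  Σᴺ-- : ∀ u f g → Σᴺ u (λ v → f v ℤ.- g v) ≡ Σᴺ u f ℤ.- Σᴺ u g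
  Σᴺ-- u f g = trans (Σᴺ-+ u f (λ v → ℤ.- g v)) (cong (λ t → Σᴺ u f ℤ.+ t) (Σᴺ-neg u g))

  Σᴰ-cong : ∀ {f g} → (∀ u v → Adj G u v → f u v ≡ g u v) → Σᴰ f ≡ Σᴰ g
  Σᴰ-cong h = sum-cong-≗ λ u → Σᴺ-cong u (h u)

  Σᴰ-+ : ∀ f g → Σᴰ (λ u v → f u v ℤ.+ g u v) ≡ Σᴰ f ℤ.+ Σᴰ g
  Σᴰ-+ f g = trans (sum-cong-≗ λ u → Σᴺ-+ u (f u) (g u)) (∑-distrib-+ (λ u → Σᴺ u (f u)) (λ u → Σᴺ u (g u)))

  Σᴰ-flip : ∀ f → Σᴰ f ≡ Σᴰ (λ u v → f v u)
  Σᴰ-flip f = trans (∑-comm (λ u v → pick (adj? u v) (f u v)))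
    (sum-cong-≗ λ v → sum-cong-≗ λ u → pick-cong (adj? u v) (adj? v u) adj-sym adj-sym (λ _ → refl))

  Antisym : (Fin n → Fin n → ℤ) → Set
  Antisym z = ∀ u v → z u v ≡ ℤ.- z v u

  Circulation : (Fin n → Fin n → ℤ) → Set
  Circulation z = ∀ u → Σᴺ u (z u) ≡ 0ℤ

  Invariant : Rotation G → (Fin n → Fin n → ℤ) → Set
  Invariant ρ f = ∀ u v → Adj G u v → f v (Rotation.σ ρ v u) ≡ f u v

  Potential : Rotation G → (Fin n → Fin n → ℤ) → (Fin n → Fin n → ℤ) → Set
  Potential ρ z f = Invariant ρ f × (∀ u v → Adj G u v → f u v ℤ.- f v u ≡ z u v)

  -- Vanishing first homology of the surface carrying the embedding.
  Exact : Rotation G → Set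
  Exact ρ = ∀ z → Antisym z → Circulation z → ∃ λ f → Potential ρ z f

-- Drawing a graph along a sweep

module Drawing {n : ℕ} (G : Graph n) (c : Fin n) where

  private
    V : Set
    V = Fin n
    Pot : Set
    Pot = V → V → ℤ

  Adj≢ : ∀ {x y} → Adj G x y → x ≢ y
  Adj≢ e refl = Graph.irrefl G _ e

  -- Chain f v q l p: turning clockwise through the edges from v to the members of l, the value of
  -- f on the faces around v changes from q to p.
  Chain : Pot → V → ℤ → List V → ℤ → Set
  Chain f v q [] p = q ≡ p
  Chain f v q (w ∷ l) p = f v w ≡ q × Chain f v (f w v) l p

  chain-cong : ∀ {f g v q} l {p} → (∀ {w} → w ∈ l → f v w ≡ g v w × f w v ≡ g w v) → Chain f v q l p → Chain g v q l p
  chain-cong [] h ch = ch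
  chain-cong {f} {g} {v} (w ∷ l) h (e , ch) = trans (sym (proj₁ (h (here refl)))) e ,
    subst (λ t → Chain g v t l _) (proj₂ (h (here refl))) (chain-cong l (h ∘ there) ch)

  chain-snoc : ∀ {f v q} l {p w} → Chain f v q l p → f v w ≡ p → Chain f v q (l ++ w ∷ []) (f w v)
  chain-snoc [] refl e = e , refl
  chain-snoc (x ∷ l) (e , ch) e′ = e , chain-snoc l ch e′

  chain-++ : ∀ {f v q} l {m β p} → Chain f v q l β → Chain f v β m p → Chain f v q (l ++ m) p
  chain-++ [] refl ch = ch
  chain-++ (x ∷ l) (e , ch) ch′ = e , chain-++ l ch ch′

  chain-sum : ∀ {f z v q} l {p} → (∀ {w} → w ∈ l → f v w ℤ.- f w v ≡ z w) → Chain f v q l p → q ≡ sumᴸ z l ℤ.+ p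
  chain-sum [] h refl = sym (ℤₚ.+-identityˡ _)
  chain-sum {f} {z} {v} {q} (w ∷ l) {p} h (refl , ch) =
    trans (lem (f v w) (f w v)) (trans (cong₂ ℤ._+_ (h (here refl)) (chain-sum l (h ∘ there) ch)) (sym (ℤₚ.+-assoc (z w) (sumᴸ z l) p)))
    where
    lem : ∀ x y → x ≡ (x ℤ.- y) ℤ.+ y
    lem = solve-∀

  -- `R v` holds the edges drawn to vertices that came after `v` on the frontier, newest first;
  -- `L v` those to vertices before it, oldest first. Hence `R v ++ L v` is a clockwise turn around
  -- `v` from the frontier down to its lower side and up again.
  record Picture : Set where
    field
      R L : V → List V
    ℓ : V → List V
    ℓ v = R v ++ L v
    field
      ℓ-sym : ∀ {v w} → w ∈ ℓ v → v ∈ ℓ w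
      ℓ-adj : ∀ {v w} → w ∈ ℓ v → Adj G v w
      ℓ-unique : ∀ v → Unique (ℓ v)

  open Picture

  -- The faces on both sides of the frontier at v have values p and q; the value below v is β.
  Around : Picture → Pot → V → ℤ → ℤ → Set
  Around P f v q p = ∃ λ β → (v ≡ c → β ≡ 0ℤ) × Chain f v q (R P v) β × Chain f v β (L P v) p

  -- Each slot between consecutive frontier vertices carries the value of the face above it. At a
  -- vertex the neighbouring values differ by the flow through the edges drawn there so far; beyond
  -- both ends of the frontier is the outer face, with value 0.
  Front : Picture → Pot → ℤ → List V → Set
  Front P f p [] = p ≡ 0ℤ
  Front P f p (x ∷ Λ) = ∃ λ q → Around P f x q p × Front P f q Λ

  record Potentials (P : Picture) (Λ : List V) (z : Pot) : Set where
    field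
      f : Pot
      diff : ∀ {v w} → w ∈ ℓ P v → f v w ℤ.- f w v ≡ z v w
      front : Front P f 0ℤ Λ
      -- Off the frontier a vertex is untouched or complete; in both cases the values close up
      -- around it.
      finished : ∀ {v} → v ∉ Λ → ∃ λ p → Around P f v p p

  around-cong : ∀ P Q {f g v q p} → R P v ≡ R Q v → L P v ≡ L Q v →
    (∀ {w} → w ∈ ℓ P v → f v w ≡ g v w × f w v ≡ g w v) → Around P f v q p → Around Q g v q p
  around-cong P Q {g = g} {v} {q} {p} eR eL h (β , h₀ , ch , ch′) = β , h₀ ,
    subst (λ l → Chain g v q l β) eR (chain-cong (R P v) (h ∘ ∈-++⁺ˡ) ch) ,
    subst (λ l → Chain g v β l p) eL (chain-cong (L P v) (h ∘ ∈-++⁺ʳ (R P v)) ch′)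

  set : {A : Set} → (V → A) → V → A → V → A
  set h x a v with v ≟ x
  ... | yes _ = a
  ... | no _ = h v

  set-eq : {A : Set} (h : V → A) (x : V) (a : A) → set h x a x ≡ a
  set-eq h x a with x ≟ x
  ... | yes _ = refl
  ... | no ne = ⊥-elim (ne refl)

  set-≢ : {A : Set} (h : V → A) {x v : V} (a : A) → v ≢ x → set h x a v ≡ h v
  set-≢ h {x} {v} a ne with v ≟ x
  ... | yes e = ⊥-elim (ne e)
  ... | no _ = refl

  set₂ : Pot → V → V → ℤ → Pot
  set₂ f x y t = set f x (set (f x) y t)

  set₂-eq : ∀ f x y t → set₂ f x y t x y ≡ t
  set₂-eq f x y t = trans (cong (λ k → k y) (set-eq f x (set (f x) y t))) (set-eq (f x) y t)

  set₂-≢ : ∀ f {x y t u v} → ¬ (u ≡ x × v ≡ y) → set₂ f x y t u v ≡ f u v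
  set₂-≢ f {x} {y} {t} {u} {v} ne with u ≟ x
  ... | no _ = refl
  ... | yes refl with v ≟ y
  ... | no _ = refl
  ... | yes e = ⊥-elim (ne (refl , e))

  module _ (P : Picture) {x y : V} (e : Adj G x y) (fresh : y ∉ ℓ P x) where

    private
      x≢y : x ≢ y
      x≢y = Adj≢ e
      fresh′ : x ∉ ℓ P y
      fresh′ i = fresh (ℓ-sym P i)

    R′ L′ : V → List V
    R′ = set (R P) x (y ∷ R P x)
    L′ = set (L P) y (L P y ++ x ∷ [])

    R-x : R′ x ≡ y ∷ R P x
    R-x = set-eq (R P) x _
    R-≢ : ∀ {v} → v ≢ x → R′ v ≡ R P v
    R-≢ = set-≢ (R P) _
    L-y : L′ y ≡ L P y ++ x ∷ []
    L-y = set-eq (L P) y _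
    L-≢ : ∀ {v} → v ≢ y → L′ v ≡ L P v
    L-≢ = set-≢ (L P) _

    at-x : R′ x ++ L′ x ≡ y ∷ ℓ P x
    at-x = cong₂ _++_ R-x (L-≢ x≢y)

    at-y : R′ y ++ L′ y ≡ ℓ P y ++ x ∷ []
    at-y = trans (cong₂ _++_ (R-≢ (x≢y ∘ sym)) L-y) (sym (Listₚ.++-assoc (R P y) (L P y) (x ∷ [])))

    at-≢ : ∀ {v} → v ≢ x → v ≢ y → R′ v ++ L′ v ≡ ℓ P v
    at-≢ p q = cong₂ _++_ (R-≢ p) (L-≢ q)

    private
      New : V → V → Set
      New v w = (v ≡ x × w ≡ y) ⊎ (v ≡ y × w ≡ x)

    ∈-new : ∀ {v w} → w ∈ R′ v ++ L′ v → w ∈ ℓ P v ⊎ New v w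
    ∈-new {v} {w} i = go (v ≟ x) (v ≟ y)
      where
      go : Dec (v ≡ x) → Dec (v ≡ y) → w ∈ ℓ P v ⊎ New v w
      go (yes refl) _ = case subst (w ∈_) at-x i of λ { (here p) → inj₂ (inj₁ (refl , p)) ; (there j) → inj₁ j }
      go (no _) (yes refl) = case ∈-++⁻ (ℓ P y) (subst (w ∈_) at-y i) of λ { (inj₁ j) → inj₁ j ; (inj₂ (here p)) → inj₂ (inj₂ (refl , p)) }
      go (no p) (no q) = inj₁ (subst (w ∈_) (at-≢ p q) i)

    new-∈ : ∀ {v w} → w ∈ ℓ P v ⊎ New v w → w ∈ R′ v ++ L′ v
    new-∈ (inj₂ (inj₁ (refl , refl))) = subst (y ∈_) (sym at-x) (here refl)
    new-∈ (inj₂ (inj₂ (refl , refl))) = subst (x ∈_) (sym at-y) (∈-++⁺ʳ (ℓ P y) (here refl))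
    new-∈ {v} {w} (inj₁ i) = go (v ≟ x) (v ≟ y)
      where
      go : Dec (v ≡ x) → Dec (v ≡ y) → w ∈ R′ v ++ L′ v
      go (yes refl) _ = subst (w ∈_) (sym at-x) (there i)
      go (no _) (yes refl) = subst (w ∈_) (sym at-y) (∈-++⁺ˡ i)
      go (no p) (no q) = subst (w ∈_) (sym (at-≢ p q)) i

    draw : Picture
    draw = record
      { R = R′ ; L = L′
      ; ℓ-sym = λ i → new-∈ (case ∈-new i of λ { (inj₁ j) → inj₁ (ℓ-sym P j) ; (inj₂ (inj₁ p)) → inj₂ (inj₂ (proj₂ p , proj₁ p))
                                               ; (inj₂ (inj₂ p)) → inj₂ (inj₁ (proj₂ p , proj₁ p)) })
      ; ℓ-adj = λ i → case ∈-new i of λ { (inj₁ j) → ℓ-adj P j ; (inj₂ (inj₁ (refl , refl))) → e ; (inj₂ (inj₂ (refl , refl))) → adj-sym G e }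
      ; ℓ-unique = λ v → uniq v (v ≟ x) (v ≟ y) }
      where
      uniq : ∀ v → Dec (v ≡ x) → Dec (v ≡ y) → Unique (R′ v ++ L′ v)
      uniq v (yes refl) _ = subst Unique (sym at-x) (∉⇒All≢ fresh ∷ ℓ-unique P x)
      uniq v (no _) (yes refl) = subst Unique (sym at-y) (unique-++⁺ (ℓ-unique P y) ([] ∷ []) λ { i (here refl) → fresh′ i })
      uniq v (no p) (no q) = subst Unique (sym (at-≢ p q)) (ℓ-unique P v)

    module _ (z : Pot) (anti : Antisym G z) (f : Pot) (diff : ∀ {v w} → w ∈ ℓ P v → f v w ℤ.- f w v ≡ z v w) where

      -- h is the value of the face into which the edge from x to y is drawn.
      module _ (h : ℤ) where
        f′ : Pot
        -- The face below the new edge keeps the value `h`; the one above it receives `h ℤ.+ z x y`.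
        f′ = set₂ (set₂ f y x h) x y (h ℤ.+ z x y)

        f-xy : f′ x y ≡ h ℤ.+ z x y
        f-xy = set₂-eq (set₂ f y x h) x y _

        f-yx : f′ y x ≡ h
        f-yx = trans (set₂-≢ (set₂ f y x h) λ (p , _) → x≢y (sym p)) (set₂-eq f y x h)

        f-old : ∀ {v w} → ¬ New v w → f′ v w ≡ f v w
        f-old ne = trans (set₂-≢ (set₂ f y x h) (ne ∘ inj₁)) (set₂-≢ f (ne ∘ inj₂))

        old-¬new : ∀ {v w} → w ∈ ℓ P v → ¬ New v w × ¬ New w v
        old-¬new i = (λ { (inj₁ (refl , refl)) → fresh i ; (inj₂ (refl , refl)) → fresh′ i })
                   , (λ { (inj₁ (refl , refl)) → fresh′ i ; (inj₂ (refl , refl)) → fresh i })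

        f-ℓ : ∀ {v w} → w ∈ ℓ P v → f v w ≡ f′ v w × f w v ≡ f′ w v
        f-ℓ i = sym (f-old (proj₁ (old-¬new i))) , sym (f-old (proj₂ (old-¬new i)))

        diff′ : ∀ {v w} → w ∈ ℓ draw v → f′ v w ℤ.- f′ w v ≡ z v w
        diff′ i with ∈-new i
        ... | inj₁ j = trans (cong₂ ℤ._-_ (sym (proj₁ (f-ℓ j))) (sym (proj₂ (f-ℓ j)))) (diff j)
        ... | inj₂ (inj₁ (refl , refl)) = trans (cong₂ ℤ._-_ f-xy f-yx) (lem h (z x y))
          where
          lem : ∀ h t → (h ℤ.+ t) ℤ.- h ≡ t
          lem = solve-∀
        ... | inj₂ (inj₂ (refl , refl)) = trans (cong₂ ℤ._-_ f-yx f-xy) (trans (lem h (z x y)) (sym (anti y x)))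
          where
          lem : ∀ h t → h ℤ.- (h ℤ.+ t) ≡ ℤ.- t
          lem = solve-∀

        around-≢ : ∀ {v q p} → v ≢ x → v ≢ y → Around P f v q p → Around draw f′ v q p
        around-≢ nx ny = around-cong P draw (sym (R-≢ nx)) (sym (L-≢ ny)) f-ℓ

        front-≢ : ∀ {p} Λ → x ∉ Λ → y ∉ Λ → Front P f p Λ → Front draw f′ p Λ
        front-≢ [] _ _ fr = fr
        front-≢ (w ∷ Λ) nx ny (q , ar , fr) = q , around-≢ (nx ∘ here ∘ sym) (ny ∘ here ∘ sym) ar , front-≢ Λ (nx ∘ there) (ny ∘ there) fr

        around-x : ∀ {p} → Around P f x h p → Around draw f′ x (h ℤ.+ z x y) p
        around-x {p} (β , h₀ , ch , ch′) = β , h₀ ,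
          subst (λ l → Chain f′ x (h ℤ.+ z x y) l β) (sym R-x)
            (f-xy , subst (λ t → Chain f′ x t (R P x) β) (sym f-yx) (chain-cong (R P x) (f-ℓ ∘ ∈-++⁺ˡ) ch)) ,
          subst (λ l → Chain f′ x β l p) (sym (L-≢ x≢y)) (chain-cong (L P x) (f-ℓ ∘ ∈-++⁺ʳ (R P x)) ch′)

        around-y : ∀ {q} → Around P f y q h → Around draw f′ y q (h ℤ.+ z x y)
        around-y {q} (β , h₀ , ch , ch′) = β , h₀ ,
          subst (λ l → Chain f′ y q l β) (sym (R-≢ (x≢y ∘ sym))) (chain-cong (R P y) (f-ℓ ∘ ∈-++⁺ˡ) ch) ,
          subst₂ (Chain f′ y β) (sym L-y) f-xy
            (chain-snoc (L P y) (chain-cong (L P y) (f-ℓ ∘ ∈-++⁺ʳ (R P y)) ch′) f-yx)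

      front-draw : ∀ {p Λ} → Unique Λ → Consec x y Λ → Front P f p Λ → ∃ λ h → Front draw (f′ h) p Λ
      front-draw {Λ = _ ∷ _ ∷ Λ} ((_ ∷ nx) ∷ ny ∷ _) here (h , ax , q , ay , fr) =
        h , h ℤ.+ z x y , around-x h ax , q , around-y h ay , front-≢ h Λ (All≢⇒∉ nx) (All≢⇒∉ ny) fr
      front-draw (nw ∷ u) (there cxy) (q , aw , fr) with front-draw u cxy fr
      ... | h , fr′ = h , q , around-≢ h (λ { refl → All≢⇒∉ nw (consec-∈ˡ cxy) }) (λ { refl → All≢⇒∉ nw (consec-∈ʳ cxy) }) aw , fr′

    draw-potentials : ∀ {Λ z} → Unique Λ → Consec x y Λ → Antisym G z → Potentials P Λ z → Potentials draw Λ z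
    draw-potentials {Λ} {z} u cxy anti pot with front-draw z anti f diff u cxy front
      where open Potentials pot
    ... | h , fr = record
      { f = f′ z anti f diff h ; diff = diff′ z anti f diff h ; front = fr
      ; finished = λ ni → let (p , ar) = finished ni in p ,
          around-≢ z anti f diff h (λ { refl → ni (consec-∈ˡ cxy) }) (λ { refl → ni (consec-∈ʳ cxy) }) ar }
      where open Potentials pot

  record Extends (Λ : List V) (P Q : Picture) : Set where
    field
      mono : ∀ {v w} → w ∈ ℓ P v → w ∈ ℓ Q v
      off : ∀ {v} → v ∉ Λ → R P v ≡ R Q v × L P v ≡ L Q v
      keeps : ∀ {z} → Antisym G z → Potentials P Λ z → Potentials Q Λ z

  -- The recursion descends through the suffixes `M`, while the frontier `Λ` on which the potentials
  -- live stays the same.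
  draw-all : ∀ {Λ} → Unique Λ → ∀ M → (∀ {x y} → Consec x y M → Consec x y Λ) → ∀ P →
    ∃ λ Q → Extends Λ P Q × (∀ {x y} → Consec x y M → Adj G x y → y ∈ ℓ Q x)
  draw-all u [] emb P = P , record { mono = id ; off = λ _ → refl , refl ; keeps = λ _ → id } , λ ()
  draw-all u (x ∷ []) emb P = P , record { mono = id ; off = λ _ → refl , refl ; keeps = λ _ → id } , λ { (there ()) }
  draw-all {Λ} u (x ∷ y ∷ M) emb P with draw-all u (y ∷ M) (emb ∘ there) P
  ... | Q , ext , dr with adj? G x y | y ∈? ℓ Q x
  ... | no ne | _ = Q , ext , λ { here e → ⊥-elim (ne e) ; (there cxy) e → dr cxy e }
  ... | yes _ | yes i = Q , ext , λ { here e → i ; (there cxy) e → dr cxy e }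
  ... | yes e | no ni = draw Q e ni , record
      { mono = λ i → new-∈ Q e ni (inj₁ (mono i))
      ; off = λ nv → let (p , q) = off nv in
          trans p (sym (R-≢ Q e ni λ { refl → nv (consec-∈ˡ xy) })) , trans q (sym (L-≢ Q e ni λ { refl → nv (consec-∈ʳ xy) }))
      ; keeps = λ anti pot → draw-potentials Q e ni u xy anti (keeps anti pot) }
      , λ { here _ → new-∈ Q e ni (inj₂ (inj₁ (refl , refl))) ; (there cxy) e′ → new-∈ Q e ni (inj₁ (dr cxy e′)) }
    where
    open Extends ext
    xy : Consec x y Λ
    xy = emb here

-- Running a sweep

module _ {A : Set} where

  step-∈ : ∀ {l m : List A} (s : Step l m) {v} → v ∈ m → v ∈ l ⊎ v ∈ insertedˢ s
  step-∈ (ins v) (here p) = inj₁ (here p)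
  step-∈ (ins v) (there (here p)) = inj₂ (here p)
  step-∈ (ins v) (there (there i)) = inj₁ (there i)
  step-∈ del (here p) = inj₁ (here p)
  step-∈ del (there i) = inj₁ (there (there i))
  step-∈ (skip s) (here p) = inj₁ (here p)
  step-∈ (skip s) (there i) with step-∈ s i
  ... | inj₁ j = inj₁ (there j)
  ... | inj₂ j = inj₂ j

  step-unique : ∀ {l m : List A} (s : Step l m) → Unique l → (∀ {v} → v ∈ insertedˢ s → v ∉ l) → Unique m
  step-unique (ins v) ((xz ∷ nx) ∷ u) f = (((λ p → f (here refl) (here (sym p))) ∷ xz ∷ nx)) ∷ (∉⇒All≢ (f (here refl) ∘ there) ∷ u)
  step-unique del ((_ ∷ nx) ∷ _ ∷ u) f = nx ∷ u
  step-unique (skip s) (nw ∷ u) f = ∉⇒All≢ (λ i → case step-∈ s i of λ { (inj₁ j) → All≢⇒∉ nw j ; (inj₂ j) → f j (here refl) })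
    ∷ step-unique s u (λ j → f j ∘ there)

  -- Applied to a vertex at its deletion: an edge still missing there would never be met again, so
  -- none is missing.
  uncovered : ∀ {l m : List A} (S : Sweep l m) {v w} → v ∉ l → v ∉ inserted S → ¬ Covers S v w
  uncovered done nl ni (inj₁ c) = nl (consec-∈ˡ c)
  uncovered done nl ni (inj₂ c) = nl (consec-∈ʳ c)
  uncovered (s ▸ S) nl ni (inj₁ (inj₁ c)) = nl (consec-∈ˡ c)
  uncovered (s ▸ S) nl ni (inj₁ (inj₂ c)) = nl (consec-∈ʳ c)
  uncovered (s ▸ S) nl ni (inj₂ c) = uncovered S (λ i → case step-∈ s i of λ
    { (inj₁ j) → nl j ; (inj₂ j) → ni (∈-++⁺ˡ j) }) (ni ∘ ∈-++⁺ʳ (insertedˢ s)) c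

module Running {n : ℕ} (G : Graph n) (c : Fin n) where
  open Drawing G c
  open Picture

  private
    V : Set
    V = Fin n

  -- A full turn around a complete vertex changes the value by the divergence of `z`, which is zero.
  balanced : ∀ P {z} f → (∀ {v w} → w ∈ ℓ P v → f v w ℤ.- f w v ≡ z v w) → Circulation G z → ∀ {y} → (∀ {w} → Adj G y w → w ∈ ℓ P y) →
    ∀ {q p} → Around P f y q p → q ≡ p
  balanced P {z} f diff circ {y} full {q} {p} (β , _ , ch , ch′) =
    trans (chain-sum (ℓ P y) diff (chain-++ (R P y) ch ch′)) (trans (cong (λ t → t ℤ.+ p) zero-sum) (ℤₚ.+-identityˡ p))
    where
    zero-sum : sumᴸ (z y) (ℓ P y) ≡ 0ℤ
    zero-sum = trans (sym (sum-list (z y) (ℓ P y) (ℓ-unique P y)))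
      (trans (sum-cong-≗ λ i → pick-cong (i ∈? ℓ P y) (adj? G y i) (ℓ-adj P) full (λ _ → refl)) (circ y))

  front-around : ∀ P {f p Λ v} → Front P f p Λ → v ∈ Λ → ∃ λ q → ∃ λ p′ → Around P f v q p′
  front-around P (q , ar , _) (here refl) = q , _ , ar
  front-around P (_ , _ , fr) (there i) = front-around P fr i

  -- An inserted vertex has no edges yet and a deleted one has them all. In both cases the slots on
  -- its two sides carry one value, so a slot is split or two slots are merged consistently.
  step-front : ∀ P {f p l m} (s : Step l m) → Unique l →
    (∀ {v} → v ∈ insertedˢ s → R P v ≡ [] × L P v ≡ [] × v ≢ c) →
    (∀ {y} → y ∈ l → y ∉ m → ∀ {q p} → Around P f y q p → q ≡ p) → Front P f p l → Front P f p m
  step-front P {f} (ins v) u fresh bal (q , ar , fr) = q , ar , q ,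
    (q , (λ e → ⊥-elim (proj₂ (proj₂ (fresh (here refl))) e)) ,
      subst (λ l → Chain f v q l q) (sym (proj₁ (fresh (here refl)))) refl ,
      subst (λ l → Chain f v q l q) (sym (proj₁ (proj₂ (fresh (here refl))))) refl) , fr
  step-front P {f} (del {x} {y} {z} {s}) ((x≢y ∷ _) ∷ ny ∷ _) fresh bal (q , ax , q′ , ay , fr) = q , ax ,
    subst (λ t → Front P f t (z ∷ s)) (bal (there (here refl)) y∉ ay) fr
    where
    y∉ : y ∉ x ∷ z ∷ s
    y∉ (here e) = x≢y (sym e)
    y∉ (there i) = All≢⇒∉ ny i
  step-front P (skip s) (nw ∷ u) fresh bal (q , ar , fr) = q , ar ,
    step-front P s u fresh (λ i ni → bal (there i) λ { (here refl) → All≢⇒∉ nw i ; (there j) → ni j }) fr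

  record Final (P : Picture) (Λ : List V) : Set where
    field
      complete : ∀ {u w} → Adj G u w → w ∈ ℓ P u
      solves : ∀ {z} → Antisym G z → Circulation G z → Potentials P Λ z

  -- Invariant: edges between frontier neighbours are drawn, every other edge is drawn or will be
  -- met later, and vertices yet to be inserted are untouched.
  run : ∀ {Λ Λ′} (S : Sweep Λ Λ′) P → Unique Λ → Unique (inserted S) → (∀ {v} → v ∈ inserted S → v ∉ Λ) →
    c ∉ inserted S → (∀ {v} → v ∈ inserted S → R P v ≡ [] × L P v ≡ []) →
    (∀ {x y} → Consec x y Λ → Adj G x y → y ∈ ℓ P x) →
    (∀ {u w} → Adj G u w → w ∈ ℓ P u ⊎ Covers S u w) →
    (∀ {z} → Antisym G z → Circulation G z → Potentials P Λ z) → Σ Picture λ Q → Final Q Λ′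
  run done P u _ _ _ _ drawn cov pots = P , record { solves = pots ; complete = λ e → case cov e of λ
    { (inj₁ i) → i ; (inj₂ (inj₁ cu)) → drawn cu e ; (inj₂ (inj₂ cu)) → ℓ-sym P (drawn cu (adj-sym G e)) } }
  run {Λ} (_▸_ {m = M} s S) P u ui fresh c∉ empty drawn cov pots with draw-all uM M id P
    where
    uM = step-unique s u (λ i → fresh (∈-++⁺ˡ i))
  ... | Q , ext , dr = run S Q uM (proj₁ (proj₂ (unique-++⁻ (insertedˢ s) ui))) freshM (c∉ ∘ ∈-++⁺ʳ (insertedˢ s))
      (λ i → let (p , q) = off (freshM i) ; (p′ , q′) = empty (∈-++⁺ʳ (insertedˢ s) i) in trans (sym p) p′ , trans (sym q) q′)
      dr (λ e → case cov′ e of λ { (inj₁ i) → inj₁ (mono i) ; (inj₂ h) → inj₂ h })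
      (λ anti circ → keeps anti (step-potentials anti circ))
    where
    open Extends ext
    uM : Unique M
    uM = step-unique s u (λ i → fresh (∈-++⁺ˡ i))
    freshM : ∀ {v} → v ∈ inserted S → v ∉ M
    freshM i j = case step-∈ s j of λ { (inj₁ k) → fresh (∈-++⁺ʳ (insertedˢ s) i) k
                                      ; (inj₂ k) → proj₂ (proj₂ (unique-++⁻ (insertedˢ s) ui)) k i }
    cov′ : ∀ {u w} → Adj G u w → w ∈ ℓ P u ⊎ Covers S u w
    cov′ e = case cov e of λ { (inj₁ i) → inj₁ i ; (inj₂ (inj₁ (inj₁ cu))) → inj₁ (drawn cu e)
                             ; (inj₂ (inj₁ (inj₂ cu))) → inj₁ (ℓ-sym P (drawn cu (adj-sym G e))) ; (inj₂ (inj₂ h)) → inj₂ h }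
    gone : ∀ {y} → y ∈ Λ → y ∉ M → ∀ {w} → Adj G y w → w ∈ ℓ P y
    gone yΛ yM e = case cov′ e of λ { (inj₁ i) → i ; (inj₂ h) → ⊥-elim (uncovered S yM (λ i → fresh (∈-++⁺ʳ (insertedˢ s) i) yΛ) h) }
    step-potentials : ∀ {z} → Antisym G z → Circulation G z → Potentials P M z
    step-potentials {z} anti circ = record
      { f = f ; diff = diff
      ; front = step-front P s u (λ i → let (p , q) = empty (∈-++⁺ˡ i) in p , q , λ { refl → c∉ (∈-++⁺ˡ i) })
          (λ i ni → balanced P f diff circ (gone i ni)) front
      ; finished = fin }
      where
      open Potentials (pots anti circ)
      fin : ∀ {v} → v ∉ M → ∃ λ p → Around P f v p p
      fin {v} nv with v ∈? Λ
      ... | no nΛ = finished nΛ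
      ... | yes i with front-around P front i
      ... | q , p , ar = p , subst (λ t → Around P f v t p) (balanced P f diff circ (gone i nv) ar) ar

  blank : Picture
  blank = record { R = λ _ → [] ; L = λ _ → [] ; ℓ-sym = λ () ; ℓ-adj = λ () ; ℓ-unique = λ _ → [] }

  -- At first there is only the outer face, so the value below every vertex is 0. For `c`, which
  -- must not be inserted by the sweep, this is recorded for good.
  blank-around : ∀ v → Around blank (λ _ _ → 0ℤ) v 0ℤ 0ℤ
  blank-around v = 0ℤ , (λ _ → refl) , refl , refl

  blank-front : ∀ Λ → Front blank (λ _ _ → 0ℤ) 0ℤ Λ
  blank-front [] = refl
  blank-front (x ∷ Λ) = 0ℤ , blank-around x , blank-front Λ

  picture : ∀ {Λ Λ′} (S : Sweep Λ Λ′) → Unique Λ → Unique (inserted S) → (∀ {v} → v ∈ inserted S → v ∉ Λ) →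
    c ∉ inserted S → (∀ {u w} → Adj G u w → Covers S u w) → Σ Picture λ Q → Final Q Λ′
  picture {Λ} S u ui fresh c∉ cov with draw-all u Λ id blank
  ... | P , ext , dr = run S P u ui fresh c∉ (λ i → let (p , q) = off (fresh i) in sym p , sym q) dr (inj₂ ∘ cov)
      (λ anti circ → keeps anti (record { f = λ _ _ → 0ℤ ; diff = λ () ; front = blank-front Λ ; finished = λ {v} _ → 0ℤ , blank-around v }))
    where open Extends ext

-- Turning around a vertex

module _ {n : ℕ} where

  branch : {P : Set} → Dec P → Fin n → Fin n → Fin n
  branch (yes _) x y = x
  branch (no _) x y = y

  -- `h` is the head of the entire list, to which its last entry wraps around.
  next : Fin n → List (Fin n) → Fin n → Fin n
  next h [] u = u
  next h (x ∷ []) u = branch (x ≟ u) h u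
  next h (x ∷ y ∷ l) u = branch (x ≟ u) y (next h (y ∷ l) u)

  turn : List (Fin n) → Fin n → Fin n
  turn [] u = u
  turn (h ∷ l) u = next h (h ∷ l) u

  next-consec : ∀ {h l u w} → Unique l → Consec u w l → next h l u ≡ w
  next-consec {u = u} _ here with u ≟ u
  ... | yes _ = refl
  ... | no ne = ⊥-elim (ne refl)
  next-consec {l = x ∷ y ∷ l} {u} (nx ∷ uq) (there c) with x ≟ u
  ... | yes refl = ⊥-elim (All≢⇒∉ nx (consec-∈ˡ c))
  ... | no _ = next-consec uq c
  next-consec {l = x ∷ []} _ (there ())

  next-last : ∀ {h l u} → Unique l → Last u l → next h l u ≡ h
  next-last {u = u} _ last with u ≟ u
  ... | yes _ = refl
  ... | no ne = ⊥-elim (ne refl)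
  next-last {l = x ∷ y ∷ l} {u} (nx ∷ uq) (there lt) with x ≟ u
  ... | yes refl = ⊥-elim (All≢⇒∉ nx (last-∈ lt))
  ... | no _ = next-last uq lt

  next-∈ : ∀ {h} l {u} → u ∈ l → next h l u ∈ h ∷ l
  next-∈ (x ∷ []) {u} i with x ≟ u
  ... | yes _ = here refl
  ... | no _ = there i
  next-∈ (x ∷ y ∷ l) {u} i with x ≟ u
  ... | yes _ = there (there (here refl))
  next-∈ (x ∷ y ∷ l) (here refl) | no ne = ⊥-elim (ne refl)
  next-∈ (x ∷ y ∷ l) (there i) | no _ = case next-∈ (y ∷ l) i of λ { (here p) → here p ; (there j) → there (there j) }

  turn-∈ : ∀ l {u} → u ∈ l → turn l u ∈ l
  turn-∈ (h ∷ l) i with next-∈ (h ∷ l) i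
  ... | here p = here p
  ... | there j = j

module _ {n : ℕ} (G : Graph n) {A : Set} where

  iter-+ : ∀ (f : A → A) j k x → iter G f (j + k) x ≡ iter G f j (iter G f k x)
  iter-+ f zero k x = refl
  iter-+ f (suc j) k x = cong f (iter-+ f j k x)

module _ {n : ℕ} (G : Graph n) where

  turn-cyclic : ∀ l → Unique l → ∀ {u w} → u ∈ l → w ∈ l → ∃ λ k → iter G (turn l) k u ≡ w
  turn-cyclic (h ∷ l) uq {u} {w} i j = trans-reach (to-end (h ∷ l) id (λ {x} lt → lt) i) (from h l id j)
    where
    f : Fin n → Fin n
    f = turn (h ∷ l)
    Reach : Fin n → Fin n → Set
    Reach u w = ∃ λ k → iter G f k u ≡ w
    trans-reach : ∀ {u v w} → Reach u v → Reach v w → Reach u w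
    trans-reach {u} (k , refl) (m , refl) = m + k , iter-+ G f m k u
    from : ∀ x s → (∀ {u w} → Consec u w (x ∷ s) → Consec u w (h ∷ l)) → ∀ {w} → w ∈ x ∷ s → Reach x w
    from x s emb (here refl) = 0 , refl
    from x (y ∷ s) emb (there i) = trans-reach (1 , next-consec uq (emb here)) (from y s (emb ∘ there) i)
    to-end : ∀ m → (∀ {u w} → Consec u w m → Consec u w (h ∷ l)) → (∀ {x} → Last x m → Last x (h ∷ l)) →
      ∀ {u} → u ∈ m → Reach u h
    to-end (x ∷ []) emb lst (here refl) = 1 , next-last uq (lst last)
    to-end (x ∷ y ∷ m) emb lst (here refl) = trans-reach (1 , next-consec uq (emb here)) (to-end (y ∷ m) (emb ∘ there) (lst ∘ there) (here refl))
    to-end (x ∷ y ∷ m) emb lst (there i) = to-end (y ∷ m) (emb ∘ there) (lst ∘ there) i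

-- The rotation system of the finished picture

module _ {n : ℕ} (G : Graph n) (a b c d : Fin n) (P : Drawing.Picture G c)
  (fin : Running.Final G c P (b ∷ a ∷ d ∷ [])) where
  open Drawing G c
  open Running G c
  open Picture P
  open Final fin

  turning : Rotation G
  turning = record
    { σ = λ v → turn (ℓ v)
    ; closed = λ v u e → ℓ-adj (turn-∈ (ℓ v) (complete e))
    ; cyclic = λ v u w e e′ → turn-cyclic G (ℓ v) (ℓ-unique v) (complete e) (complete e′) }

  chain-turn : ∀ f {v p} h l {q} → (∀ {u w} → Consec u w l → Consec u w (ℓ v)) → Unique (ℓ v) → f v h ≡ p →
    (∀ {u} → Last u l → next h (ℓ v) u ≡ h) →
    Chain f v q l p → ∀ {u} → u ∈ l → f v (next h (ℓ v) u) ≡ f u v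
  chain-turn f h (w ∷ []) emb uq eh lst (_ , refl) (here refl) = trans (cong (f _) (lst last)) eh
  chain-turn f h (w ∷ x ∷ l) emb uq eh lst (_ , e , _) (here refl) = trans (cong (f _) (next-consec uq (emb here))) e
  chain-turn f h (w ∷ x ∷ l) emb uq eh lst (_ , ch) (there i) = chain-turn f h (x ∷ l) (emb ∘ there) uq eh (lst ∘ there) ch i

  closed-invariant : ∀ f {v p} → Chain f v p (ℓ v) p → ∀ {u} → u ∈ ℓ v → f v (turn (ℓ v) u) ≡ f u v
  closed-invariant f {v} ch i = go (ℓ v) refl ch i
    where
    go : ∀ l {p} → ℓ v ≡ l → Chain f v p l p → ∀ {u} → u ∈ l → f v (turn l u) ≡ f u v
    go (h ∷ l) {p} eq ch@(e , _) {u} i = subst (λ m → f v (next h m u) ≡ f u v) eq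
      (chain-turn f h (h ∷ l) (subst (Consec _ _) (sym eq)) (ℓ-unique v) e
        (λ lt → next-last (ℓ-unique v) (subst (Last _) (sym eq) lt)) ch i)

  module _ (b≢c : b ≢ c) (c≢d : c ≢ d) (a≢c : a ≢ c) {z} (anti : Antisym G z) (circ : Circulation G z) where
    open Potentials (solves anti circ)

    private
      bal : ∀ {y q p} → Around P f y q p → q ≡ p
      bal = balanced P f diff circ complete

      q₁ q₂ : ℤ
      q₁ = proj₁ front
      q₂ = proj₁ (proj₂ (proj₂ front))

      q₁≡0 : q₁ ≡ 0ℤ
      q₁≡0 = bal (proj₁ (proj₂ front))

      q₂≡0 : q₂ ≡ 0ℤ
      q₂≡0 = trans (bal (proj₁ (proj₂ (proj₂ (proj₂ front))))) q₁≡0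

      around-b : Around P f b 0ℤ 0ℤ
      around-b = subst (λ t → Around P f b t 0ℤ) q₁≡0 (proj₁ (proj₂ front))

      around-a : Around P f a 0ℤ 0ℤ
      around-a = subst₂ (Around P f a) q₂≡0 q₁≡0 (proj₁ (proj₂ (proj₂ (proj₂ front))))

      around-d : Around P f d 0ℤ 0ℤ
      around-d = subst₂ (Around P f d) (proj₂ (proj₂ (proj₂ (proj₂ (proj₂ (proj₂ front)))))) q₂≡0
        (proj₁ (proj₂ (proj₂ (proj₂ (proj₂ (proj₂ front))))))

    loop : ∀ v → ∃ λ p → Chain f v p (ℓ v) p
    loop v = go (v ∈? (b ∷ a ∷ d ∷ []))
      where
      close : ∀ {v p} → Around P f v p p → ∃ λ p → Chain f v p (ℓ v) p
      close {v} (β , _ , ch , ch′) = _ , chain-++ (R v) ch ch′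
      go : ∀ {v} → Dec (v ∈ b ∷ a ∷ d ∷ []) → ∃ λ p → Chain f v p (ℓ v) p
      go (no ni) = close (proj₂ (finished ni))
      go (yes (here refl)) = close around-b
      go (yes (there (here refl))) = close around-a
      go (yes (there (there (here refl)))) = close around-d

    potential : Potential G turning z f
    potential = (λ u v e → closed-invariant f (proj₂ (loop v)) (complete (adj-sym G e))) , (λ u v e → diff (complete e))

    -- In the end every frontier vertex is balanced, so the value 0 spreads from the ends over the
    -- whole frontier. Being 0 for all circulations is how darts of the outer face are recognised
    -- later.
    outer : ∀ {v} → v ≡ a ⊎ v ≡ b ⊎ v ≡ d → ∀ {w l} → ℓ v ≡ w ∷ l → f v w ≡ 0ℤ
    outer {v} o {w} eq = go (around o)
      where
      around : v ≡ a ⊎ v ≡ b ⊎ v ≡ d → Around P f v 0ℤ 0ℤ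
      around (inj₁ refl) = around-a
      around (inj₂ (inj₁ refl)) = around-b
      around (inj₂ (inj₂ refl)) = around-d
      go : Around P f v 0ℤ 0ℤ → f v w ≡ 0ℤ
      go (β , _ , ch , ch′) = proj₁ (subst (λ l → Chain f v 0ℤ l 0ℤ) eq (chain-++ (R v) ch ch′))

    c-∉ : c ∉ b ∷ a ∷ d ∷ []
    c-∉ (here p) = b≢c (sym p)
    c-∉ (there (here p)) = a≢c (sym p)
    c-∉ (there (there (here p))) = c≢d p

    bottom : ∀ {w l} → L c ≡ w ∷ l → f c w ≡ 0ℤ
    bottom {w} eq with finished c-∉
    ... | p , β , β0 , ch , ch′ = trans (proj₁ (subst (λ l → Chain f c β l p) eq ch′)) (β0 refl)

    -- If no edge lies in `L c`, the value 0 below `c` is also the value from which the turn through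
    -- `R c` starts, because `c` has left the frontier and the turn closes up.
    bottom′ : ∀ {w l} → L c ≡ [] → R c ≡ w ∷ l → f c w ≡ 0ℤ
    bottom′ {w} eL eR with finished c-∉
    ... | p , β , β0 , ch , ch′ = trans (proj₁ (subst (λ l → Chain f c p l β) eR ch))
            (trans (sym (subst (λ l → Chain f c β l p) eL ch′)) (β0 refl))

-- Homogeneous linear systems over ℤ

dot : ∀ {k} → (Fin k → ℤ) → (Fin k → ℤ) → ℤ
dot e x = sum λ j → e j ℤ.* x j

*-zero⁻ : ∀ i {j} → i ≢ 0ℤ → i ℤ.* j ≡ 0ℤ → j ≡ 0ℤ
*-zero⁻ i ne eq with ℤₚ.i*j≡0⇒i≡0∨j≡0 i eq
... | inj₁ p = ⊥-elim (ne p)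
... | inj₂ p = p

private
  pivot : ∀ {k} (es : List (Fin (suc k) → ℤ)) → All (λ e → e zero ≡ 0ℤ) es ⊎
    ∃ λ e → ∃ λ p → ∃ λ s → es ≡ p ++ e ∷ s × e zero ≢ 0ℤ
  pivot [] = inj₁ []
  pivot (e ∷ es) with e zero ℤ.≟ 0ℤ
  ... | no ne = inj₂ (e , [] , es , refl , ne)
  ... | yes eq with pivot es
  ... | inj₁ al = inj₁ (eq ∷ al)
  ... | inj₂ (e′ , p , s , refl , ne) = inj₂ (e′ , e ∷ p , s , refl , ne)

-- Elimination without fractions: a pivot equation `e` removes the first unknown from the others,
-- and the solution of the reduced system is multiplied by `e zero` to remain integral.
solution : ∀ {k} (es : List (Fin k → ℤ)) → length es < k →
  ∃ λ x → (∃ λ j → x j ≢ 0ℤ) × All (λ e → dot e x ≡ 0ℤ) es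
solution {suc k} es lt with pivot es
... | inj₁ al = x , (zero , λ ()) , All.map (λ {e} eq → trans (cong₂ ℤ._+_ (trans (ℤₚ.*-identityʳ (e zero)) eq)
        (sum-0 {f = λ j → e (suc j) ℤ.* 0ℤ} λ j → ℤₚ.*-zeroʳ (e (suc j)))) refl) al
  where
  x : Fin (suc k) → ℤ
  x zero = 1ℤ
  x (suc _) = 0ℤ
... | inj₂ (e , p , s , refl , ne) = x , (suc j , λ eq → yj (*-zero⁻ (e zero) ne eq)) ,
    Allₚ.++⁺ (others p (λ i → ∈-++⁺ˡ i)) (own ∷ others s (λ i → ∈-++⁺ʳ p i))
  where
  reduce : (Fin (suc k) → ℤ) → Fin k → ℤ
  reduce g j = e zero ℤ.* g (suc j) ℤ.- g zero ℤ.* e (suc j)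
  len : ∀ (p : List (Fin (suc k) → ℤ)) {s} → length (p ++ e ∷ s) < suc k → length (Data.List.map reduce (p ++ s)) < k
  len p {s} lt = ℕₚ.≤-trans (ℕₚ.≤-reflexive (cong suc (Listₚ.length-map reduce (p ++ s))))
    (ℕₚ.≤-pred (ℕₚ.≤-trans (ℕₚ.≤-reflexive (cong suc (go p))) lt))
    where
    go : ∀ p → suc (length (p ++ s)) ≡ length (p ++ e ∷ s)
    go [] = refl
    go (_ ∷ p) = cong suc (go p)
  rec = solution (Data.List.map reduce (p ++ s)) (len p lt)
  y = proj₁ rec
  j = proj₁ (proj₁ (proj₂ rec))
  yj = proj₂ (proj₁ (proj₂ rec))
  T : (Fin (suc k) → ℤ) → ℤ
  T g = sum λ j → g (suc j) ℤ.* y j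
  x : Fin (suc k) → ℤ
  x zero = ℤ.- T e
  x (suc j) = e zero ℤ.* y j
  tail-sum : ∀ g → sum (λ j → g (suc j) ℤ.* x (suc j)) ≡ e zero ℤ.* T g
  tail-sum g = trans (sum-cong-≗ λ j → lem (g (suc j)) (e zero) (y j)) (sum-* (e zero) (λ j → g (suc j) ℤ.* y j))
    where
    lem : ∀ a b c → a ℤ.* (b ℤ.* c) ≡ b ℤ.* (a ℤ.* c)
    lem = solve-∀
  value : ∀ g → dot g x ≡ dot (reduce g) y
  value g = trans (cong (λ t → g zero ℤ.* x zero ℤ.+ t) (tail-sum g)) (trans (lem (g zero) (T e) (e zero) (T g)) (sym (trans
      (sum-cong-≗ λ j → dist (e zero) (g (suc j)) (g zero) (e (suc j)) (y j))
      (trans (∑-distrib-+ (λ j → e zero ℤ.* (g (suc j) ℤ.* y j)) (λ j → ℤ.- g zero ℤ.* (e (suc j) ℤ.* y j)))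
        (cong₂ ℤ._+_ (sum-* (e zero) (λ j → g (suc j) ℤ.* y j)) (sum-* (ℤ.- g zero) (λ j → e (suc j) ℤ.* y j)))))))
    where
    lem : ∀ a b c d → a ℤ.* (ℤ.- b) ℤ.+ c ℤ.* d ≡ c ℤ.* d ℤ.+ (ℤ.- a) ℤ.* b
    lem = solve-∀
    dist : ∀ a b c d y → (a ℤ.* b ℤ.- c ℤ.* d) ℤ.* y ≡ a ℤ.* (b ℤ.* y) ℤ.+ (ℤ.- c) ℤ.* (d ℤ.* y)
    dist = solve-∀
  own : dot e x ≡ 0ℤ
  own = trans (cong (λ t → e zero ℤ.* x zero ℤ.+ t) (tail-sum e)) (lem (e zero) (T e))
    where
    lem : ∀ a b → a ℤ.* (ℤ.- b) ℤ.+ a ℤ.* b ≡ 0ℤ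
    lem = solve-∀
  others : ∀ q → (∀ {g} → g ∈ q → g ∈ p ++ s) → All (λ g → dot g x ≡ 0ℤ) q
  others q emb = All.tabulate λ {g} i → trans (value g) (All.lookup (Allₚ.map⁻ (proj₂ (proj₂ rec))) (emb i))

-- Proofs compute with `eval`, which reduces to the intended expression; only the solver looks at
-- the coefficients.
record Form (k : ℕ) : Set where
  field
    eval : (Fin k → ℤ) → ℤ
    coeff : Fin k → ℤ
    eval-dot : ∀ x → eval x ≡ dot coeff x

open Form public

module _ {k : ℕ} where

  coord : Fin k → Form k
  coord i = record { eval = λ x → x i ; coeff = λ j → pick (j ≟ i) 1ℤ ; eval-dot = λ x →
    sym (trans (sum-cong-≗ λ j → lem (j ≟ i) (x j)) (sum-single i x)) }
    where
    lem : {P : Set} (d : Dec P) (x : ℤ) → pick d 1ℤ ℤ.* x ≡ pick d x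
    lem (yes _) x = ℤₚ.*-identityˡ x
    lem (no _) x = refl

  infixl 6 _⊞_
  infixl 7 _⊡_

  _⊞_ : Form k → Form k → Form k
  f ⊞ g = record { eval = λ x → eval f x ℤ.+ eval g x ; coeff = λ j → coeff f j ℤ.+ coeff g j ; eval-dot = λ x →
    trans (cong₂ ℤ._+_ (eval-dot f x) (eval-dot g x)) (sym (trans (sum-cong-≗ λ j → ℤₚ.*-distribʳ-+ (x j) (coeff f j) (coeff g j))
      (∑-distrib-+ (λ j → coeff f j ℤ.* x j) (λ j → coeff g j ℤ.* x j)))) }

  _⊡_ : ℤ → Form k → Form k
  c ⊡ f = record { eval = λ x → c ℤ.* eval f x ; coeff = λ j → c ℤ.* coeff f j ; eval-dot = λ x →
    trans (cong (λ t → c ℤ.* t) (eval-dot f x)) (sym (trans (sum-cong-≗ λ j → ℤₚ.*-assoc c (coeff f j) (x j)) (sum-* c (λ j → coeff f j ℤ.* x j)))) }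

  nought : Form k
  nought = record { eval = λ _ → 0ℤ ; coeff = λ _ → 0ℤ ; eval-dot = λ x → sym (sum-0 {k} {λ j → 0ℤ ℤ.* x j} λ j → refl) }

  total : ∀ {m} → (Fin m → Form k) → Form k
  total {zero} F = nought
  total {suc m} F = F zero ⊞ total (F ∘ suc)

  eval-total : ∀ {m} (F : Fin m → Form k) x → eval (total F) x ≡ sum (λ i → eval (F i) x)
  eval-total {zero} F x = refl
  eval-total {suc m} F x = cong (λ t → eval (F zero) x ℤ.+ t) (eval-total (F ∘ suc) x)

  only : {P : Set} → Dec P → Form k → Form k
  only (yes _) f = f
  only (no _) f = nought

  eval-only : {P : Set} (d : Dec P) (f : Form k) (x : Fin k → ℤ) → eval (only d f) x ≡ pick d (eval f x)
  eval-only (yes _) f x = refl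
  eval-only (no _) f x = refl

  abstract
    solve-forms : (fs : List (Form k)) → length fs < k → ∃ λ x → (∃ λ j → x j ≢ 0ℤ) × (∀ {f} → f ∈ fs → eval f x ≡ 0ℤ)
    solve-forms fs lt with solution (Data.List.map coeff fs) (subst (_< k) (sym (Listₚ.length-map coeff fs)) lt)
    ... | x , nz , al = x , nz , λ {f} i → trans (eval-dot f x) (All.lookup (Allₚ.map⁻ al) i)

sum-squares : ∀ {n} (f : Fin n → ℤ) → (∀ i → 0ℤ ℤ.≤ f i) → sum f ≡ 0ℤ → ∀ i → f i ≡ 0ℤ
sum-squares {suc n} f nn eq = λ { zero → f0 ; (suc i) → sum-squares (f ∘ suc) (nn ∘ suc) s0 i }
  where
  nonneg : ∀ {n} (f : Fin n → ℤ) → (∀ i → 0ℤ ℤ.≤ f i) → 0ℤ ℤ.≤ sum f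
  nonneg {zero} f nn = ℤₚ.≤-refl
  nonneg {suc n} f nn = ℤₚ.+-mono-≤ (nn zero) (nonneg (f ∘ suc) (nn ∘ suc))
  S : ℤ
  S = sum (f ∘ suc)
  f0 : f zero ≡ 0ℤ
  f0 = ℤₚ.≤-antisym (ℤₚ.≤-trans (ℤₚ.≤-trans (ℤₚ.≤-reflexive (sym (ℤₚ.+-identityʳ (f zero))))
         (ℤₚ.+-monoʳ-≤ (f zero) (nonneg (f ∘ suc) (nn ∘ suc)))) (ℤₚ.≤-reflexive eq)) (nn zero)
  s0 : S ≡ 0ℤ
  s0 = trans (sym (ℤₚ.+-identityˡ S)) (trans (cong (λ t → t ℤ.+ S) (sym f0)) eq)

square-≥0 : ∀ i → 0ℤ ℤ.≤ i ℤ.* i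
square-≥0 (ℤ.+ zero) = ℤₚ.≤-refl
square-≥0 (ℤ.+ suc n) = ℤ.+≤+ z≤n
square-≥0 (ℤ.-[1+ n ]) = ℤ.+≤+ z≤n

square-0 : ∀ i → i ℤ.* i ≡ 0ℤ → i ≡ 0ℤ
square-0 i eq with ℤₚ.i*j≡0⇒i≡0∨j≡0 i eq
... | inj₁ p = p
... | inj₂ p = p

-- Circulations and face potentials

module Surface {n : ℕ} (G : Graph n) (ρ : Rotation G) where
  open Rotation ρ

  iter-closed : ∀ {v u} k → Adj G v u → Adj G v (iter G (σ v) k u)
  iter-closed zero e = e
  iter-closed (suc k) e = closed _ _ (iter-closed k e)

  iter-suc : ∀ {A : Set} (f : A → A) k x → iter G f (suc k) x ≡ iter G f k (f x)
  iter-suc f zero x = refl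
  iter-suc f (suc k) x = cong f (iter-suc f k x)

  iter-period : ∀ {A : Set} (f : A → A) p x → iter G f p x ≡ x → ∀ k → iter G f (k * p) x ≡ x
  iter-period f p x eq zero = refl
  iter-period f p x eq (suc k) = trans (iter-+ G f p (k * p) x) (trans (cong (iter G f p) (iter-period f p x eq k)) eq)

  -- Some power of σ v beyond the first fixes both arguments.
  σ-injective : ∀ {v u w} → Adj G v u → Adj G v w → σ v u ≡ σ v w → u ≡ w
  σ-injective {v} {u} {w} eu ew eq with cyclic v (σ v u) u (closed v u eu) eu | cyclic v (σ v w) w (closed v w ew) ew
  ... | k , ku | m , mw = trans (sym (iter-period (σ v) (suc k) u (trans (iter-suc (σ v) k u) ku) (suc m)))
      (trans step (trans (cong (λ t → iter G (σ v) t w) (ℕₚ.*-comm (suc m) (suc k)))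
        (iter-period (σ v) (suc m) w (trans (iter-suc (σ v) m w) mw) (suc k))))
    where
    step : iter G (σ v) (suc m * suc k) u ≡ iter G (σ v) (suc m * suc k) w
    step = trans (iter-suc (σ v) (k + m * suc k) u) (trans (cong (iter G (σ v) (k + m * suc k)) eq) (sym (iter-suc (σ v) (k + m * suc k) w)))

  -- The inverse of `σ v`, as the power that undoes one turn. Outside the neighbourhood it is the
  -- identity, so that together with a likewise extended `σ v` it yields a permutation of `Fin n`.
  back : Fin n → Fin n → Fin n
  back v w with adj? G v w
  ... | no _ = w
  ... | yes e with cyclic v (σ v w) w (closed v w e) e
  ... | k , _ = iter G (σ v) k w

  σ-back : ∀ {v w} → Adj G v w → Adj G v (back v w) × σ v (back v w) ≡ w
  σ-back {v} {w} e with adj? G v w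
  ... | no ne = ⊥-elim (ne e)
  ... | yes e′ with cyclic v (σ v w) w (closed v w e′) e′
  ... | k , eq = iter-closed k e , trans (iter-suc (σ v) k w) eq

  private
    forth : Fin n → Fin n → Fin n
    forth v w with adj? G v w
    ... | yes _ = σ v w
    ... | no _ = w

    forth-yes : ∀ {v w} → Adj G v w → forth v w ≡ σ v w
    forth-yes {v} {w} e with adj? G v w
    ... | yes _ = refl
    ... | no ne = ⊥-elim (ne e)

    forth-no : ∀ {v w} → ¬ Adj G v w → forth v w ≡ w
    forth-no {v} {w} ne with adj? G v w
    ... | yes e = ⊥-elim (ne e)
    ... | no _ = refl

    back-no : ∀ {v w} → ¬ Adj G v w → back v w ≡ w
    back-no {v} {w} ne with adj? G v w
    ... | yes e = ⊥-elim (ne e)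
    ... | no _ = refl

    forth-back : ∀ v w → forth v (back v w) ≡ w
    forth-back v w = go (adj? G v w)
      where
      go : Dec (Adj G v w) → forth v (back v w) ≡ w
      go (yes e) = trans (forth-yes (proj₁ (σ-back e))) (proj₂ (σ-back e))
      go (no ne) = trans (cong (forth v) (back-no ne)) (forth-no ne)

    back-forth : ∀ v w → back v (forth v w) ≡ w
    back-forth v w = go (adj? G v w)
      where
      go : Dec (Adj G v w) → back v (forth v w) ≡ w
      go (no ne) = trans (cong (back v) (forth-no ne)) (back-no ne)
      go (yes e) = trans (cong (back v) (forth-yes e))
        (σ-injective (proj₁ (σ-back (closed v w e))) e (proj₂ (σ-back (closed v w e))))

  Σᴺ-σ : ∀ u f → Σᴺ G u (λ v → f (σ u v)) ≡ Σᴺ G u f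
  Σᴺ-σ u f = sym (trans (sum-permute (λ v → pick (adj? G u v) (f v)) π) (sum-cong-≗ λ v → eq v (adj? G u v)))
    where
    π : Permutation n n
    π = permutation (forth u) (back u) (forth-back u) (back-forth u)
    eq : ∀ v (e : Dec (Adj G u v)) → pick (adj? G u (forth u v)) (f (forth u v)) ≡ pick (adj? G u v) (f (σ u v))
    eq v (yes e) = trans (cong (λ t → pick (adj? G u t) (f t)) (forth-yes e))
      (trans (pick-yes (adj? G u (σ u v)) (closed u v e)) (sym (pick-yes (adj? G u v) e)))
    eq v (no ne) = trans (cong (λ t → pick (adj? G u t) (f t)) (forth-no ne)) (trans (pick-no (adj? G u v) ne) (sym (pick-no (adj? G u v) ne)))

  -- By invariance the terms `f v u` are the terms `f u v` permuted by `σ u`.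
  coboundary-circulation : ∀ {f} → Invariant G ρ f → Circulation G (λ u v → f u v ℤ.- f v u)
  coboundary-circulation {f} inv u = trans (Σᴺ-- G u (f u) (λ v → f v u))
    (trans (cong (λ t → Σᴺ G u (f u) ℤ.- t) (trans (Σᴺ-cong G u λ v e → sym (inv v u (adj-sym G e))) (Σᴺ-σ u (f u)))) (ℤₚ.+-inverseʳ (Σᴺ G u (f u))))

  -- Dirichlet energy: summation by parts turns the sum of the squared differences into a
  -- combination of divergences, which vanish.
  gradient-zero : ∀ (y : Fin n → ℤ) → Circulation G (λ u v → y u ℤ.- y v) → ∀ u v → Adj G u v → y u ≡ y v
  gradient-zero y circ u v e = ℤₚ.i-j≡0⇒i≡j (y u) (y v) (square-0 g (trans (sym (pick-yes (adj? G u v) e))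
      (sum-squares (λ v → pick (adj? G u v) (g² u v)) (λ v → nn u v) (sum-squares (λ u → Σᴺ G u (g² u)) (λ u → sum-nn (nn u)) total-zero u) v)))
    where
    g : ℤ
    g = y u ℤ.- y v
    g² : Fin n → Fin n → ℤ
    g² u v = (y u ℤ.- y v) ℤ.* (y u ℤ.- y v)
    nn : ∀ u v → 0ℤ ℤ.≤ pick (adj? G u v) (g² u v)
    nn u v with adj? G u v
    ... | yes _ = square-≥0 (y u ℤ.- y v)
    ... | no _ = ℤₚ.≤-refl
    sum-nn : ∀ {m} {f : Fin m → ℤ} → (∀ i → 0ℤ ℤ.≤ f i) → 0ℤ ℤ.≤ sum f
    sum-nn {zero} h = ℤₚ.≤-refl
    sum-nn {suc m} h = ℤₚ.+-mono-≤ (h zero) (sum-nn (h ∘ suc))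
    part : ∀ s → Σᴰ G (λ u v → (s ℤ.* y u) ℤ.* (y u ℤ.- y v)) ≡ 0ℤ
    part s = sum-0 {f = λ u → Σᴺ G u (λ v → (s ℤ.* y u) ℤ.* (y u ℤ.- y v))} λ u →
      trans (Σᴺ-* G u (s ℤ.* y u) (λ v → y u ℤ.- y v)) (trans (cong (λ t → (s ℤ.* y u) ℤ.* t) (circ u)) (ℤₚ.*-zeroʳ (s ℤ.* y u)))
    total-zero : Σᴰ G g² ≡ 0ℤ
    total-zero = trans (Σᴰ-cong G λ u v _ → lem (y u) (y v)) (trans (Σᴰ-+ G (λ u v → (1ℤ ℤ.* y u) ℤ.* (y u ℤ.- y v)) (λ u v → (1ℤ ℤ.* y v) ℤ.* (y v ℤ.- y u)))
      (cong₂ ℤ._+_ (part 1ℤ) (trans (Σᴰ-flip G (λ u v → (1ℤ ℤ.* y v) ℤ.* (y v ℤ.- y u))) (part 1ℤ))))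
      where
      lem : ∀ a b → (a ℤ.- b) ℤ.* (a ℤ.- b) ≡ (1ℤ ℤ.* a) ℤ.* (a ℤ.- b) ℤ.+ (1ℤ ℤ.* b) ℤ.* (b ℤ.- a)
      lem = solve-∀

  Connected : Set
  Connected = ∀ x y → Walk (Adj G) (λ _ → ⊤) x y

  along-edges : {A : Set} (y : Fin n → A) → Connected → (∀ u v → Adj G u v → y u ≡ y v) → ∀ u v → y u ≡ y v
  along-edges y conn h u v = go (conn u v)
    where
    go : ∀ {u v} → Walk (Adj G) (λ _ → ⊤) u v → y u ≡ y v
    go ⟦ _ ⟧ = refl
    go (_ ▷⟨ e ⟩ w) = trans (h _ _ e) (go w)

  around-vertex : ∀ (f : Fin n → ℤ) u → (∀ v → Adj G u v → f (σ u v) ≡ f v) → ∀ {v w} → Adj G u v → Adj G u w → f v ≡ f w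
  around-vertex f u h {v} {w} ev ew with cyclic u v w ev ew
  ... | k , refl = sym (go k)
    where
    go : ∀ k → f (iter G (σ u) k v) ≡ f v
    go zero = refl
    go (suc k) = trans (h _ (iter-closed k ev)) (go k)

  -- Connectedness of the dual graph: a face function that agrees across every edge changes neither
  -- in turning around a vertex nor in passing to a neighbour.
  symmetric-constant : Connected → ∀ f → Invariant G ρ f → (∀ u v → Adj G u v → f u v ≡ f v u) →
    ∀ {u v x y} → Adj G u v → Adj G x y → f u v ≡ f x y
  symmetric-constant conn f inv sy {u} {v} {x} {y} e e′ = go (conn u x) e e′
    where
    turn-const : ∀ {u v w} → Adj G u v → Adj G u w → f u v ≡ f u w
    turn-const {u} = around-vertex (f u) u (λ v e → trans (inv v u (adj-sym G e)) (sym (sy u v e)))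
    go : ∀ {u v x y} → Walk (Adj G) (λ _ → ⊤) u x → Adj G u v → Adj G x y → f u v ≡ f x y
    go ⟦ _ ⟧ e e′ = turn-const e e′
    go (_ ▷⟨ e₁ ⟩ w) e e′ = trans (turn-const e e₁) (trans (sy _ _ e₁) (go w (adj-sym G e₁) e′))

  -- The coboundary and `z` are circulations, hence so is the gradient, which therefore vanishes and
  -- leaves a relation between the other two.
  gradient-split : ∀ (f : Fin n → Fin n → ℤ) (y : Fin n → ℤ) s (z : Fin n → Fin n → ℤ) → Invariant G ρ f → Circulation G z →
    (∀ u v → Adj G u v → (f u v ℤ.- f v u) ℤ.+ (y u ℤ.- y v) ℤ.+ s ℤ.* z u v ≡ 0ℤ) →
    (∀ u v → Adj G u v → y u ≡ y v) × (∀ u v → Adj G u v → f u v ℤ.- f v u ≡ ℤ.- s ℤ.* z u v)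
  gradient-split f y s z inv circ eq = flat , λ u v e →
      trans (lem (f u v ℤ.- f v u) (y u) (y v) (s ℤ.* z u v))
        (trans (cong₂ (λ a b → a ℤ.- (b ℤ.- y v) ℤ.- s ℤ.* z u v) (eq u v e) (flat u v e)) (lem′ (y v) s (z u v)))
    where
    lem : ∀ a b c d → a ≡ (a ℤ.+ (b ℤ.- c) ℤ.+ d) ℤ.- (b ℤ.- c) ℤ.- d
    lem = solve-∀
    lem′ : ∀ b s t → 0ℤ ℤ.- (b ℤ.- b) ℤ.- s ℤ.* t ≡ ℤ.- s ℤ.* t
    lem′ = solve-∀
    flat : ∀ u v → Adj G u v → y u ≡ y v
    flat = gradient-zero y λ u → trans (Σᴺ-cong G u λ v e → trans (lem″ (f u v ℤ.- f v u) (y u) (y v) (s ℤ.* z u v))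
        (trans (cong (λ a → a ℤ.- ((f u v ℤ.- f v u) ℤ.+ s ℤ.* z u v)) (eq u v e)) (ℤₚ.+-identityˡ _)))
      (trans (Σᴺ-neg G u (λ v → (f u v ℤ.- f v u) ℤ.+ s ℤ.* z u v))
        (cong ℤ.-_ (trans (Σᴺ-+ G u (λ v → f u v ℤ.- f v u) (λ v → s ℤ.* z u v))
          (cong₂ ℤ._+_ (coboundary-circulation inv u) (trans (Σᴺ-* G u s (z u)) (trans (cong (λ t → s ℤ.* t) (circ u)) (ℤₚ.*-zeroʳ s)))))))
      where
      lem″ : ∀ a b c d → b ℤ.- c ≡ (a ℤ.+ (b ℤ.- c) ℤ.+ d) ℤ.- (a ℤ.+ d)
      lem″ = solve-∀

-- Euler's formula

one : {A P : Set} → Dec P → A → List A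
one (yes _) x = x ∷ []
one (no _) x = []

∈-one : {A P : Set} (d : Dec P) {x y : A} → y ∈ one d x → y ≡ x × P
∈-one (yes p) (here e) = e , p

∈-one⁺ : {A P : Set} (d : Dec P) {x : A} → P → x ∈ one d x
∈-one⁺ (yes _) p = here refl
∈-one⁺ (no ¬p) p = ⊥-elim (¬p p)

gather : {A : Set} {m : ℕ} → (Fin m → List A) → List A
gather {m = zero} f = []
gather {m = suc m} f = f zero ++ gather (f ∘ suc)

∈-gather : {A : Set} {m : ℕ} (f : Fin m → List A) {x : A} → x ∈ gather f → ∃ λ i → x ∈ f i
∈-gather {m = suc m} f i with ∈-++⁻ (f zero) i
... | inj₁ j = zero , j
... | inj₂ j = let (k , h) = ∈-gather (f ∘ suc) j in suc k , h

∈-gather⁺ : {A : Set} {m : ℕ} (f : Fin m → List A) {x : A} (i : Fin m) → x ∈ f i → x ∈ gather f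
∈-gather⁺ f zero h = ∈-++⁺ˡ h
∈-gather⁺ f (suc i) h = ∈-++⁺ʳ (f zero) (∈-gather⁺ (f ∘ suc) i h)

gather-unique : {A : Set} {m : ℕ} (f : Fin m → List A) → (∀ i → Unique (f i)) →
  (∀ {i j x} → x ∈ f i → x ∈ f j → i ≡ j) → Unique (gather f)
gather-unique {m = zero} f u dj = []
gather-unique {m = suc m} f u dj = unique-++⁺ (u zero) (gather-unique (f ∘ suc) (u ∘ suc) (λ i j → Finₚ.suc-injective (dj i j)))
  (λ i j → let (k , h) = ∈-gather (f ∘ suc) j in case dj i h of λ ())

module _ {n : ℕ} (G : Graph n) where

  private
    ∑ : ∀ {m} → (Fin m → ℕ) → ℕ
    ∑ = sumFin G

  ∑-cong : ∀ {m} {f g : Fin m → ℕ} → (∀ i → f i ≡ g i) → ∑ f ≡ ∑ g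
  ∑-cong {zero} h = refl
  ∑-cong {suc m} h = cong₂ _+_ (h zero) (∑-cong (h ∘ suc))

  ∑-plus : ∀ {m} (f g : Fin m → ℕ) → ∑ (λ i → f i + g i) ≡ ∑ f + ∑ g
  ∑-plus {zero} f g = refl
  ∑-plus {suc m} f g = trans (cong (f zero + g zero +_) (∑-plus (f ∘ suc) (g ∘ suc))) (lem (f zero) (g zero) (∑ (f ∘ suc)) (∑ (g ∘ suc)))
    where
    lem : ∀ a b c d → a + b + (c + d) ≡ a + c + (b + d)
    lem a b c d = trans (ℕₚ.+-assoc a b (c + d)) (trans (cong (a +_) (trans (sym (ℕₚ.+-assoc b c d))
      (trans (cong (_+ d) (ℕₚ.+-comm b c)) (ℕₚ.+-assoc c b d)))) (sym (ℕₚ.+-assoc a c (b + d))))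

  ∑-swap : ∀ {m k} (f : Fin m → Fin k → ℕ) → ∑ (λ i → ∑ (f i)) ≡ ∑ (λ j → ∑ (λ i → f i j))
  ∑-swap {zero} {k} f = sym (zeros k)
    where
    zeros : ∀ k → ∑ {k} (λ _ → 0) ≡ 0
    zeros zero = refl
    zeros (suc k) = zeros k
  ∑-swap {suc m} f = trans (cong (∑ (f zero) +_) (∑-swap (f ∘ suc))) (sym (∑-plus (f zero) (λ j → ∑ (λ i → f (suc i) j))))

  length-gather : {A : Set} {m : ℕ} (f : Fin m → List A) → length (gather f) ≡ ∑ (λ i → length (f i))
  length-gather {m = zero} f = refl
  length-gather {m = suc m} f = trans (Listₚ.length-++ (f zero)) (cong (length (f zero) +_) (length-gather (f ∘ suc)))

  up? : ∀ u v → Dec (u Fin.< v × Adj G u v)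
  up? u v = (u Fin.<? v) ×-dec adj? G u v

  edges : List (Fin n × Fin n)
  edges = gather λ u → gather λ v → one (up? u v) (u , v)

  edges-adj : ∀ {u v} → (u , v) ∈ edges → u Fin.< v × Adj G u v
  edges-adj i with ∈-gather (λ u → gather λ v → one (up? u v) (u , v)) i
  ... | u , j with ∈-gather (λ v → one (up? u v) (u , v)) j
  ... | v , k with ∈-one (up? u v) k
  ... | refl , p = p

  adj-edges : ∀ {u v} → u Fin.< v × Adj G u v → (u , v) ∈ edges
  adj-edges {u} {v} p = ∈-gather⁺ (λ u → gather λ v → one (up? u v) (u , v)) u
    (∈-gather⁺ (λ v → one (up? u v) (u , v)) v (∈-one⁺ (up? u v) p))

  edges-unique : Unique edges
  edges-unique = gather-unique (λ u → gather λ v → one (up? u v) (u , v))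
      (λ u → gather-unique (λ v → one (up? u v) (u , v)) (λ v → single (up? u v))
        (λ {i} {j} h k → trans (sym (cong proj₂ (proj₁ (∈-one (up? u i) h)))) (cong proj₂ (proj₁ (∈-one (up? u j) k)))))
      (λ {i} {j} h k → trans (sym (row i h)) (row j k))
    where
    single : {P : Set} (d : Dec P) {x : Fin n × Fin n} → Unique (one d x)
    single (yes _) = [] ∷ []
    single (no _) = []
    row : ∀ u {x} → x ∈ gather (λ v → one (up? u v) (u , v)) → proj₁ x ≡ u
    row u h with ∈-gather (λ v → one (up? u v) (u , v)) h
    ... | v , k = cong proj₁ (proj₁ (∈-one (up? u v) k))

  dart-edges : dartCount G ≡ length edges + length edges
  dart-edges = trans (∑-cong λ u → trans (∑-cong λ v → split u v) (∑-plus (λ v → len (up? u v) (u , v)) (λ v → len (up? v u) (v , u))))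
      (trans (∑-plus (λ u → ∑ λ v → len (up? u v) (u , v)) (λ u → ∑ λ v → len (up? v u) (v , u)))
        (cong₂ _+_ (sym count-edges) (trans (∑-swap (λ u v → len (up? v u) (v , u))) (sym count-edges))))
    where
    len : {P : Set} → Dec P → Fin n × Fin n → ℕ
    len d x = length (one d x)
    count-edges : length edges ≡ ∑ λ u → ∑ λ v → len (up? u v) (u , v)
    count-edges = trans (length-gather (λ u → gather λ v → one (up? u v) (u , v))) (∑-cong λ u → length-gather (λ v → one (up? u v) (u , v)))
    yes-len : {P : Set} (d : Dec P) {x : Fin n × Fin n} → P → len d x ≡ 1
    yes-len (yes _) p = refl
    yes-len (no ¬p) p = ⊥-elim (¬p p)
    no-len : {P : Set} (d : Dec P) {x : Fin n × Fin n} → ¬ P → len d x ≡ 0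
    no-len (yes p) ¬p = ⊥-elim (¬p p)
    no-len (no _) ¬p = refl
    split : ∀ u v → (if adj G u v then 1 else 0) ≡ len (up? u v) (u , v) + len (up? v u) (v , u)
    split u v = go (adj G u v) refl
      where
      go : ∀ t → adj G u v ≡ t → (if t then 1 else 0) ≡ len (up? u v) (u , v) + len (up? v u) (v , u)
      go false eq = sym (cong₂ _+_ (no-len (up? u v) λ (_ , e) → case trans (sym eq) e of λ ())
                      (no-len (up? v u) λ (_ , e) → case trans (sym eq) (adj-sym G e) of λ ()))
      go true eq with Finₚ.<-cmp u v
      ... | tri< p _ q = sym (cong₂ _+_ (yes-len (up? u v) (p , eq)) (no-len (up? v u) (q ∘ proj₁)))
      ... | tri> p _ q = sym (cong₂ _+_ (no-len (up? u v) (p ∘ proj₁)) (yes-len (up? v u) (q , adj-sym G eq)))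
      ... | tri≈ _ refl _ = ⊥-elim (Graph.irrefl G u eq)

module Faces {n : ℕ} (G : Graph n) (ρ : Rotation G) (conn : Surface.Connected G ρ) (v₀ : Fin n) {F : ℕ} (faces : HasFaces G ρ F) (f₀ : Fin F) where
  open Surface G ρ

  lab : (d : Dart G) → IsDart G d → Fin F
  lab = proj₁ faces

  lab-same : ∀ {d e} (pd : IsDart G d) (pe : IsDart G e) → SameFace G ρ d e → lab d pd ≡ lab e pe
  lab-same pd pe = proj₂ (proj₁ (proj₂ faces) _ _ pd pe)

  same-lab : ∀ {d e} (pd : IsDart G d) (pe : IsDart G e) → lab d pd ≡ lab e pe → SameFace G ρ d e
  same-lab pd pe = proj₁ (proj₁ (proj₂ faces) _ _ pd pe)

  dart : (i : Fin F) → Σ (Dart G) λ d → Σ (IsDart G d) λ pd → lab d pd ≡ i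
  dart = proj₂ (proj₂ faces)

  -- Unknowns: one for each face, one for each vertex, and a scale.
  k : ℕ
  k = F + (n + 1)

  faceᵢ : Fin F → Fin k
  faceᵢ i = i Fin.↑ˡ (n + 1)

  vertexᵢ : Fin n → Fin k
  vertexᵢ u = F Fin.↑ʳ (u Fin.↑ˡ 1)

  scaleᵢ : Fin k
  scaleᵢ = F Fin.↑ʳ (n Fin.↑ʳ zero)

  all-zero : (x : Fin k → ℤ) → (∀ i → x (faceᵢ i) ≡ 0ℤ) → (∀ u → x (vertexᵢ u) ≡ 0ℤ) → x scaleᵢ ≡ 0ℤ → ∀ j → x j ≡ 0ℤ
  all-zero x hf hv hs j with Fin.splitAt F j in eq
  ... | inj₁ i = subst (λ t → x t ≡ 0ℤ) (Finₚ.splitAt⁻¹-↑ˡ eq) (hf i)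
  ... | inj₂ j′ with Fin.splitAt n j′ in eq′
  ... | inj₁ u = subst (λ t → x t ≡ 0ℤ) (trans (cong (F Fin.↑ʳ_) (Finₚ.splitAt⁻¹-↑ˡ eq′)) (Finₚ.splitAt⁻¹-↑ʳ eq)) (hv u)
  ... | inj₂ zero = subst (λ t → x t ≡ 0ℤ) (trans (cong (F Fin.↑ʳ_) (Finₚ.splitAt⁻¹-↑ʳ eq′)) (Finₚ.splitAt⁻¹-↑ʳ eq)) hs

  face-form′ : ∀ u v → Dec (Adj G u v) → Form k
  face-form′ u v (yes e) = coord (faceᵢ (lab (u , v) e))
  face-form′ u v (no _) = nought

  face-form : ∀ u v → Form k
  face-form u v = face-form′ u v (adj? G u v)

  edge-form : (Fin n → Fin n → ℤ) → Fin n × Fin n → Form k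
  edge-form z (u , v) = (face-form u v ⊞ ℤ.-1ℤ ⊡ face-form v u) ⊞ (coord (vertexᵢ u) ⊞ ℤ.-1ℤ ⊡ coord (vertexᵢ v)) ⊞ z u v ⊡ coord scaleᵢ

  -- The two normalising equations remove the additive constants, which neither the coboundary nor
  -- the gradient can see.
  system : (Fin n → Fin n → ℤ) → List (Form k)
  system z = coord (faceᵢ f₀) ∷ coord (vertexᵢ v₀) ∷ Data.List.map (edge-form z) (edges G)

  module _ {z : Fin n → Fin n → ℤ} (anti : Antisym G z) (circ : Circulation G z) (x : Fin k → ℤ)
           (sol : ∀ {f} → f ∈ system z → eval f x ≡ 0ℤ) where

    X : Fin n → Fin n → ℤ
    X u v = eval (face-form u v) x

    X-val : ∀ {u v} (e : Adj G u v) → X u v ≡ x (faceᵢ (lab (u , v) e))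
    X-val {u} {v} e = go (adj? G u v)
      where
      go : (d : Dec (Adj G u v)) → eval (face-form′ u v d) x ≡ x (faceᵢ (lab (u , v) e))
      go (yes e′) = cong (x ∘ faceᵢ) (lab-same e′ e (0 , refl))
      go (no ne) = ⊥-elim (ne e)

    X-invariant : Invariant G ρ X
    X-invariant u v e = trans (X-val (Rotation.closed ρ v u (adj-sym G e)))
      (trans (cong (x ∘ faceᵢ) (sym (lab-same e (Rotation.closed ρ v u (adj-sym G e)) (1 , refl)))) (sym (X-val e)))

    y : Fin n → ℤ
    y u = x (vertexᵢ u)

    s : ℤ
    s = x scaleᵢ

    relation : ∀ u v → Adj G u v → (X u v ℤ.- X v u) ℤ.+ (y u ℤ.- y v) ℤ.+ s ℤ.* z u v ≡ 0ℤ
    relation u v e with Finₚ.<-cmp u v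
    ... | tri≈ _ refl _ = ⊥-elim (Graph.irrefl G u e)
    ... | tri< p _ _ = trans (lem (X u v) (X v u) (y u) (y v) s (z u v))
            (sol (there (there (∈-map⁺ (edge-form z) (adj-edges G (p , e))))))
      where
      lem : ∀ a b c d s t → (a ℤ.- b) ℤ.+ (c ℤ.- d) ℤ.+ s ℤ.* t ≡ (a ℤ.+ ℤ.-1ℤ ℤ.* b) ℤ.+ (c ℤ.+ ℤ.-1ℤ ℤ.* d) ℤ.+ t ℤ.* s
      lem = solve-∀
    ... | tri> _ _ p = trans (cong (λ t → (X u v ℤ.- X v u) ℤ.+ (y u ℤ.- y v) ℤ.+ s ℤ.* t) (anti u v))
            (trans (lem (X u v) (X v u) (y u) (y v) s (z v u)) (cong ℤ.-_ (sol (there (there (∈-map⁺ (edge-form z) (adj-edges G (p , adj-sym G e))))))))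
      where
      lem : ∀ a b c d s t → (a ℤ.- b) ℤ.+ (c ℤ.- d) ℤ.+ s ℤ.* (ℤ.- t) ≡ ℤ.- ((b ℤ.+ ℤ.-1ℤ ℤ.* a) ℤ.+ (d ℤ.+ ℤ.-1ℤ ℤ.* c) ℤ.+ t ℤ.* s)
      lem = solve-∀

    solved : (∀ u v → Adj G u v → y u ≡ y v) × (∀ u v → Adj G u v → X u v ℤ.- X v u ≡ ℤ.- s ℤ.* z u v)
    solved = gradient-split X y s z X-invariant circ relation

    -- Without the term in `z`, gradient and coboundary vanish separately; both functions are then
    -- constant, and the normalisation makes the constants 0.
    scaleless : s ≡ 0ℤ → ∀ j → x j ≡ 0ℤ
    scaleless s0 = all-zero x faces-zero
        (λ u → trans (along-edges y conn (proj₁ solved) u v₀) (sol (there (here refl)))) s0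
      where
      sy : ∀ u v → Adj G u v → X u v ≡ X v u
      sy u v e = ℤₚ.i-j≡0⇒i≡j (X u v) (X v u) (trans (proj₂ solved u v e) (trans (cong (λ t → ℤ.- t ℤ.* z u v) s0) refl))
      faces-zero : ∀ i → x (faceᵢ i) ≡ 0ℤ
      faces-zero i with dart i | dart f₀
      ... | (u , v) , e , refl | (u′ , v′) , e′ , eq = trans (sym (X-val e)) (trans (symmetric-constant conn X X-invariant sy e e′)
              (trans (X-val e′) (trans (cong (x ∘ faceᵢ) eq) (sol (here refl)))))

  length-system : ∀ z → length (system z) ≡ 2 + length (edges G)
  length-system z = cong (2 +_) (Listₚ.length-map (edge-form z) (edges G))

  k-suc : k ≡ suc (n + F)
  k-suc = trans (ℕₚ.+-comm F (n + 1)) (trans (cong (_+ F) (ℕₚ.+-comm n 1)) refl)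

  abstract
    -- Euler's formula leaves exactly one unknown more than there are equations, and a nonzero
    -- solution has nonzero scale by `scaleless`. The factor `s` stays because the system is solved
    -- over ℤ.
    almost-exact : 2 * (n + F) ≡ dartCount G + 4 → ∀ z → Antisym G z → Circulation G z →
      ∃ λ s → s ≢ 0ℤ × ∃ λ f → Invariant G ρ f × (∀ u v → Adj G u v → f u v ℤ.- f v u ≡ s ℤ.* z u v)
    almost-exact euler z anti circ =
      conclude (solve-forms (system z) (ℕₚ.≤-reflexive (trans (cong suc (length-system z)) (trans (cong suc (sym nF)) (sym k-suc)))))
      where
      nF : n + F ≡ 2 + length (edges G)
      nF = ℕₚ.*-cancelˡ-≡ (n + F) (2 + length (edges G)) 2 (trans euler (trans (cong (_+ 4) (dart-edges G)) (lem (length (edges G)))))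
        where
        lem : ∀ e → e + e + 4 ≡ 2 * (2 + e)
        lem e = trans (ℕₚ.+-comm (e + e) 4) (sym (trans (ℕₚ.*-distribˡ-+ 2 2 e) (cong (λ t → 4 + (e + t)) (ℕₚ.+-identityʳ e))))
      conclude : (∃ λ x → (∃ λ j → x j ≢ 0ℤ) × (∀ {g} → g ∈ system z → eval g x ≡ 0ℤ)) →
        ∃ λ s → s ≢ 0ℤ × ∃ λ f → Invariant G ρ f × (∀ u v → Adj G u v → f u v ℤ.- f v u ≡ s ℤ.* z u v)
      conclude (x , (j , ne) , sol) = ℤ.- x scaleᵢ , (λ eq → ne (scaleless anti circ x sol (trans (sym (ℤₚ.neg-involutive _)) (cong ℤ.-_ eq)) j)) ,
        X anti circ x sol , X-invariant anti circ x sol , proj₂ (solved anti circ x sol)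

  abstract
    -- Were there more faces, the vanishing of the scale could be imposed as a further equation, and
    -- a nonzero solution would still exist.
    euler-≤ : n + F ≤ 2 + length (edges G)
    euler-≤ with n + F ℕ.≤? 2 + length (edges G)
    ... | yes le = le
    ... | no nle with solve-forms (coord scaleᵢ ∷ system (λ _ _ → 0ℤ)) (ℕₚ.≤-trans (s≤s (s≤s (ℕₚ.≤-reflexive (length-system (λ _ _ → 0ℤ)))))
                       (ℕₚ.≤-trans (s≤s (ℕₚ.≰⇒> nle)) (ℕₚ.≤-reflexive (sym k-suc))))
    ... | x , (j , ne) , sol = ⊥-elim (ne (scaleless {z = λ _ _ → 0ℤ} (λ _ _ → refl) (λ u → sum-0 {f = λ v → pick (adj? G u v) 0ℤ} λ v → pick-0 (adj? G u v)) x (sol ∘ there) (sol (here refl)) j))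

lookup-injective : {A : Set} {l : List A} → Unique l → ∀ i j → Data.List.lookup l i ≡ Data.List.lookup l j → i ≡ j
lookup-injective (_ ∷ u) zero zero eq = refl
lookup-injective {l = x ∷ l} (nx ∷ u) zero (suc j) eq = ⊥-elim (All≢⇒∉ nx (subst (_∈ l) (sym eq) (lookup-∈ l j)))
  where
  lookup-∈ : {A : Set} (l : List A) (j : Fin (length l)) → Data.List.lookup l j ∈ l
  lookup-∈ (x ∷ l) zero = here refl
  lookup-∈ (x ∷ l) (suc j) = there (lookup-∈ l j)
lookup-injective {l = x ∷ l} (nx ∷ u) (suc i) zero eq = sym (lookup-injective (nx ∷ u) zero (suc i) (sym eq))
lookup-injective (_ ∷ u) (suc i) (suc j) eq = cong suc (lookup-injective u i j eq)

index-lookup : {A : Set} {l : List A} {x : A} (i : x ∈ l) → Data.List.lookup l (Any.index i) ≡ x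
index-lookup (here e) = sym e
index-lookup (there i) = index-lookup i

lookup-mem : {A : Set} (l : List A) (j : Fin (length l)) → Data.List.lookup l j ∈ l
lookup-mem (x ∷ l) zero = here refl
lookup-mem (x ∷ l) (suc j) = there (lookup-mem l j)

module _ {n : ℕ} (G : Graph n) (ρ : Rotation G) where

  φ-dart : ∀ d → IsDart G d → IsDart G (φ G ρ d)
  φ-dart (u , v) e = Rotation.closed ρ v u (adj-sym G e)

  invariant-iter : ∀ (f : Fin n → Fin n → ℤ) → Invariant G ρ f → ∀ k d → IsDart G d →
    IsDart G (iter G (φ G ρ) k d) × f (proj₁ (iter G (φ G ρ) k d)) (proj₂ (iter G (φ G ρ) k d)) ≡ f (proj₁ d) (proj₂ d)
  invariant-iter f inv zero d e = e , refl
  invariant-iter f inv (suc k) d e = let (e′ , eq) = invariant-iter f inv k d e ; (u , v) = iter G (φ G ρ) k d in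
    φ-dart (u , v) e′ , trans (inv u v e′) eq

-- If all circulations have potentials then there are enough faces: otherwise some nonzero
-- circulation is orthogonal to all faces, hence to its own potential.
module Enough {n F : ℕ} (G : Graph n) (ρ : Rotation G) (conn : Surface.Connected G ρ) (v₀ : Fin n)
  (faces : HasFaces G ρ F) (f₀ : Fin F) (exact : Exact G ρ) where
  open Surface G ρ
  open Faces G ρ conn v₀ faces f₀ using (lab; lab-same; same-lab; dart)

  K : ℕ
  K = length (edges G)

  half′ : ∀ u v → Dec (u Fin.< v × Adj G u v) → Form K
  half′ u v (yes p) = coord (Any.index (adj-edges G p))
  half′ u v (no _) = nought

  half : Fin n → Fin n → Form K
  half u v = half′ u v (up? G u v)

  zf : Fin n → Fin n → Form K
  zf u v = half u v ⊞ ℤ.-1ℤ ⊡ half v u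

  On : Fin F → Fin n → Fin n → Set
  On i u v = Σ (Adj G u v) λ e → lab (u , v) e ≡ i

  on? : ∀ i u v → Dec (On i u v)
  on? i u v = go (adj? G u v)
    where
    go : Dec (Adj G u v) → Dec (On i u v)
    go (no ne) = no (ne ∘ proj₁)
    go (yes e) = map′ (e ,_) (λ (e′ , p) → trans (lab-same e e′ (0 , refl)) p) (lab (u , v) e ≟ i)

  div-form : Fin n → Form K
  div-form u = total λ v → only (adj? G u v) (zf u v)

  face-sum-form : Fin F → Form K
  face-sum-form i = total λ u → total λ v → only (on? i u v) (zf u v)

  others : ∀ {m} → Fin m → List (Fin m)
  others {m} i₀ = filter (λ i → ¬? (i ≟ i₀)) (allFin m)

  others-< : ∀ {m} (i₀ : Fin m) → length (others i₀) < m
  others-< {m} i₀ = ℕₚ.<-≤-trans (count-< (λ i → ¬? (i ≟ i₀)) (λ _ → yes tt) (λ _ → tt) {i₀} tt (λ ne → ne refl))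
    (ℕₚ.≤-trans (Listₚ.length-filter (λ _ → yes tt) (allFin m)) (ℕₚ.≤-reflexive (Listₚ.length-tabulate {n = m} id)))

  ∈-others : ∀ {m} {i i₀ : Fin m} → i ≢ i₀ → i ∈ others i₀
  ∈-others {i = i} {i₀} ne = ∈-filter⁺ (λ i → ¬? (i ≟ i₀)) (∈-allFin i) ne

  -- One vertex and one face are left out: the divergence at `v₀` follows from the others, and the
  -- potential is shifted to vanish on `f₀`. These omissions account for the 2 in Euler's formula.
  forms : List (Form K)
  forms = Data.List.map div-form (others v₀) ++ Data.List.map face-sum-form (others f₀)

  forms-< : 2 + length forms ≤ n + F
  forms-< = ℕₚ.≤-trans (ℕₚ.≤-reflexive (cong (2 +_) (trans (Listₚ.length-++ (Data.List.map div-form (others v₀)))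
      (cong₂ _+_ (Listₚ.length-map div-form (others v₀)) (Listₚ.length-map face-sum-form (others f₀))))))
    (ℕₚ.≤-trans (ℕₚ.≤-reflexive (cong suc (sym (ℕₚ.+-suc (length (others v₀)) (length (others f₀))))))
      (ℕₚ.+-mono-≤ (others-< v₀) (others-< f₀)))

  module _ (x : Fin K → ℤ) (sol : ∀ {f} → f ∈ forms → eval f x ≡ 0ℤ) where

    z : Fin n → Fin n → ℤ
    z u v = eval (zf u v) x

    anti : Antisym G z
    anti u v = lem (eval (half u v) x) (eval (half v u) x)
      where
      lem : ∀ a b → a ℤ.+ ℤ.-1ℤ ℤ.* b ≡ ℤ.- (b ℤ.+ ℤ.-1ℤ ℤ.* a)
      lem = solve-∀

    div : Fin n → ℤ
    div u = Σᴺ G u (z u)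

    eval-div : ∀ u → eval (div-form u) x ≡ div u
    eval-div u = trans (eval-total (λ v → only (adj? G u v) (zf u v)) x) (sum-cong-≗ λ v → eval-only (adj? G u v) (zf u v) x)

    div-0 : ∀ u → u ≢ v₀ → div u ≡ 0ℤ
    div-0 u ne = trans (sym (eval-div u)) (sol (∈-++⁺ˡ (∈-map⁺ div-form (∈-others ne))))

    twice-0 : ∀ t → t ℤ.+ t ≡ 0ℤ → t ≡ 0ℤ
    twice-0 t eq = *-zero⁻ (ℤ.+ 2) (λ ()) (trans (lem t) eq)
      where
      lem : ∀ t → (ℤ.+ 2) ℤ.* t ≡ t ℤ.+ t
      lem = solve-∀

    total-0 : Σᴰ G z ≡ 0ℤ
    total-0 = twice-0 (Σᴰ G z) (trans (cong (λ t → Σᴰ G z ℤ.+ t) (Σᴰ-flip G z)) (trans (sym (Σᴰ-+ G z (λ u v → z v u)))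
      (sum-0 {f = λ u → Σᴺ G u (λ v → z u v ℤ.+ z v u)} λ u → sum-0 {f = λ v → pick (adj? G u v) (z u v ℤ.+ z v u)} λ v →
        trans (pick-cong (adj? G u v) (adj? G u v) id id (λ _ → trans (cong (λ t → t ℤ.+ z v u) (anti u v)) (ℤₚ.+-inverseˡ (z v u)))) (pick-0 (adj? G u v)))))

    div-v₀ : div v₀ ≡ 0ℤ
    div-v₀ = trans (sym (sum-single v₀ div)) (trans (sum-cong-≗ λ u → at u (u ≟ v₀)) total-0)
      where
      at : ∀ u (d : Dec (u ≡ v₀)) → pick d (div u) ≡ div u
      at u (yes _) = refl
      at u (no ne) = sym (div-0 u ne)

    circ : Circulation G z
    circ u = go (u ≟ v₀)
      where
      go : Dec (u ≡ v₀) → div u ≡ 0ℤ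
      go (yes refl) = div-v₀
      go (no ne) = div-0 u ne

    face-sum : Fin F → ℤ
    face-sum i = sum λ u → sum λ v → pick (on? i u v) (z u v)

    eval-face : ∀ i → eval (face-sum-form i) x ≡ face-sum i
    eval-face i = trans (eval-total (λ u → total λ v → only (on? i u v) (zf u v)) x)
      (sum-cong-≗ λ u → trans (eval-total (λ v → only (on? i u v) (zf u v)) x) (sum-cong-≗ λ v → eval-only (on? i u v) (zf u v) x))

    face-sum-0 : ∀ i → i ≢ f₀ → face-sum i ≡ 0ℤ
    face-sum-0 i ne = trans (sym (eval-face i)) (sol (∈-++⁺ʳ (Data.List.map div-form (others v₀)) (∈-map⁺ face-sum-form (∈-others ne))))

    module _ (f : Fin n → Fin n → ℤ) (pot : Potential G ρ z f) where

      face-const : ∀ {d e} (pd : IsDart G d) (pe : IsDart G e) → lab d pd ≡ lab e pe → f (proj₁ d) (proj₂ d) ≡ f (proj₁ e) (proj₂ e)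
      face-const {d} pd pe eq = let (k , h) = same-lab pd pe eq in
        trans (sym (proj₂ (invariant-iter G ρ f (proj₁ pot) k d pd))) (cong (λ (u , v) → f u v) h)

      ξ : Fin F → ℤ
      ξ i = let ((u , v) , _) = dart i in f u v

      f-ξ : ∀ {u v} (e : Adj G u v) → f u v ≡ ξ (lab (u , v) e)
      f-ξ {u} {v} e = let (_ , e′ , eq) = dart (lab (u , v) e) in face-const e e′ (sym eq)

      c : Fin F → ℤ
      c i = ξ i ℤ.- ξ f₀

      zY : Fin n → Fin n → ℤ
      zY u v = z u v ℤ.* (f u v ℤ.- ξ f₀)

      T : Fin F → Fin n → Fin n → ℤ
      T i u v = pick (on? i u v) (c i ℤ.* z u v)

      by-face : ∀ u v → pick (adj? G u v) (zY u v) ≡ sum λ i → T i u v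
      by-face u v = go (adj? G u v)
        where
        go : (d : Dec (Adj G u v)) → pick d (zY u v) ≡ sum (λ i → T i u v)
        go (no ne) = sym (sum-0 {f = λ i → T i u v} λ i → pick-no (on? i u v) (ne ∘ proj₁))
        go (yes e) = trans (trans (cong (λ t → z u v ℤ.* (t ℤ.- ξ f₀)) (f-ξ e)) (ℤₚ.*-comm (z u v) (c l)))
            (sym (trans (sum-cong-≗ λ i → pick-cong (on? i u v) (i ≟ l)
                (λ (e′ , p) → trans (sym p) (lab-same e′ e (0 , refl))) (λ p → e , sym p) (λ _ → refl))
              (sum-single l (λ i → c i ℤ.* z u v))))
          where
          l : Fin F
          l = lab (u , v) e

      T-sum : ∀ i → sum (λ u → sum (T i u)) ≡ c i ℤ.* face-sum i
      T-sum i = trans (sum-cong-≗ λ u → trans (sum-cong-≗ λ v → pick-* (on? i u v) (c i) (z u v)) (sum-* (c i) (λ v → pick (on? i u v) (z u v))))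
        (sum-* (c i) (λ u → sum λ v → pick (on? i u v) (z u v)))

      T-0 : ∀ i → sum (λ u → sum (T i u)) ≡ 0ℤ
      T-0 i = trans (T-sum i) (go (i ≟ f₀))
        where
        go : Dec (i ≡ f₀) → c i ℤ.* face-sum i ≡ 0ℤ
        go (yes refl) = cong (λ t → t ℤ.* face-sum i) (ℤₚ.+-inverseʳ (ξ i))
        go (no ne) = trans (cong (λ t → c i ℤ.* t) (face-sum-0 i ne)) (ℤₚ.*-zeroʳ (c i))

      swap₁ : ∀ u → sum (λ v → sum λ i → T i u v) ≡ sum (λ i → sum (T i u))
      swap₁ u = ∑-comm (λ v i → T i u v)

      swap₂ : sum (λ u → sum λ i → sum (T i u)) ≡ sum (λ i → sum λ u → sum (T i u))
      swap₂ = ∑-comm (λ u i → sum (T i u))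

      orthogonal : Σᴰ G zY ≡ 0ℤ
      orthogonal = trans (sum-cong-≗ λ u → trans (sum-cong-≗ (by-face u)) (swap₁ u)) (trans swap₂ (sum-0 {f = λ i → sum λ u → sum (T i u)} T-0))

      -- By antisymmetry, `z` paired with the coboundary of `f` is twice `z` paired with the shifted
      -- `f`, and the latter is a combination of face sums.
      squares : Σᴰ G (λ u v → z u v ℤ.* z u v) ≡ 0ℤ
      squares = trans (Σᴰ-cong G λ u v e → trans (cong (λ t → z u v ℤ.* t) (sym (proj₂ pot u v e)))
          (trans (lem (z u v) (f u v) (f v u) (ξ f₀)) (cong (λ t → zY u v ℤ.+ t ℤ.* (f v u ℤ.- ξ f₀)) (sym (anti v u)))))
        (trans (Σᴰ-+ G zY (λ u v → zY v u)) (cong₂ ℤ._+_ orthogonal (trans (sym (Σᴰ-flip G zY)) orthogonal)))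
        where
        lem : ∀ z a b c → z ℤ.* (a ℤ.- b) ≡ z ℤ.* (a ℤ.- c) ℤ.+ (ℤ.- z) ℤ.* (b ℤ.- c)
        lem = solve-∀

      z-zero : ∀ u v → Adj G u v → z u v ≡ 0ℤ
      z-zero u v e = square-0 (z u v) (trans (sym (pick-yes (adj? G u v) e))
          (sum-squares (λ v → pick (adj? G u v) (z u v ℤ.* z u v)) (nn u)
            (sum-squares (λ u → Σᴺ G u (λ v → z u v ℤ.* z u v)) (λ u → sum-nn (nn u)) squares u) v))
        where
        nn : ∀ u v → 0ℤ ℤ.≤ pick (adj? G u v) (z u v ℤ.* z u v)
        nn u v = go (adj? G u v)
          where
          go : (d : Dec (Adj G u v)) → 0ℤ ℤ.≤ pick d (z u v ℤ.* z u v)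
          go (yes _) = square-≥0 (z u v)
          go (no _) = ℤₚ.≤-refl
        sum-nn : ∀ {m} {f : Fin m → ℤ} → (∀ i → 0ℤ ℤ.≤ f i) → 0ℤ ℤ.≤ sum f
        sum-nn {zero} h = ℤₚ.≤-refl
        sum-nn {suc m} h = ℤₚ.+-mono-≤ (h zero) (sum-nn (h ∘ suc))

    x-zero : ∀ j → x j ≡ 0ℤ
    x-zero j = trans (sym z-x) (z-zero (proj₁ (exact z anti circ)) (proj₂ (exact z anti circ)) u v (proj₂ p))
      where
      u = proj₁ (Data.List.lookup (edges G) j)
      v = proj₂ (Data.List.lookup (edges G) j)
      p : u Fin.< v × Adj G u v
      p = edges-adj G (lookup-mem (edges G) j)
      half-yes : (d : Dec (u Fin.< v × Adj G u v)) → eval (half′ u v d) x ≡ x j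
      half-yes (yes q) = cong x (lookup-injective (edges-unique G) _ j (index-lookup (adj-edges G q)))
      half-yes (no nq) = ⊥-elim (nq p)
      half-no : (d : Dec (v Fin.< u × Adj G v u)) → eval (half′ v u d) x ≡ 0ℤ
      half-no (yes (q , _)) = ⊥-elim (Finₚ.<-asym q (proj₁ p))
      half-no (no _) = refl
      z-x : z u v ≡ x j
      z-x = trans (cong₂ (λ a b → a ℤ.+ ℤ.-1ℤ ℤ.* b) (half-yes (up? G u v)) (half-no (up? G v u))) (ℤₚ.+-identityʳ (x j))

  abstract
    euler-≥ : 2 + K ≤ n + F
    euler-≥ = go (2 + K ℕ.≤? n + F)
      where
      absurd : (∃ λ x → (∃ λ j → x j ≢ 0ℤ) × (∀ {f} → f ∈ forms → eval f x ≡ 0ℤ)) → ⊥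
      absurd (x , (j , ne) , sol) = ne (x-zero x sol j)
      go : Dec (2 + K ≤ n + F) → 2 + K ≤ n + F
      go (yes le) = le
      go (no nle) = ⊥-elim (absurd (solve-forms forms (ℕₚ.≤-pred (ℕₚ.≤-pred (ℕₚ.≤-trans (s≤s forms-<) (ℕₚ.≰⇒> nle))))))

  euler : 2 * (n + F) ≡ dartCount G + 4
  euler = trans (cong (2 *_) (ℕₚ.≤-antisym (Faces.euler-≤ G ρ conn v₀ faces f₀) euler-≥))
      (trans (sym (lem K)) (cong (_+ 4) (sym (dart-edges G))))
    where
    lem : ∀ e → e + e + 4 ≡ 2 * (2 + e)
    lem e = trans (ℕₚ.+-comm (e + e) 4) (sym (trans (ℕₚ.*-distribˡ-+ 2 2 e) (cong (λ t → 4 + (e + t)) (ℕₚ.+-identityʳ e))))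

-- The face orbits

module Orbits {n : ℕ} (G : Graph n) (ρ : Rotation G) where
  open Surface G ρ

  private
    D : Set
    D = Dart G
    Φ : D → D
    Φ = φ G ρ

  infix 4 _≟ᴰ_
  _≟ᴰ_ : (d e : D) → Dec (d ≡ e)
  _≟ᴰ_ = Productₚ.≡-dec _≟_ _≟_

  φ-injective : ∀ {d e} → IsDart G d → IsDart G e → Φ d ≡ Φ e → d ≡ e
  φ-injective {u , v} {u′ , v′} p q eq with Productₚ.,-injectiveˡ eq
  ... | refl = cong (_, v) (σ-injective (adj-sym G p) (adj-sym G q) (Productₚ.,-injectiveʳ eq))

  iter-dart : ∀ k {d} → IsDart G d → IsDart G (iter G Φ k d)
  iter-dart zero p = p
  iter-dart (suc k) p = φ-dart G ρ _ (iter-dart k p)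

  iter-injective : ∀ k {d e} → IsDart G d → IsDart G e → iter G Φ k d ≡ iter G Φ k e → d ≡ e
  iter-injective zero p q eq = eq
  iter-injective (suc k) p q eq = iter-injective k p q (φ-injective (iter-dart k p) (iter-dart k q) eq)

  abstract
    -- Two among the first `n * n + 1` iterates coincide, and injectivity on darts moves the
    -- coincidence back to the start.
    period : ∀ {d} → IsDart G d → ∃ λ p → iter G Φ (suc p) d ≡ d
    period {d} pd with Finₚ.pigeonhole (ℕₚ.n<1+n (n * n)) (λ (i : Fin (suc (n * n))) → code (iter G Φ (toℕ i) d))
      where
      code : D → Fin (n * n)
      code (u , v) = Fin.combine u v
    ... | i , j , i<j , eq with ℕₚ.m≤n⇒∃[o]m+o≡n i<j
    ... | o , h = o , sym (iter-injective (toℕ i) pd (iter-dart (suc o) pd)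
        (trans same (trans (cong (λ t → iter G Φ t d) (trans (sym h) (sym (ℕₚ.+-suc (toℕ i) o)))) (iter-+ G Φ (toℕ i) (suc o) d))))
      where
      same : iter G Φ (toℕ i) d ≡ iter G Φ (toℕ j) d
      same = let (p , q) = Finₚ.combine-injective _ _ _ _ eq in cong₂ _,_ p q

  same-trans : ∀ {d e f} → SameFace G ρ d e → SameFace G ρ e f → SameFace G ρ d f
  same-trans {d} (k , refl) (m , refl) = m + k , iter-+ G Φ m k d

  same-sym : ∀ {d e} → IsDart G d → SameFace G ρ d e → SameFace G ρ e d
  same-sym {d} pd (k , refl) with period pd
  ... | p , eq = k * p , trans (sym (iter-+ G Φ (k * p) k d)) (trans (cong (λ t → iter G Φ t d)
      (trans (ℕₚ.+-comm (k * p) k) (sym (ℕₚ.*-suc k p)))) (iter-period Φ (suc p) d eq k))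

  abstract
    same? : ∀ {d} → IsDart G d → ∀ e → Dec (SameFace G ρ d e)
    same? {d} pd e with period pd
    ... | p , eq with any? (λ (i : Fin (suc p)) → iter G Φ (toℕ i) d ≟ᴰ e)
    ... | yes (i , h) = yes (toℕ i , h)
    ... | no none = no λ { (k , refl) → none (Fin.fromℕ< (DivMod.m%n<n k (suc p)) , trans
          (cong (λ t → iter G Φ t d) (Finₚ.toℕ-fromℕ< (DivMod.m%n<n k (suc p)))) (sym (reduce k))) }
      where
      reduce : ∀ k → iter G Φ k d ≡ iter G Φ (k DivMod.% suc p) d
      reduce k = trans (cong (λ t → iter G Φ t d) (DivMod.m≡m%n+[m/n]*n k (suc p)))
        (trans (iter-+ G Φ (k DivMod.% suc p) _ d) (cong (iter G Φ (k DivMod.% suc p)) (iter-period Φ (suc p) d eq (k DivMod./ suc p))))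

  private
    ID : Set
    ID = Σ D (IsDart G)

    _~_ : ID → ID → Set
    x ~ y = SameFace G ρ (proj₁ x) (proj₁ y)

    one-dart : ∀ u v → Dec (Adj G u v) → List ID
    one-dart u v (yes e) = ((u , v) , e) ∷ []
    one-dart u v (no _) = []

    darts : List ID
    darts = gather λ u → gather λ v → one-dart u v (adj? G u v)

    darts-all : ∀ {u v} → Adj G u v → ∃ λ e → ((u , v) , e) ∈ darts
    darts-all {u} {v} e with go (adj? G u v)
      where
      go : (d : Dec (Adj G u v)) → ∃ λ e → ((u , v) , e) ∈ one-dart u v d
      go (yes e′) = e′ , here refl
      go (no ne) = ⊥-elim (ne e)
    ... | e′ , i = e′ , ∈-gather⁺ (λ u → gather λ v → one-dart u v (adj? G u v)) u (∈-gather⁺ (λ v → one-dart u v (adj? G u v)) v i)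

    search : ∀ x (l : List ID) → Dec (∃ λ i → x ~ Data.List.lookup l i)
    search x l = any? λ i → same? (proj₂ x) (proj₁ (Data.List.lookup l i))

    apart : {l : List ID} → AllPairs (λ x y → ¬ (y ~ x)) l → ∀ i j → Data.List.lookup l i ~ Data.List.lookup l j → i ≡ j
    apart (_ ∷ _) zero zero _ = refl
    apart {x ∷ l} (nx ∷ _) zero (suc j) s = ⊥-elim (All.lookup nx (lookup-mem l j) (same-sym (proj₂ x) s))
    apart {x ∷ l} (nx ∷ _) (suc i) zero s = ⊥-elim (All.lookup nx (lookup-mem l i) s)
    apart (_ ∷ ap) (suc i) (suc j) s = cong suc (apart ap i j s)

    -- One dart for each face, chosen greedily; positions in the list of chosen darts serve as face
    -- labels.
    Reps : List ID → Set
    Reps l = ∃ λ r → AllPairs (λ x y → ¬ (y ~ x)) r × (∀ {x} → x ∈ l → ∃ λ i → x ~ Data.List.lookup r i)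

    abstract
      reps : ∀ l → Reps l
      reps [] = [] , [] , λ ()
      reps (x ∷ l) with reps l
      ... | r , ap , cov with search x r
      ... | yes h = r , ap , λ { (here refl) → h ; (there i) → cov i }
      ... | no none = x ∷ r , All.tabulate (λ {y} j s → none (at r j (same-sym (proj₂ y) s))) ∷ ap
          , λ { (here refl) → zero , (0 , refl) ; (there i) → let (k , h) = cov i in suc k , h }
        where
        at : ∀ r {y} → y ∈ r → x ~ y → ∃ λ i → x ~ Data.List.lookup r i
        at (y ∷ r) (here refl) s = zero , s
        at (z ∷ r) (there j) s = let (i , h) = at r j s in suc i , h

    R : Reps darts
    R = reps darts

  face-count : ℕ
  face-count = length (proj₁ R)

  private
    label : (d : D) → (e : IsDart G d) → ∃ λ (i : Fin face-count) → SameFace G ρ d (proj₁ (Data.List.lookup (proj₁ R) i))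
    label (u , v) e = let (_ , i) = darts-all e in proj₂ (proj₂ R) i

  has-faces : HasFaces G ρ face-count
  has-faces = (λ d e → proj₁ (label d e))
    , (λ d e pd pe → (λ eq → same-trans (proj₂ (label d pd)) (same-sym pe (subst (λ i → SameFace G ρ e (proj₁ (Data.List.lookup (proj₁ R) i))) (sym eq) (proj₂ (label e pe)))))
      , (λ s → apart (proj₁ (proj₂ R)) _ _ (same-trans (same-sym pd (proj₂ (label d pd))) (same-trans s (proj₂ (label e pe))))))
    , (λ i → let (d , e) = Data.List.lookup (proj₁ R) i in d , e , apart (proj₁ (proj₂ R)) _ _ (same-sym e (proj₂ (label d e))))

  planar : Connected → (v₀ : Fin n) → ∃ (λ d → IsDart G d) → Exact G ρ → PlanarEmbedding G ρ
  planar conn v₀ (d , e) exact = face-count , has-faces , Enough.euler G ρ conn v₀ has-faces (proj₁ label₀) exact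
    where
    label₀ = label d e

  -- Two darts on which suitable potentials of every circulation vanish lie on a common face: take
  -- the coboundary of the indicator function of the face of one of them.
  common-face : Connected → ∀ {d e} → IsDart G d → IsDart G e →
    (∀ z → Antisym G z → Circulation G z → ∃ λ f → Potential G ρ z f × f (proj₁ d) (proj₂ d) ≡ 0ℤ × f (proj₁ e) (proj₂ e) ≡ 0ℤ) →
    SameFace G ρ d e
  common-face conn {d} {e} pd pe pots = conclude (pots (λ u v → X u v ℤ.- X v u) (λ u v → lem (X u v) (X v u)) (coboundary-circulation X-inv))
    where
    X : Fin n → Fin n → ℤ
    X u v = pick (same? pd (u , v)) 1ℤ
    X-inv : Invariant G ρ X
    X-inv u v h = pick-cong (same? pd (Φ (u , v))) (same? pd (u , v)) (λ s → same-trans s (same-sym {d = u , v} h (1 , refl))) (λ s → same-trans s (1 , refl)) (λ _ → refl)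
    lem : ∀ a b → a ℤ.- b ≡ ℤ.- (b ℤ.- a)
    lem = solve-∀
    conclude : (∃ λ f → Potential G ρ (λ u v → X u v ℤ.- X v u) f × f (proj₁ d) (proj₂ d) ≡ 0ℤ × f (proj₁ e) (proj₂ e) ≡ 0ℤ) → SameFace G ρ d e
    conclude (f , (inv , diff) , fd , fe) = decide (same? pd e)
      where
      H : Fin n → Fin n → ℤ
      H u v = f u v ℤ.- X u v
      H-inv : Invariant G ρ H
      H-inv u v h = cong₂ ℤ._-_ (inv u v h) (X-inv u v h)
      H-sym : ∀ u v → Adj G u v → H u v ≡ H v u
      H-sym u v h = ℤₚ.i-j≡0⇒i≡j (H u v) (H v u) (trans (regroup (f u v) (f v u) (X u v) (X v u)) (trans (cong (λ t → t ℤ.- (X u v ℤ.- X v u)) (diff u v h)) (ℤₚ.+-inverseʳ (X u v ℤ.- X v u))))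
        where
        regroup : ∀ a b x y → (a ℤ.- x) ℤ.- (b ℤ.- y) ≡ (a ℤ.- b) ℤ.- (x ℤ.- y)
        regroup = solve-∀
      same-H : H (proj₁ d) (proj₂ d) ≡ H (proj₁ e) (proj₂ e)
      same-H = symmetric-constant conn H H-inv H-sym pd pe
      decide : Dec (SameFace G ρ d e) → SameFace G ρ d e
      decide (yes s) = s
      decide (no ns) = ⊥-elim (case trans (sym lhs) (trans same-H rhs) of λ ())
        where
        lhs : H (proj₁ d) (proj₂ d) ≡ ℤ.- 1ℤ
        lhs = cong₂ ℤ._-_ fd (pick-yes (same? pd d) (0 , refl))
        rhs : H (proj₁ e) (proj₂ e) ≡ 0ℤ
        rhs = cong₂ ℤ._-_ fe (pick-no (same? pd e) ns)

-- Exclusion of the two alternatives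

module Crossing {n : ℕ} (G : Graph n) (ρ : Rotation G) (conn : Surface.Connected G ρ) (v₀ : Fin n)
                {F : ℕ} (faces : HasFaces G ρ F) (f₀ : Fin F) (genus-0 : 2 * (n + F) ≡ dartCount G + 4) where
  open Surface G ρ
  open Orbits G ρ
  open Rotation ρ using (σ)

  private
    src : ℕ → Dart G → Fin n
    src k d = proj₁ (iter G (φ G ρ) k d)

    unit : Fin n → Fin n → Fin n → Fin n → ℤ
    unit x y u v = pick (u ≟ x ×-dec v ≟ y) 1ℤ

    unit-flip : ∀ x y u v → unit x y u v ≡ unit y x v u
    unit-flip x y u v = pick-cong (u ≟ x ×-dec v ≟ y) (v ≟ y ×-dec u ≟ x) (λ (p , q) → q , p) (λ (p , q) → q , p) (λ _ → refl)

    Σᴺ-unit : ∀ {x y} u → Adj G x y → Σᴺ G u (unit x y u) ≡ pick (u ≟ x) 1ℤ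
    Σᴺ-unit {x} {y} u e = go (u ≟ x)
      where
      go : (d : Dec (u ≡ x)) → Σᴺ G u (unit x y u) ≡ pick d 1ℤ
      go (yes refl) = trans (sum-cong-≗ λ v → eq v (v ≟ y)) (sum-single y (λ _ → 1ℤ))
        where
        eq : ∀ v (d : Dec (v ≡ y)) → pick (adj? G u v) (unit u y u v) ≡ pick d 1ℤ
        eq v (yes refl) = trans (pick-yes (adj? G u v) e) (pick-yes (u ≟ u ×-dec v ≟ v) (refl , refl))
        eq v (no ne) = trans (cong (pick (adj? G u v)) (pick-no (u ≟ u ×-dec v ≟ y) (ne ∘ proj₂))) (pick-0 (adj? G u v))
      go (no ne) = trans (Σᴺ-cong G u λ v _ → pick-no (u ≟ x ×-dec v ≟ y) (ne ∘ proj₁)) (sum-0 {n} {λ v → pick (adj? G u v) 0ℤ} λ v → pick-0 (adj? G u v))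

    arc : Fin n → Fin n → Fin n → Fin n → ℤ
    arc x y u v = unit x y u v ℤ.- unit y x u v

    -- A walk as a unit flow from its start to its end; edges used repeatedly count with sign and
    -- multiplicity.
    flow : ∀ {X : Fin n → Set} {x y} → Walk (Adj G) X x y → Fin n → Fin n → ℤ
    flow ⟦ _ ⟧ u v = 0ℤ
    flow (_▷⟨_⟩_ {x = x} {y = y} _ _ w) u v = arc x y u v ℤ.+ flow w u v

    flow-anti : ∀ {X : Fin n → Set} {x y} (w : Walk (Adj G) X x y) → Antisym G (flow w)
    flow-anti ⟦ _ ⟧ u v = refl
    flow-anti (_▷⟨_⟩_ {x = x} {y = y} _ _ w) u v =
      trans (cong₂ ℤ._+_ (cong₂ ℤ._-_ (unit-flip x y u v) (unit-flip y x u v)) (flow-anti w u v)) (lem (unit y x v u) (unit x y v u) (flow w v u))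
      where
      lem : ∀ a b c → (a ℤ.- b) ℤ.+ (ℤ.- c) ≡ ℤ.- ((b ℤ.- a) ℤ.+ c)
      lem = solve-∀

    flow-off : ∀ {X : Fin n → Set} {x y} (w : Walk (Adj G) X x y) {u v} → ¬ X u → flow w u v ≡ 0ℤ
    flow-off ⟦ _ ⟧ nx = refl
    flow-off (_▷⟨_⟩_ {x = x} {y = y} px _ w) {u} {v} nx = cong₂ ℤ._+_
      (cong₂ ℤ._-_ (pick-no (u ≟ x ×-dec v ≟ y) (λ { (refl , _) → nx px })) (pick-no (u ≟ y ×-dec v ≟ x) (λ { (refl , _) → nx (walk-start w) })))
      (flow-off w nx)

    flow-div : ∀ {X : Fin n → Set} {x y} (w : Walk (Adj G) X x y) u → Σᴺ G u (flow w u) ≡ pick (u ≟ x) 1ℤ ℤ.- pick (u ≟ y) 1ℤ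
    flow-div (⟦_⟧ {x = x} _) u = trans (Σᴺ-* G u 0ℤ (λ _ → 0ℤ)) (sym (ℤₚ.+-inverseʳ (pick (u ≟ x) 1ℤ)))
    flow-div (_▷⟨_⟩_ {x = x} {y = y} {z = z} _ e w) u = trans (Σᴺ-+ G u (arc x y u) (flow w u))
      (trans (cong₂ ℤ._+_ (trans (Σᴺ-- G u (unit x y u) (unit y x u)) (cong₂ ℤ._-_ (Σᴺ-unit u e) (Σᴺ-unit u (adj-sym G e)))) (flow-div w u))
        (lem (pick (u ≟ x) 1ℤ) (pick (u ≟ y) 1ℤ) (pick (u ≟ z) 1ℤ)))
      where
      lem : ∀ a b c → (a ℤ.- b) ℤ.+ (b ℤ.- c) ≡ a ℤ.- c
      lem = solve-∀

  -- Cutting the sphere along the X-path closed up through the face would separate the two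
  -- Y-vertices.  Algebraically: t is the indicator of the stretch of the face from p₀ to p₂, so the
  -- X-path minus the coboundary of t is a circulation; correcting a potential f of it by t gives a
  -- function H which is constant along Y, while f agrees and t differs at the two Y-vertices.
  crossing : ∀ (X Y : Fin n → Set) → (∀ {v} → X v → Y v → ⊥) → ∀ {D₀} → IsDart G D₀ → ∀ {k₁ k₂ k₃} → k₁ < k₂ →
    (∀ j → j < k₂ → src j D₀ ≢ src k₂ D₀ × src j D₀ ≢ src k₃ D₀) →
    Walk (Adj G) X (proj₁ D₀) (src k₂ D₀) → Walk (Adj G) Y (src k₁ D₀) (src k₃ D₀) → ⊥
  crossing X Y disj {D₀} pd {k₁} {k₂} {k₃} k₁<k₂ early wX wY =
    conclude (Faces.almost-exact G ρ conn v₀ faces f₀ genus-0 z z-anti z-circ)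
    where
    Φ : Dart G → Dart G
    Φ = φ G ρ
    at : ℕ → Dart G
    at k = iter G Φ k D₀
    p₀ p₂ : Fin n
    p₀ = proj₁ D₀
    p₂ = src k₂ D₀
    On : Dart G → Set
    On e = ∃ λ (j : Fin k₂) → at (toℕ j) ≡ e
    on? : ∀ e → Dec (On e)
    on? e = any? λ j → at (toℕ j) ≟ᴰ e
    on : ∀ {j e} → j < k₂ → at j ≡ e → On e
    on {j} {e} lt eq = Fin.fromℕ< lt , trans (cong at (Finₚ.toℕ-fromℕ< lt)) eq
    t : Fin n → Fin n → ℤ
    t u v = pick (on? (u , v)) 1ℤ
    k₂-pos : 0 < k₂
    k₂-pos = ℕₚ.≤-<-trans z≤n k₁<k₂
    not-last : ¬ On (at k₂)
    not-last (j , eq) = proj₁ (early (toℕ j) (Finₚ.toℕ<n j)) (cong proj₁ eq)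
    not-back : ∀ m → m < k₂ → at (suc m) ≢ D₀
    not-back m lt eq with ℕₚ.m≤n⇒∃[o]m+o≡n lt
    ... | o , h = proj₁ (early o (ℕₚ.<-≤-trans (ℕₚ.m<n+m o (s≤s z≤n)) (ℕₚ.≤-reflexive h)))
      (cong proj₁ (trans (cong (iter G Φ o) (sym eq)) (trans (sym (iter-+ G Φ o (suc m) D₀)) (cong at (trans (ℕₚ.+-comm o (suc m)) h)))))
    u₀ u₂ : Fin n → Fin n → ℤ
    u₀ = unit (proj₁ D₀) (proj₂ D₀)
    u₂ = unit (proj₁ (at k₂)) (proj₂ (at k₂))
    unit-yes : ∀ (d e : Dart G) → e ≡ d → unit (proj₁ d) (proj₂ d) (proj₁ e) (proj₂ e) ≡ 1ℤ
    unit-yes d e refl = pick-yes (proj₁ d ≟ proj₁ d ×-dec proj₂ d ≟ proj₂ d) (refl , refl)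
    unit-no : ∀ (d e : Dart G) → e ≢ d → unit (proj₁ d) (proj₂ d) (proj₁ e) (proj₂ e) ≡ 0ℤ
    unit-no d e ne = pick-no (proj₁ e ≟ proj₁ d ×-dec proj₂ e ≟ proj₂ d) λ (p , q) → ne (cong₂ _,_ p q)
    -- Along face tracing `t` jumps up on entering `D₀` and down on entering position `k₂`, and
    -- nowhere else; `not-back` and `not-last` keep the two jumps from interfering.
    t-step : ∀ u v → Adj G u v → t v (σ v u) ≡ t u v ℤ.+ (u₀ v (σ v u) ℤ.- u₂ v (σ v u))
    t-step u v e = go (on? (u , v)) (on? (Φ (u , v)))
      where
      before : ∀ i → at (suc i) ≡ Φ (u , v) → at i ≡ (u , v)
      before i eq = φ-injective (iter-dart i pd) e eq
      go : (p : Dec (On (u , v))) (q : Dec (On (Φ (u , v)))) → pick q 1ℤ ≡ pick p 1ℤ ℤ.+ (u₀ v (σ v u) ℤ.- u₂ v (σ v u))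
      go (yes (j , eq)) (yes q) = sym (cong (λ x → 1ℤ ℤ.+ x) (cong₂ ℤ._-_
        (unit-no D₀ (Φ (u , v)) (λ h → not-back (toℕ j) (Finₚ.toℕ<n j) (trans (cong Φ eq) h)))
        (unit-no (at k₂) (Φ (u , v)) (λ h → not-last (subst On h q)))))
      go (yes (j , eq)) (no nq) = sym (cong (λ x → 1ℤ ℤ.+ x) (cong₂ ℤ._-_
        (unit-no D₀ (Φ (u , v)) (λ h → nq (on k₂-pos (sym h))))
        (unit-yes (at k₂) (Φ (u , v)) (trans (cong Φ (sym eq)) (cong at end)))))
        where
        end : suc (toℕ j) ≡ k₂
        end = ℕₚ.≤-antisym (Finₚ.toℕ<n j) (ℕₚ.≮⇒≥ λ lt → nq (on lt (cong Φ eq)))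
      go (no np) (yes q) = sym (trans (ℤₚ.+-identityˡ _) (cong₂ ℤ._-_ (unit-yes D₀ (Φ (u , v)) (start q))
        (unit-no (at k₂) (Φ (u , v)) (λ h → not-last (subst On h q)))))
        where
        start : On (Φ (u , v)) → Φ (u , v) ≡ D₀
        start (j , eq) = undo (toℕ j) refl eq
          where
          undo : ∀ i → toℕ j ≡ i → at i ≡ Φ (u , v) → Φ (u , v) ≡ D₀
          undo zero _ eq = sym eq
          undo (suc i) ji eq = ⊥-elim (np (on (ℕₚ.<-trans (ℕₚ.n<1+n i) (subst (λ x → x < k₂) ji (Finₚ.toℕ<n j))) (before i eq)))
      go (no np) (no nq) = sym (trans (ℤₚ.+-identityˡ _) (cong₂ ℤ._-_
        (unit-no D₀ (Φ (u , v)) (λ h → nq (on k₂-pos (sym h))))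
        (unit-no (at k₂) (Φ (u , v)) (λ h → final k₂ refl k₂-pos (sym h)))))
        where
        final : ∀ i → i ≡ k₂ → 0 < i → at i ≡ Φ (u , v) → ⊥
        final (suc i) refl _ eq = np (on (ℕₚ.n<1+n i) (before i eq))
    t-div : ∀ u → Σᴺ G u (λ v → t u v ℤ.- t v u) ≡ pick (u ≟ p₀) 1ℤ ℤ.- pick (u ≟ p₂) 1ℤ
    t-div u = trans (Σᴺ-- G u (t u) (λ v → t v u)) (trans (cong (λ x → x ℤ.- Σᴺ G u (λ v → t v u)) turned) (lem (Σᴺ G u (λ v → t v u)) (pick (u ≟ p₀) 1ℤ ℤ.- pick (u ≟ p₂) 1ℤ)))
      where
      lem : ∀ a b → (a ℤ.+ b) ℤ.- a ≡ b
      lem = solve-∀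
      Δ : Fin n → ℤ
      Δ v = u₀ u v ℤ.- u₂ u v
      turned : Σᴺ G u (t u) ≡ Σᴺ G u (λ v → t v u) ℤ.+ (pick (u ≟ p₀) 1ℤ ℤ.- pick (u ≟ p₂) 1ℤ)
      turned = trans (sym (Σᴺ-σ u (t u))) (trans (Σᴺ-cong G u λ v e → t-step v u (adj-sym G e))
        (trans (Σᴺ-+ G u (λ v → t v u) (λ v → Δ (σ u v))) (cong (λ x → Σᴺ G u (λ v → t v u) ℤ.+ x)
          (trans (Σᴺ-σ u Δ) (trans (Σᴺ-- G u (u₀ u) (u₂ u)) (cong₂ ℤ._-_ (Σᴺ-unit u pd) (Σᴺ-unit u (iter-dart k₂ pd))))))))
    z : Fin n → Fin n → ℤ
    z u v = flow wX u v ℤ.- (t u v ℤ.- t v u)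
    z-anti : Antisym G z
    z-anti u v = trans (cong (λ x → x ℤ.- (t u v ℤ.- t v u)) (flow-anti wX u v)) (lem (flow wX v u) (t u v) (t v u))
      where
      lem : ∀ a b c → ℤ.- a ℤ.- (b ℤ.- c) ≡ ℤ.- (a ℤ.- (c ℤ.- b))
      lem = solve-∀
    z-circ : Circulation G z
    z-circ u = trans (Σᴺ-- G u (flow wX u) (λ v → t u v ℤ.- t v u))
      (trans (cong₂ ℤ._-_ (flow-div wX u) (t-div u)) (ℤₚ.+-inverseʳ (pick (u ≟ p₀) 1ℤ ℤ.- pick (u ≟ p₂) 1ℤ)))
    conclude : (∃ λ s → s ≢ 0ℤ × ∃ λ f → Invariant G ρ f × (∀ u v → Adj G u v → f u v ℤ.- f v u ≡ s ℤ.* z u v)) → ⊥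
    conclude (s , s≢0 , f , inv , diff) = s≢0 (trans (cancel f₁ s) (trans (cong (λ x → x ℤ.- f₁) same) (ℤₚ.+-inverseʳ f₁)))
      where
      H : Fin n → Fin n → ℤ
      H u v = f u v ℤ.+ s ℤ.* t u v
      H-sym : ∀ u v → Adj G u v → ¬ X u → H u v ≡ H v u
      H-sym u v e nx = ℤₚ.i-j≡0⇒i≡j (H u v) (H v u) (trans (regroup (f u v) (f v u) s (t u v) (t v u))
        (trans (cong (λ x → x ℤ.+ s ℤ.* (t u v ℤ.- t v u)) (trans (diff u v e) (cong (λ x → s ℤ.* (x ℤ.- (t u v ℤ.- t v u))) (flow-off wX nx))))
          (vanish s (t u v ℤ.- t v u))))
        where
        regroup : ∀ a b s x y → (a ℤ.+ s ℤ.* x) ℤ.- (b ℤ.+ s ℤ.* y) ≡ (a ℤ.- b) ℤ.+ s ℤ.* (x ℤ.- y)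
        regroup = solve-∀
        vanish : ∀ s x → s ℤ.* (0ℤ ℤ.- x) ℤ.+ s ℤ.* x ≡ 0ℤ
        vanish = solve-∀
      -- Both jumps of `t` take place at ends of the `X`-walk, so none happens here.
      H-turn : ∀ u → ¬ X u → ∀ v → Adj G u v → H u (σ u v) ≡ H u v
      H-turn u nx v e = trans (cong₂ (λ a b → a ℤ.+ s ℤ.* b) (inv v u (adj-sym G e)) (trans (t-step v u (adj-sym G e)) (trans (cong (λ x → t v u ℤ.+ x)
          (cong₂ ℤ._-_ (pick-no (u ≟ p₀ ×-dec σ u v ≟ proj₂ D₀) (λ { (refl , _) → nx (walk-start wX) }))
                       (pick-no (u ≟ p₂ ×-dec σ u v ≟ proj₂ (at k₂)) (λ { (refl , _) → nx (walk-end wX) })))) (ℤₚ.+-identityʳ (t v u)))))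
        (sym (H-sym u v e nx))
      along : ∀ {x y} → Walk (Adj G) Y x y → ∀ {v w} → Adj G x v → Adj G y w → H x v ≡ H y w
      along {x} ⟦ py ⟧ e e′ = around-vertex (H x) x (H-turn x (λ px → disj px py)) e e′
      along {x} (_▷⟨_⟩_ {y = x′} py e₁ w) e e′ = trans (around-vertex (H x) x (H-turn x nx) e e₁)
          (trans (H-sym x x′ e₁ nx) (along w (adj-sym G e₁) e′))
        where
        nx : ¬ X x
        nx px = disj px py
      F₁ : ∀ k → ℤ
      F₁ k = f (proj₁ (at k)) (proj₂ (at k))
      f₁ : ℤ
      f₁ = f (proj₁ D₀) (proj₂ D₀)
      F₁-const : ∀ k → F₁ k ≡ f₁
      F₁-const k = proj₂ (invariant-iter G ρ f inv k D₀ pd)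
      -- Position `k₁` is on the stretch and position `k₃` is not, so the constancy of `H` along `Y`
      -- equates `f₁ ℤ.+ s` with `f₁`.
      same : f₁ ℤ.+ s ≡ f₁
      same = trans (sym (trans (cong₂ (λ a b → a ℤ.+ s ℤ.* b) (F₁-const k₁) (pick-yes (on? (at k₁)) (on k₁<k₂ refl))) (cong (λ x → f₁ ℤ.+ x) (ℤₚ.*-identityʳ s))))
        (trans (along wY (iter-dart k₁ pd) (iter-dart k₃ pd))
          (trans (cong₂ (λ a b → a ℤ.+ s ℤ.* b) (F₁-const k₃) (pick-no (on? (at k₃)) (λ (j , eq) → proj₂ (early (toℕ j) (Finₚ.toℕ<n j)) (cong proj₁ eq))))
            (trans (cong (λ x → f₁ ℤ.+ x) (ℤₚ.*-zeroʳ s)) (ℤₚ.+-identityʳ f₁))))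
      cancel : ∀ a s → s ≡ (a ℤ.+ s) ℤ.- a
      cancel = solve-∀

  -- The search goes upwards; `r` counts the positions left before the known visit.
  first-visit : ∀ {D₀ x} → (∃ λ k → src k D₀ ≡ x) → ∃ λ k → src k D₀ ≡ x × (∀ j → j < k → src j D₀ ≢ x)
  first-visit {D₀} {x} (k , h) = go k h (0) (ℕₚ.+-identityʳ k) (λ _ ())
    where
    go : ∀ r {k} → src k D₀ ≡ x → ∀ i → r + i ≡ k → (∀ j → j < i → src j D₀ ≢ x) → ∃ λ k → src k D₀ ≡ x × (∀ j → j < k → src j D₀ ≢ x)
    go zero h i refl none = i , h , none
    go (suc r) h i eq none = decide (src i D₀ ≟ x)
      where
      decide : Dec (src i D₀ ≡ x) → ∃ λ k → src k D₀ ≡ x × (∀ j → j < k → src j D₀ ≢ x)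
      decide (yes p) = i , p , none
      decide (no np) = go r h (suc i) (trans (ℕₚ.+-suc r i) eq) λ j lt → onward (ℕₚ.m≤n⇒m<n∨m≡n (ℕₚ.≤-pred lt))
        where
        onward : ∀ {j} → j < i ⊎ j ≡ i → src j D₀ ≢ x
        onward (inj₁ lt) = none _ lt
        onward (inj₂ refl) = np

module _ {n : ℕ} (G : Graph n) where

  walkIn→walk : ∀ {P : Fin n → Set} {x y} → WalkIn G P x y → Walk (Adj G) P x y
  walkIn→walk [ p ] = ⟦ p ⟧
  walkIn→walk (p ∷⟨ e ⟩ w) = p ▷⟨ e ⟩ walkIn→walk w

  walk→walkIn : ∀ {P : Fin n → Set} {x y} → Walk (Adj G) P x y → WalkIn G P x y
  walk→walkIn ⟦ p ⟧ = [ p ]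
  walk→walkIn (p ▷⟨ e ⟩ w) = p ∷⟨ e ⟩ walk→walkIn w

  bridge : ∀ {A B : Fin n → Set} {x y} → Branch G x A → Branch G y B → Joined G A B → Walk (Adj G) (λ v → A v ⊎ B v) x y
  bridge (ax , cA) (by , cB) (u , v , au , bv , e) =
    walk-mono inj₁ (walkIn→walk (cA _ _ ax au)) ⊕ (inj₁ au ▷⟨ e ⟩ walk-mono inj₂ (walkIn→walk (cB _ _ bv by)))

  -- Among `b`, `c`, `d`, the one whose first visit is in the middle is paired with `a`. Two branch
  -- sets and an edge between them connect each pair, and the two pairs cross on the face.
  exclusive : ∀ {a b c d} → a ≢ b → a ≢ c → a ≢ d → b ≢ c → b ≢ d → c ≢ d → (∀ x y → Walk (Adj G) (λ _ → ⊤) x y) →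
    RootedK4Minor G a b c d → PlanarWithCommonFace G a b c d → ⊥
  exclusive {a} {b} {c} {d} a≢b a≢c a≢d b≢c b≢d c≢d conn
    (A , B , C , D , bA , bB , bC , bD , AB , AC , AD , BC , BD , CD , jAB , jAC , jAD , jBC , jBD , jCD)
    (ρ , (F , faces , eq) , d₀ , pd₀ , (ka , refl) , fb , fc , fd) =
    sort (visit fb) (visit fc) (visit fd)
    where
    open Orbits G ρ
    -- The face is traced from a dart at `a`, so that `a` has position 0.
    D₀ : Dart G
    D₀ = iter G (φ G ρ) ka d₀
    pD₀ : IsDart G D₀
    pD₀ = iter-dart ka pd₀
    open Crossing G ρ conn (proj₁ D₀) faces (proj₁ faces D₀ pD₀) eq
    Visit : Fin n → Set
    Visit x = ∃ λ k → proj₁ (iter G (φ G ρ) k D₀) ≡ x × (∀ j → j < k → proj₁ (iter G (φ G ρ) j D₀) ≢ x)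
    visit : ∀ {x} → OnFace G ρ d₀ x → Visit x
    visit {x} (k , h) = first-visit (let (m , eq) = same-trans (same-sym pd₀ (ka , refl)) (k , refl) in m , trans (cong proj₁ eq) h)
    ordered : ∀ {p q r} (P : Visit p) (Q : Visit q) (R : Visit r) → proj₁ P < proj₁ Q → proj₁ Q < proj₁ R →
      ∀ {X Y : Fin n → Set} → (∀ {v} → X v → Y v → ⊥) → Walk (Adj G) X (proj₁ D₀) q → Walk (Adj G) Y p r → ⊥
    ordered (k₁ , refl , _) (k₂ , refl , n₂) (k₃ , refl , n₃) l₁ l₂ dj wX wY =
      crossing _ _ dj pD₀ {k₁} {k₂} {k₃} l₁ (λ j l → n₂ j l , n₃ j (ℕₚ.<-trans l l₂)) wX wY
    dj : ∀ {P Q R S : Fin n → Set} → Disjoint G P R → Disjoint G P S → Disjoint G Q R → Disjoint G Q S → ∀ {v} → P v ⊎ Q v → R v ⊎ S v → ⊥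
    dj pr ps qr qs (inj₁ p) (inj₁ r) = pr _ p r
    dj pr ps qr qs (inj₁ p) (inj₂ s) = ps _ p s
    dj pr ps qr qs (inj₂ q) (inj₁ r) = qr _ q r
    dj pr ps qr qs (inj₂ q) (inj₂ s) = qs _ q s
    rev : ∀ {P : Fin n → Set} {x y} → Walk (Adj G) P x y → Walk (Adj G) P y x
    rev = walk-rev (adj-sym G)
    b-cd : ∀ {v} → A v ⊎ B v → C v ⊎ D v → ⊥
    b-cd = dj AC AD BC BD
    c-bd : ∀ {v} → A v ⊎ C v → B v ⊎ D v → ⊥
    c-bd = dj AB AD (λ v x y → BC v y x) CD
    d-bc : ∀ {v} → A v ⊎ D v → B v ⊎ C v → ⊥
    d-bc = dj AB AC (λ v x y → BD v y x) (λ v x y → CD v y x)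
    apart : ∀ {x y} → x ≢ y → (P : Visit x) (Q : Visit y) → proj₁ P < proj₁ Q ⊎ proj₁ Q < proj₁ P
    apart ne (k , h , _) (m , h′ , _) = case ℕₚ.<-cmp k m of λ
      { (tri< l _ _) → inj₁ l ; (tri> _ _ g) → inj₂ g ; (tri≈ _ refl _) → ⊥-elim (ne (trans (sym h) h′)) }
    sort : Visit b → Visit c → Visit d → ⊥
    sort vb vc vd = go (apart b≢c vb vc) (apart b≢d vb vd) (apart c≢d vc vd)
      where
      go : proj₁ vb < proj₁ vc ⊎ proj₁ vc < proj₁ vb → proj₁ vb < proj₁ vd ⊎ proj₁ vd < proj₁ vb → proj₁ vc < proj₁ vd ⊎ proj₁ vd < proj₁ vc → ⊥
      go (inj₁ bc) _ (inj₁ cd) = ordered vb vc vd bc cd c-bd (bridge bA bC jAC) (bridge bB bD jBD)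
      go (inj₁ bc) (inj₁ bd) (inj₂ dc) = ordered vb vd vc bd dc d-bc (bridge bA bD jAD) (bridge bB bC jBC)
      go (inj₁ bc) (inj₂ db) (inj₂ dc) = ordered vd vb vc db bc b-cd (bridge bA bB jAB) (rev (bridge bC bD jCD))
      go (inj₂ cb) (inj₁ bd) _ = ordered vc vb vd cb bd b-cd (bridge bA bB jAB) (bridge bC bD jCD)
      go (inj₂ cb) (inj₂ db) (inj₁ cd) = ordered vc vd vb cd db d-bc (bridge bA bD jAD) (rev (bridge bB bC jBC))
      go (inj₂ cb) (inj₂ db) (inj₂ dc) = ordered vd vc vb dc cb c-bd (bridge bA bC jAC) (rev (bridge bB bD jBD))

-- From a linkage across a cycle to a rooted K₄-minor

-- A cycle through a, b, c, d in this order; Sa is the open arc from d to b around a, and so on.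
record Ring {n : ℕ} (G : Graph n) (a b c d : Fin n) : Set₁ where
  field
    EZ : Fin n → Fin n → Set
    EZ? : ∀ u v → Dec (EZ u v)
    EZ-sym : ∀ {u v} → EZ u v → EZ v u
    EZ-adj : ∀ {u v} → EZ u v → Adj G u v
    Sa Sb Sc Sd : Fin n → Set
    a∈Sa : Sa a
    b∈Sb : Sb b
    c∈Sc : Sc c
    d∈Sd : Sd d
    Sa-closed : ∀ {u v} → Sa u → EZ u v → v ≢ b → v ≢ d → Sa v
    Sb-closed : ∀ {u v} → Sb u → EZ u v → v ≢ a → v ≢ c → Sb v
    Sd-closed : ∀ {u v} → Sd u → EZ u v → v ≢ a → v ≢ c → Sd v
    Sa-Sc : ∀ {v} → Sa v → Sc v → ⊥
    Sb-Sd : ∀ {v} → Sb v → Sd v → ⊥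
    a⇝b : Walk EZ (λ v → v ≡ a ⊎ Sb v) a b
    a⇝d : Walk EZ (λ v → v ≡ a ⊎ Sd v) a d
    b⇝c : Walk EZ (λ v → v ≡ b ⊎ Sc v) b c
    d⇝c : Walk EZ (λ v → v ≡ d ⊎ Sc v) d c

module _ {n : ℕ} (G : Graph n) where

  private
    E : Fin n → Fin n → Set
    E = Adj G
    E? : ∀ u v → Dec (E u v)
    E? = adj? G
    E-sym : ∀ {u v} → E u v → E v u
    E-sym = adj-sym G

  -- Connectedness seen from one fixed vertex, which is easier to maintain while pieces are moved
  -- between the two sides.
  Rooted : (Fin n → Set) → Fin n → Set
  Rooted W r = ∀ {v} → W v → Walk E W r v

  module _ {W S : Fin n → Set} {r t : Fin n} (W-rooted : Rooted W r) (S? : ∀ v → Dec (S v))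
           (S-rooted : Rooted S r) (S⊆W : ∀ {v} → S v → W v) (r∈S : S r)
           (P? : ∀ v → Dec (W v × ¬ S v)) (T : Comp E E? (λ v → W v × ¬ S v) P? t) where
    open Comp T

    S-avoids : ∀ {v} → S v → ¬ C v
    S-avoids s c = proj₂ (C⊆P c) s

    -- `C` is an entire component of `W` minus `S`, so a walk from elsewhere in `W` towards `r`
    -- reaches `S` before it can enter `C`.
    rest-rooted : Rooted (λ v → W v × ¬ C v) r
    rest-rooted {v} (w , nc) = decide (S? v)
      where
      S-walk : ∀ {s} → S s → Walk E (λ v → W v × ¬ C v) r s
      S-walk s = walk-mono (λ s → S⊆W s , S-avoids s) (S-rooted s)
      decide : Dec (S v) → Walk E (λ v → W v × ¬ C v) r v
      decide (yes s) = S-walk s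
      decide (no ns) with walk-exit (λ v → ¬ S v) (λ v → ¬? (S? v)) (walk-rev E-sym (W-rooted w)) ns (λ ns → ns r∈S)
      ... | u , s , wk , e , ps , ¬¬s = S-walk s∈S ⊕ (walk-end (S-walk s∈S) ▷⟨ E-sym e ⟩ walk-rev E-sym stretch)
        where
        s∈S : S s
        s∈S with S? s
        ... | yes p = p
        ... | no np = ⊥-elim (¬¬s np)
        stretch : Walk E (λ v → W v × ¬ C v) v u
        stretch = walk-mono (λ ((p , _) , q) → p , q) (walk-closed (λ v → (W v × ¬ S v) × ¬ C v) (λ (p , q) e p′ → p′ , λ c → q (step c (E-sym e) p)) wk ((w , ns) , nc))

    attached : W t → ∃ λ s → ∃ λ u → S s × C u × E s u
    attached wt with walk-exit C C? (walk-rev E-sym (W-rooted wt)) root (S-avoids r∈S)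
    ... | u , s , wk , e , ws , ns = s , u , s∈S , proj₂ (walk-end wk) , E-sym e
      where
      s∈S : S s
      s∈S with S? s
      ... | yes p = p
      ... | no np = ⊥-elim (ns (step (proj₂ (walk-end wk)) e (ws , np)))

    union-rooted : W t → Rooted (λ v → S v ⊎ C v) r
    union-rooted wt (inj₁ s) = walk-mono inj₁ (S-rooted s)
    union-rooted wt (inj₂ c) with attached wt
    ... | s , u , s∈S , cu , e = walk-mono inj₁ (S-rooted s∈S) ⊕ (inj₁ s∈S ▷⟨ e ⟩ walk-mono (inj₂ ∘ proj₂) (walk-rev E-sym (sound cu) ⊕ sound c))

  module Linkages (EZ : Fin n → Fin n → Set) (EZ? : ∀ u v → Dec (EZ u v)) (EZ-sym : ∀ {u v} → EZ u v → EZ v u)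
                  (EZ-adj : ∀ {u v} → EZ u v → E u v) where

    record Link (a b c d : Fin n) (X Y : Fin n → Set) : Set where
      field
        X? : ∀ v → Dec (X v)
        Y? : ∀ v → Dec (Y v)
        disjoint : ∀ {v} → X v → Y v → ⊥
        cover : ∀ v → X v ⊎ Y v
        a∈X : X a
        c∈X : X c
        b∈Y : Y b
        d∈Y : Y d
        X-rooted : Rooted X a
        Y-rooted : Rooted Y b

    swap-link : ∀ {a b c d X Y} → Link a b c d X Y → Link b a d c Y X
    swap-link l = record { X? = Y? ; Y? = X? ; disjoint = λ y x → disjoint x y ; cover = λ v → Data.Sum.swap (cover v)
      ; a∈X = b∈Y ; c∈X = d∈Y ; b∈Y = a∈X ; d∈Y = c∈X ; X-rooted = Y-rooted ; Y-rooted = X-rooted }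
      where open Link l

    Bichromatic : (X Y : Fin n → Set) → Fin n → Fin n → Set
    Bichromatic X Y u v = EZ u v × ((X u × Y v) ⊎ (Y u × X v))

    record Better (a b c d : Fin n) (X Y : Fin n → Set) : Set₁ where
      field
        X′ Y′ : Fin n → Set
        link′ : Link a b c d X′ Y′
        fewer : ∀ {u v} → Bichromatic X′ Y′ u v → Bichromatic X Y u v
        lost : ∃ λ u → ∃ λ v → Bichromatic X Y u v × ¬ Bichromatic X′ Y′ u v

    swap-better : ∀ {a b c d X Y} → Better b a d c Y X → Better a b c d X Y
    swap-better B = record { X′ = Y′ ; Y′ = X′ ; link′ = swap-link link′
      ; fewer = λ (e , h) → let (e′ , h′) = fewer (e , Data.Sum.swap h) in e′ , Data.Sum.swap h′
      ; lost = let (u , v , (e , h) , nh) = lost in u , v , (e , Data.Sum.swap h) , λ (e′ , h′) → nh (e′ , Data.Sum.swap h′) }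
      where open Better B

    -- The part of `Y` that has to stay. Its closure under cycle edges ensures that moving a
    -- component of the rest creates no new cycle edge between the two sides.
    record Core (b d : Fin n) (Y S : Fin n → Set) : Set where
      field
        S? : ∀ v → Dec (S v)
        S⊆Y : ∀ {v} → S v → Y v
        S-rooted : Rooted S b
        b∈S : S b
        d∈S : S d
        Z-closed : ∀ {u v} → S u → EZ u v → Y v → S v

    -- The component of `y` outside the core changes sides. No cycle edge joins it to the remainder
    -- of `Y`, so nothing becomes bichromatic, while the edge from `x` to `y` ceases to be.
    improve : ∀ {a b c d X Y S} → Link a b c d X Y → Core b d Y S → ∀ {x y} → X x → Y y → EZ x y → ¬ S y → Better a b c d X Y
    improve {a} {b} {c} {d} {X} {Y} {S} l co {x} {y} px py e ny = record
      { X′ = λ v → X v ⊎ C v ; Y′ = λ v → Y v × ¬ C v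
      ; link′ = record
        { X? = λ v → X? v ⊎-dec C? v ; Y? = λ v → Y? v ×-dec ¬? (C? v)
        ; disjoint = λ { (inj₁ x) (y , _) → disjoint x y ; (inj₂ c) (_ , nc) → nc c }
        ; cover = cover′
        ; a∈X = inj₁ a∈X ; c∈X = inj₁ c∈X
        ; b∈Y = b∈Y , λ c → proj₂ (C⊆P c) b∈S
        ; d∈Y = d∈Y , λ c → proj₂ (C⊆P c) d∈S
        ; X-rooted = λ { (inj₁ x) → walk-mono inj₁ (X-rooted x)
                       ; (inj₂ c) → walk-mono inj₁ (X-rooted px) ⊕ (inj₁ px ▷⟨ EZ-adj e ⟩ walk-mono (inj₂ ∘ proj₂) (sound c)) }
        ; Y-rooted = rest-rooted Y-rooted S? S-rooted S⊆Y b∈S P? T }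
      ; fewer = λ { (e , inj₁ (inj₁ x , y , _)) → e , inj₁ (x , y)
                  ; (e , inj₁ (inj₂ c , y , nc)) → ⊥-elim (inside c e y nc)
                  ; (e , inj₂ ((y , _) , inj₁ x)) → e , inj₂ (y , x)
                  ; (e , inj₂ ((y , nc) , inj₂ c)) → ⊥-elim (inside c (EZ-sym e) y nc) }
      ; lost = x , y , (e , inj₁ (px , py)) , λ { (_ , inj₁ (_ , _ , nc)) → nc root ; (_ , inj₂ ((y , _) , _)) → disjoint px y } }
      where
      open Link l
      open Core co
      P? : ∀ v → Dec (Y v × ¬ S v)
      P? v = Y? v ×-dec ¬? (S? v)
      T : Comp E E? (λ v → Y v × ¬ S v) P? y
      T = component E E? _ P? y (py , ny)
      open Comp T
      cover′ : ∀ v → (X v ⊎ C v) ⊎ (Y v × ¬ C v)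
      cover′ v with cover v | C? v
      ... | inj₁ x | _ = inj₁ (inj₁ x)
      ... | inj₂ y | yes c = inj₁ (inj₂ c)
      ... | inj₂ y | no nc = inj₂ (y , nc)
      inside : ∀ {u v} → C u → EZ u v → Y v → ¬ C v → ⊥
      inside {u} {v} cu e y nc = nc (step cu (EZ-adj e) (y , λ s → proj₂ (C⊆P cu) (Z-closed s (EZ-sym e) (proj₁ (C⊆P cu)))))

  rooted→branch : ∀ {W r} → W r → Rooted W r → Branch G r W
  rooted→branch w h = w , λ x y wx wy → walk→walkIn G (walk-rev E-sym (h wx) ⊕ h wy)

  module Cross {a b c d : Fin n} (Z : Ring G a b c d) where
    open Ring Z
    open Linkages EZ EZ? EZ-sym EZ-adj

    module _ {X Y : Fin n → Set} (l : Link a b c d X Y) where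
      open Link l

      private
        seg : (P : Fin n → Set) (P? : ∀ v → Dec (P v)) (x : Fin n) → P x → Comp EZ EZ? P P? x
        seg = component EZ EZ?

        ρa : Comp EZ EZ? X X? a
        ρa = seg X X? a a∈X
        module A = Comp ρa

        -- The stretch of the cycle around `a` inside `X` cannot pass `b` or `d`, which belong to
        -- `Y`.
        A⊆Sa : ∀ {v} → A.C v → Sa v
        A⊆Sa cv = walk-end (walk-closed Sa (λ s e x → Sa-closed s e (λ { refl → disjoint x b∈Y }) (λ { refl → disjoint x d∈Y })) (walk-mono proj₁ (A.sound cv)) a∈Sa)

        X∖A? : ∀ v → Dec (X v × ¬ A.C v)
        X∖A? v = X? v ×-dec ¬? (A.C? v)
        C₀ : Comp E E? (λ v → X v × ¬ A.C v) X∖A? c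
        C₀ = component E E? _ X∖A? c (c∈X , λ h → Sa-Sc (A⊆Sa h) c∈Sc)
        module C = Comp C₀

        A-rooted : Rooted A.C a
        A-rooted cv = walk-map (λ _ _ → EZ-adj) (walk-mono proj₂ (A.sound cv))

        core-X : Core a c X (λ v → A.C v ⊎ C.C v)
        core-X = record
          { S? = λ v → A.C? v ⊎-dec C.C? v
          ; S⊆Y = λ { (inj₁ p) → A.C⊆P p ; (inj₂ q) → proj₁ (C.C⊆P q) }
          ; S-rooted = union-rooted X-rooted A.C? A-rooted A.C⊆P A.root X∖A? C₀ c∈X
          ; b∈S = inj₁ A.root ; d∈S = inj₂ C.root
          ; Z-closed = λ { (inj₁ p) e x → inj₁ (A.step p e x) ; {v = v} (inj₂ q) e x → closed q e x (A.C? v) } }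
          where
          closed : ∀ {u v} → C.C u → EZ u v → X v → Dec (A.C v) → A.C v ⊎ C.C v
          closed q e x (yes p) = inj₁ p
          closed q e x (no np) = inj₂ (C.step q (EZ-adj e) (x , np))

        record Contact (S : Fin n → Set) : Set where
          field
            s r : Fin n
            r∈A : A.C r
            s∈Y : Y s
            s∈S : S s
            r-s : EZ r s

        contact : ∀ {S q} → Y q → Walk EZ (λ v → v ≡ a ⊎ S v) a q → Contact S
        contact {S} q∈Y w with walk-exit X X? w a∈X (λ x → disjoint x q∈Y)
        ... | r , s , wk , e , inj₂ h , nx = record { s = s ; r = r ; r∈A = A.complete (walk-mono proj₂ wk) ; s∈Y = Data.Sum.[ ⊥-elim ∘ nx , id ]′ (cover s) ; s∈S = h ; r-s = e }
        ... | r , s , wk , e , inj₁ refl , nx = ⊥-elim (nx a∈X)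

        -- On the way along the cycle from `q` to `c`, the first vertex outside `Y` is in one of the
        -- two pieces by hypothesis; lying on the arc around `c`, it is not in the stretch around
        -- `a`.
        far : (∀ {x y} → X x → Y y → EZ x y → A.C x ⊎ C.C x) → ∀ {q} → Y q → Walk EZ (λ v → v ≡ q ⊎ Sc v) q c →
          ∃ λ β → ∃ λ x → Walk EZ Y q β × EZ β x × C.C x
        far good q∈Y w with walk-exit Y Y? w q∈Y (λ y → disjoint c∈X y)
        ... | β , x , wk , e , inj₁ refl , ny = ⊥-elim (ny q∈Y)
        ... | β , x , wk , e , inj₂ h , ny = β , x , walk-mono proj₂ wk , e ,
              Data.Sum.[ (λ p → ⊥-elim (Sa-Sc (A⊆Sa p) h)) , id ]′ (good (Data.Sum.[ id , ⊥-elim ∘ ny ]′ (cover x)) (proj₂ (walk-end wk)) (EZ-sym e))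

        A-C : Disjoint G A.C C.C
        A-C v p q = proj₂ (C.C⊆P q) p

        -- The stretch of `Y` around the contact `t` is taken out; `B₀` is what `b` still reaches,
        -- and `D₁` the component of `d` in the rest of `Y`. If `B₀` contains `d`, or `D₁` misses
        -- `t`, then `t` lies outside a core and can be moved across; otherwise both sides split
        -- into the minor.
        finish : (∀ {x y} → X x → Y y → EZ x y → A.C x ⊎ C.C x) →
          ∀ {s t r r′} → A.C r → EZ r s → A.C r′ → EZ r′ t → Y s → (t∈Y : Y t) →
          (b∉ρ : ¬ Comp.C (seg Y Y? t t∈Y) b) →
          Walk E (λ v → Y v × ¬ Comp.C (seg Y Y? t t∈Y) v) b s →
          RootedK4Minor G a b c d ⊎ Better a b c d X Y
        finish good {s} {t} {r} {r′} r∈A r-s r′∈A r′-t s∈Y t∈Y b∉ρ wbs = conclude (B.C? d) (λ h → D₁? h (Comp.C? (D₁ h) t))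
          where
          module R = Comp (seg Y Y? t t∈Y)
          Y∖R? : ∀ v → Dec (Y v × ¬ R.C v)
          Y∖R? v = Y? v ×-dec ¬? (R.C? v)
          B₀ : Comp E E? (λ v → Y v × ¬ R.C v) Y∖R? b
          B₀ = component E E? _ Y∖R? b (b∈Y , b∉ρ)
          module B = Comp B₀
          B-rooted : Rooted B.C b
          B-rooted p = walk-mono proj₂ (B.sound p)
          B-closed : ∀ {u v} → B.C u → EZ u v → Y v → B.C v
          B-closed p e y = B.step p (EZ-adj e) (y , λ h → proj₂ (B.C⊆P p) (R.step h (EZ-sym e) (proj₁ (B.C⊆P p))))
          Y∖B? : ∀ v → Dec (Y v × ¬ B.C v)
          Y∖B? v = Y? v ×-dec ¬? (B.C? v)
          D₁ : ¬ B.C d → Comp E E? (λ v → Y v × ¬ B.C v) Y∖B? d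
          D₁ h = component E E? _ Y∖B? d (d∈Y , h)
          t∉B : ¬ B.C t
          t∉B p = proj₂ (B.C⊆P p) R.root
          D₁? : (h : ¬ B.C d) → Dec (Comp.C (D₁ h) t) → RootedK4Minor G a b c d ⊎ Better a b c d X Y
          D₁? h (no t∉D) = inj₂ (improve l core (A.C⊆P r′∈A) t∈Y r′-t λ { (inj₁ p) → t∉B p ; (inj₂ q) → t∉D q })
            where
            module D = Comp (D₁ h)
            core : Core b d Y (λ v → B.C v ⊎ D.C v)
            core = record { S? = λ v → B.C? v ⊎-dec D.C? v ; S⊆Y = λ { (inj₁ p) → proj₁ (B.C⊆P p) ; (inj₂ q) → proj₁ (D.C⊆P q) }
              ; S-rooted = union-rooted Y-rooted B.C? B-rooted (proj₁ ∘ B.C⊆P) B.root Y∖B? (D₁ h) d∈Y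
              ; b∈S = inj₁ B.root ; d∈S = inj₂ D.root
              ; Z-closed = λ { (inj₁ p) e y → inj₁ (B-closed p e y) ; {v = v} (inj₂ q) e y → closed q e y (B.C? v) } }
              where
              closed : ∀ {u v} → D.C u → EZ u v → Y v → Dec (B.C v) → B.C v ⊎ D.C v
              closed q e x (yes p) = inj₁ p
              closed q e x (no np) = inj₂ (D.step q (EZ-adj e) (x , np))
          -- The two contacts join the piece of `a` to those of `b` and `d`, the two splits join `a`
          -- to `c` and `b` to `d`, and the cycle joins `c` to `b` and `d`.
          D₁? h (yes t∈D) = inj₁ ((λ v → X v × ¬ C.C v) , (λ v → Y v × ¬ D.C v) , C.C , D.C ,
              rooted→branch (a∈X , λ q → proj₂ (C.C⊆P q) A.root) (rest-rooted X-rooted A.C? A-rooted A.C⊆P A.root X∖A? C₀) ,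
              rooted→branch (b∈Y , λ q → proj₂ (D.C⊆P q) B.root) (rest-rooted Y-rooted B.C? B-rooted (proj₁ ∘ B.C⊆P) B.root Y∖B? (D₁ h)) ,
              rooted→branch C.root (walk-mono proj₂ ∘ C.sound) , rooted→branch D.root (walk-mono proj₂ ∘ D.sound) ,
              (λ v (x , _) (y , _) → disjoint x y) , (λ v (_ , nc) q → nc q) , (λ v (x , _) q → disjoint x (proj₁ (D.C⊆P q))) ,
              (λ v (y , _) q → disjoint (proj₁ (C.C⊆P q)) y) , (λ v (_ , nd) q → nd q) , (λ v p q → disjoint (proj₁ (C.C⊆P p)) (proj₁ (D.C⊆P q))) ,
              (r , s , A∖C r∈A , B∖D (B.complete wbs) , EZ-adj r-s) ,
              (let (u , v , p , q , e) = attached X-rooted A.C? A-rooted A.C⊆P A.root X∖A? C₀ c∈X in u , v , A∖C p , q , e) ,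
              (r′ , t , A∖C r′∈A , t∈D , EZ-adj r′-t) ,
              (let (β , x , wk , e , q) = far good b∈Y b⇝c in β , x , B∖D (walk-end (walk-closed B.C B-closed wk B.root)) , q , EZ-adj e) ,
              (let (u , v , p , q , e) = attached Y-rooted B.C? B-rooted (proj₁ ∘ B.C⊆P) B.root Y∖B? (D₁ h) d∈Y in u , v , B∖D p , q , e) ,
              (let (δ , x , wk , e , q) = far good d∈Y d⇝c in x , δ , q , walk-end (walk-closed D.C D-closed wk D.root) , E-sym (EZ-adj e)))
            where
            module D = Comp (D₁ h)
            A∖C : ∀ {v} → A.C v → X v × ¬ C.C v
            A∖C p = A.C⊆P p , λ q → A-C _ p q
            B∖D : ∀ {v} → B.C v → Y v × ¬ D.C v
            B∖D p = proj₁ (B.C⊆P p) , λ q → proj₂ (D.C⊆P q) p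
            D-closed : ∀ {u v} → D.C u → EZ u v → Y v → D.C v
            D-closed q e y = D.step q (EZ-adj e) (y , λ p → proj₂ (D.C⊆P q) (B-closed p (EZ-sym e) (proj₁ (D.C⊆P q))))
          conclude : Dec (B.C d) → (¬ B.C d → RootedK4Minor G a b c d ⊎ Better a b c d X Y) → RootedK4Minor G a b c d ⊎ Better a b c d X Y
          conclude (no h) k = k h
          conclude (yes d∈B) _ = inj₂ (improve l (record { S? = B.C? ; S⊆Y = proj₁ ∘ B.C⊆P ; S-rooted = B-rooted ; b∈S = B.root ; d∈S = d∈B ; Z-closed = B-closed })
            (A.C⊆P r′∈A) t∈Y r′-t t∉B)

        splits : (∀ {x y} → X x → Y y → EZ x y → A.C x ⊎ C.C x) → Contact Sb → Contact Sd → RootedK4Minor G a b c d ⊎ Better a b c d X Y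
        splits good c₁ c₂ = choose (reach? E E? _ Y∖R₂? b C₁.s)
          where
          module C₁ = Contact c₁
          module C₂ = Contact c₂
          module R₁ = Comp (seg Y Y? C₁.s C₁.s∈Y)
          module R₂ = Comp (seg Y Y? C₂.s C₂.s∈Y)
          R₁⊆Sb : ∀ {v} → R₁.C v → Sb v
          R₁⊆Sb p = walk-end (walk-closed Sb (λ s e y → Sb-closed s e (λ { refl → disjoint a∈X y }) (λ { refl → disjoint c∈X y })) (walk-mono proj₁ (R₁.sound p)) C₁.s∈S)
          R₂⊆Sd : ∀ {v} → R₂.C v → Sd v
          R₂⊆Sd p = walk-end (walk-closed Sd (λ s e y → Sd-closed s e (λ { refl → disjoint a∈X y }) (λ { refl → disjoint c∈X y })) (walk-mono proj₁ (R₂.sound p)) C₂.s∈S)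
          Y∖R₂? : ∀ v → Dec (Y v × ¬ R₂.C v)
          Y∖R₂? v = Y? v ×-dec ¬? (R₂.C? v)
          b∉R₂ : ¬ R₂.C b
          b∉R₂ p = Sb-Sd b∈Sb (R₂⊆Sd p)
          choose : Dec (Walk E (λ v → Y v × ¬ R₂.C v) b C₁.s) → RootedK4Minor G a b c d ⊎ Better a b c d X Y
          choose (yes w) = finish good C₁.r∈A C₁.r-s C₂.r∈A C₂.r-s C₁.s∈Y C₂.s∈Y b∉R₂ w
          -- Every walk in `Y` from `b` to `C₁.s` now meets the stretch around `C₂.s`, and before
          -- that it avoids the stretch around `C₁.s`. So the contacts exchange roles.
          choose (no nw) = finish good C₂.r∈A C₂.r-s C₁.r∈A C₁.r-s C₂.s∈Y C₁.s∈Y (λ p → nw (along p ⟦ b∈Y , b∉R₂ ⟧))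
              (detour (walk-exit B.C B.C? (Y-rooted C₁.s∈Y) B.root (λ p → nw (walk-mono proj₁ (B.sound p)))))
            where
            B₀ : Comp E E? (λ v → Y v × ¬ R₂.C v) Y∖R₂? b
            B₀ = component E E? _ Y∖R₂? b (b∈Y , b∉R₂)
            module B = Comp B₀
            along : ∀ {v} → R₁.C v → Walk E (λ v → Y v × ¬ R₂.C v) b v → Walk E (λ v → Y v × ¬ R₂.C v) b C₁.s
            along p w = w ⊕ walk-rev E-sym (walk-mono (λ (y , r) → y , λ r₂ → Sb-Sd (R₁⊆Sb r) (R₂⊆Sd r₂)) (walk-map (λ _ _ → EZ-adj) (R₁.sound p)))
            detour : (∃ λ u → ∃ λ v → Walk E (λ w → Y w × B.C w) b u × E u v × Y v × ¬ B.C v) → Walk E (λ v → Y v × ¬ R₁.C v) b C₂.s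
            detour (u , v , wk , e , y , nb) = walk-mono (λ (y , p) → y , λ r → nw (along r (walk-mono proj₁ (B.sound p)))) wk
                ⊕ (u-ok ▷⟨ e ⟩ walk-mono (λ (y , r₂) → y , λ r → Sb-Sd (R₁⊆Sb r) (R₂⊆Sd r₂)) (walk-rev E-sym (walk-map (λ _ _ → EZ-adj) (R₂.sound v∈R₂))))
              where
              u-ok : Y u × ¬ R₁.C u
              u-ok = let (y , p) = walk-end wk in y , λ r → nw (along r (walk-mono proj₁ (B.sound p)))
              v∈R₂ : R₂.C v
              v∈R₂ with R₂.C? v
              ... | yes r = r
              ... | no nr = ⊥-elim (nb (B.step (proj₂ (walk-end wk)) e (y , nr)))

      minor-or-better : RootedK4Minor G a b c d ⊎ Better a b c d X Y
      minor-or-better with any? (λ x → (X? x ×-dec ¬? (A.C? x ⊎-dec C.C? x)) ×-dec any? (λ y → Y? y ×-dec EZ? x y))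
      -- A cycle edge that leaves `X` outside both pieces allows an improvement with the two sides
      -- exchanged.
      ... | yes (x , (px , bad) , y , py , e) = inj₂ (swap-better (improve (swap-link l) core-X py px (EZ-sym e) bad))
      ... | no none = splits good (contact b∈Y a⇝b) (contact d∈Y a⇝d)
        where
        good : ∀ {x y} → X x → Y y → EZ x y → A.C x ⊎ C.C x
        good {x} {y} px py e with A.C? x ⊎-dec C.C? x
        ... | yes h = h
        ... | no bad = ⊥-elim (none (x , (px , bad) , y , py , e))

    link→minor : ∀ {X Y} → Link a b c d X Y → RootedK4Minor G a b c d
    link→minor l = go (suc (bichromatic l)) l ℕₚ.≤-refl
      where
      -- Ordered pairs are coded as elements of `Fin (n * n)`, so that `count` can measure progress.
      Bi? : ∀ {X Y} → Link a b c d X Y → (i : Fin (n * n)) → Dec (Bichromatic X Y (proj₁ (Fin.remQuot n i)) (proj₂ (Fin.remQuot {n} n i)))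
      Bi? l i = EZ? _ _ ×-dec ((X? _ ×-dec Y? _) ⊎-dec (Y? _ ×-dec X? _))
        where open Link l
      bichromatic : ∀ {X Y} → Link a b c d X Y → ℕ
      bichromatic l = count (Bi? l)
      go : ∀ k {X Y} (l : Link a b c d X Y) → bichromatic l < k → RootedK4Minor G a b c d
      go (suc k) {X} {Y} l lt with minor-or-better l
      ... | inj₁ m = m
      ... | inj₂ B = go k link′ (ℕₚ.<-≤-trans (drop lost) (ℕₚ.≤-pred lt))
        where
        open Better B
        drop : (∃ λ u → ∃ λ v → Bichromatic X Y u v × ¬ Bichromatic X′ Y′ u v) → bichromatic link′ < bichromatic l
        drop (u , v , h , nh) = count-< (Bi? link′) (Bi? l) fewer {Fin.combine u v}
          (subst (λ p → Bichromatic X Y (proj₁ p) (proj₂ p)) (sym (Finₚ.remQuot-combine u v)) h)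
          (λ h′ → nh (subst (λ p → Bichromatic X′ Y′ (proj₁ p) (proj₂ p)) (Finₚ.remQuot-combine u v) h′))

-- A cycle through four given vertices

module _ {A : Set} where

  Cyclic : A → List A → A → A → Set
  Cyclic z l u v = Consec u v (z ∷ l ++ z ∷ [])

  rotate : ∀ (p : List A) {z y s u v} → Cyclic y (s ++ z ∷ p) u v → Cyclic z (p ++ y ∷ s) u v
  rotate p {z} {y} {s} {u} {v} h with consec-split (y ∷ s) (subst (λ l → Consec u v (y ∷ l)) (Listₚ.++-assoc s (z ∷ p) (y ∷ [])) h)
  ... | inj₁ h₁ = subst (λ l → Consec u v (z ∷ l)) (sym (Listₚ.++-assoc p (y ∷ s) (z ∷ []))) (consec-++ʳ (z ∷ p) h₁)
  ... | inj₂ h₂ = subst (λ l → Consec u v (z ∷ l)) (sym (Listₚ.++-assoc p (y ∷ s) (z ∷ []))) (consec-join₁ (z ∷ p) h₂)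

  rotate-unique : ∀ (p : List A) {z y s} → Unique (z ∷ p ++ y ∷ s) → Unique (y ∷ s ++ z ∷ p)
  rotate-unique p {z} {y} {s} u = let (up , us , dj) = unique-++⁻ (z ∷ p) {y ∷ s} u in unique-++⁺ {p = y ∷ s} us up (λ i j → dj j i)

  rotate-∈ : ∀ (p : List A) {z y s x} → x ∈ z ∷ p ++ y ∷ s → x ∈ y ∷ s ++ z ∷ p
  rotate-∈ p {z} {y} {s} i with ∈-++⁻ (z ∷ p) i
  ... | inj₁ j = ∈-++⁺ʳ (y ∷ s) j
  ... | inj₂ j = ∈-++⁺ˡ j

  consec-prefix : ∀ {x y B u v} (m : List A) → Consec u v (x ∷ m ++ y ∷ []) → Cyclic x (m ++ y ∷ B) u v
  consec-prefix {x} {y} {B} {u} {v} m h = subst (λ l → Consec u v (x ∷ l)) (sym (Listₚ.++-assoc m (y ∷ B) (x ∷ []))) (consec-join₁ (x ∷ m) h)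

  consec-snoc : ∀ (l : List A) {y u v} → Consec u v (l ++ y ∷ []) → Consec u v l ⊎ (Last u l × v ≡ y)
  consec-snoc [] (there ())
  consec-snoc (x ∷ []) here = inj₂ (last , refl)
  consec-snoc (x ∷ []) (there (there ()))
  consec-snoc (x ∷ w ∷ l) here = inj₁ here
  consec-snoc (x ∷ w ∷ l) (there h) with consec-snoc (w ∷ l) h
  ... | inj₁ c = inj₁ (there c)
  ... | inj₂ (la , e) = inj₂ (there la , e)

  unique-⊆-length : ∀ {l m : List A} → Unique l → (∀ {x} → x ∈ l → x ∈ m) → length l ≤ length m
  unique-⊆-length {[]} _ _ = z≤n
  unique-⊆-length {x ∷ l} (nx ∷ u) sub with ∈-∃++ (sub (here refl))
  ... | p , s , refl = ℕₚ.≤-trans (s≤s (unique-⊆-length u rest)) (ℕₚ.≤-reflexive (trans (cong suc (Listₚ.length-++ p)) (trans (sym (ℕₚ.+-suc (length p) (length s))) (sym (Listₚ.length-++ p)))))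
    where
    rest : ∀ {y} → y ∈ l → y ∈ p ++ s
    rest i with ∈-++⁻ p (sub (there i))
    ... | inj₁ j = ∈-++⁺ˡ j
    ... | inj₂ (here refl) = ⊥-elim (All≢⇒∉ nx i)
    ... | inj₂ (there j) = ∈-++⁺ʳ p j

  module _ {K T : A → Set} (K? : ∀ x → Dec (K x)) (T? : ∀ x → Dec (T x)) where

    -- A stretch that may be rerouted: `K` will mark the contacts of a component and `T` the
    -- vertices that must stay on the cycle.
    record Gapless (l : List A) : Set where
      field
        {p g s} : List A
        {x y} : A
        split : l ≡ p ++ x ∷ g ++ y ∷ s
        Kx : K x
        Ky : K y
        g-K : ∀ {w} → w ∈ g → ¬ K w
        g-T : ∀ {w} → w ∈ g → ¬ T w

    private
      tail : ℕ → List A → Set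
      tail zero g = ∀ {w} → w ∈ g → ¬ T w
      tail (suc _) g = ⊤

      -- `t` tells whether a `T` has been seen since the last `K`. A `K` met while `t` is 1 is
      -- charged to that `T`, so without a gapless stretch the remaining `K`s exceed the remaining
      -- `T`s by at most `t`.
      scan : ∀ p x g m t → t ≤ 1 → K x → (∀ {w} → w ∈ g → ¬ K w) → tail t g →
        Gapless (p ++ x ∷ g ++ m) ⊎ length (filter K? m) ≤ length (filter T? m) + t
      scan p x g [] t _ kx gk gt = inj₂ z≤n
      scan p x g (w ∷ m) t le kx gk gt with K? w
      scan p x g (w ∷ m) zero le kx gk gt | yes kw = inj₁ (record { split = refl ; Kx = kx ; Ky = kw ; g-K = gk ; g-T = gt })
      scan p x g (w ∷ m) (suc zero) le kx gk gt | yes kw with scan (p ++ x ∷ g) w [] m zero z≤n kw (λ ()) (λ ())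
      ... | inj₁ h = inj₁ (subst Gapless (Listₚ.++-assoc p (x ∷ g) (w ∷ m)) h)
      ... | inj₂ h = inj₂ (ℕₚ.≤-trans (s≤s (ℕₚ.≤-trans h (ℕₚ.+-monoˡ-≤ 0 more))) (ℕₚ.≤-reflexive (sym (trans (ℕₚ.+-suc _ 0) refl))))
        where
        more : length (filter T? m) ≤ length (filter T? (w ∷ m))
        more with T? w
        ... | yes _ = ℕₚ.n≤1+n _
        ... | no _ = ℕₚ.≤-refl
      scan p x g (w ∷ m) (suc (suc _)) (s≤s ()) kx gk gt | yes kw
      scan p x g (w ∷ m) t le kx gk gt | no nk with T? w
      ... | yes tw with scan p x (g ++ w ∷ []) m 1 ℕₚ.≤-refl kx nk′ tt
        where
        nk′ : ∀ {v} → v ∈ g ++ w ∷ [] → ¬ K v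
        nk′ i with ∈-++⁻ g i
        ... | inj₁ j = gk j
        ... | inj₂ (here refl) = nk
      ...   | inj₁ h = inj₁ (subst (λ l → Gapless (p ++ x ∷ l)) (Listₚ.++-assoc g (w ∷ []) m) h)
      ...   | inj₂ h = inj₂ (ℕₚ.≤-trans h (ℕₚ.≤-trans (ℕₚ.≤-reflexive (ℕₚ.+-comm _ 1)) (s≤s (ℕₚ.m≤m+n _ t))))
      scan p x g (w ∷ m) t le kx gk gt | no nk | no nt with scan p x (g ++ w ∷ []) m t le kx nk′ (still t gt)
        where
        nk′ : ∀ {v} → v ∈ g ++ w ∷ [] → ¬ K v
        nk′ i with ∈-++⁻ g i
        ... | inj₁ j = gk j
        ... | inj₂ (here refl) = nk
        still : ∀ t → tail t g → tail t (g ++ w ∷ [])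
        still (suc _) _ = tt
        still zero gt i with ∈-++⁻ g i
        ... | inj₁ j = gt j
        ... | inj₂ (here refl) = nt
      ...   | inj₁ h = inj₁ (subst (λ l → Gapless (p ++ x ∷ l)) (Listₚ.++-assoc g (w ∷ []) m) h)
      ...   | inj₂ h = inj₂ h

    gapless : ∀ x m → K x → length (filter T? m) < length (filter K? m) → Gapless (x ∷ m)
    gapless x m kx lt with scan [] x [] m zero z≤n kx (λ ()) (λ ())
    ... | inj₁ h = h
    ... | inj₂ h = ⊥-elim (ℕₚ.<⇒≱ lt (ℕₚ.≤-trans h (ℕₚ.≤-reflexive (ℕₚ.+-identityʳ _))))

simple-path : ∀ {n} {E : Fin n → Fin n → Set} {P : Fin n → Set} {x y} → Walk E P x y →
  ∃ λ l → Unique (x ∷ l) × (∀ {v} → v ∈ x ∷ l → P v) × Last y (x ∷ l) × (∀ {u v} → Consec u v (x ∷ l) → E u v)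
simple-path ⟦ p ⟧ = [] , [] ∷ [] , (λ { (here refl) → p }) , last , λ { (there ()) }
simple-path {x = x} (_▷⟨_⟩_ {y = z} p e w) with simple-path w
... | l , u , ps , la , es with x ∈? (z ∷ l)
... | no ni = z ∷ l , ∉⇒All≢ ni ∷ u , (λ { (here refl) → p ; (there i) → ps i }) , there la , λ { here → e ; (there c) → es c }
... | yes i with ∈-∃++ i
... | q , s , eq = s , proj₁ (proj₂ (unique-++⁻ q (subst Unique eq u))) , (λ j → ps (subst (_ ∈_) (sym eq) (∈-++⁺ʳ q j))) ,
      last-++⁻ q (subst (Last _) eq la) , λ c → es (subst (Consec _ _) (sym eq) (consec-++ʳ q c))

module _ {n : ℕ} (G : Graph n) where

  record Cycle (z : Fin n) (l : List (Fin n)) : Set where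
    field
      unique : Unique (z ∷ l)
      adjacent : ∀ {u v} → Cyclic z l u v → Adj G u v
      nonempty : l ≢ []

  rotate-cycle : ∀ p {z y s} → Cycle z (p ++ y ∷ s) → Cycle y (s ++ z ∷ p)
  rotate-cycle p {s = s} C = record { unique = rotate-unique p unique ; adjacent = adjacent ∘ rotate p ; nonempty = ne s }
    where
    open Cycle C
    ne : ∀ s {z : Fin n} {p} → s ++ z ∷ p ≢ []
    ne [] ()
    ne (_ ∷ _) ()

  Wide : Set
  Wide = ∀ (l : List (Fin n)) → length l ≤ 3 → ∀ {x y} → x ∉ l → y ∉ l → Walk (Adj G) (_∉ l) x y

  module _ (wide : Wide) where

    record Extended (v : Fin n) (T : List (Fin n)) : Set where
      field
        {z} : Fin n
        {l} : List (Fin n)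
        cycle : Cycle z l
        T⊆ : ∀ {t} → t ∈ T → t ∈ z ∷ l
        v∈ : v ∈ z ∷ l

    module _ (v : Fin n) (T : List (Fin n)) (T≤3 : length T ≤ 3) where

      private
        off? : ∀ z (l : List (Fin n)) x → Dec (x ∉ z ∷ l)
        off? z l x = ¬? (x ∈? (z ∷ l))

        island : ∀ z l → v ∉ z ∷ l → Comp (Adj G) (adj? G) (_∉ z ∷ l) (off? z l) v
        island z l = component (Adj G) (adj? G) _ (off? z l) v

        size : ∀ z l → v ∉ z ∷ l → ℕ
        size z l o = count (Comp.C? (island z l o))

      -- Reroute the cycle through the component containing v, between two neighbouring contacts with
      -- no vertex of T in between; the component shrinks.
      absorb : ∀ k z l → Cycle z l → (∀ {t} → t ∈ T → t ∈ z ∷ l) → (o : v ∉ z ∷ l) → size z l o < k → Extended v T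
      absorb (suc k) z l cyc T⊆ o lt = few-or-many (3 ℕ.<? length contacts)
        where
        open Cycle cyc
        module H = Comp (island z l o)
        K : Fin n → Set
        K x = ∃ λ h → H.C h × Adj G x h
        K? : ∀ x → Dec (K x)
        K? x = any? λ h → H.C? h ×-dec adj? G x h
        contacts : List (Fin n)
        contacts = filter K? (z ∷ l)

        -- The cycle rotated so that it starts with the part g to be replaced.
        module _ {x y g r} (cyc′ : Cycle x (g ++ y ∷ r)) (same : ∀ {t} → t ∈ z ∷ l → t ∈ x ∷ g ++ y ∷ r)
                 (back : ∀ {t} → t ∈ x ∷ g ++ y ∷ r → t ∈ z ∷ l) (Kx : K x) (Ky : K y)
                 (g-K : ∀ {w} → w ∈ g → ¬ K w) (g-T : ∀ {w} → w ∈ g → w ∉ T) where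

          replaced : ∀ {m h h′} → Adj G x h → Unique (h ∷ m) → (∀ {u} → u ∈ h ∷ m → H.C u) → Last h′ (h ∷ m) →
            (∀ {u w} → Consec u w (h ∷ m) → Adj G u w) → Adj G h′ y → Extended v T
          replaced {m} {h} {h′} xh um Hm la em h′y = decide (v ∈? (x ∷ h ∷ m ++ y ∷ r))
            where
            module C′ = Cycle cyc′
            m′ : List (Fin n)
            m′ = h ∷ m ++ y ∷ r
            off : ∀ {u} → u ∈ h ∷ m → u ∉ z ∷ l
            off i = H.C⊆P (Hm i)
            u-parts : Unique (x ∷ g) × Unique (y ∷ r) × (∀ {w} → w ∈ x ∷ g → w ∈ y ∷ r → ⊥)
            u-parts = unique-++⁻ (x ∷ g) C′.unique
            unique′ : Unique (x ∷ m′)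
            unique′ = unique-++⁺ {p = x ∷ h ∷ m}
              (∉⇒All≢ (λ i → off i (back (here refl))) ∷ um) (proj₁ (proj₂ u-parts))
              λ { (here refl) i → proj₂ (proj₂ u-parts) (here refl) i ; (there i) j → off i (back (∈-++⁺ʳ (x ∷ g) j)) }
            adjacent′ : ∀ {u w} → Cyclic x m′ u w → Adj G u w
            adjacent′ {u} {w} c with consec-split (x ∷ h ∷ m) (subst (λ l → Consec u w (x ∷ h ∷ l)) (Listₚ.++-assoc m (y ∷ r) (x ∷ [])) c)
            ... | inj₂ c₂ = C′.adjacent (subst (λ l → Consec u w (x ∷ l)) (sym (Listₚ.++-assoc g (y ∷ r) (x ∷ []))) (consec-++ʳ (x ∷ g) c₂))
            ... | inj₁ here = xh
            ... | inj₁ (there c₁) with consec-snoc (h ∷ m) c₁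
            ... | inj₁ c₃ = em c₃
            ... | inj₂ (la′ , refl) = subst (λ t → Adj G t y) (last-≡ la la′) h′y
              where
              last-≡ : ∀ {l : List (Fin n)} {a b} → Last a l → Last b l → a ≡ b
              last-≡ last last = refl
              last-≡ (there p) (there q) = last-≡ p q
              last-≡ last (there ())
              last-≡ (there ()) last
            cycle′ : Cycle x m′
            cycle′ = record { unique = unique′ ; adjacent = adjacent′ ; nonempty = λ () }
            keep : ∀ {t} → t ∉ g → t ∈ x ∷ g ++ y ∷ r → t ∈ x ∷ m′
            keep ng (here e) = here e
            keep ng (there i) with ∈-++⁻ g i
            ... | inj₁ j = ⊥-elim (ng j)
            ... | inj₂ j = ∈-++⁺ʳ (x ∷ h ∷ m) j
            T⊆′ : ∀ {t} → t ∈ T → t ∈ x ∷ m′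
            T⊆′ i = keep (λ j → g-T j i) (same (T⊆ i))
            decide : Dec (v ∈ x ∷ m′) → Extended v T
            decide (yes i) = record { cycle = cycle′ ; T⊆ = T⊆′ ; v∈ = i }
            -- The vertex `h` has moved from the component to the cycle, and the discarded vertices
            -- `g` have no neighbour in the component, so it can only shrink.
            decide (no o′) = absorb k x m′ cycle′ T⊆′ o′ (ℕₚ.<-≤-trans (count-< H′.C? H.C? (λ {u} → shrinks {u}) {h} (Hm (here refl)) (λ c → H′.C⊆P {h} c (there (here refl)))) (ℕₚ.≤-pred lt))
              where
              module H′ = Comp (island x m′ o′)
              shrinks : ∀ {u} → H′.C u → H.C u
              shrinks {u} c = walk-end (walk-closed H.C grow (walk-mono proj₁ (H′.sound {u} c)) H.root)
                where
                grow : ∀ {u w} → H.C u → Adj G u w → w ∉ x ∷ m′ → H.C w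
                grow {u} {w} hu e nw with w ∈? (z ∷ l)
                ... | no nz = H.step {u} {w} hu e nz
                ... | yes iz = ⊥-elim (nw (keep (λ j → g-K j (u , hu , adj-sym G e)) (same iz)))

          reroute : Extended v T
          reroute = go Kx Ky
            where
            go : K x → K y → Extended v T
            go (h , ch , e) (h′ , ch′ , e′) with simple-path (walk-rev (adj-sym G) (walk-mono proj₂ (H.sound ch)) ⊕ walk-mono proj₂ (H.sound ch′))
            ... | m , um , Hm , la , em = replaced e um Hm la em (adj-sym G e′)

        few-or-many : Dec (3 < length contacts) → Extended v T
        -- Three or fewer contacts cannot separate `v` from another vertex of the cycle. Hence all
        -- its vertices are contacts, and any two neighbours will do.
        few-or-many (no few) = dense l refl
          where
          all-contacts : ∀ {x} → x ∈ z ∷ l → K x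
          all-contacts {x} i with K? x
          ... | yes h = h
          ... | no nk with walk-exit H.C H.C? (wide contacts (ℕₚ.≮⇒≥ few) (λ j → o (proj₁ (∈-filter⁻ K? {xs = z ∷ l} j))) (λ j → nk (proj₂ (∈-filter⁻ K? {xs = z ∷ l} j)))) H.root (λ c → H.C⊆P c i)
          ... | u , w , wk , e , nw , nc = ⊥-elim (nc (H.step (proj₂ (walk-end wk)) e (λ j → nw (∈-filter⁺ K? j (u , proj₂ (walk-end wk) , adj-sym G e)))))
          dense : ∀ l′ → l ≡ l′ → Extended v T
          dense [] eq = ⊥-elim (nonempty eq)
          dense (y ∷ r) refl = reroute {g = []} cyc id id (all-contacts (here refl)) (all-contacts (there (here refl))) (λ ()) (λ ())
        -- There are more contacts than vertices of `T`, so somewhere on the cycle two successive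
        -- contacts have no vertex of `T` between them.
        few-or-many (yes many) with split-first K? (z ∷ l) (some contacts refl many)
          where
          some : ∀ m → contacts ≡ m → 3 < length m → ∃ λ x → x ∈ z ∷ l × K x
          some (x ∷ _) eq _ = x , ∈-filter⁻ K? {xs = z ∷ l} (subst (x ∈_) (sym eq) (here refl))
        ... | pre , x₀ , suf , eq , kx₀ , np = from-contact pre eq np
          where
          Spanning : Fin n → List (Fin n) → Set
          Spanning y m = Cycle y m × (∀ {t} → t ∈ z ∷ l → t ∈ y ∷ m) × (∀ {t} → t ∈ y ∷ m → t ∈ z ∷ l)

          spin : ∀ p {x y s} → Spanning x (p ++ y ∷ s) → Spanning y (s ++ x ∷ p)
          spin p {s = s} (c , f , g) = rotate-cycle p c , rotate-∈ p ∘ f , g ∘ rotate-∈ s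

          closing : ∀ {y m} → Spanning y m → K y → Gapless K? (_∈? T) (y ∷ m ++ y ∷ []) → Extended v T
          closing {y} {m} sp ky gl = go sp p (unsnoc s) split Kx Ky g-K g-T
            where
            open Gapless gl using (p; s; split; Kx; Ky; g-K; g-T)
            data Snoc : List (Fin n) → Set where
              empty : Snoc []
              snoc : ∀ s w → Snoc (s ++ w ∷ [])
            unsnoc : ∀ s → Snoc s
            unsnoc [] = empty
            unsnoc (w ∷ s) with unsnoc s
            ... | empty = snoc [] w
            ... | snoc s w′ = snoc (w ∷ s) w′
            use : ∀ {x w g r} → Spanning x (g ++ w ∷ r) → K x → K w → (∀ {w} → w ∈ g → ¬ K w) → (∀ {w} → w ∈ g → w ∉ T) → Extended v T
            use (c , f , b) kx kw gk gt = reroute c f b kx kw gk gt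
            go : ∀ {y m} → Spanning y m → ∀ p {x₁ g y₁ s} → Snoc s → y ∷ m ++ y ∷ [] ≡ p ++ x₁ ∷ g ++ y₁ ∷ s → K x₁ → K y₁ →
              (∀ {w} → w ∈ g → ¬ K w) → (∀ {w} → w ∈ g → w ∉ T) → Extended v T
            -- Both ends of the stretch are the repeated vertex `y`, which would then be the only
            -- contact.
            go {y} {m} sp [] {g = g} empty eq Kx Ky g-K g-T with Listₚ.∷-injective eq
            ... | refl , eq′ with Listₚ.∷ʳ-injective m g eq′
            ... | refl , refl = ⊥-elim (ℕₚ.<⇒≱ many (ℕₚ.≤-trans (unique-⊆-length {m = y ∷ []}
                    (Uniqueₚ.filter⁺ K? (Cycle.unique cyc)) at-head) (s≤s z≤n)))
              where
              at-head : ∀ {t} → t ∈ contacts → t ∈ y ∷ []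
              at-head i with ∈-filter⁻ K? {xs = z ∷ l} i
              ... | j , kt with proj₁ (proj₂ sp) j
              ... | here e = here e
              ... | there k = ⊥-elim (g-K k kt)
            go {y} {m} sp [] {g = g} {y₁} (snoc s w) eq Kx Ky g-K g-T with Listₚ.∷-injective eq
            ... | refl , eq′ with Listₚ.∷ʳ-injective m (g ++ y₁ ∷ s) (trans eq′ (sym (Listₚ.++-assoc g (y₁ ∷ s) (w ∷ []))))
            ... | refl , refl = use sp Kx Ky g-K g-T
            go {y} {m} sp (a ∷ p) {x₁} {g} {y₁} empty eq Kx Ky g-K g-T with Listₚ.∷-injective eq
            ... | refl , eq′ with Listₚ.∷ʳ-injective m (p ++ x₁ ∷ g) (trans eq′ (sym (Listₚ.++-assoc p (x₁ ∷ g) (y₁ ∷ []))))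
            ... | refl , refl = use (spin p sp) Kx Ky g-K g-T
            go {y} {m} sp (a ∷ p) {x₁} {g} {y₁} (snoc s w) eq Kx Ky g-K g-T with Listₚ.∷-injective eq
            ... | refl , eq′ with Listₚ.∷ʳ-injective m (p ++ x₁ ∷ g ++ y₁ ∷ s)
                  (trans eq′ (trans (cong (λ t → p ++ x₁ ∷ t) (sym (Listₚ.++-assoc g (y₁ ∷ s) (w ∷ [])))) (sym (Listₚ.++-assoc p (x₁ ∷ g ++ y₁ ∷ s) (w ∷ [])))))
            ... | refl , refl = use (subst (Spanning x₁) (Listₚ.++-assoc g (y₁ ∷ s) (y ∷ p)) (spin p sp)) Kx Ky g-K g-T

          from-head : ∀ {y m} → Spanning y m → K y → Extended v T
          from-head {y} {m} sp@(c , f , b) ky = closing sp ky (gapless K? (_∈? T) y (m ++ y ∷ []) ky enough)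
            where
            u′ : Unique (m ++ y ∷ [])
            u′ = let (uy , um , dj) = unique-++⁻ (y ∷ []) {m} (Cycle.unique c) in unique-++⁺ um uy (λ i j → dj j i)
            onto : ∀ {t} → t ∈ y ∷ m → t ∈ m ++ y ∷ []
            onto (here e) = ∈-++⁺ʳ m (here e)
            onto (there i) = ∈-++⁺ˡ i
            enough : length (filter (_∈? T) (m ++ y ∷ [])) < length (filter K? (m ++ y ∷ []))
            enough = ℕₚ.≤-<-trans (ℕₚ.≤-trans (unique-⊆-length (Uniqueₚ.filter⁺ (_∈? T) u′) (λ i → proj₂ (∈-filter⁻ (_∈? T) {xs = m ++ y ∷ []} i))) T≤3)
              (ℕₚ.<-≤-trans many (unique-⊆-length (Uniqueₚ.filter⁺ K? (Cycle.unique cyc))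
                λ i → let (j , k) = ∈-filter⁻ K? {xs = z ∷ l} i in ∈-filter⁺ K? (onto (f j)) k))

          from-contact : ∀ pre → z ∷ l ≡ pre ++ x₀ ∷ suf → (∀ {y} → y ∈ pre → ¬ K y) → Extended v T
          from-contact [] refl np = from-head (cyc , id , id) kx₀
          from-contact (_ ∷ pre) refl np = from-head (spin pre (cyc , id , id)) kx₀

      extend : ∀ {z l} → Cycle z l → (∀ {t} → t ∈ T → t ∈ z ∷ l) → Extended v T
      extend {z} {l} cyc T⊆ with v ∈? (z ∷ l)
      ... | yes i = record { cycle = cyc ; T⊆ = T⊆ ; v∈ = i }
      ... | no o = absorb (suc (size z l o)) z l cyc T⊆ o ℕₚ.≤-refl

    abstract
      -- Starting from an edge at `a`, the vertices `b`, `c`, `d` are caught in turn while those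
      -- caught before are kept; the last round protects three.
      through : ∀ {a b} c d → a ≢ b → ∃ λ l → Cycle a l × b ∈ a ∷ l × c ∈ a ∷ l × d ∈ a ∷ l
      through {a} {b} c d a≢b with walk-step a≢b (wide [] z≤n {a} {b} (λ ()) (λ ()))
      ... | y , e , _ = finish (extend d (c ∷ b ∷ a ∷ []) ℕₚ.≤-refl E₂.cycle λ { (here refl) → E₂.v∈ ; (there i) → E₂.T⊆ i })
        where
        start : Cycle a (y ∷ [])
        start = record { unique = ((λ { refl → Graph.irrefl G _ e }) ∷ []) ∷ [] ∷ [] ; adjacent = λ { here → e ; (there here) → adj-sym G e ; (there (there (there ()))) } ; nonempty = λ () }
        E₁ : Extended b (a ∷ [])
        E₁ = extend b (a ∷ []) (s≤s z≤n) start λ { (here e) → here e ; (there ()) }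
        module E₁ = Extended E₁
        E₂ : Extended c (b ∷ a ∷ [])
        E₂ = extend c (b ∷ a ∷ []) (s≤s (s≤s z≤n)) E₁.cycle λ { (here refl) → E₁.v∈ ; (there i) → E₁.T⊆ i }
        module E₂ = Extended E₂
        finish : Extended d (c ∷ b ∷ a ∷ []) → ∃ λ l → Cycle a l × b ∈ a ∷ l × c ∈ a ∷ l × d ∈ a ∷ l
        finish ex = at (T⊆ (there (there (here refl))))
          where
          open Extended ex
          at : a ∈ z ∷ l → ∃ λ l → Cycle a l × b ∈ a ∷ l × c ∈ a ∷ l × d ∈ a ∷ l
          at (here refl) = l , cycle , T⊆ (there (here refl)) , T⊆ (here refl) , v∈
          at (there i) with ∈-∃++ i
          ... | p , s , refl = s ++ z ∷ p , rotate-cycle p cycle , rotate-∈ p (T⊆ (there (here refl))) , rotate-∈ p (T⊆ (here refl)) , rotate-∈ p v∈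

-- Arcs of the cycle and the order of the four vertices on it

module _ {n : ℕ} where

  consec? : (u v : Fin n) → ∀ l → Dec (Consec u v l)
  consec? u v [] = no λ ()
  consec? u v (x ∷ []) = no λ { (there ()) }
  consec? u v (x ∷ y ∷ l) with u ≟ x | v ≟ y | consec? u v (y ∷ l)
  ... | yes refl | yes refl | _ = yes here
  ... | _ | _ | yes c = yes (there c)
  ... | no ne | _ | no nc = no λ { here → ne refl ; (there c) → nc c }
  ... | yes _ | no ne | no nc = no λ { here → ne refl ; (there c) → nc c }

  Either : (Fin n → Fin n → Set) → Fin n → Fin n → Set
  Either C u v = C u v ⊎ C v u

  arc-closed : ∀ {x y} X {Y u v} → Unique (x ∷ X ++ y ∷ Y) → u ∈ X → Either (Cyclic x (X ++ y ∷ Y)) u v → v ≢ x → v ≢ y → v ∈ X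
  arc-closed {x} {y} X {Y} {u} {v} un i c v≢x v≢y = go c
    where
    parts : Unique (x ∷ X) × Unique (y ∷ Y) × (∀ {w} → w ∈ x ∷ X → w ∈ y ∷ Y → ⊥)
    parts = unique-++⁻ (x ∷ X) un
    halves : ∀ {p q} → Cyclic x (X ++ y ∷ Y) p q → Consec p q (x ∷ X ++ y ∷ []) ⊎ Consec p q (y ∷ Y ++ x ∷ [])
    halves {p} {q} h = consec-split (x ∷ X) (subst (λ l → Consec p q (x ∷ l)) (Listₚ.++-assoc X (y ∷ Y) (x ∷ [])) h)
    in₁ : v ∈ x ∷ X ++ y ∷ [] → v ∈ X
    in₁ (here e) = ⊥-elim (v≢x e)
    in₁ (there j) with ∈-++⁻ X j
    ... | inj₁ k = k
    ... | inj₂ (here e) = ⊥-elim (v≢y e)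
    out₂ : u ∉ y ∷ Y ++ x ∷ []
    out₂ j with ∈-++⁻ (y ∷ Y) j
    ... | inj₁ k = proj₂ (proj₂ parts) (there i) k
    ... | inj₂ (here refl) = case proj₁ parts of λ { (nx ∷ _) → All≢⇒∉ nx i }
    go : Either (Cyclic x (X ++ y ∷ Y)) u v → v ∈ X
    go (inj₁ h) with halves h
    ... | inj₁ c = in₁ (consec-∈ʳ c)
    ... | inj₂ c = ⊥-elim (out₂ (consec-∈ˡ c))
    go (inj₂ h) with halves h
    ... | inj₁ c = in₁ (consec-∈ˡ c)
    ... | inj₂ c = ⊥-elim (out₂ (consec-∈ʳ c))

  list-walk : ∀ {E : Fin n → Fin n → Set} {P : Fin n → Set} x m y → (∀ {u v} → Consec u v (x ∷ m ++ y ∷ []) → E u v) →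
    (∀ {v} → v ∈ x ∷ m ++ y ∷ [] → P v) → Walk E P x y
  list-walk x [] y es ps = ps (here refl) ▷⟨ es here ⟩ ⟦ ps (there (here refl)) ⟧
  list-walk x (w ∷ m) y es ps = ps (here refl) ▷⟨ es here ⟩ list-walk w m y (es ∘ there) (ps ∘ there)

module _ {n : ℕ} (G : Graph n) where

  -- Each arc is read off from a rotation of the list in which it becomes an initial stretch;
  -- `Around` records that a rotation has the same cycle edges.
  ring : ∀ {a b c d} p q r s → Cycle G a (p ++ b ∷ q ++ c ∷ r ++ d ∷ s) → Ring G a b c d
  ring {a} {b} {c} {d} p q r s cyc = record
    { EZ = EZ ; EZ? = λ u v → consec? u v M ⊎-dec consec? v u M ; EZ-sym = Data.Sum.swap
    ; EZ-adj = λ { (inj₁ h) → adjacent h ; (inj₂ h) → adj-sym G (adjacent h) }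
    ; Sa = _∈ s ++ a ∷ p ; Sb = _∈ p ++ b ∷ q ; Sc = _∈ q ++ c ∷ r ; Sd = _∈ r ++ d ∷ s
    ; a∈Sa = ∈-++⁺ʳ s (here refl) ; b∈Sb = ∈-++⁺ʳ p (here refl) ; c∈Sc = ∈-++⁺ʳ q (here refl) ; d∈Sd = ∈-++⁺ʳ r (here refl)
    ; Sa-closed = λ i e nb nd → arc-closed (s ++ a ∷ p) (Around.distinct at-d) i (via at-d e) nd nb
    ; Sb-closed = λ i e na nc → arc-closed (p ++ b ∷ q) (Around.distinct at-a) i (via at-a e) na nc
    ; Sd-closed = λ i e na nc → arc-closed (r ++ d ∷ s) (Around.distinct at-c) i (via at-c e) nc na
    ; Sa-Sc = λ i j → proj₂ (proj₂ (unique-++⁻ (d ∷ s ++ a ∷ p) {b ∷ q ++ c ∷ r} (Around.distinct at-d))) (there i) (there j)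
    ; Sb-Sd = λ i j → proj₂ (proj₂ (unique-++⁻ (a ∷ p ++ b ∷ q) {c ∷ r ++ d ∷ s} (Around.distinct at-a))) (there i) (there j)
    ; a⇝b = along base λ { (here e) → inj₁ e ; (there i) → inj₂ (grow p i) }
    ; a⇝d = back (along (cast (Listₚ.++-assoc s (a ∷ p) (b ∷ q ++ c ∷ r)) at-d) λ { (here e) → inj₂ (∈-++⁺ʳ r (here e)) ; (there i) → last-in s (inj₂ ∘ ∈-++⁺ʳ r ∘ there) inj₁ i })
    ; b⇝c = along (cast (Listₚ.++-assoc q (c ∷ r ++ d ∷ s) (a ∷ p)) (spin p base)) λ { (here e) → inj₁ e ; (there i) → inj₂ (grow q i) }
    ; d⇝c = back (along (cast (Listₚ.++-assoc r (d ∷ s) (a ∷ p ++ b ∷ q)) at-c) λ { (here e) → inj₂ (∈-++⁺ʳ q (here e)) ; (there i) → last-in r (inj₂ ∘ ∈-++⁺ʳ q ∘ there) inj₁ i }) }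
    where
    open Cycle cyc
    M : List (Fin n)
    M = a ∷ (p ++ b ∷ q ++ c ∷ r ++ d ∷ s) ++ a ∷ []
    EZ : Fin n → Fin n → Set
    EZ = Either (Cyclic a (p ++ b ∷ q ++ c ∷ r ++ d ∷ s))
    record Around (x : Fin n) (l : List (Fin n)) : Set where
      field
        to : ∀ {u v} → Cyclic x l u v → Cyclic a (p ++ b ∷ q ++ c ∷ r ++ d ∷ s) u v
        from : ∀ {u v} → Cyclic a (p ++ b ∷ q ++ c ∷ r ++ d ∷ s) u v → Cyclic x l u v
        distinct : Unique (x ∷ l)
    base : Around a (p ++ b ∷ q ++ c ∷ r ++ d ∷ s)
    base = record { to = id ; from = id ; distinct = unique }
    spin : ∀ m {x y t} → Around x (m ++ y ∷ t) → Around y (t ++ x ∷ m)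
    spin m {t = t} A = record { to = λ h → to (rotate m h) ; from = λ h → rotate t (from h) ; distinct = rotate-unique m distinct }
      where open Around A
    cast : ∀ {x l l′} → l ≡ l′ → Around x l → Around x l′
    cast refl A = A
    at-a : Around a ((p ++ b ∷ q) ++ c ∷ (r ++ d ∷ s))
    at-a = cast (sym (Listₚ.++-assoc p (b ∷ q) (c ∷ r ++ d ∷ s))) base
    at-c : Around c ((r ++ d ∷ s) ++ a ∷ (p ++ b ∷ q))
    at-c = spin (p ++ b ∷ q) at-a
    at-b : Around b ((q ++ c ∷ r) ++ d ∷ (s ++ a ∷ p))
    at-b = cast (trans (cong (_++ a ∷ p) (sym (Listₚ.++-assoc q (c ∷ r) (d ∷ s)))) (Listₚ.++-assoc (q ++ c ∷ r) (d ∷ s) (a ∷ p))) (spin p base)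
    at-d : Around d ((s ++ a ∷ p) ++ b ∷ (q ++ c ∷ r))
    at-d = spin (q ++ c ∷ r) at-b
    via : ∀ {x l u v} → Around x l → EZ u v → Either (Cyclic x l) u v
    via A (inj₁ h) = inj₁ (Around.from A h)
    via A (inj₂ h) = inj₂ (Around.from A h)
    along : ∀ {P : Fin n → Set} {m x y B} → Around x (m ++ y ∷ B) → (∀ {v} → v ∈ x ∷ m ++ y ∷ [] → P v) → Walk EZ P x y
    along {m = m} {x} {y} A ps = list-walk x m y (λ h → inj₁ (Around.to A (consec-prefix m h))) ps
    back : ∀ {P : Fin n → Set} {x y} → Walk EZ P x y → Walk EZ P y x
    back = walk-rev Data.Sum.swap
    grow : ∀ m {x t v} → v ∈ m ++ x ∷ [] → v ∈ m ++ x ∷ t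
    grow m i with ∈-++⁻ m i
    ... | inj₁ j = ∈-++⁺ˡ j
    ... | inj₂ (here e) = ∈-++⁺ʳ m (here e)
    last-in : ∀ m {x v} {P : Set} → (v ∈ m → P) → (v ≡ x → P) → v ∈ m ++ x ∷ [] → P
    last-in m f g i with ∈-++⁻ m i
    ... | inj₁ j = f j
    ... | inj₂ (here e) = g e

  ring-flip : ∀ {a b c d} → Ring G a b c d → Ring G a d c b
  ring-flip Z = record
    { EZ = EZ ; EZ? = EZ? ; EZ-sym = EZ-sym ; EZ-adj = EZ-adj ; Sa = Sa ; Sb = Sd ; Sc = Sc ; Sd = Sb
    ; a∈Sa = a∈Sa ; b∈Sb = d∈Sd ; c∈Sc = c∈Sc ; d∈Sd = b∈Sb
    ; Sa-closed = λ s e x y → Sa-closed s e y x ; Sb-closed = Sd-closed ; Sd-closed = Sb-closed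
    ; Sa-Sc = Sa-Sc ; Sb-Sd = λ x y → Sb-Sd y x ; a⇝b = a⇝d ; a⇝d = a⇝b ; b⇝c = d⇝c ; d⇝c = b⇝c }
    where open Ring Z

  -- There are six orders after `a`, and reversal pairs them up; the three left differ in which
  -- vertex is opposite `a`.
  rings : ∀ {a b c d l} → a ≢ b → a ≢ c → a ≢ d → b ≢ c → b ≢ d → c ≢ d → Cycle G a l → b ∈ a ∷ l → c ∈ a ∷ l → d ∈ a ∷ l →
    Ring G a b c d ⊎ Ring G a b d c ⊎ Ring G a c b d
  rings {a} {b} {c} {d} a≢b a≢c a≢d b≢c b≢d c≢d cyc ib ic id = from-b (∈-∃++ (tail (a≢b ∘ sym) ib)) cyc (tail (a≢c ∘ sym) ic) (tail (a≢d ∘ sym) id)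
    where
    tail : ∀ {x y} {l : List (Fin n)} → x ≢ y → x ∈ y ∷ l → x ∈ l
    tail ne (here e) = ⊥-elim (ne e)
    tail ne (there i) = i
    other : ∀ m {x y} {t : List (Fin n)} → x ≢ y → x ∈ m ++ y ∷ t → x ∈ m ⊎ x ∈ t
    other m ne i with ∈-++⁻ m i
    ... | inj₁ j = inj₁ j
    ... | inj₂ j = inj₂ (tail ne j)
    left : ∀ p {t : List (Fin n)} {x} → x ∈ p → ∃ λ p₁ → ∃ λ p₂ → p ++ t ≡ p₁ ++ x ∷ p₂ ++ t × p ≡ p₁ ++ x ∷ p₂
    left p {t} i with ∈-∃++ i
    ... | p₁ , p₂ , refl = p₁ , p₂ , Listₚ.++-assoc p₁ (_ ∷ p₂) t , refl
    Goal : Set₁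
    Goal = Ring G a b c d ⊎ Ring G a b d c ⊎ Ring G a c b d
    from-b : ∀ {l} → (∃ λ p → ∃ λ t → l ≡ p ++ b ∷ t) → Cycle G a l → c ∈ l → d ∈ l → Goal
    from-b (p , t , refl) cyc ic id with other p (b≢c ∘ sym) ic | other p (b≢d ∘ sym) id
    ... | inj₁ jc | inj₂ jd with left p {b ∷ t} jc | ∈-∃++ jd
    ... | p₁ , p₂ , eq , _ | t₁ , t₂ , refl = inj₂ (inj₂ (ring p₁ p₂ t₁ t₂ (subst (Cycle G a) eq cyc)))
    from-b (p , t , refl) cyc ic id | inj₂ jc | inj₁ jd with left p {b ∷ t} jd | ∈-∃++ jc
    ... | p₁ , p₂ , eq , _ | t₁ , t₂ , refl = inj₂ (inj₂ (ring-flip (ring p₁ p₂ t₁ t₂ (subst (Cycle G a) eq cyc))))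
    from-b (p , t , refl) cyc ic id | inj₁ jc | inj₁ jd with left p {b ∷ t} jc
    ... | p₁ , p₂ , eq , refl with other p₁ (c≢d ∘ sym) jd
    ... | inj₁ kd with left p₁ {c ∷ p₂ ++ b ∷ t} kd
    ... | q₁ , q₂ , eq′ , _ = inj₁ (ring-flip (ring q₁ q₂ p₂ t (subst (Cycle G a) (trans eq eq′) cyc)))
    from-b (p , t , refl) cyc ic id | inj₁ jc | inj₁ jd | p₁ , p₂ , eq , refl | inj₂ kd with left p₂ {b ∷ t} kd
    ... | q₁ , q₂ , eq′ , _ = inj₂ (inj₁ (ring-flip (ring p₁ q₁ q₂ t (subst (Cycle G a) (trans eq (cong (λ l → p₁ ++ c ∷ l) eq′)) cyc))))
    from-b (p , t , refl) cyc ic id | inj₂ jc | inj₂ jd with ∈-∃++ jc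
    ... | t₁ , t₂ , refl with other t₁ (c≢d ∘ sym) jd
    ... | inj₂ kd with ∈-∃++ kd
    ... | q₁ , q₂ , refl = inj₁ (ring p t₁ q₁ q₂ cyc)
    from-b (p , t , refl) cyc ic id | inj₂ jc | inj₂ jd | t₁ , t₂ , refl | inj₁ kd with left t₁ {c ∷ t₂} kd
    ... | q₁ , q₂ , eq′ , _ = inj₂ (inj₁ (ring p q₁ q₂ t₂ (subst (Cycle G a) (cong (λ l → p ++ b ∷ l) eq′) cyc)))

-- The dichotomy

module _ {n : ℕ} where

  private
    infix 4 _∈ˢ_
    _∈ˢ_ : Fin n → Subset.Subset n → Set
    _∈ˢ_ = Subset._∈_

  to-subset : List (Fin n) → Subset.Subset n
  to-subset [] = Subset.⊥
  to-subset (x ∷ l) = Subset.⁅ x ⁆ Subset.∪ to-subset l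

  ∈-subset⁺ : ∀ {x} l → x ∈ l → x ∈ˢ to-subset l
  ∈-subset⁺ (x ∷ l) (here refl) = Subsetₚ.x∈p∪q⁺ (inj₁ (Subsetₚ.x∈⁅x⁆ x))
  ∈-subset⁺ (x ∷ l) (there i) = Subsetₚ.x∈p∪q⁺ {p = Subset.⁅ x ⁆} (inj₂ (∈-subset⁺ l i))

  ∈-subset⁻ : ∀ {x} l → x ∈ˢ to-subset l → x ∈ l
  ∈-subset⁻ [] i = ⊥-elim (Subsetₚ.∉⊥ i)
  ∈-subset⁻ (y ∷ l) i with Subsetₚ.x∈p∪q⁻ Subset.⁅ y ⁆ (to-subset l) i
  ... | inj₁ j = here (Subsetₚ.x∈⁅y⁆⇒x≡y y j)
  ... | inj₂ j = there (∈-subset⁻ l j)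

  size-∪ : ∀ {m} (p q : Subset.Subset m) → Subset.∣ p Subset.∪ q ∣ ≤ Subset.∣ p ∣ + Subset.∣ q ∣
  size-∪ [] [] = z≤n
  size-∪ (true ∷ p) (true ∷ q) = s≤s (ℕₚ.≤-trans (size-∪ p q) (ℕₚ.+-monoʳ-≤ Subset.∣ p ∣ (ℕₚ.n≤1+n _)))
  size-∪ (true ∷ p) (false ∷ q) = s≤s (size-∪ p q)
  size-∪ (false ∷ p) (true ∷ q) = ℕₚ.≤-trans (s≤s (size-∪ p q)) (ℕₚ.≤-reflexive (sym (ℕₚ.+-suc _ _)))
  size-∪ (false ∷ p) (false ∷ q) = size-∪ p q

  size-subset : ∀ l → Subset.∣ to-subset l ∣ ≤ length l
  size-subset [] = ℕₚ.≤-reflexive (Subsetₚ.∣⊥∣≡0 n)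
  size-subset (x ∷ l) = ℕₚ.≤-trans (size-∪ Subset.⁅ x ⁆ (to-subset l)) (ℕₚ.+-mono-≤ (ℕₚ.≤-reflexive (Subsetₚ.∣⁅x⁆∣≡1 x)) (size-subset l))

  module _ {E : Fin n → Fin n → Set} where

    trace : ∀ {P x y} → Walk E P x y → List (Fin n)
    trace (⟦_⟧ {x} _) = x ∷ []
    trace (_▷⟨_⟩_ {x} _ _ w) = x ∷ trace w

    trace-sub : ∀ {P x y} (w : Walk E P x y) {v} → v ∈ trace w → P v
    trace-sub ⟦ p ⟧ (here refl) = p
    trace-sub (p ▷⟨ _ ⟩ w) (here refl) = p
    trace-sub (p ▷⟨ _ ⟩ w) (there i) = trace-sub w i

    trace-walk : ∀ {P x y} (w : Walk E P x y) → Walk E (_∈ trace w) x y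
    trace-walk ⟦ p ⟧ = ⟦ here refl ⟧
    trace-walk (p ▷⟨ e ⟩ w) = here refl ▷⟨ e ⟩ walk-mono there (trace-walk w)

module _ {n : ℕ} (G : Graph n) where

  abstract
    wide : KConnected G 4 → Wide G
    wide (_ , k) l le nx ny = walk-mono (λ ni i → ni (∈-subset⁺ l i))
      (walkIn→walk G (k (to-subset l) (s≤s (ℕₚ.≤-trans (size-subset l) le)) _ _ (λ i → nx (∈-subset⁻ l i)) (λ i → ny (∈-subset⁻ l i))))

  swap-minor : ∀ {a b c d} → RootedK4Minor G a b c d → RootedK4Minor G a b d c
  swap-minor (A , B , C , D , bA , bB , bC , bD , AB , AC , AD , BC , BD , CD , jAB , jAC , jAD , jBC , jBD , u , v , cu , dv , e) =
    A , B , D , C , bA , bB , bD , bC , AB , AD , AC , BD , BC , (λ v x y → CD v y x) , jAB , jAD , jAC , jBD , jBC , v , u , dv , cu , adj-sym G e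

  swap-minor′ : ∀ {a b c d} → RootedK4Minor G a b c d → RootedK4Minor G a c b d
  swap-minor′ (A , B , C , D , bA , bB , bC , bD , AB , AC , AD , BC , BD , CD , jAB , jAC , jAD , (u , v , bu , cv , e) , jBD , jCD) =
    A , C , B , D , bA , bC , bB , bD , AC , AB , AD , (λ v x y → BC v y x) , CD , BD , jAC , jAB , jAD , (v , u , cv , bu , adj-sym G e) , jCD , jBD

  module Four (wide : Wide G) {a b c d : Fin n} (a≢b : a ≢ b) (a≢c : a ≢ c) (a≢d : a ≢ d) (b≢c : b ≢ c) (b≢d : b ≢ d) (c≢d : c ≢ d) where

    conn : ∀ x y → Walk (Adj G) (λ _ → ⊤) x y
    conn x y = walk-mono (λ _ → tt) (wide [] z≤n {x} {y} (λ ()) (λ ()))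

    neighbour : ∀ x → ∃ λ y → Adj G x y
    neighbour x with x ≟ a
    ... | yes refl = let (y , e , _) = walk-step a≢b (conn a b) in y , e
    ... | no ne = let (y , e , _) = walk-step ne (conn x a) in y , e

    society : Society n
    society = record
      { V = λ _ → ⊤ ; V? = λ _ → yes tt ; E = Adj G ; E? = adj? G ; E-sym = adj-sym G ; E-irr = Graph.irrefl G _ ; E⇒V = λ _ → tt
      ; a = a ; b = b ; c = c ; d = d ; Va = tt ; Vb = tt ; Vc = tt ; Vd = tt
      ; a≢b = a≢b ; a≢c = a≢c ; a≢d = a≢d ; b≢c = b≢c ; b≢d = b≢d ; c≢d = c≢d }
    open Society society using (Terminal; terminal?; Full; Unlinked; Off)

    -- Some terminal differs from `p`, `q`, `r`, as there are four, and deleting three vertices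
    -- leaves it reachable.
    full : Full
    full p q r x (_ , np , nq , nr) with any? (λ t → terminal? t ×-dec ¬? (t ∈? (p ∷ q ∷ r ∷ [])))
    ... | yes (t , T , nt) = t , T , walk-mono (λ ni → tt , (λ e → ni (here e)) , (λ e → ni (there (here e))) , (λ e → ni (there (there (here e)))))
          (wide (p ∷ q ∷ r ∷ []) ℕₚ.≤-refl (λ { (here e) → np e ; (there (here e)) → nq e ; (there (there (here e))) → nr e }) nt)
    ... | no none = ⊥-elim (ℕₚ.<⇒≱ ℕₚ.≤-refl (unique-⊆-length {l = a ∷ b ∷ c ∷ d ∷ []} {m = p ∷ q ∷ r ∷ []}
          ((a≢b ∷ a≢c ∷ a≢d ∷ []) ∷ (b≢c ∷ b≢d ∷ []) ∷ (c≢d ∷ []) ∷ [] ∷ [])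
          λ { (here refl) → blocked (inj₁ refl) ; (there (here refl)) → blocked (inj₂ (inj₁ refl))
            ; (there (there (here refl))) → blocked (inj₂ (inj₂ (inj₁ refl))) ; (there (there (there (here refl)))) → blocked (inj₂ (inj₂ (inj₂ refl))) }))
      where
      blocked : ∀ {t} → Terminal t → t ∈ p ∷ q ∷ r ∷ []
      blocked {t} T with t ∈? (p ∷ q ∷ r ∷ [])
      ... | yes i = i
      ... | no ni = ⊥-elim (none (t , T , ni))

    -- A subset of `Fin n` takes the place of two predicates, so the question is decided by
    -- exhaustion; the vertices of a walk form a subset large enough to translate back.
    Linked : Set
    Linked = ∃ λ (S : Subset.Subset n) → Walk (Adj G) (Subset._∈ S) a c × Walk (Adj G) (Subset._∉ S) b d

    linked? : Dec Linked
    linked? = Subsetₚ.anySubset? λ S → reach? (Adj G) (adj? G) _ (λ v → v Subsetₚ.∈? S) a c ×-dec reach? (Adj G) (adj? G) _ (λ v → ¬? (v Subsetₚ.∈? S)) b d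

    unlinked : ¬ Linked → Unlinked
    unlinked no-link X Y dj wX wY = no-link (to-subset (trace wX) , walk-mono (∈-subset⁺ (trace wX)) (trace-walk wX) ,
      walk-mono (λ y i → dj (trace-sub wX (∈-subset⁻ (trace wX) i)) y) wY)

    -- The linkage is enlarged to a partition: one side is the component of `b` outside the
    -- component of `a` in `S`, and everything else stays connected to `a`.
    minor : Ring G a b c d → Linked → RootedK4Minor G a b c d
    minor Z (S , w , w′) = Cross.link→minor G Z (record
      { X? = λ v → yes tt ×-dec ¬? (Y.C? v) ; Y? = Y.C? ; disjoint = λ (_ , ny) y → ny y
      ; cover = λ v → case Y.C? v of λ { (yes y) → inj₂ y ; (no ny) → inj₁ (tt , ny) }
      ; a∈X = tt , S-avoids G ⊤-rooted X.C? X-rooted (λ _ → tt) X.root rest? Y₀ X.root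
      ; c∈X = tt , S-avoids G ⊤-rooted X.C? X-rooted (λ _ → tt) X.root rest? Y₀ (X.complete w)
      ; b∈Y = Y.root ; d∈Y = Y.complete (walk-mono off-X w′)
      ; X-rooted = rest-rooted G ⊤-rooted X.C? X-rooted (λ _ → tt) X.root rest? Y₀
      ; Y-rooted = λ y → walk-mono proj₂ (Y.sound y) })
      where
      X₀ : Comp (Adj G) (adj? G) (Subset._∈ S) (λ v → v Subsetₚ.∈? S) a
      X₀ = component (Adj G) (adj? G) _ _ a (walk-start w)
      module X = Comp X₀
      off-X : ∀ {v} → v Subset.∉ S → ⊤ × ¬ X.C v
      off-X nv = tt , λ x → nv (X.C⊆P x)
      rest? : ∀ v → Dec (⊤ × ¬ X.C v)
      rest? v = yes tt ×-dec ¬? (X.C? v)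
      Y₀ : Comp (Adj G) (adj? G) (λ v → ⊤ × ¬ X.C v) rest? b
      Y₀ = component (Adj G) (adj? G) _ rest? b (off-X (walk-start w′))
      module Y = Comp Y₀
      ⊤-rooted : Rooted G (λ _ → ⊤) a
      ⊤-rooted {v} _ = conn a v
      X-rooted : Rooted G X.C a
      X-rooted x = walk-mono proj₂ (X.sound x)

    module Planar (O : Sweepable society) where
      open Sweepable O

      abstract
        -- From `L` on, `a` is inserted next to `b` and swept over the path. This covers all its
        -- edges, as without hanging regions every neighbour of `a` is on `L`.
        whole : Swp (b ∷ c ∷ d ∷ []) (b ∷ a ∷ d ∷ []) (λ v → v ≢ b × v ≢ c × v ≢ d) (Adj G)
        whole with first-last b≢d L-first L-last
        ... | m , eq = go m eq (m ++ d ∷ []) refl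
          where
          go : ∀ m → L ≡ b ∷ m ++ d ∷ [] → ∀ t → m ++ d ∷ [] ≡ t → Swp (b ∷ c ∷ d ∷ []) (b ∷ a ∷ d ∷ []) (λ v → v ≢ b × v ≢ c × v ≢ d) (Adj G)
          go [] _ [] ()
          go (_ ∷ _) _ [] ()
          go m eq (z ∷ s) eq′ = swp-weaken off-terminals (swp-trans (swp-trans S₁ S₂ (λ { (core , _) refl → a∉core core })) S₃ λ _ ()) all-edges
            where
            S₁ : Swp (b ∷ c ∷ d ∷ []) (b ∷ z ∷ s) (λ v → Core v × v ≢ b × v ≢ c × v ≢ d) CoreEdge
            S₁ = swp-cast refl (trans eq (cong (b ∷_) eq′)) sweep₁
            S₂ : Swp (b ∷ z ∷ s) (b ∷ a ∷ z ∷ s) (λ v → v ≡ a) (λ u w → Beside u w (b ∷ a ∷ z ∷ []))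
            S₂ = swp-context [] s (swp-ins b a z)
            S₃ : Swp (b ∷ a ∷ z ∷ s) (b ∷ a ∷ d ∷ []) (λ _ → ⊥) (λ u w → u ≡ a × w ∈ (m ++ d ∷ []))
            S₃ = swp-cast (cong (λ t → b ∷ a ∷ t) (trans (Listₚ.++-identityʳ (m ++ d ∷ [])) eq′)) refl (swp-context (b ∷ []) [] (swp-sweep-away a m d))
            a∉core : ¬ Core a
            a∉core (inj₁ i) = proj₂ (L-sub i) refl
            a∉core (inj₂ (_ , ne , _)) = ne refl
            off-terminals : ∀ {v} → ((Core v × v ≢ b × v ≢ c × v ≢ d) ⊎ v ≡ a) ⊎ ⊥ → v ≢ b × v ≢ c × v ≢ d
            off-terminals (inj₁ (inj₁ (_ , h))) = h
            off-terminals (inj₁ (inj₂ refl)) = a≢b , a≢c , a≢d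
            core : ∀ {v} → v ≢ a → Core v
            core {v} ne = by (v ∈? L)
              where
              by : Dec (v ∈ L) → Core v
              by (yes i) = inj₁ i
              by (no ni) = inj₂ (tt , ne , ni , full-gapless society full O)
            all-edges : (T : Sweep (b ∷ c ∷ d ∷ []) (b ∷ a ∷ d ∷ [])) →
              (∀ {x y} → (CoreEdge x y ⊎ Beside x y (b ∷ a ∷ z ∷ [])) ⊎ (x ≡ a × y ∈ (m ++ d ∷ [])) → Covers T x y) → ∀ {x y} → Adj G x y → Covers T x y
            all-edges T f {x} {y} e = by (x ≟ a) (y ≟ a)
              where
              from-a : ∀ {y} → Adj G a y → Covers T a y
              from-a e with a-nbr e
              ... | inj₂ g = ⊥-elim (full-gapless society full O g)
              ... | inj₁ i with subst (_ ∈_) eq i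
              ... | here refl = f (inj₁ (inj₂ (inj₂ here)))
              ... | there j = f (inj₂ (refl , j))
              by : Dec (x ≡ a) → Dec (y ≡ a) → Covers T x y
              by (yes refl) _ = from-a e
              by (no _) (yes refl) = covers-sym T (from-a (adj-sym G e))
              by (no nx) (no ny) = f (inj₁ (inj₁ (e , core nx , core ny)))

      abstract
        drawn : Σ (Drawing.Picture G c) λ P → Running.Final G c P (b ∷ a ∷ d ∷ [])
        drawn = Running.picture G c (sweep whole) ((b≢c ∷ b≢d ∷ []) ∷ (c≢d ∷ []) ∷ [] ∷ []) (ins-unique whole)
          (λ i → let (nb , nc , nd) = ins-sub whole i in λ { (here e) → nb e ; (there (here e)) → nc e ; (there (there (here e))) → nd e })
          (λ i → proj₁ (proj₂ (ins-sub whole i)) refl) (covered whole)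

      module _ (P : Drawing.Picture G c) (fin : Running.Final G c P (b ∷ a ∷ d ∷ [])) where
        open Drawing G c
        open Running.Final fin
        open Picture P renaming (L to Lᴾ; R to Rᴾ)

        private
          ρ : Rotation G
          ρ = turning G a b c d P fin

          pot : ∀ {z} → Antisym G z → Circulation G z → Fin n → Fin n → ℤ
          pot anti circ = Potentials.f (solves anti circ)

          -- A dart at v leading into the outer face.
          Outer : Fin n → Set
          Outer v = ∃ λ w → Adj G v w × (∀ {z} (anti : Antisym G z) (circ : Circulation G z) → pot anti circ v w ≡ 0ℤ)

          outer-dart : ∀ {v} → v ≡ a ⊎ v ≡ b ⊎ v ≡ d → Outer v
          outer-dart {v} o = go (ℓ v) refl
            where
            go : ∀ l → ℓ v ≡ l → Outer v
            go [] eq = let (y , e) = neighbour v in case subst (y ∈_) eq (complete e) of λ ()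
            go (w ∷ l) eq = w , ℓ-adj (subst (w ∈_) (sym eq) (here refl)) , λ anti circ → outer G a b c d P fin b≢c c≢d a≢c anti circ o eq

          outer-c : Outer c
          outer-c = go (Lᴾ c) (Rᴾ c) refl refl
            where
            go : ∀ l r → Lᴾ c ≡ l → Rᴾ c ≡ r → Outer c
            go (w ∷ l) r eq _ = w , ℓ-adj (∈-++⁺ʳ (Rᴾ c) (subst (w ∈_) (sym eq) (here refl))) , λ anti circ → bottom G a b c d P fin b≢c c≢d a≢c anti circ eq
            go [] (w ∷ r) eq eq′ = w , ℓ-adj (∈-++⁺ˡ (subst (w ∈_) (sym eq′) (here refl))) , λ anti circ → bottom′ G a b c d P fin b≢c c≢d a≢c anti circ eq eq′
            go [] [] eq eq′ = let (y , e) = neighbour c in case subst (y ∈_) (cong₂ _++_ eq′ eq) (complete e) of λ ()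

          same-face : ∀ {u v} (p : Outer u) (q : Outer v) → SameFace G ρ (u , proj₁ p) (v , proj₁ q)
          same-face {u} {v} (w , e , zero-w) (x , e′ , zero-x) = Orbits.common-face G ρ conn {u , w} {v , x} e e′ pots
            where
            pots : ∀ z → Antisym G z → Circulation G z → ∃ λ f → Potential G ρ z f × f u w ≡ 0ℤ × f v x ≡ 0ℤ
            pots z anti circ = pot anti circ , potential G a b c d P fin b≢c c≢d a≢c anti circ , zero-w anti circ , zero-x anti circ

          exact : Exact G ρ
          exact z anti circ = pot anti circ , potential G a b c d P fin b≢c c≢d a≢c anti circ

          on-face : ∀ {u v} (p : Outer u) → Outer v → OnFace G ρ (u , proj₁ p) v
          on-face p q = let (k , eq) = same-face p q in k , cong proj₁ eq

          assemble : Outer a → Outer b → Outer c → Outer d → PlanarWithCommonFace G a b c d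
          assemble p q r s = ρ , Orbits.planar G ρ conn a ((a , proj₁ p) , proj₁ (proj₂ p)) exact ,
            (a , proj₁ p) , proj₁ (proj₂ p) , (0 , refl) , on-face p q , on-face p r , on-face p s

        planar-face : PlanarWithCommonFace G a b c d
        planar-face = assemble (outer-dart (inj₁ refl)) (outer-dart (inj₂ (inj₁ refl))) outer-c (outer-dart (inj₂ (inj₂ refl)))

    planar-face′ : ¬ Linked → PlanarWithCommonFace G a b c d
    planar-face′ no-link = let (P , fin) = Planar.drawn O in Planar.planar-face O P fin
      where
      O : Sweepable society
      O = solve _ society ℕₚ.≤-refl ((λ p q r _ _ _ → full p q r) , (λ s → full a s s)) (unlinked no-link)

    minor-or-planar : Ring G a b c d → RootedK4Minor G a b c d ⊎ PlanarWithCommonFace G a b c d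
    minor-or-planar Z with linked?
    ... | yes l = inj₁ (minor Z l)
    ... | no nl = inj₂ (planar-face′ nl)

theorem6 : (n : ℕ) (G : Graph n) (a b c d : Fin n) →
    a ≢ b → a ≢ c → a ≢ d → b ≢ c → b ≢ d → c ≢ d →
    KConnected G 4 →
    (RootedK4Minor G a b c d ⊎ PlanarWithCommonFace G a b c d) ×
    ¬ (RootedK4Minor G a b c d × PlanarWithCommonFace G a b c d)
theorem6 n G a b c d a≢b a≢c a≢d b≢c b≢d c≢d k =
    from-cycle (through G (wide G k) c d a≢b) ,
    λ (m , p) → exclusive G a≢b a≢c a≢d b≢c b≢d c≢d (Four.conn G (wide G k) a≢b a≢c a≢d b≢c b≢d c≢d) m p
  where
  Goal : Set₁
  Goal = RootedK4Minor G a b c d ⊎ PlanarWithCommonFace G a b c d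
  from-abdc : RootedK4Minor G a b d c ⊎ PlanarWithCommonFace G a b d c → Goal
  from-abdc (inj₁ m) = inj₁ (swap-minor G m)
  from-abdc (inj₂ (ρ , emb , d₀ , pd , fa , fb , fd , fc)) = inj₂ (ρ , emb , d₀ , pd , fa , fb , fc , fd)
  from-acbd : RootedK4Minor G a c b d ⊎ PlanarWithCommonFace G a c b d → Goal
  from-acbd (inj₁ m) = inj₁ (swap-minor′ G m)
  from-acbd (inj₂ (ρ , emb , d₀ , pd , fa , fc , fb , fd)) = inj₂ (ρ , emb , d₀ , pd , fa , fb , fc , fd)
  from-ring : Ring G a b c d ⊎ Ring G a b d c ⊎ Ring G a c b d → Goal
  from-ring (inj₁ Z) = Four.minor-or-planar G (wide G k) a≢b a≢c a≢d b≢c b≢d c≢d Z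
  from-ring (inj₂ (inj₁ Z)) = from-abdc (Four.minor-or-planar G (wide G k) a≢b a≢d a≢c b≢d b≢c (c≢d ∘ sym) Z)
  from-ring (inj₂ (inj₂ Z)) = from-acbd (Four.minor-or-planar G (wide G k) a≢c a≢b a≢d (b≢c ∘ sym) c≢d b≢d Z)
  from-cycle : (∃ λ l → Cycle G a l × b ∈ a ∷ l × c ∈ a ∷ l × d ∈ a ∷ l) → Goal
  from-cycle (l , cyc , ib , ic , id) = from-ring (rings G a≢b a≢c a≢d b≢c b≢d c≢d cyc ib ic id)
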